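{- Let $A=(q,q^4;q^5)_\infty$, $B=(q^2,q^3;q^5)_\infty$, $E_1=(q;q)_\infty$, $E_5=(q^5;q^5)_\infty$ and $S=\sum_{n=-\infty}^{\infty}(-1)^n n\, q^{n(5n+1)/2}$. For $r\in\{0,3,4\}$ write $F_r(q)=\sum_{n\ge0}\big[NB_4(1,5,5n+r)-NB_4(4,5,5n+r)+2NB_4(2,5,5n+r)-2NB_4(3,5,5n+r)\big]q^n$. Then \begin{align*} F_0(q)=\;&5S\Big(-7q^3\frac{A^6E_5^9}{B^8E_1^{12}}+12q^2\frac{A\,E_5^9}{B^3E_1^{12}}-4q\frac{B^2E_5^9}{A^4E_1^{12}}-9\frac{B^7E_5^9}{A^9E_1^{12}}+20q^2\frac{A^4E_5^7}{B^5E_1^{12}}-5q\frac{E_5^7}{A\,E_1^{12}}+5\frac{B^5E_5^7}{A^6E_1^{12}}\Big)\\ &+10q^2\frac{A^4E_5^8}{B^4E_1^{12}}-\frac52q\frac{B\,E_5^8}{A\,E_1^{12}}+\frac52\frac{B^6E_5^8}{A^6E_1^{12}}-\frac{305}{2}q^3\frac{A^3E_5^{12}}{B^5E_1^{12}}+\frac{335}{2}q^2\frac{E_5^{12}}{A^2E_1^{12}}+85q\frac{B^5E_5^{12}}{A^7E_1^{12}}\\ &+5\frac{B^{10}E_5^{12}}{A^{12}E_1^{12}}+25q^3\frac{A^6E_5^{10}}{B^7E_1^{12}}-15q^2\frac{A\,E_5^{10}}{B^2E_1^{12}}-10q\frac{B^3E_5^{10}}{A^4E_1^{12}}-\frac{15}{2}\frac{B^8E_5^{10}}{A^9E_1^{12}},\\[4pt]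 F_3(q)=\;&55q^3\frac{A^6E_5^{12}}{B^8E_1^{12}}-\frac{335}{2}q^2\frac{A\,E_5^{12}}{B^3E_1^{12}}+260q\frac{B^2E_5^{12}}{A^4E_1^{12}}+\frac{45}{2}\frac{B^7E_5^{12}}{A^9E_1^{12}}-5q^2\frac{A^4E_5^{10}}{B^5E_1^{12}}-\frac{35}{2}q\frac{E_5^{10}}{A\,E_1^{12}}-\frac{15}{2}\frac{B^5E_5^{10}}{A^6E_1^{12}},\\[4pt] F_4(q)=\;&-\frac{45}{2}q^3\frac{A^7E_5^{12}}{B^9E_1^{12}}+260q^2\frac{A^2E_5^{12}}{B^4E_1^{12}}+\frac{335}{2}q\frac{B\,E_5^{12}}{A^3E_1^{12}}+55\frac{B^6E_5^{12}}{A^8E_1^{12}}+\frac52q^2\frac{A^5E_5^{10}}{B^6E_1^{12}}+\frac52q\frac{E_5^{10}}{B\,E_1^{12}}-15\frac{B^4E_5^{10}}{A^5E_1^{12}}. \end{align*}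
   Context: Notation: $(a;q)_\infty=\prod_{n\ge0}(1-aq^n)$ and $(a_1,\dots,a_t;q)_\infty=(a_1;q)_\infty\cdots(a_t;q)_\infty$; identities are of formal power series in $q$ (equivalently analytic for $|q|<1$). For $k\ge2$, a $k$-colored partition of $n\ge0$ is a $k$-tuple $\pi=(\pi^{(1)},\dots,\pi^{(k)})$ of ordinary partitions with $|\pi^{(1)}|+\cdots+|\pi^{(k)}|=n$ (written $\pi\vdash n$); $\#(\pi^{(i)})$ is the number of parts of $\pi^{(i)}$, and $\mathrm{crank}_k(\pi)=\#(\pi^{(1)})-\#(\pi^{(2)})$. For $k\ge2$, $j\ge2$, $0\le m\le j-1$, $n\ge0$, $$NB_k(m,j,n)=\sum_{\pi\vdash n,\ \mathrm{crank}_k(\pi)\equiv m \pmod j}\#(\pi^{(1)}).$$ -}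

module Defs where

open import Data.Nat as ℕ using (ℕ; zero; suc; _∸_; _≤ᵇ_; _≡ᵇ_; _⊓_; NonZero)
open import Data.Integer as ℤ using (ℤ; +_; -[1+_]; ∣_∣; _%ℕ_)
open import Data.Rational as ℚ using (ℚ; 0ℚ; 1ℚ; _/_)
open import Data.Nat.ListAction using (sum)
open import Data.List as L using (List; []; _∷_; [_]; map; concatMap; upTo; length)
open import Data.Vec as V using (Vec; []; _∷_)
open import Data.Bool using (Bool; true; false; if_then_else_)
open import Relation.Nullary.Decidable using (⌊_⌋)

-- Formal power series in q with rational coefficients: n ↦ [q^n] f

PS : Set
PS = ℕ → ℚ

sumTo : (ℕ → ℚ) → ℕ → ℚ
sumTo f zero    = 0ℚ
sumTo f (suc n) = sumTo f n ℚ.+ f n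

one : PS
one zero    = 1ℚ
one (suc _) = 0ℚ

_⊕_ : PS → PS → PS
(f ⊕ g) n = f n ℚ.+ g n
infixl 6 _⊕_

_·_ : ℚ → PS → PS
(c · f) n = c ℚ.* f n
infixr 7 _·_

_⊗_ : PS → PS → PS
(f ⊗ g) n = sumTo (λ i → f i ℚ.* g (n ∸ i)) (suc n)
infixl 7 _⊗_

qpow : ℕ → PS → PS
qpow k f n = if k ≤ᵇ n then f (n ∸ k) else 0ℚ

pow : PS → ℕ → PS
pow f zero    = one
pow f (suc k) = f ⊗ pow f k

-- Multiplicative inverse of a power series with constant term 1:
-- g 0 = 1, g (n+1) = - Σ_{j=1}^{n+1} f j * g (n+1-j).
-- invUpTo f n gives the correct coefficients in degrees ≤ n.
invUpTo : PS → ℕ → PS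
invUpTo f zero    = one
invUpTo f (suc n) i =
  if i ≤ᵇ n then invUpTo f n i
  else ℚ.- sumTo (λ j → f (suc j) ℚ.* invUpTo f n (n ∸ j)) (suc n)

inv : PS → PS
inv f n = invUpTo f n n

powℤ : PS → ℤ → PS
powℤ f (+ n)    = pow f n
powℤ f -[1+ n ] = pow (inv f) (suc n)

oneMinusQ : ℕ → PS
oneMinusQ m zero    = 1ℚ
oneMinusQ m (suc n) = if m ≡ᵇ suc n then ℚ.- 1ℚ else 0ℚ

pochTrunc : ℕ → ℕ → ℕ → PS
pochTrunc a c zero    = one
pochTrunc a c (suc N) = pochTrunc a c N ⊗ oneMinusQ (a ℕ.+ c ℕ.* N)

-- (q^a ; q^c)_∞ : the degree-n coefficient already stabilises once the
-- factors with k ≤ n are included (a + c k > n for k > n when a, c ≥ 1).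
poch : ℕ → ℕ → PS
poch a c n = pochTrunc a c (suc n) n

Aₚ : PS
Aₚ = poch 1 5 ⊗ poch 4 5

Bₚ : PS
Bₚ = poch 2 5 ⊗ poch 3 5

E₁ : PS
E₁ = poch 1 1

E₅ : PS
E₅ = poch 5 5

-- S = Σ_{n ∈ ℤ} (-1)^n n q^{n(5n+1)/2}.  Only |n| ≤ N+1 can contribute
-- to the coefficient of q^N.
signℤ : ℤ → ℤ
signℤ z = if (∣ z ∣ ℕ.% 2) ≡ᵇ 0 then + 1 else ℤ.- (+ 1)

Sₚ : PS
Sₚ N = sumTo term (suc (2 ℕ.* suc N))
  where
  term : ℕ → ℚ
  term i =
    let z = (+ i) ℤ.- (+ suc N) in
    if ⌊ z ℤ.* ((+ 5) ℤ.* z ℤ.+ + 1) ℤ.≟ (+ 2) ℤ.* (+ N) ⌋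
    then (signℤ z ℤ.* z) / 1 else 0ℚ

-- all partitions of k (nonincreasing lists of positive parts) with
-- parts ≤ mx; the first argument is fuel (fuel ≥ k suffices).
partsF : ℕ → ℕ → ℕ → List (List ℕ)
partsF _        zero    _  = [ [] ]
partsF zero     (suc k) _  = []
partsF (suc fu) (suc k) mx =
  concatMap (λ p → map (p ∷_) (partsF fu (suc k ∸ p) p))
            (map suc (upTo (suc k ⊓ mx)))

partitions : ℕ → List (List ℕ)
partitions n = partsF n n n

colored : (k n : ℕ) → List (Vec (List ℕ) k)
colored zero zero    = [ [] ]
colored zero (suc n) = []
colored (suc k) n =
  concatMap (λ a → concatMap (λ p → map (p ∷_) (colored k (n ∸ a)))
                             (partitions a))
            (upTo (suc n))

-- crank_k(π) = #(π^(1)) - #(π^(2))   (meaningful for k ≥ 2)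
crank : {k : ℕ} → Vec (List ℕ) k → ℤ
crank (p ∷ r ∷ _) = + length p ℤ.- + length r
crank _           = + 0

parts₁ : {k : ℕ} → Vec (List ℕ) k → ℕ
parts₁ (p ∷ _) = length p
parts₁ []      = 0

NB : (k m j n : ℕ) → .{{NonZero j}} → ℕ
NB k m j n =
  sum (map (λ π → if (crank π %ℕ j) ≡ᵇ m then parts₁ π else 0)
             (colored k n))

F : ℕ → PS
F r n =
  let N = 5 ℕ.* n ℕ.+ r in
  ((+ NB 4 1 5 N) ℤ.- (+ NB 4 4 5 N)
    ℤ.+ (+ 2) ℤ.* (+ NB 4 2 5 N) ℤ.- (+ 2) ℤ.* (+ NB 4 3 5 N)) / 1

T : ℚ → ℕ → ℤ → ℤ → ℕ → PS
T c k a b e = c · qpow k (powℤ Aₚ a ⊗ powℤ Bₚ b ⊗ pow E₅ e ⊗ powℤ E₁ (ℤ.- (+ 12)))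

ℚ[_] : ℤ → ℚ
ℚ[ z ] = z / 1

_≐_ : PS → PS → Set
f ≐ g = ∀ n → f n ≡ g n
  where open import Relation.Binary.PropositionalEquality using (_≡_)

{-# OPTIONS --safe #-}
-- Put Z = ζ(1 + ε) with ζ⁵ = 1 and ε² = 0. The ε-part of 1/((Zq, Z⁻¹q; q)_∞ (q; q)²_∞) collects #(π⁽¹⁾) - #(π⁽²⁾) times
-- ζ^crank, and exchanging the first two colours turns a suitable linear functional of it into twice the combination in F_r.
-- The Jacobi triple product dissects E₁ (Zq, Z⁻¹; q)_∞ modulo 5 with coefficients in B(q⁵)E₅(q⁵), A(q⁵)E₅(q⁵), S(q⁵) and the
-- analogue S′ of S for A; Jacobi's series for E₁³, obtained from the same expansion at Z = 1 + ε, expresses S and S′ through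
-- X = B/A and E₅. Then 1/E₁ is dissected by multiplying over the conjugates q ↦ ζⁱq, where E₁ is a quadratic form in q, A(q⁵)
-- and B(q⁵) that factors over ℚ(√5). What remains is to read off the residues 0, 3 and 4 of one polynomial in q and X(q⁵).
module Submission where

open import Algebra.Bundles using (CommutativeRing; CommutativeMonoid)
open import Data.Bool as Bool using (Bool; true; false; if_then_else_)
open import Data.Fin using (Fin)
open import Data.Fin.Patterns using (0F; 1F; 2F; 3F; 4F; 5F)
open import Data.Integer as ℤ using (ℤ; +_; -[1+_])
open import Data.List as List using (List; concatMap; upTo; applyUpTo; length)
open import Data.Maybe using (nothing)
open import Data.Nat as ℕ using (ℕ; zero; suc; _≤_; _<_; z≤n; s≤s)
open import Data.Nat.Tactic.RingSolver using (solve-∀)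
open import Data.Product using (_×_; _,_; proj₁; proj₂)
open import Data.Rational as ℚ using (ℚ; 0ℚ; 1ℚ; _/_)
open import Data.Sum using (_⊎_; inj₁; inj₂)
open import Data.Vec as Vec using (Vec; []; _∷_; lookup)
open import Level using (0ℓ; _⊔_)
open import Relation.Binary.PropositionalEquality as ≡ using (_≡_)
open import Relation.Nullary using (yes; no; contradiction)
open import Relation.Nullary.Decidable using (⌊_⌋)
import Algebra.Properties.AbelianGroup as AbelianGroupP
import Algebra.Properties.CommutativeSemigroup as CommutativeSemigroupP
import Algebra.Properties.CommutativeSemiring.Exp as CExp
import Algebra.Properties.Group as GroupP
import Algebra.Properties.Monoid.Mult.TCOptimised as MultTC
import Algebra.Properties.Ring as RingP
import Algebra.Properties.Semiring.Exp as Exp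
import Algebra.Properties.Semiring.Exp.TCOptimised as ExpTC
import Algebra.Properties.Semiring.Mult as Mult
import Data.Integer.DivMod as ℤD
import Data.Integer.Properties as ℤP
import Data.Integer.Tactic.RingSolver as ℤSolver
import Data.Nat.ListAction as ListAction
import Data.Nat.Properties as ℕP
import Data.Rational.Properties as ℚP
import Data.Rational.Unnormalised as ℚᵘ
import Data.Rational.Unnormalised.Properties as ℚᵘP
import Data.Vec.N-ary as N
import Data.Vec.Properties as VecP
import Relation.Binary.Reasoning.Setoid as SetoidReasoning
import Tactic.RingSolver.Core.Expression as Expression
import Tactic.RingSolver.Core.Polynomial.Base as PolyBase
import Tactic.RingSolver.Core.Polynomial.Homomorphism as PolyHom
import Tactic.RingSolver.Core.Polynomial.Parameters as Par
import Tactic.RingSolver.Core.Polynomial.Semantics as PolySem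
import Defs
open import Defs using (PS; ℚ[_]; sumTo; invUpTo; pochTrunc; oneMinusQ; signℤ; partsF; partitions; colored; crank; parts₁)

module Polynomials where
  isZero : ℤ → Bool
  isZero (+ zero) = true
  isZero _        = false

  coefficients : Par.RawCoeff 0ℓ 0ℓ
  coefficients = record
    { rawRing = CommutativeRing.rawRing ℤP.+-*-commutativeRing ; isZero = isZero }

  open Expression public using (Expr)
  open Expression using (Κ; Ι; _⊕_; _⊗_; _⊛_; ⊝_)
  open PolyBase coefficients using (Poly; FlatPoly; _⊐_; κ; ι; _⊞_; _⊠_; ⊟_; _⊡_)

  normalise : ∀ {n} → Expr ℤ n → Poly n
  normalise (Κ x)   = κ x
  normalise (Ι x)   = ι x
  normalise (x ⊕ y) = normalise x ⊞ normalise y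
  normalise (x ⊗ y) = normalise x ⊠ normalise y
  normalise (⊝ x)   = ⊟ normalise x
  normalise (x ⊛ i) = normalise x ⊡ i

  isZeroPoly : ∀ {n} → Poly n → Bool
  isZeroPoly (FlatPoly.Κ c ⊐ _) = isZero c
  isZeroPoly (FlatPoly.⅀ _ ⊐ _) = false

  infixl 6 _:+_ _:-_
  infixl 7 _:*_
  infix  8 :-_
  infixr 9 _:^_
  infix  4 _:=_

  _:+_ _:*_ _:-_ : ∀ {n} → Expr ℤ n → Expr ℤ n → Expr ℤ n
  _:+_ = _⊕_
  _:*_ = _⊗_
  a :- b = a ⊕ ⊝ b

  :-_ : ∀ {n} → Expr ℤ n → Expr ℤ n
  :-_ = ⊝_

  # : ∀ {n} → ℕ → Expr ℤ n
  # k = Κ (+ k)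

  _:^_ : ∀ {n} → Expr ℤ n → ℕ → Expr ℤ n
  e :^ zero  = # 1
  e :^ suc n = e :* e :^ n

  var : ∀ {n} → Fin n → Expr ℤ n
  var = Ι

  _:=_ : ∀ {n} → Expr ℤ n → Expr ℤ n → Expr ℤ n × Expr ℤ n
  _:=_ = _,_

  sides : ∀ n → N.N-ary n (Expr ℤ n) (Expr ℤ n × Expr ℤ n) → Expr ℤ n × Expr ℤ n
  sides n f = f N.$ⁿ Vec.map Ι (Vec.allFin n)

  holds : ∀ n → N.N-ary n (Expr ℤ n) (Expr ℤ n × Expr ℤ n) → Bool
  holds n f = isZeroPoly (normalise (proj₁ (sides n f) :- proj₂ (sides n f)))

open Polynomials

module IntegerSolver {c ℓ} (R : CommutativeRing c ℓ) where
  open CommutativeRing R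
  open RingP ring using (-‿distribˡ-*; -‿distribʳ-*; -0#≈0#; -‿involutive)
  open AbelianGroupP +-abelianGroup using (⁻¹-∙-comm)
  open Mult semiring using (×-homo-+; ×1-homo-*) renaming (_×_ to _⋆_)
  open MultTC +-monoid using () renaming (_×_ to _⋆′_; ×ᵤ≈× to ⋆≈⋆′)
  open SetoidReasoning setoid

  fromℤ : ℤ → Carrier
  fromℤ (+ n)    = n ⋆′ 1#
  fromℤ -[1+ n ] = - (suc n ⋆′ 1#)

  private
    slow : ℤ → Carrier
    slow (+ n)    = n ⋆ 1#
    slow -[1+ n ] = - (suc n ⋆ 1#)

    fast≈slow : ∀ i → fromℤ i ≈ slow i
    fast≈slow (+ n)    = sym (⋆≈⋆′ n 1#)
    fast≈slow -[1+ n ] = -‿cong (sym (⋆≈⋆′ (suc n) 1#))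

    a-a : ∀ a b x → (a + x) + - (a + b) ≈ x + - b
    a-a a b x = begin
      (a + x) + - (a + b)      ≈⟨ +-cong (+-comm a x) (sym (⁻¹-∙-comm a b)) ⟩
      (x + a) + (- a + - b)    ≈⟨ +-assoc x a _ ⟩
      x + (a + (- a + - b))    ≈⟨ +-congˡ (sym (+-assoc a (- a) (- b))) ⟩
      x + ((a + - a) + - b)    ≈⟨ +-congˡ (+-congʳ (-‿inverseʳ a)) ⟩
      x + (0# + - b)           ≈⟨ +-congˡ (+-identityˡ _) ⟩
      x + - b                  ∎

    slow-⊖ : ∀ m n → slow (m ℤ.⊖ n) ≈ m ⋆ 1# + - (n ⋆ 1#)
    slow-⊖ zero    zero    = sym (trans (+-identityˡ _) -0#≈0#)
    slow-⊖ zero    (suc n) = sym (+-identityˡ _)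
    slow-⊖ (suc m) zero    = sym (trans (+-congˡ -0#≈0#) (+-identityʳ _))
    slow-⊖ (suc m) (suc n) = begin
      slow (suc m ℤ.⊖ suc n)            ≡⟨ ≡.cong slow (ℤP.[1+m]⊖[1+n]≡m⊖n m n) ⟩
      slow (m ℤ.⊖ n)                    ≈⟨ slow-⊖ m n ⟩
      m ⋆ 1# + - (n ⋆ 1#)               ≈⟨ sym (a-a 1# (n ⋆ 1#) (m ⋆ 1#)) ⟩
      (suc m ⋆ 1#) + - (suc n ⋆ 1#)     ∎

    slow-+ : ∀ i j → slow (i ℤ.+ j) ≈ slow i + slow j
    slow-+ (+ m)    (+ n)    = ×-homo-+ 1# m n
    slow-+ (+ m)    -[1+ n ] = slow-⊖ m (suc n)
    slow-+ -[1+ m ] (+ n)    = trans (slow-⊖ n (suc m)) (+-comm _ _)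
    slow-+ -[1+ m ] -[1+ n ] = begin
      - (suc (suc (m ℕ.+ n)) ⋆ 1#)          ≡⟨ ≡.cong (λ k → - (suc k ⋆ 1#)) (≡.sym (ℕP.+-suc m n)) ⟩
      - ((suc m ℕ.+ suc n) ⋆ 1#)            ≈⟨ -‿cong (×-homo-+ 1# (suc m) (suc n)) ⟩
      - (suc m ⋆ 1# + suc n ⋆ 1#)           ≈⟨ sym (⁻¹-∙-comm _ _) ⟩
      - (suc m ⋆ 1#) + - (suc n ⋆ 1#)       ∎

    slow-neg : ∀ i → slow (ℤ.- i) ≈ - slow i
    slow-neg (+ zero)  = sym -0#≈0#
    slow-neg (+ suc n) = refl
    slow-neg -[1+ n ]  = sym (-‿involutive _)

    slow-*ⁿ : ∀ m j → slow (+ m ℤ.* j) ≈ m ⋆ 1# * slow j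
    slow-*ⁿ m (+ n)    = trans (reflexive (≡.cong slow (≡.sym (ℤP.pos-* m n)))) (×1-homo-* m n)
    slow-*ⁿ m -[1+ n ] = begin
      slow (+ m ℤ.* (ℤ.- (+ suc n)))   ≡⟨ ≡.cong slow (≡.sym (ℤP.neg-distribʳ-* (+ m) (+ suc n))) ⟩
      slow (ℤ.- (+ m ℤ.* + suc n))     ≈⟨ slow-neg (+ m ℤ.* + suc n) ⟩
      - slow (+ m ℤ.* + suc n)         ≈⟨ -‿cong (slow-*ⁿ m (+ suc n)) ⟩
      - (m ⋆ 1# * (suc n ⋆ 1#))        ≈⟨ -‿distribʳ-* _ _ ⟩
      m ⋆ 1# * - (suc n ⋆ 1#)          ∎

    slow-* : ∀ i j → slow (i ℤ.* j) ≈ slow i * slow j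
    slow-* (+ m)    j = slow-*ⁿ m j
    slow-* -[1+ m ] j = begin
      slow ((ℤ.- (+ suc m)) ℤ.* j)   ≡⟨ ≡.cong slow (≡.sym (ℤP.neg-distribˡ-* (+ suc m) j)) ⟩
      slow (ℤ.- (+ suc m ℤ.* j))     ≈⟨ slow-neg (+ suc m ℤ.* j) ⟩
      - slow (+ suc m ℤ.* j)         ≈⟨ -‿cong (slow-*ⁿ (suc m) j) ⟩
      - (suc m ⋆ 1# * slow j)        ≈⟨ -‿distribˡ-* _ _ ⟩
      - (suc m ⋆ 1#) * slow j        ∎

  fromℤ-+ : ∀ i j → fromℤ (i ℤ.+ j) ≈ fromℤ i + fromℤ j
  fromℤ-+ i j = trans (fast≈slow (i ℤ.+ j)) (trans (slow-+ i j) (sym (+-cong (fast≈slow i) (fast≈slow j))))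

  fromℤ-* : ∀ i j → fromℤ (i ℤ.* j) ≈ fromℤ i * fromℤ j
  fromℤ-* i j = trans (fast≈slow (i ℤ.* j)) (trans (slow-* i j) (sym (*-cong (fast≈slow i) (fast≈slow j))))

  fromℤ-neg : ∀ i → fromℤ (ℤ.- i) ≈ - fromℤ i
  fromℤ-neg i = trans (fast≈slow (ℤ.- i)) (trans (slow-neg i) (sym (-‿cong (fast≈slow i))))

  private
    isZero-sound : ∀ i → Bool.T (isZero i) → 0# ≈ fromℤ i
    isZero-sound (+ zero) _ = refl

    homo : Par.Homomorphism 0ℓ 0ℓ c ℓ
    homo = record
      { from = coefficients
      ; to = record
          { 0≟_ = λ _ → nothing
          ; isAlmostCommutativeRing = record
              { isCommutativeSemiring = isCommutativeSemiring
              ; -‿cong = -‿cong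
              ; -‿*-distribˡ = λ x y → sym (-‿distribˡ-* x y)
              ; -‿+-comm = ⁻¹-∙-comm } }
      ; morphism = record
          { ⟦_⟧ = fromℤ ; +-homo = fromℤ-+ ; *-homo = fromℤ-* ; -‿homo = fromℤ-neg
          ; 0-homo = refl ; 1-homo = refl }
      ; Zero-C⟶Zero-R = isZero-sound }

  open Expression using (Κ; Ι; _⊕_; _⊗_; _⊛_; ⊝_)
  open Expression.Eval rawRing fromℤ public using () renaming (⟦_⟧ to eval)
  open PolyBase coefficients using (Poly; FlatPoly; _⊐_)
  open PolySem homo using () renaming (⟦_⟧ to ⟦_⟧ₚ)
  open PolyHom homo using (κ-hom; ι-hom; ⊞-hom; ⊠-hom; ⊟-hom; ⊡-hom)
  open ExpTC semiring using (^-congˡ)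
  private
    correct : ∀ {n} (e : Expr ℤ n) ρ → ⟦ normalise e ⟧ₚ ρ ≈ eval e ρ
    correct (Κ x)   ρ = κ-hom x ρ
    correct (Ι x)   ρ = ι-hom x ρ
    correct (x ⊕ y) ρ = trans (⊞-hom (normalise x) (normalise y) ρ) (+-cong (correct x ρ) (correct y ρ))
    correct (x ⊗ y) ρ = trans (⊠-hom (normalise x) (normalise y) ρ) (*-cong (correct x ρ) (correct y ρ))
    correct (⊝ x)   ρ = trans (⊟-hom (normalise x) ρ) (-‿cong (correct x ρ))
    correct (x ⊛ i) ρ = trans (⊡-hom (normalise x) i ρ) (^-congˡ i (correct x ρ))

    zeroPoly : ∀ {n} (p : Poly n) ρ → Bool.T (isZeroPoly p) → ⟦ p ⟧ₚ ρ ≈ 0#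
    zeroPoly (FlatPoly.Κ c ⊐ _) ρ ok = sym (isZero-sound c ok)

    sound : ∀ {n} (a b : Expr ℤ n) → Bool.T (isZeroPoly (normalise (a :- b))) → ∀ ρ → eval a ρ ≈ eval b ρ
    sound a b ok ρ = begin
      eval a ρ                              ≈⟨ sym (+-identityʳ _) ⟩
      eval a ρ + 0#                         ≈⟨ +-congˡ (sym (-‿inverseˡ _)) ⟩
      eval a ρ + (- eval b ρ + eval b ρ)    ≈⟨ sym (+-assoc _ _ _) ⟩
      eval (a :- b) ρ + eval b ρ            ≈⟨ +-congʳ (sym (correct (a :- b) ρ)) ⟩
      ⟦ normalise (a :- b) ⟧ₚ ρ + eval b ρ       ≈⟨ +-congʳ (zeroPoly (normalise (a :- b)) ρ ok) ⟩
      0# + eval b ρ                         ≈⟨ +-identityˡ _ ⟩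
      eval b ρ                              ∎

  solve : ∀ n f {ok : Bool.T (holds n f)} → N.Eq n _≈_ (N.curryⁿ (eval (proj₁ (sides n f)))) (N.curryⁿ (eval (proj₂ (sides n f))))
  solve n f {ok} = N.curryⁿ-cong _≈_ (eval (proj₁ (sides n f))) (eval (proj₂ (sides n f))) (sound (proj₁ (sides n f)) (proj₂ (sides n f)) ok)

  eval-cong : ∀ {n} (e : Expr ℤ n) {ρ ρ′} → (∀ i → lookup ρ i ≈ lookup ρ′ i) → eval e ρ ≈ eval e ρ′
  eval-cong (Κ x)   p = refl
  eval-cong (Ι x)   p = p x
  eval-cong (x ⊕ y) p = +-cong (eval-cong x p) (eval-cong y p)
  eval-cong (x ⊗ y) p = *-cong (eval-cong x p) (eval-cong y p)
  eval-cong (⊝ x)   p = -‿cong (eval-cong x p)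
  eval-cong (x ⊛ i) p = ^-congˡ i (eval-cong x p)

module Series {c ℓ} (K : CommutativeRing c ℓ) where
  private module K = CommutativeRing K
  open K using (Carrier; _≈_; refl; sym; trans)

  private
    Seq : Set c
    Seq = ℕ → Carrier

  record Series : Set c where
    no-eta-equality
    constructor series
    field coe : Seq
  open Series public

  infix 4 _≋_ _≈[_]_ _⟶_

  record _≋_ (f g : Series) : Set ℓ where
    constructor pw
    field at : ∀ n → coe f n ≈ coe g n
  open _≋_ public

  private
    next : Seq → Seq
    next f n = f (suc n)

    conv : Seq → Seq → Seq
    conv f g zero    = f 0 K.* g 0
    conv f g (suc n) = f 0 K.* g (suc n) K.+ conv (next f) g n

  tail : Series → Series
  coe (tail f) = next (coe f)

  _⊹_ _✶_ : Series → Series → Series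
  coe (f ⊹ g) n = coe f n K.+ coe g n
  coe (f ✶ g)   = conv (coe f) (coe g)

  neg : Series → Series
  coe (neg f) n = K.- coe f n

  zeroₛ : Series
  coe zeroₛ _ = K.0#

  κ : Carrier → Series
  coe (κ a) zero    = a
  coe (κ a) (suc _) = K.0#

  shift : Series → Series
  coe (shift f) zero    = K.0#
  coe (shift f) (suc n) = coe f n

  private
    module S₀ = IntegerSolver K
    open S₀

    conv-local : ∀ n {f f′ g g′} → (∀ i → i ≤ n → f i ≈ f′ i) → (∀ i → i ≤ n → g i ≈ g′ i) →
                 conv f g n ≈ conv f′ g′ n
    conv-local zero    p r = K.*-cong (p 0 z≤n) (r 0 z≤n)
    conv-local (suc n) p r = K.+-cong (K.*-cong (p 0 z≤n) (r (suc n) ℕP.≤-refl))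
      (conv-local n (λ i i≤n → p (suc i) (s≤s i≤n)) (λ i i≤n → r i (ℕP.m≤n⇒m≤1+n i≤n)))

    conv-suc : ∀ f g n → conv f g (suc n) ≈ conv f (next g) n K.+ f (suc n) K.* g 0
    conv-suc f g zero    = refl
    conv-suc f g (suc n) = trans (K.+-congˡ (conv-suc (next f) g n)) (sym (K.+-assoc _ _ _))

    conv-comm : ∀ f g n → conv f g n ≈ conv g f n
    conv-comm f g zero    = K.*-comm _ _
    conv-comm f g (suc n) = trans (K.+-cong (K.*-comm _ _) (conv-comm (next f) g n))
      (trans (K.+-comm _ _) (sym (conv-suc g f n)))

    conv-distribʳ : ∀ h f g n → conv (λ i → f i K.+ g i) h n ≈ conv f h n K.+ conv g h n
    conv-distribʳ h f g zero    = K.distribʳ _ _ _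
    conv-distribʳ h f g (suc n) = trans (K.+-congˡ (conv-distribʳ h (next f) (next g) n))
      (solve 5 (λ a b x u v → (a :+ b) :* x :+ (u :+ v) := (a :* x :+ u) :+ (b :* x :+ v)) _ _ _ _ _)

    conv-scale : ∀ a f g n → conv (λ i → a K.* f i) g n ≈ a K.* conv f g n
    conv-scale a f g zero    = K.*-assoc _ _ _
    conv-scale a f g (suc n) = trans (K.+-congˡ (conv-scale a (next f) g n))
      (solve 4 (λ a x y z → a :* x :* y :+ a :* z := a :* (x :* y :+ z)) _ _ _ _)

    conv-assoc : ∀ f g h n → conv (conv f g) h n ≈ conv f (conv g h) n
    conv-assoc f g h zero    = K.*-assoc _ _ _
    conv-assoc f g h (suc n) = begin
      f 0 K.* g 0 K.* h (suc n) K.+ conv (λ i → f 0 K.* g (suc i) K.+ conv (next f) g i) h n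
        ≈⟨ K.+-congˡ (conv-distribʳ h (λ i → f 0 K.* g (suc i)) (conv (next f) g) n) ⟩
      f 0 K.* g 0 K.* h (suc n) K.+ (conv (λ i → f 0 K.* g (suc i)) h n K.+ conv (conv (next f) g) h n)
        ≈⟨ K.+-congˡ (K.+-cong (conv-scale (f 0) (next g) h n) (conv-assoc (next f) g h n)) ⟩
      f 0 K.* g 0 K.* h (suc n) K.+ (f 0 K.* conv (next g) h n K.+ conv (next f) (conv g h) n)
        ≈⟨ solve 5 (λ a b x y z → a :* b :* x :+ (a :* y :+ z) := a :* (b :* x :+ y) :+ z) _ _ _ _ _ ⟩
      f 0 K.* (g 0 K.* h (suc n) K.+ conv (next g) h n) K.+ conv (next f) (conv g h) n ∎
      where open SetoidReasoning K.setoid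

    conv-zero : ∀ f n → conv (λ _ → K.0#) f n ≈ K.0#
    conv-zero f zero    = K.zeroˡ _
    conv-zero f (suc n) = trans (K.+-cong (K.zeroˡ _) (conv-zero f n)) (K.+-identityˡ _)

  ✶-cong : ∀ {f f′ g g′} → f ≋ f′ → g ≋ g′ → (f ✶ g) ≋ (f′ ✶ g′)
  ✶-cong p r = pw λ n → conv-local n (λ i _ → at p i) (λ i _ → at r i)

  κ-✶ : ∀ a f n → coe (κ a ✶ f) n ≈ a K.* coe f n
  κ-✶ a f zero    = refl
  κ-✶ a f (suc n) = trans (K.+-congˡ (conv-zero (coe f) n)) (K.+-identityʳ _)

  private
    ✶-identityˡ : ∀ f n → coe (κ K.1# ✶ f) n ≈ coe f n
    ✶-identityˡ f n = trans (κ-✶ K.1# f n) (K.*-identityˡ _)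

  shift-✶ : ∀ f g → (shift f ✶ g) ≋ shift (f ✶ g)
  shift-✶ f g = pw λ where
    zero    → K.zeroˡ _
    (suc n) → trans (K.+-congʳ (K.zeroˡ _)) (K.+-identityˡ _)

  seriesRing : CommutativeRing c ℓ
  seriesRing = record
    { Carrier = Series ; _≈_ = _≋_ ; _+_ = _⊹_ ; _*_ = _✶_ ; -_ = neg ; 0# = zeroₛ ; 1# = κ K.1#
    ; isCommutativeRing = record
      { isRing = record
        { +-isAbelianGroup = record
          { isGroup = record
            { isMonoid = record
              { isSemigroup = record
                { isMagma = record
                  { isEquivalence = record
                    { refl  = pw λ _ → refl
                    ; sym   = λ p → pw λ n → sym (at p n)
                    ; trans = λ p r → pw λ n → trans (at p n) (at r n) }
                  ; ∙-cong = λ p r → pw λ n → K.+-cong (at p n) (at r n) }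
                ; assoc = λ f g h → pw λ n → K.+-assoc _ _ _ }
              ; identity = (λ f → pw λ n → K.+-identityˡ _) , (λ f → pw λ n → K.+-identityʳ _) }
            ; inverse = (λ f → pw λ n → K.-‿inverseˡ _) , (λ f → pw λ n → K.-‿inverseʳ _)
            ; ⁻¹-cong = λ p → pw λ n → K.-‿cong (at p n) }
          ; comm = λ f g → pw λ n → K.+-comm _ _ }
        ; *-cong = ✶-cong
        ; *-assoc = λ f g h → pw (conv-assoc (coe f) (coe g) (coe h))
        ; *-identity = (λ f → pw (✶-identityˡ f)) , (λ f → pw λ n → trans (conv-comm (coe f) _ n) (✶-identityˡ f n))
        ; distrib = (λ h f g → pw λ n → trans (conv-comm (coe h) _ n)
                        (trans (conv-distribʳ (coe h) (coe f) (coe g) n)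
                               (K.+-cong (conv-comm (coe f) (coe h) n) (conv-comm (coe g) (coe h) n))))
                  , (λ h f g → pw (conv-distribʳ (coe h) (coe f) (coe g))) }
      ; *-comm = λ f g → pw (conv-comm (coe f) (coe g)) } }

  private module S = CommutativeRing seriesRing

  q : Series
  q = shift (κ K.1#)

  q-✶ : ∀ f → (q ✶ f) ≋ shift f
  q-✶ f = S.trans (shift-✶ (κ K.1#) f) (pw λ where
    zero    → refl
    (suc n) → ✶-identityˡ f n)

  κ-cong : ∀ {a b} → a ≈ b → κ a ≋ κ b
  κ-cong p = pw λ where
    zero    → p
    (suc n) → refl

  κ-+ : ∀ a b → κ (a K.+ b) ≋ κ a ⊹ κ b
  κ-+ a b = pw λ where
    zero    → refl
    (suc n) → sym (K.+-identityˡ _)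

  κ-* : ∀ a b → κ (a K.* b) ≋ (κ a ✶ κ b)
  κ-* a b = pw λ where
    zero    → refl
    (suc n) → sym (trans (κ-✶ a (κ b) (suc n)) (K.zeroʳ _))

  κ-neg : ∀ a → κ (K.- a) ≋ neg (κ a)
  κ-neg a = pw λ where
    zero    → refl
    (suc n) → solve 0 (# 0 := :- # 0)

  record _≈[_]_ (f : Series) (N : ℕ) (g : Series) : Set ℓ where
    constructor pw<
    field at< : ∀ n → n < N → coe f n ≈ coe g n
  open _≈[_]_ public

  ≋⇒≈ : ∀ {N f g} → f ≋ g → f ≈[ N ] g
  ≋⇒≈ p = pw< λ n _ → at p n

  ≈-refl : ∀ {N f} → f ≈[ N ] f
  ≈-refl = pw< λ n _ → refl

  ≈-sym : ∀ {N f g} → f ≈[ N ] g → g ≈[ N ] f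
  ≈-sym p = pw< λ n n<N → sym (at< p n n<N)

  ≈-trans : ∀ {N f g h} → f ≈[ N ] g → g ≈[ N ] h → f ≈[ N ] h
  ≈-trans p r = pw< λ n n<N → trans (at< p n n<N) (at< r n n<N)

  ≈-weaken : ∀ {M N f g} → M ≤ N → f ≈[ N ] g → f ≈[ M ] g
  ≈-weaken M≤N p = pw< λ n n<M → at< p n (ℕP.≤-trans n<M M≤N)

  ≈-+ : ∀ {N f f′ g g′} → f ≈[ N ] f′ → g ≈[ N ] g′ → f ⊹ g ≈[ N ] f′ ⊹ g′
  ≈-+ p r = pw< λ n n<N → K.+-cong (at< p n n<N) (at< r n n<N)

  ≈-neg : ∀ {N f f′} → f ≈[ N ] f′ → neg f ≈[ N ] neg f′
  ≈-neg p = pw< λ n n<N → K.-‿cong (at< p n n<N)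

  ≈-* : ∀ {N f f′ g g′} → f ≈[ N ] f′ → g ≈[ N ] g′ → f ✶ g ≈[ N ] f′ ✶ g′
  ≈-* p r = pw< λ n n<N → conv-local n (λ i i≤n → at< p i (ℕP.≤-<-trans i≤n n<N))
                                    (λ i i≤n → at< r i (ℕP.≤-<-trans i≤n n<N))

  ≈-all : ∀ {f g} → (∀ N → f ≈[ N ] g) → f ≋ g
  ≈-all p = pw λ n → at< (p (suc n)) n ℕP.≤-refl

  record _⟶_ (s : ℕ → Series) (f : Series) : Set ℓ where
    constructor tends
    field approx : ∀ N → s N ≈[ N ] f
  open _⟶_ public

  ⟶-unique : ∀ {s f g} → s ⟶ f → s ⟶ g → f ≋ g
  ⟶-unique p r = ≈-all λ N → ≈-trans (≈-sym (approx p N)) (approx r N)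

  ⟶-cong : ∀ {s t f} → (∀ N → s N ≋ t N) → s ⟶ f → t ⟶ f
  ⟶-cong e p = tends λ N → ≈-trans (≈-sym (≋⇒≈ (e N))) (approx p N)

  ⟶-const : ∀ f → (λ _ → f) ⟶ f
  ⟶-const f = tends λ N → ≈-refl

  ⟶-+ : ∀ {s t f g} → s ⟶ f → t ⟶ g → (λ N → s N ⊹ t N) ⟶ (f ⊹ g)
  ⟶-+ p r = tends λ N → ≈-+ (approx p N) (approx r N)

  ⟶-* : ∀ {s t f g} → s ⟶ f → t ⟶ g → (λ N → s N ✶ t N) ⟶ (f ✶ g)
  ⟶-* p r = tends λ N → ≈-* (approx p N) (approx r N)

  ⟶-neg : ∀ {s f} → s ⟶ f → (λ N → neg (s N)) ⟶ neg f
  ⟶-neg p = tends λ N → ≈-neg (approx p N)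

  ⟶-sub : ∀ {s f} (k : ℕ → ℕ) → (∀ N → N ≤ k N) → s ⟶ f → (λ N → s (k N)) ⟶ f
  ⟶-sub k N≤kN p = tends λ N → ≈-weaken (N≤kN N) (approx p (k N))

  lim : (ℕ → Series) → Series
  coe (lim s) n = coe (s (suc n)) n

  lim-⟶ : ∀ s → (∀ N → s (suc N) ≈[ N ] s N) → s ⟶ lim s
  lim-⟶ s step = tends λ N → pw< λ n n<N → go n N (ℕP.≤⇒≤′ n<N)
    where
    go : ∀ n N → suc n ℕ.≤′ N → coe (s N) n ≈ coe (s (suc n)) n
    go n _       (ℕ.≤′-reflexive ≡.refl) = refl
    go n (suc N) (ℕ.≤′-step p) = trans (at< (step N) n (ℕP.≤′⇒≤ p)) (go n N p)

module Fold {c ℓ} (M : CommutativeMonoid c ℓ) where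
  open CommutativeMonoid M
  open CommutativeSemigroupP commutativeSemigroup using (interchange)

  fold : (ℕ → Carrier) → ℕ → Carrier
  fold f zero    = ε
  fold f (suc n) = fold f n ∙ f n

  fold-cong : ∀ {f g} n → (∀ k → f k ≈ g k) → fold f n ≈ fold g n
  fold-cong zero    p = refl
  fold-cong (suc n) p = ∙-cong (fold-cong n p) (p n)

  fold-∙ : ∀ f g n → fold (λ k → f k ∙ g k) n ≈ fold f n ∙ fold g n
  fold-∙ f g zero    = sym (identityˡ ε)
  fold-∙ f g (suc n) = trans (∙-congʳ (fold-∙ f g n)) (interchange _ _ _ _)

  fold-suc : ∀ f n → fold f (suc n) ≈ f 0 ∙ fold (λ k → f (suc k)) n
  fold-suc f zero    = trans (identityˡ _) (sym (identityʳ _))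
  fold-suc f (suc n) = trans (∙-congʳ (fold-suc f n)) (assoc _ _ _)

  block : (ℕ → Carrier) → ℕ → Carrier
  block f i = (((f (i ℕ.* 5) ∙ f (1 ℕ.+ i ℕ.* 5)) ∙ f (2 ℕ.+ i ℕ.* 5)) ∙ f (3 ℕ.+ i ℕ.* 5)) ∙ f (4 ℕ.+ i ℕ.* 5)

  fold-blocks : ∀ f n → fold f (n ℕ.* 5) ≈ fold (block f) n
  fold-blocks f zero    = refl
  fold-blocks f (suc n) = trans
    (trans (∙-congʳ (trans (∙-congʳ (trans (∙-congʳ (assoc _ _ _)) (assoc _ _ _))) (assoc _ _ _))) (assoc _ _ _))
    (∙-congʳ (fold-blocks f n))

module RingFolds {c ℓ} (R : CommutativeRing c ℓ) where
  open CommutativeRing R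
  open Fold +-commutativeMonoid public
    renaming (fold to ∑; fold-cong to ∑-cong; fold-∙ to ∑-+; fold-suc to ∑-suc; block to ∑-block; fold-blocks to ∑-blocks)
  open Fold *-commutativeMonoid public
    renaming (fold to ∏; fold-cong to ∏-cong; fold-∙ to ∏-*; fold-suc to ∏-suc; block to ∏-block; fold-blocks to ∏-blocks)

  *-∑ : ∀ a f n → a * ∑ f n ≈ ∑ (λ k → a * f k) n
  *-∑ a f zero    = zeroʳ a
  *-∑ a f (suc n) = trans (distribˡ _ _ _) (+-congʳ (*-∑ a f n))

-- Finite form of the Jacobi triple product for xy = p.  Here r a stands for 1/(p;p)_a, so that
-- D N k is the Gaussian binomial coefficient [2N+1 choose N-k] in p.
module FiniteJacobi {c ℓ} (R : CommutativeRing c ℓ) (p x y : CommutativeRing.Carrier R)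
  (xy≈p : CommutativeRing._≈_ R (CommutativeRing._*_ R x y) p) where
  open CommutativeRing R hiding (zero)
  open RingFolds R
  open Exp semiring using (_^_; ^-homo-*)
  open IntegerSolver R
  open SetoidReasoning setoid

  X Y : ℕ → Carrier
  X zero    = 1#
  X (suc k) = X k * (x * p ^ k)
  Y zero    = 1#
  Y (suc k) = Y k * (y * p ^ k)

  sgn : ℕ → Carrier
  sgn zero    = 1#
  sgn (suc k) = - sgn k

  E : ℕ → Carrier
  E k = sgn k * (X k - Y (suc k))

  D : ℕ → ℕ → Carrier
  D zero    zero    = 1#
  D zero    (suc k) = 0#
  D (suc N) zero    = (1# + p ^ (suc N ℕ.+ suc N) + p ^ suc N) * D N 0 + p ^ suc (suc N) * D N 1
  D (suc N) (suc k) = (1# + p ^ (suc N ℕ.+ suc N)) * D N (suc k) + p ^ (N ℕ.∸ k) * D N k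
                      + p ^ suc (suc (suc (N ℕ.+ k))) * D N (suc (suc k))

  D-zero : ∀ N k → N < k → D N k ≈ 0#
  D-zero zero    (suc k) _         = refl
  D-zero (suc N) (suc k) (s≤s N<k) = begin
    (1# + p ^ (suc N ℕ.+ suc N)) * D N (suc k) + p ^ (N ℕ.∸ k) * D N k + p ^ suc (suc (suc (N ℕ.+ k))) * D N (suc (suc k))
      ≈⟨ +-cong (+-cong (*-congˡ (D-zero N (suc k) (ℕP.m<n⇒m<1+n N<k))) (*-congˡ (D-zero N k N<k)))
                (*-congˡ (D-zero N (suc (suc k)) (ℕP.m<n⇒m<1+n (ℕP.m<n⇒m<1+n N<k)))) ⟩
    (1# + p ^ (suc N ℕ.+ suc N)) * 0# + p ^ (N ℕ.∸ k) * 0# + p ^ suc (suc (suc (N ℕ.+ k))) * 0#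
      ≈⟨ solve 3 (λ a b c → a :* # 0 :+ b :* # 0 :+ c :* # 0 := # 0) _ _ _ ⟩
    0# ∎

  private
    W : ℕ → Carrier
    W N = 1# + p ^ (suc N ℕ.+ suc N) - p ^ N * (x + y * p)

    W-factor : ∀ N → (1# - x * p ^ N) * (1# - y * p ^ suc N) ≈ W N
    W-factor N = begin
      (1# - x * p ^ N) * (1# - y * (p * p ^ N))
        ≈⟨ solve 4 (λ x y p P → (# 1 :- x :* P) :* (# 1 :- y :* (p :* P))
                     := # 1 :+ x :* y :* P :* (p :* P) :- P :* (x :+ y :* p)) x y p (p ^ N) ⟩
      1# + x * y * p ^ N * p ^ suc N - p ^ N * (x + y * p)
        ≈⟨ +-congʳ (+-congˡ (trans (*-congʳ (*-congʳ xy≈p)) (sym (^-homo-* p (suc N) (suc N))))) ⟩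
      W N ∎

    E-step₀ : (x + y * p) * E 0 ≈ - E 1 - p * E 0
    E-step₀ = begin
      (x + y * p) * (1# * (1# - 1# * (y * 1#)))
        ≈⟨ solve 3 (λ x y p → (x :+ y :* p) :* (# 1 :* (# 1 :- # 1 :* (y :* # 1)))
              := x :- x :* y :+ y :* p :- y :* y :* p) x y p ⟩
      x - x * y + y * p - y * y * p
        ≈⟨ +-congʳ (+-congʳ (+-congˡ (-‿cong xy≈p))) ⟩
      x - p + y * p - y * y * p
        ≈⟨ solve 3 (λ x y p → x :- p :+ y :* p :- y :* y :* p :=
              :- (:- # 1 :* (# 1 :* (x :* # 1) :- # 1 :* (y :* # 1) :* (y :* (p :* # 1)))) :- p :* (# 1 :* (# 1 :- # 1 :* (y :* # 1)))) x y p ⟩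
      - E 1 - p * E 0 ∎

    E-step : ∀ k → p ^ suc k * (x + y * p) * E (suc k) ≈ - E (suc (suc k)) - p ^ suc (suc (k ℕ.+ suc k)) * E k
    E-step k = begin
      p ^ suc k * (x + y * p) * E (suc k)
        ≈⟨ solve 7 (λ x y p P s a b →
             (p :* P) :* (x :+ y :* p) :* (:- s :* (a :* (x :* P) :- b :* (y :* P) :* (y :* (p :* P))))
             := :- (s :* (a :* (x :* P) :* (x :* (p :* P)) :- b :* (y :* P) :* (y :* (p :* P)) :* (y :* (p :* (p :* P)))))
                :- (s :* (a :- b :* (y :* P))) :* ((x :* y) :* (P :* (p :* (p :* P)))))
             x y p (p ^ k) (sgn k) (X k) (Y k) ⟩
      - (sgn k * (X (suc (suc k)) - Y (suc (suc (suc k))))) - E k * ((x * y) * (p ^ k * p ^ suc (suc k)))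
        ≈⟨ +-cong (-‿cong (solve 2 (λ s a → s :* a := :- (:- s) :* a) _ _))
             (-‿cong (trans (*-comm _ _) (*-congʳ (trans (*-cong xy≈p (trans (sym (^-homo-* p k (suc (suc k)))) (reflexive (≡.cong (p ^_) (ℕP.+-suc k (suc k)))))) refl)))) ⟩
      - E (suc (suc k)) - p ^ suc (suc (k ℕ.+ suc k)) * E k ∎

    E-step′ : ∀ a k → p ^ (suc k ℕ.+ a) * (x + y * p) * E (suc k) ≈ - (p ^ a * E (suc (suc k))) - p ^ suc (suc (suc k ℕ.+ a ℕ.+ k)) * E k
    E-step′ a k = begin
      p ^ (suc k ℕ.+ a) * (x + y * p) * E (suc k) ≈⟨ *-congʳ (*-congʳ (^-homo-* p (suc k) a)) ⟩
      p ^ suc k * p ^ a * (x + y * p) * E (suc k)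
        ≈⟨ solve 4 (λ u v w e → u :* v :* w :* e := v :* (u :* w :* e)) _ _ _ _ ⟩
      p ^ a * (p ^ suc k * (x + y * p) * E (suc k)) ≈⟨ *-congˡ (E-step k) ⟩
      p ^ a * (- E (suc (suc k)) - p ^ suc (suc (k ℕ.+ suc k)) * E k)
        ≈⟨ solve 4 (λ u e v f → u :* (:- e :- v :* f) := :- (u :* e) :- (u :* v) :* f) _ _ _ _ ⟩
      - (p ^ a * E (suc (suc k))) - (p ^ a * p ^ suc (suc (k ℕ.+ suc k))) * E k
        ≈⟨ +-congˡ (-‿cong (*-congʳ (trans (sym (^-homo-* p a _)) (reflexive (≡.cong (p ^_) (lemma a k)))))) ⟩
      - (p ^ a * E (suc (suc k))) - p ^ suc (suc (suc k ℕ.+ a ℕ.+ k)) * E k ∎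
      where
      open import Data.Nat.Tactic.RingSolver using (solve-∀)
      lemma : ∀ a k → a ℕ.+ suc (suc (k ℕ.+ suc k)) ≡ suc (suc (suc k ℕ.+ a ℕ.+ k))
      lemma = solve-∀

    partial : ∀ N n → n ≤ N →
      ∑ (λ k → W N * (D N k * E k)) (suc n) ≈
      ∑ (λ k → D (suc N) k * E k) (suc n) + p ^ (N ℕ.∸ n) * D N n * E (suc n) - p ^ suc (suc (N ℕ.+ n)) * D N (suc n) * E n
    partial N zero z≤n = begin
      0# + W N * (D N 0 * E 0)
        ≈⟨ solve 5 (λ u v w d e → # 0 :+ (u :- v :* w) :* (d :* e) := d :* (u :* e :- v :* (w :* e))) _ _ _ _ _ ⟩
      D N 0 * ((1# + p ^ (suc N ℕ.+ suc N)) * E 0 - p ^ N * ((x + y * p) * E 0))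
        ≈⟨ *-congˡ (+-congˡ (-‿cong (*-congˡ E-step₀))) ⟩
      D N 0 * ((1# + p ^ (suc N ℕ.+ suc N)) * E 0 - p ^ N * (- E 1 - p * E 0))
        ≈⟨ solve 8 (λ d w P p e₁ e₀ R d₁ →
             d :* (w :* e₀ :- P :* (:- e₁ :- p :* e₀)) :=
             # 0 :+ ((w :+ p :* P) :* d :+ R :* d₁) :* e₀ :+ P :* d :* e₁ :- R :* d₁ :* e₀)
             (D N 0) _ (p ^ N) p (E 1) (E 0) (p ^ suc (suc N)) (D N 1) ⟩
      ∑ (λ k → D (suc N) k * E k) 1 + p ^ N * D N 0 * E 1 - p ^ suc (suc N) * D N 1 * E 0
        ≈⟨ +-congˡ (-‿cong (*-congʳ (*-congʳ (reflexive (≡.cong (λ j → p ^ suc (suc j)) (≡.sym (ℕP.+-identityʳ N))))))) ⟩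
      _ ∎
    partial N (suc n) n<N = begin
      ∑ (λ k → W N * (D N k * E k)) (suc n) + W N * (D N (suc n) * E (suc n))
        ≈⟨ +-cong (partial N n (ℕP.<⇒≤ n<N)) (solve 5 (λ u v w d e → (u :- v :* w) :* (d :* e) := d :* (u :* e :- v :* w :* e)) _ _ _ _ _) ⟩
      (S₁ + A * D N n * E (suc n) - B * D N (suc n) * E n)
        + D N (suc n) * ((1# + p ^ (suc N ℕ.+ suc N)) * E (suc n) - p ^ N * (x + y * p) * E (suc n))
        ≈⟨ +-congˡ (*-congˡ (+-congˡ (-‿cong (≡.subst
             (λ j → p ^ j * (x + y * p) * E (suc n) ≈ - (p ^ (N ℕ.∸ suc n) * E (suc (suc n))) - p ^ suc (suc (j ℕ.+ n)) * E n)
             (ℕP.m+[n∸m]≡n n<N) (E-step′ (N ℕ.∸ suc n) n))))) ⟩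
      (S₁ + A * D N n * E (suc n) - B * D N (suc n) * E n)
        + D N (suc n) * ((1# + p ^ (suc N ℕ.+ suc N)) * E (suc n) - (- (p ^ (N ℕ.∸ suc n) * E (suc (suc n))) - B * E n))
        ≈⟨ solve 11 (λ S A d₀ e₁ B d₁ e₀ w a e₂ Cd →
              (S :+ A :* d₀ :* e₁ :- B :* d₁ :* e₀) :+ d₁ :* (w :* e₁ :- (:- (a :* e₂) :- B :* e₀))
              := S :+ (w :* d₁ :+ A :* d₀ :+ Cd) :* e₁ :+ a :* d₁ :* e₂ :- Cd :* e₁)
              S₁ A (D N n) (E (suc n)) B (D N (suc n)) (E n) _ _ (E (suc (suc n))) (p ^ suc (suc (suc (N ℕ.+ n))) * D N (suc (suc n))) ⟩
      S₁ + D (suc N) (suc n) * E (suc n) + p ^ (N ℕ.∸ suc n) * D N (suc n) * E (suc (suc n)) - p ^ suc (suc (suc (N ℕ.+ n))) * D N (suc (suc n)) * E (suc n)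
        ≈⟨ +-congˡ (-‿cong (*-congʳ (*-congʳ (reflexive (≡.cong (λ j → p ^ suc (suc j)) (≡.sym (ℕP.+-suc N n))))))) ⟩
      _ ∎
      where
      S₁ A B : Carrier
      S₁ = ∑ (λ k → D (suc N) k * E k) (suc n)
      A = p ^ (N ℕ.∸ n)
      B = p ^ suc (suc (N ℕ.+ n))

  finiteJacobi : ∀ N → ∏ (λ k → 1# - x * p ^ k) N * ∏ (λ k → 1# - y * p ^ k) (suc N) ≈ ∑ (λ k → D N k * E k) (suc N)
  finiteJacobi zero = solve 1 (λ y → # 1 :* (# 1 :* (# 1 :- y :* # 1)) := # 0 :+ # 1 :* (# 1 :* (# 1 :- # 1 :* (y :* # 1)))) y
  finiteJacobi (suc N) = begin
    (∏ (λ k → 1# - x * p ^ k) N * (1# - x * p ^ N)) * (∏ (λ k → 1# - y * p ^ k) (suc N) * (1# - y * p ^ suc N))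
      ≈⟨ solve 4 (λ a b c d → (a :* b) :* (c :* d) := (b :* d) :* (a :* c)) _ _ _ _ ⟩
    ((1# - x * p ^ N) * (1# - y * p ^ suc N)) * (∏ (λ k → 1# - x * p ^ k) N * ∏ (λ k → 1# - y * p ^ k) (suc N))
      ≈⟨ *-cong (W-factor N) (finiteJacobi N) ⟩
    W N * ∑ (λ k → D N k * E k) (suc N) ≈⟨ *-∑ _ _ (suc N) ⟩
    ∑ (λ k → W N * (D N k * E k)) (suc N) ≈⟨ partial N N ℕP.≤-refl ⟩
    S₁ + p ^ (N ℕ.∸ N) * D N N * E (suc N) - p ^ suc (suc (N ℕ.+ N)) * D N (suc N) * E N
      ≈⟨ +-congˡ (-‿cong (*-congʳ (*-congˡ (D-zero N (suc N) ℕP.≤-refl)))) ⟩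
    S₁ + p ^ (N ℕ.∸ N) * D N N * E (suc N) - p ^ suc (suc (N ℕ.+ N)) * 0# * E N
      ≈⟨ solve 7 (λ S a d e b f w → S :+ a :* d :* e :- b :* # 0 :* f := S :+ (w :* # 0 :+ a :* d :+ b :* p₀ :* # 0) :* e)
            S₁ (p ^ (N ℕ.∸ N)) (D N N) (E (suc N)) (p ^ suc (suc (N ℕ.+ N))) (E N) (1# + p ^ (suc N ℕ.+ suc N)) ⟩
    S₁ + ((1# + p ^ (suc N ℕ.+ suc N)) * 0# + p ^ (N ℕ.∸ N) * D N N + p ^ suc (suc (N ℕ.+ N)) * 1# * 0#) * E (suc N)
      ≈⟨ +-congˡ (*-congʳ (+-cong (+-congʳ (*-congˡ (sym (D-zero N (suc N) ℕP.≤-refl))))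
            (trans (zeroʳ _) (sym (trans (*-congˡ (D-zero N (suc (suc N)) (ℕP.m<n⇒m<1+n ℕP.≤-refl))) (zeroʳ _)))))) ⟩
    S₁ + D (suc N) (suc N) * E (suc N) ∎
    where
    p₀ : ∀ {n} → Expr _ n
    p₀ = # 1
    S₁ : Carrier
    S₁ = ∑ (λ k → D (suc N) k * E k) (suc N)

  poch : ℕ → Carrier
  poch = ∏ (λ k → 1# - p ^ suc k)

  module ClosedForm (r : ℕ → Carrier) (r₀ : r 0 ≈ 1#) (r-step : ∀ a → r a ≈ (1# - p ^ suc a) * r (suc a)) where
    r⁻² : ℕ → Carrier
    r⁻² zero          = 0#
    r⁻² (suc zero)    = 0#
    r⁻² (suc (suc a)) = r a

    private
      r⁻²-step : ∀ a → r⁻² (suc a) ≈ (1# - p ^ a) * r⁻² (suc (suc a))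
      r⁻²-step zero    = solve 1 (λ x → # 0 := (# 1 :- # 1) :* x) _
      r⁻²-step (suc a) = r-step a

      -- Multiplying by p makes this hold at a = 0 as well, where both sides vanish.
      p*r⁻² : ∀ a → p * r⁻² a ≈ (p - p ^ a) * ((1# - p ^ a) * r⁻² (suc (suc a)))
      p*r⁻² zero    = solve 2 (λ p r → p :* # 0 := (p :- # 1) :* ((# 1 :- # 1) :* r)) _ _
      p*r⁻² (suc a) = begin
        p * r⁻² (suc a) ≈⟨ *-congˡ (trans (r⁻²-step a) (*-congˡ (r⁻²-step (suc a)))) ⟩
        p * ((1# - p ^ a) * ((1# - p ^ suc a) * r⁻² (suc (suc (suc a)))))
          ≈⟨ solve 3 (λ p P r → p :* ((# 1 :- P) :* ((# 1 :- p :* P) :* r)) := (p :- p :* P) :* ((# 1 :- p :* P) :* r)) _ _ _ ⟩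
        (p - p ^ suc a) * ((1# - p ^ suc a) * r⁻² (suc (suc (suc a)))) ∎

      odd : ℕ → ℕ
      odd N = suc (N ℕ.+ N)

      poch-odd : ∀ N → poch (odd (suc N)) ≈ poch (odd N) * (1# - p ^ (suc N ℕ.+ suc N)) * (1# - p * p ^ (suc N ℕ.+ suc N))
      poch-odd N rewrite ℕP.+-suc N N = refl

      goal : ℕ → ℕ → Set _
      goal N k = D N k ≈ poch (odd N) * (r⁻² (suc (suc N) ℕ.∸ k) * r (N ℕ.+ suc k))

      closed₀ : ∀ N → goal N 0 → goal N 1 → goal (suc N) 0
      closed₀ N h₀ h₁ = begin
        (1# + p ^ (suc N ℕ.+ suc N) + γ) * D N 0 + p * γ * D N 1
          ≈⟨ +-cong (*-cong (+-congʳ (+-congˡ γ²)) (trans h₀ (*-congˡ (*-cong (r⁻²-step (suc N)) (reflexive (≡.cong r (ℕP.+-comm N 1)))))))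
                    (*-congˡ (trans h₁ (*-congˡ (*-congˡ (reflexive (≡.cong r (ℕP.+-comm N 2))))))) ⟩
        (1# + γ * γ + γ) * (Π * ((1# - γ) * ρ * ρ)) + p * γ * (Π * (r⁻² (suc N) * τ))
          ≈⟨ solve 7 (λ γ Π ρ ρ′ p s τ → (# 1 :+ γ :* γ :+ γ) :* (Π :* ((# 1 :- γ) :* ρ :* ρ′)) :+ p :* γ :* (Π :* (s :* τ))
               := Π :* ((# 1 :+ γ :* γ :+ γ) :* ((# 1 :- γ) :* ρ :* ρ′) :+ γ :* ((p :* s) :* τ))) γ Π ρ ρ p _ τ ⟩
        Π * ((1# + γ * γ + γ) * ((1# - γ) * ρ * ρ) + γ * ((p * r⁻² (suc N)) * τ))
          ≈⟨ *-congˡ (+-cong (*-congˡ (*-congˡ (r-step (suc N)))) (*-congˡ (*-congʳ (p*r⁻² (suc N))))) ⟩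
        Π * ((1# + γ * γ + γ) * ((1# - γ) * ρ * ((1# - p * γ) * τ)) + γ * ((p - γ) * ((1# - γ) * ρ) * τ))
          ≈⟨ solve 5 (λ γ Π ρ p τ → Π :* ((# 1 :+ γ :* γ :+ γ) :* ((# 1 :- γ) :* ρ :* ((# 1 :- p :* γ) :* τ)) :+ γ :* ((p :- γ) :* ((# 1 :- γ) :* ρ) :* τ))
               := Π :* (# 1 :- γ :* γ) :* (# 1 :- p :* (γ :* γ)) :* (ρ :* τ)) γ Π ρ p τ ⟩
        Π * (1# - γ * γ) * (1# - p * (γ * γ)) * (ρ * τ)
          ≈⟨ *-cong (*-cong (*-congˡ (+-congˡ (-‿cong (sym γ²)))) (+-congˡ (-‿cong (*-congˡ (sym γ²))))) (*-congˡ (reflexive (≡.cong r (≡.sym (ℕP.+-comm (suc N) 1))))) ⟩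
        Π * (1# - p ^ (suc N ℕ.+ suc N)) * (1# - p * p ^ (suc N ℕ.+ suc N)) * (ρ * r (suc N ℕ.+ 1)) ≈⟨ *-congʳ (sym (poch-odd N)) ⟩
        poch (odd (suc N)) * (ρ * r (suc N ℕ.+ 1)) ∎
        where
        γ Π ρ τ : Carrier
        γ = p ^ suc N
        Π = poch (odd N)
        ρ = r (suc N)
        τ = r (suc (suc N))
        γ² : p ^ (suc N ℕ.+ suc N) ≈ γ * γ
        γ² = ^-homo-* p (suc N) (suc N)

      closed₁ : ∀ a k → let N = k ℕ.+ a in goal N k → goal N (suc k) → goal N (suc (suc k)) → goal (suc N) (suc k)
      closed₁ a k h₀ h₁ h₂ = begin
        (1# + p ^ (suc N ℕ.+ suc N)) * D N (suc k) + p ^ (N ℕ.∸ k) * D N k + p ^ suc (suc (suc (N ℕ.+ k))) * D N (suc (suc k))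
          ≈⟨ +-cong (+-cong (*-cong (+-congˡ P≈αβ) h₁′) (*-cong (reflexive (≡.cong (p ^_) (ℕP.m+n∸m≡n k a))) h₀′)) (*-congˡ h₂′) ⟩
        (1# + α * β) * (Π * ((1# - α) * ρ * ((1# - p * β) * τ))) + α * (Π * (ρ * ((1# - β) * ((1# - p * β) * τ)))) + p * β * (Π * (r⁻² a * τ))
          ≈⟨ solve 7 (λ α β p Π ρ τ s → (# 1 :+ α :* β) :* (Π :* ((# 1 :- α) :* ρ :* ((# 1 :- p :* β) :* τ))) :+ α :* (Π :* (ρ :* ((# 1 :- β) :* ((# 1 :- p :* β) :* τ)))) :+ p :* β :* (Π :* (s :* τ))
               := (# 1 :+ α :* β) :* (Π :* ((# 1 :- α) :* ρ :* ((# 1 :- p :* β) :* τ))) :+ α :* (Π :* (ρ :* ((# 1 :- β) :* ((# 1 :- p :* β) :* τ)))) :+ β :* (Π :* ((p :* s) :* τ))) α β p Π ρ τ (r⁻² a) ⟩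
        (1# + α * β) * (Π * ((1# - α) * ρ * ((1# - p * β) * τ))) + α * (Π * (ρ * ((1# - β) * ((1# - p * β) * τ)))) + β * (Π * ((p * r⁻² a) * τ))
          ≈⟨ +-congˡ (*-congˡ (*-congˡ (*-congʳ (p*r⁻² a)))) ⟩
        (1# + α * β) * (Π * ((1# - α) * ρ * ((1# - p * β) * τ))) + α * (Π * (ρ * ((1# - β) * ((1# - p * β) * τ)))) + β * (Π * ((p - α) * ((1# - α) * ρ) * τ))
          ≈⟨ solve 6 (λ α β p Π ρ τ → (# 1 :+ α :* β) :* (Π :* ((# 1 :- α) :* ρ :* ((# 1 :- p :* β) :* τ))) :+ α :* (Π :* (ρ :* ((# 1 :- β) :* ((# 1 :- p :* β) :* τ)))) :+ β :* (Π :* ((p :- α) :* ((# 1 :- α) :* ρ) :* τ))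
               := Π :* (# 1 :- α :* β) :* (# 1 :- p :* (α :* β)) :* (ρ :* τ)) α β p Π ρ τ ⟩
        Π * (1# - α * β) * (1# - p * (α * β)) * (ρ * τ)
          ≈⟨ *-cong (*-cong (*-congˡ (+-congˡ (-‿cong (sym P≈αβ)))) (+-congˡ (-‿cong (*-congˡ (sym P≈αβ)))))
                    (*-cong (reflexive (≡.cong r⁻² (≡.sym (idx 2)))) (reflexive (≡.cong r (≡.sym (s₂ N k))))) ⟩
        Π * (1# - p ^ (suc N ℕ.+ suc N)) * (1# - p * p ^ (suc N ℕ.+ suc N)) * (r⁻² (suc (suc N) ℕ.∸ k) * r (suc N ℕ.+ suc (suc k)))
          ≈⟨ *-congʳ (sym (poch-odd N)) ⟩
        poch (odd (suc N)) * (r⁻² (suc (suc N) ℕ.∸ k) * r (suc N ℕ.+ suc (suc k))) ∎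
        where
        open import Data.Nat.Tactic.RingSolver using (solve-∀)
        N : ℕ
        N = k ℕ.+ a
        α β Π ρ τ : Carrier
        α = p ^ a
        β = p ^ suc (suc (N ℕ.+ k))
        Π = poch (odd N)
        ρ = r⁻² (suc (suc a))
        τ = r (suc (suc (suc (N ℕ.+ k))))
        s₂ : ∀ N k → suc N ℕ.+ suc (suc k) ≡ suc (suc (suc (N ℕ.+ k)))
        s₂ = solve-∀
        s₁ : ∀ a k → suc (k ℕ.+ a) ℕ.+ suc (k ℕ.+ a) ≡ a ℕ.+ suc (suc (k ℕ.+ a ℕ.+ k))
        s₁ = solve-∀
        idx : ∀ j → (j ℕ.+ N) ℕ.∸ k ≡ j ℕ.+ a
        idx j = ≡.trans (≡.cong (ℕ._∸ k) (≡.trans (≡.sym (ℕP.+-assoc j k a)) (≡.trans (≡.cong (ℕ._+ a) (ℕP.+-comm j k)) (ℕP.+-assoc k j a)))) (ℕP.m+n∸m≡n k (j ℕ.+ a))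
        P≈αβ : p ^ (suc N ℕ.+ suc N) ≈ α * β
        P≈αβ = trans (reflexive (≡.cong (p ^_) (s₁ a k))) (^-homo-* p a _)
        r₁ : r (suc (suc (N ℕ.+ k))) ≈ (1# - p * β) * τ
        r₁ = r-step _
        h₀′ : D N k ≈ Π * (ρ * ((1# - β) * ((1# - p * β) * τ)))
        h₀′ = trans h₀ (*-congˡ (*-cong (reflexive (≡.cong r⁻² (idx 2)))
          (trans (reflexive (≡.cong r (ℕP.+-suc N k))) (trans (r-step _) (*-congˡ r₁)))))
        h₁′ : D N (suc k) ≈ Π * ((1# - α) * ρ * ((1# - p * β) * τ))
        h₁′ = trans h₁ (*-congˡ (*-cong (trans (reflexive (≡.cong r⁻² (idx 1))) (r⁻²-step a))
          (trans (reflexive (≡.cong r (≡.trans (ℕP.+-suc N (suc k)) (≡.cong suc (ℕP.+-suc N k))))) r₁)))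
        h₂′ : D N (suc (suc k)) ≈ Π * (r⁻² a * τ)
        h₂′ = trans h₂ (*-congˡ (*-cong (reflexive (≡.cong r⁻² (idx 0))) (reflexive (≡.cong r (≡.trans (ℕP.+-suc N (suc (suc k))) (≡.cong suc (≡.trans (ℕP.+-suc N (suc k)) (≡.cong suc (ℕP.+-suc N k)))))))))

      closed : ∀ N k → (∀ k → goal N k) → goal (suc N) (suc k)
      closed N k h with ℕP.≤-total k N
      ... | inj₁ k≤N with ℕP.m≤n⇒∃[o]m+o≡n k≤N
      ...   | a , ≡.refl = closed₁ a k (h k) (h (suc k)) (h (suc (suc k)))
      closed N k h | inj₂ N≤k with ℕP.m≤n⇒m<n∨m≡n N≤k
      ...   | inj₂ ≡.refl = ≡.subst (λ M → (∀ k → goal M k) → goal (suc M) (suc k)) (ℕP.+-identityʳ k)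
                       (λ h → closed₁ 0 k (h k) (h (suc k)) (h (suc (suc k)))) h
      ...   | inj₁ N<k = trans (D-zero (suc N) (suc k) (s≤s N<k))
                       (sym (trans (*-congˡ (trans (*-congʳ (reflexive (small N k N<k))) (zeroˡ _))) (zeroʳ _)))
        where
        small : ∀ N k → N < k → r⁻² (suc (suc N) ℕ.∸ k) ≡ 0#
        small zero    (suc zero)    _       = ≡.refl
        small zero    (suc (suc k)) _       = ≡.cong r⁻² (ℕP.0∸n≡0 k)
        small (suc N) (suc k)       (s≤s p) = small N k p

    closedForm : ∀ N k → D N k ≈ poch (suc (N ℕ.+ N)) * (r⁻² (suc (suc N) ℕ.∸ k) * r (N ℕ.+ suc k))
    closedForm zero zero = begin
      1# ≈⟨ sym r₀ ⟩
      r 0 ≈⟨ r-step 0 ⟩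
      (1# - p ^ 1) * r 1 ≈⟨ solve 2 (λ a b → a :* b := # 1 :* a :* (# 1 :* b)) _ _ ⟩
      1# * (1# - p ^ 1) * (1# * r 1) ≈⟨ *-congˡ (*-congʳ (sym r₀)) ⟩
      1# * (1# - p ^ 1) * (r 0 * r 1) ∎
    closedForm zero (suc k) = sym (trans (*-congˡ (trans (*-congʳ (reflexive (small k))) (zeroˡ _))) (zeroʳ _))
      where
      small : ∀ k → r⁻² (1 ℕ.∸ k) ≡ 0#
      small zero          = ≡.refl
      small (suc zero)    = ≡.refl
      small (suc (suc k)) = ≡.refl
    closedForm (suc N) zero    = closed₀ N (closedForm N 0) (closedForm N 1)
    closedForm (suc N) (suc k) = closed N k (closedForm N)

module FirstOrderPowers {c ℓ} (R : CommutativeRing c ℓ) where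
  open CommutativeRing R hiding (zero)
  open Exp semiring using (_^_)
  open IntegerSolver R

  ν : ℕ → Carrier
  ν zero    = 0#
  ν (suc k) = 1# + ν k

  first-order : ∀ x δ → δ * δ ≈ 0# → ∀ k → (x * (1# + δ)) ^ k ≈ x ^ k * (1# + ν k * δ)
  first-order x δ δ² zero    = solve 1 (λ d → # 1 := # 1 :* (# 1 :+ # 0 :* d)) δ
  first-order x δ δ² (suc k) = trans (*-congˡ (first-order x δ δ² k))
    (trans (solve 4 (λ x d X n → (x :* (# 1 :+ d)) :* (X :* (# 1 :+ n :* d)) := x :* X :* (# 1 :+ (# 1 :+ n) :* d :+ n :* (d :* d))) x δ (x ^ k) (ν k))
      (*-congˡ (trans (+-congˡ (trans (*-congˡ δ²) (zeroʳ _))) (+-identityʳ _))))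

module SeriesLimits {c ℓ} (K : CommutativeRing c ℓ) where
  private module K = CommutativeRing K
  open Series K public
  open CommutativeRing seriesRing hiding (zero) public
  open RingFolds seriesRing public
  open Exp semiring using (_^_) public
  open SetoidReasoning setoid
  open IntegerSolver seriesRing using (solve)

  order-*-cong : ∀ k {M h f g} → h ≈[ k ] 0# → f ≈[ M ] g → h * f ≈[ k ℕ.+ M ] h * g
  order-*-cong zero    ph pf = ≈-* ≈-refl pf
  order-*-cong (suc k) {M} {h} {f} {g} ph pf = pw< λ where
      zero    _         → K.trans (vanish f 0) (K.sym (vanish g 0))
      (suc n) (s≤s n<N) → K.+-cong (K.trans (vanish f (suc n)) (K.sym (vanish g (suc n)))) (at< (order-*-cong k tail-order pf) n n<N)
    where
    vanish : ∀ f n → coe h 0 K.* coe f n K.≈ K.0#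
    vanish f n = K.trans (K.*-congʳ (at< ph 0 (s≤s z≤n))) (K.zeroˡ _)
    tail-order : tail h ≈[ k ] 0#
    tail-order = pw< λ n n<k → at< ph (suc n) (s≤s n<k)

  order-* : ∀ k {M h f} → h ≈[ k ] 0# → f ≈[ M ] 0# → h * f ≈[ k ℕ.+ M ] 0#
  order-* k {h = h} ph pf = ≈-trans (order-*-cong k ph pf) (≋⇒≈ (zeroʳ h))

  order-*ˡ : ∀ {M f} h → f ≈[ M ] 0# → h * f ≈[ M ] 0#
  order-*ˡ h = order-* 0 (pw< λ _ ())

  order-^ : ∀ {p} → p ≈[ 1 ] 0# → ∀ k → p ^ k ≈[ k ] 0#
  order-^ p₁ zero    = pw< λ _ ()
  order-^ p₁ (suc k) = order-* 1 p₁ (order-^ p₁ k)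

  order-q : q ≈[ 1 ] 0#
  order-q = pw< λ where
    zero    _        → K.refl
    (suc _) (s≤s ())

  ∑-⟶ : ∀ (f : ℕ → Carrier) → (∀ k → f k ≈[ k ] 0#) → ∑ f ⟶ lim (∑ f)
  ∑-⟶ f ord = lim-⟶ (∑ f) λ N → ≈-trans (≈-+ ≈-refl (ord N)) (≋⇒≈ (+-identityʳ _))

  1-f : ∀ {N} {f : Carrier} → f ≈[ N ] 0# → 1# - f ≈[ N ] 1#
  1-f ord = ≈-trans (≈-+ ≈-refl (≈-neg ord)) (≋⇒≈ (solve 0 (# 1 :- # 0 := # 1)))

  ∏-stable : ∀ (f : ℕ → Carrier) → (∀ k → f k ≈[ k ] 0#) → ∀ {M N} → N ≤ M → ∏ (λ k → 1# - f k) M ≈[ N ] ∏ (λ k → 1# - f k) N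
  ∏-stable f ord N≤M = go (ℕP.≤⇒≤′ N≤M)
    where
    go : ∀ {M N} → N ℕ.≤′ M → ∏ (λ k → 1# - f k) M ≈[ N ] ∏ (λ k → 1# - f k) N
    go (ℕ.≤′-reflexive ≡.refl) = ≈-refl
    go {suc M} (ℕ.≤′-step N≤M) = ≈-trans (≈-* (go N≤M) (≈-weaken (ℕP.≤′⇒≤ N≤M) (1-f (ord M)))) (≋⇒≈ (*-identityʳ _))

  ∏-⟶ : ∀ (f : ℕ → Carrier) → (∀ k → f k ≈[ k ] 0#) → ∏ (λ k → 1# - f k) ⟶ lim (∏ (λ k → 1# - f k))
  ∏-⟶ f ord = lim-⟶ _ λ N → ∏-stable f ord (ℕP.n≤1+n N)

  geometric : ∀ h N → (1# - h) * ∑ (h ^_) N ≋ 1# - h ^ N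
  geometric h zero    = solve 1 (λ h → (# 1 :- h) :* # 0 := # 1 :- # 1) h
  geometric h (suc N) = begin
    (1# - h) * (∑ (h ^_) N + h ^ N)             ≈⟨ distribˡ _ _ _ ⟩
    (1# - h) * ∑ (h ^_) N + (1# - h) * h ^ N    ≈⟨ +-congʳ (geometric h N) ⟩
    (1# - h ^ N) + (1# - h) * h ^ N             ≈⟨ solve 2 (λ h P → (# 1 :- P) :+ (# 1 :- h) :* P := # 1 :- h :* P) _ _ ⟩
    1# - h ^ suc N                              ∎

  inverse : Carrier → Carrier
  inverse f = lim (∑ ((1# - f) ^_))

  inverse-* : ∀ {f} → coe f 0 K.≈ K.1# → f * inverse f ≋ 1#
  inverse-* {f} f₀ = ⟶-unique
    (⟶-* {s = λ _ → f} (⟶-const f) (∑-⟶ (h ^_) (order-^ h₁)))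
    (⟶-cong (λ N → trans (sym (geometric h N)) (*-congʳ (solve 1 (λ f → # 1 :- (# 1 :- f) := f) f)))
      (tends λ N → 1-f (order-^ h₁ N)))
    where
    h : Carrier
    h = 1# - f
    h₁ : h ≈[ 1 ] 0#
    h₁ = pw< λ where
      zero    _        → K.trans (K.+-congˡ (K.-‿cong f₀)) (K.-‿inverseʳ _)
      (suc _) (s≤s ())

  module JacobiTripleProduct (p x y : Carrier) (xy≈p : x * y ≋ p) (x₁ : x ≈[ 1 ] 0#) where
    open FiniteJacobi seriesRing p x y xy≈p public using (X; Y; sgn; E; D; poch; finiteJacobi)
    open FiniteJacobi seriesRing p x y xy≈p using (module ClosedForm)

    p₁ : p ≈[ 1 ] 0#
    p₁ = ≈-trans (≋⇒≈ (sym xy≈p)) (≈-weaken (ℕP.m≤m+n 1 0) (order-* 1 {0} x₁ (pw< λ _ ())))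

    private
      p-order : ∀ k → p ^ suc k ≈[ k ] 0#
      p-order k = ≈-weaken (ℕP.n≤1+n k) (order-^ p₁ (suc k))

      poch₀ : ∀ n → coe (poch n) 0 K.≈ K.1#
      poch₀ n = K.trans (at< (∏-stable′ n) 0 (s≤s z≤n)) (K.trans (K.*-identityˡ _) (at< (1-f (order-^ p₁ 1)) 0 (s≤s z≤n)))
        where
        ∏-stable′ : ∀ n → poch n ≈[ 1 ] poch 1
        ∏-stable′ zero    = ≈-sym (≈-trans (≈-* ≈-refl (1-f (order-^ p₁ 1))) (≋⇒≈ (*-identityʳ _)))
        ∏-stable′ (suc n) = ∏-stable (λ k → p ^ suc k) p-order {suc n} (s≤s z≤n)

      r : ℕ → Carrier
      r n = inverse (poch n)

      poch-r : ∀ n → poch n * r n ≋ 1#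
      poch-r n = inverse-* (poch₀ n)

      r-step : ∀ a → r a ≋ (1# - p ^ suc a) * r (suc a)
      r-step a = begin
        r a                                                    ≈⟨ sym (*-identityʳ _) ⟩
        r a * 1#                                               ≈⟨ *-congˡ (sym (poch-r (suc a))) ⟩
        r a * (poch a * (1# - p ^ suc a) * r (suc a))
          ≈⟨ solve 4 (λ r P f s → r :* (P :* f :* s) := (P :* r) :* (f :* s)) _ _ _ _ ⟩
        poch a * r a * ((1# - p ^ suc a) * r (suc a))          ≈⟨ *-congʳ (poch-r a) ⟩
        1# * ((1# - p ^ suc a) * r (suc a))                    ≈⟨ *-identityˡ _ ⟩
        (1# - p ^ suc a) * r (suc a)                           ∎

      open ClosedForm r (trans (sym (*-identityˡ _)) (poch-r 0)) r-step using (r⁻²; closedForm)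

    X-order : ∀ k → X k ≈[ k ] 0#
    X-order zero    = pw< λ _ ()
    X-order (suc k) = ≈-weaken (ℕP.≤-reflexive (≡.trans (ℕP.+-comm 1 k) (≡.cong (k ℕ.+_) (≡.sym (ℕP.+-identityʳ 1)))))
      (order-* k (X-order k) (order-* 1 {0} x₁ (pw< λ _ ())))

    E-order : ∀ k → E k ≈[ k ] 0#
    E-order k = order-*ˡ (sgn k) (≈-trans (≈-+ (X-order k) (≈-neg (order-*ˡ (Y k) (order-*ˡ y (order-^ p₁ k)))))
                  (≋⇒≈ (solve 0 (# 0 :- # 0 := # 0))))

    private
      poch-inverse : ∀ {m n} → n ≤ m → poch m * r n ≈[ n ] 1#
      poch-inverse {m} {n} n≤m = ≈-trans (≈-* (∏-stable (λ k → p ^ suc k) p-order n≤m) ≈-refl) (≋⇒≈ (poch-r n))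

      coefficient : ∀ N k → k ≤ N → poch N * D N k ≈[ N ℕ.∸ k ] 1#
      coefficient N k k≤N = ≈-trans (≋⇒≈ rearrange)
        (≈-trans (≈-* (poch-inverse (ℕP.m∸n≤m N k))
                      (≈-weaken (ℕP.≤-trans (ℕP.m∸n≤m N k) (ℕP.m≤m+n N (suc k)))
                        (poch-inverse (ℕP.≤-trans (ℕP.≤-reflexive (ℕP.+-suc N k)) (s≤s (ℕP.+-monoʳ-≤ N k≤N))))))
                 (≋⇒≈ (*-identityʳ 1#)))
        where
        index : r⁻² (suc (suc N) ℕ.∸ k) ≋ r (N ℕ.∸ k)
        index = reflexive (≡.cong r⁻² (ℕP.+-∸-assoc 2 k≤N))
        rearrange : poch N * D N k ≋ (poch N * r (N ℕ.∸ k)) * (poch (suc (N ℕ.+ N)) * r (N ℕ.+ suc k))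
        rearrange = trans (*-congˡ (trans (closedForm N k) (*-congˡ (*-congʳ index))))
          (solve 4 (λ a b c d → a :* (b :* (c :* d)) := (a :* c) :* (b :* d)) _ _ _ _)

      summand : ∀ N k → k ≤ N → poch N * (D N k * E k) ≈[ N ] E k
      summand N k k≤N = ≈-trans (≋⇒≈ (solve 3 (λ a b c → a :* (b :* c) := c :* (a :* b)) _ _ _))
        (≈-trans (≈-weaken (ℕP.≤-reflexive (≡.sym (ℕP.m+[n∸m]≡n k≤N))) (order-*-cong k (E-order k) (coefficient N k k≤N)))
                 (≋⇒≈ (*-identityʳ _)))

      sums : ∀ N n → n ≤ suc N → ∑ (λ k → poch N * (D N k * E k)) n ≈[ N ] ∑ E n
      sums N zero    _       = ≈-refl
      sums N (suc n) (s≤s n≤N) = ≈-+ (sums N n (ℕP.m≤n⇒m≤1+n n≤N)) (summand N n n≤N)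

    jacobi : ∀ {P F G} → poch ⟶ P → ∏ (λ k → 1# - x * p ^ k) ⟶ F → (λ N → ∏ (λ k → 1# - y * p ^ k) (suc N)) ⟶ G →
             ∑ E ⟶ P * (F * G)
    jacobi P F G = tends λ N → ≈-sym (≈-trans (≈-sym (approx (⟶-* P (⟶-* F G)) N))
      (≈-trans (≋⇒≈ (trans (*-congˡ (finiteJacobi N)) (*-∑ _ _ (suc N))))
      (≈-trans (sums N (suc N) ℕP.≤-refl)
      (≈-trans (≈-+ ≈-refl (E-order N)) (≋⇒≈ (+-identityʳ _))))))

record RingHom {c ℓ c′ ℓ′} (K : CommutativeRing c ℓ) (L : CommutativeRing c′ ℓ′) : Set (c ⊔ ℓ ⊔ c′ ⊔ ℓ′) where
  private
    module K = CommutativeRing K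
    module L = CommutativeRing L
  field
    ⟦_⟧    : K.Carrier → L.Carrier
    ⟦⟧-cong : ∀ {a b} → a K.≈ b → ⟦ a ⟧ L.≈ ⟦ b ⟧
    +-hom  : ∀ a b → ⟦ a K.+ b ⟧ L.≈ ⟦ a ⟧ L.+ ⟦ b ⟧
    *-hom  : ∀ a b → ⟦ a K.* b ⟧ L.≈ ⟦ a ⟧ L.* ⟦ b ⟧
    neg-hom : ∀ a → ⟦ K.- a ⟧ L.≈ L.- ⟦ a ⟧
    1-hom  : ⟦ K.1# ⟧ L.≈ L.1#

  open Exp K.semiring using () renaming (_^_ to _^ᴷ_)
  open Exp L.semiring using () renaming (_^_ to _^ᴸ_)
  private
    module FK = RingFolds K
    module FL = RingFolds L
    module IK = IntegerSolver K
    module IL = IntegerSolver L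
  open Expression using (Κ; Ι; _⊕_; _⊗_; _⊛_; ⊝_)

  sub-hom : ∀ a b → ⟦ a K.- b ⟧ L.≈ ⟦ a ⟧ L.- ⟦ b ⟧
  sub-hom a b = L.trans (+-hom a (K.- b)) (L.+-congˡ (neg-hom b))

  0-hom : ⟦ K.0# ⟧ L.≈ L.0#
  0-hom = L.trans (⟦⟧-cong (K.sym (K.-‿inverseʳ K.0#))) (L.trans (sub-hom K.0# K.0#) (L.-‿inverseʳ _))

  ^-hom : ∀ a n → ⟦ a ^ᴷ n ⟧ L.≈ ⟦ a ⟧ ^ᴸ n
  ^-hom a zero    = 1-hom
  ^-hom a (suc n) = L.trans (*-hom a _) (L.*-congˡ (^-hom a n))

  ∏-hom : ∀ f n → ⟦ FK.∏ f n ⟧ L.≈ FL.∏ (λ k → ⟦ f k ⟧) n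
  ∏-hom f zero    = 1-hom
  ∏-hom f (suc n) = L.trans (*-hom _ _) (L.*-congʳ (∏-hom f n))

  ∑-hom : ∀ f n → ⟦ FK.∑ f n ⟧ L.≈ FL.∑ (λ k → ⟦ f k ⟧) n
  ∑-hom f zero    = 0-hom
  ∑-hom f (suc n) = L.trans (+-hom _ _) (L.+-congʳ (∑-hom f n))

  fromℤ-hom : ∀ i → ⟦ IK.fromℤ i ⟧ L.≈ IL.fromℤ i
  fromℤ-hom (ℤ.+ n)    = pos n
    where
    pos : ∀ n → ⟦ IK.fromℤ (ℤ.+ n) ⟧ L.≈ IL.fromℤ (ℤ.+ n)
    pos zero          = 0-hom
    pos (suc zero)    = 1-hom
    pos (suc (suc n)) = L.trans (⟦⟧-cong (IK.fromℤ-+ (ℤ.+ 1) (ℤ.+ suc n))) (L.trans (+-hom _ _)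
      (L.trans (L.+-cong 1-hom (pos (suc n))) (L.sym (IL.fromℤ-+ (ℤ.+ 1) (ℤ.+ suc n)))))
  fromℤ-hom ℤ.-[1+ n ] = L.trans (neg-hom _) (L.-‿cong (fromℤ-hom (ℤ.+ suc n)))

  eval-hom : ∀ {n} (e : Expr ℤ n) ρ → ⟦ IK.eval e ρ ⟧ L.≈ IL.eval e (Vec.map ⟦_⟧ ρ)
  eval-hom (Κ x)   ρ = fromℤ-hom x
  eval-hom (Ι x)   ρ = L.reflexive (≡.sym (VecP.lookup-map x ⟦_⟧ ρ))
  eval-hom (x ⊕ y) ρ = L.trans (+-hom _ _) (L.+-cong (eval-hom x ρ) (eval-hom y ρ))
  eval-hom (x ⊗ y) ρ = L.trans (*-hom _ _) (L.*-cong (eval-hom x ρ) (eval-hom y ρ))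
  eval-hom (⊝ x)   ρ = L.trans (neg-hom _) (L.-‿cong (eval-hom x ρ))
  eval-hom (x ⊛ i) ρ = L.trans (⟦⟧-cong (K.sym (MultTC.×ᵤ≈× K.*-monoid i _)))
    (L.trans (^-hom _ i) (L.trans (Exp.^-congˡ L.semiring i (eval-hom x ρ)) (MultTC.×ᵤ≈× L.*-monoid i _)))

module MapSeries {c ℓ c′ ℓ′} {K : CommutativeRing c ℓ} {L : CommutativeRing c′ ℓ′} (h : RingHom K L) where
  private
    module K = CommutativeRing K
    module L = CommutativeRing L
    module SK = SeriesLimits K
    module SL = SeriesLimits L
  open RingHom h
  open SeriesLimits K using (coe; _≈[_]_; at<; at)
  open SeriesLimits L using (pw; pw<; tends)

  map : SK.Series → SL.Series
  SL.coe (map f) n = ⟦ coe f n ⟧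

  private
    map-✶ : ∀ n f g → ⟦ coe (f SK.✶ g) n ⟧ L.≈ SL.coe (map f SL.✶ map g) n
    map-✶ zero    f g = *-hom _ _
    map-✶ (suc n) f g = L.trans (+-hom _ _) (L.+-cong (*-hom _ _) (map-✶ n (SK.tail f) g))

  mapHom : RingHom SK.seriesRing SL.seriesRing
  mapHom = record
    { ⟦_⟧ = map
    ; ⟦⟧-cong = λ p → pw λ n → ⟦⟧-cong (at p n)
    ; +-hom = λ f g → pw λ n → +-hom _ _
    ; *-hom = λ f g → pw λ n → map-✶ n f g
    ; neg-hom = λ f → pw λ n → neg-hom _
    ; 1-hom = pw λ where
        zero    → 1-hom
        (suc n) → 0-hom }

  map-⟶ : ∀ {s f} → s SK.⟶ f → (λ N → map (s N)) SL.⟶ map f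
  map-⟶ p = tends λ N → pw< λ n n<N → ⟦⟧-cong (at< (SK.approx p N) n n<N)

  map-q : map SK.q SL.≋ SL.q
  map-q = pw λ where
    zero          → 0-hom
    (suc zero)    → 1-hom
    (suc (suc n)) → 0-hom

-- The substitution q ↦ wq.
module Twist {c ℓ} (K : CommutativeRing c ℓ) (w : CommutativeRing.Carrier K) where
  private module K = CommutativeRing K
  open SeriesLimits K
  open Exp K.semiring using () renaming (_^_ to _^ᴷ_)
  private module I = IntegerSolver K

  σ : Series → Series
  coe (σ f) n = w ^ᴷ n K.* coe f n

  private
    σ-✶ : ∀ n f g → coe (σ (f ✶ g)) n K.≈ coe (σ f ✶ σ g) n
    σ-✶ zero    f g = I.solve 2 (λ a b → # 1 :* (a :* b) := (# 1 :* a) :* (# 1 :* b)) _ _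
    σ-✶ (suc n) f g = K.trans
      (I.solve 5 (λ w W a b c → w :* W :* (a :* b :+ c) := (# 1 :* a) :* (w :* W :* b) :+ w :* (W :* c)) _ _ _ _ _)
      (K.+-congˡ (K.trans (K.*-congˡ (σ-✶ n (tail f) g)) (K.trans (K.sym (κ-✶ w (σ (tail f) ✶ σ g) n))
        (K.trans (K.sym (at (*-assoc (κ w) (σ (tail f)) (σ g)) n)) (at (*-congʳ {σ g} (tail-σ f)) n)))))
      where
      tail-σ : ∀ f → κ w ✶ σ (tail f) ≋ tail (σ f)
      tail-σ f = pw λ n → K.trans (κ-✶ w (σ (tail f)) n) (K.sym (K.*-assoc _ _ _))

  σHom : RingHom seriesRing seriesRing
  σHom = record
    { ⟦_⟧ = σ
    ; ⟦⟧-cong = λ p → pw λ n → K.*-congˡ (at p n)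
    ; +-hom = λ f g → pw λ n → K.distribˡ _ _ _
    ; *-hom = λ f g → pw λ n → σ-✶ n f g
    ; neg-hom = λ f → pw λ n → I.solve 2 (λ a b → a :* :- b := :- (a :* b)) _ _
    ; 1-hom = pw λ where
        zero    → K.*-identityˡ _
        (suc n) → K.zeroʳ _ }

  σ-⟶ : ∀ {s f} → s ⟶ f → (λ N → σ (s N)) ⟶ σ f
  σ-⟶ p = tends λ N → pw< λ n n<N → K.*-congˡ (at< (approx p N) n n<N)

  σ-q : σ q ≋ κ w * q
  σ-q = pw λ n → K.trans (go n) (K.sym (κ-✶ w q n))
    where
    go : ∀ n → coe (σ q) n K.≈ w K.* coe q n
    go zero          = I.solve 1 (λ w → # 1 :* # 0 := w :* # 0) _
    go (suc zero)    = I.solve 1 (λ w → w :* # 1 :* # 1 := w :* # 1) _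
    go (suc (suc n)) = K.trans (K.zeroʳ _) (K.sym (K.zeroʳ _))

-- The substitution q ↦ q⁵ and the resulting 5-dissections.
module Dissection {c ℓ} (K : CommutativeRing c ℓ) where
  private module K = CommutativeRing K
  open SeriesLimits K
  open SetoidReasoning setoid

  private
    spread : (ℕ → K.Carrier) → ℕ → K.Carrier
    spread f 0 = f 0
    spread f 1 = K.0#
    spread f 2 = K.0#
    spread f 3 = K.0#
    spread f 4 = K.0#
    spread f (suc (suc (suc (suc (suc n))))) = spread (λ i → f (suc i)) n

  φ : Series → Series
  coe (φ f) = spread (coe f)

  private
    φ-local : ∀ n {f g : ℕ → K.Carrier} → (∀ i → i ≤ n → f i K.≈ g i) → spread f n K.≈ spread g n
    φ-local 0 p = p 0 z≤n
    φ-local 1 p = K.refl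
    φ-local 2 p = K.refl
    φ-local 3 p = K.refl
    φ-local 4 p = K.refl
    φ-local (suc (suc (suc (suc (suc n))))) p =
      φ-local n (λ i i≤n → p (suc i) (s≤s (ℕP.≤-trans i≤n (ℕP.m≤n+m n 4))))

    φ-+ : ∀ n f g → coe (φ (f ⊹ g)) n K.≈ coe (φ f) n K.+ coe (φ g) n
    φ-+ 0 f g = K.refl
    φ-+ 1 f g = K.sym (K.+-identityˡ _)
    φ-+ 2 f g = K.sym (K.+-identityˡ _)
    φ-+ 3 f g = K.sym (K.+-identityˡ _)
    φ-+ 4 f g = K.sym (K.+-identityˡ _)
    φ-+ (suc (suc (suc (suc (suc n))))) f g = φ-+ n (tail f) (tail g)

    module I = IntegerSolver K

    φ-neg : ∀ n f → coe (φ (neg f)) n K.≈ K.- coe (φ f) n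
    φ-neg 0 f = K.refl
    φ-neg 1 f = I.solve 0 (# 0 := :- # 0)
    φ-neg 2 f = I.solve 0 (# 0 := :- # 0)
    φ-neg 3 f = I.solve 0 (# 0 := :- # 0)
    φ-neg 4 f = I.solve 0 (# 0 := :- # 0)
    φ-neg (suc (suc (suc (suc (suc n))))) f = φ-neg n (tail f)

    φ-κ✶ : ∀ n a f → coe (φ (κ a ✶ f)) n K.≈ a K.* coe (φ f) n
    φ-κ✶ 0 a f = K.refl
    φ-κ✶ 1 a f = K.sym (K.zeroʳ a)
    φ-κ✶ 2 a f = K.sym (K.zeroʳ a)
    φ-κ✶ 3 a f = K.sym (K.zeroʳ a)
    φ-κ✶ 4 a f = K.sym (K.zeroʳ a)
    φ-κ✶ (suc (suc (suc (suc (suc n))))) a f =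
      K.trans (φ-local n (λ i _ → K.trans (κ-✶ a f (suc i)) (K.sym (κ-✶ a (tail f) i)))) (φ-κ✶ n a (tail f))

    tail-✶ : ∀ f g → tail (f ✶ g) ≋ (κ (coe f 0) ✶ tail g) ⊹ (tail f ✶ g)
    tail-✶ f g = pw λ n → K.+-congʳ (K.sym (κ-✶ (coe f 0) (tail g) n))

    φ-✶ : ∀ n f g → coe (φ (f ✶ g)) n K.≈ coe (φ f ✶ φ g) n
    φ-✶ 0 f g = K.refl
    φ-✶ 1 f g = I.solve 2 (λ a b → # 0 := a :* # 0 :+ # 0 :* b) _ _
    φ-✶ 2 f g = I.solve 2 (λ a b → # 0 := a :* # 0 :+ (# 0 :* # 0 :+ # 0 :* b)) _ _
    φ-✶ 3 f g = I.solve 2 (λ a b → # 0 := a :* # 0 :+ (# 0 :* # 0 :+ (# 0 :* # 0 :+ # 0 :* b))) _ _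
    φ-✶ 4 f g = I.solve 2 (λ a b → # 0 := a :* # 0 :+ (# 0 :* # 0 :+ (# 0 :* # 0 :+ (# 0 :* # 0 :+ # 0 :* b)))) _ _
    φ-✶ (suc (suc (suc (suc (suc n))))) f g = K.trans (φ-local n (λ i _ → at (tail-✶ f g) i))
      (K.trans (φ-+ n (κ (coe f 0) ✶ tail g) (tail f ✶ g))
      (K.trans (K.+-cong (φ-κ✶ n (coe f 0) (tail g)) (φ-✶ n (tail f) g))
      (I.solve 7 (λ a b c d e h i → a :* b :+ c := a :* b :+ (# 0 :* d :+ (# 0 :* e :+ (# 0 :* h :+ (# 0 :* i :+ c))))) _ _ _ _ _ _ _)))

  φHom : RingHom seriesRing seriesRing
  φHom = record
    { ⟦_⟧ = φ
    ; ⟦⟧-cong = λ p → pw λ n → φ-local n (λ i _ → at p i)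
    ; +-hom = λ f g → pw λ n → φ-+ n f g
    ; *-hom = λ f g → pw λ n → φ-✶ n f g
    ; neg-hom = λ f → pw λ n → φ-neg n f
    ; 1-hom = φ-κ K.1# }
    where
    φ-0 : ∀ n → spread (λ _ → K.0#) n K.≈ K.0#
    φ-0 0 = K.refl
    φ-0 1 = K.refl
    φ-0 2 = K.refl
    φ-0 3 = K.refl
    φ-0 4 = K.refl
    φ-0 (suc (suc (suc (suc (suc n))))) = φ-0 n
    φ-κ : ∀ a → φ (κ a) ≋ κ a
    φ-κ a = pw λ where
      0 → K.refl
      1 → K.refl
      2 → K.refl
      3 → K.refl
      4 → K.refl
      (suc (suc (suc (suc (suc n))))) → φ-0 n

  φ-⟶ : ∀ {s f} → s ⟶ f → (λ N → φ (s N)) ⟶ φ f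
  φ-⟶ p = tends λ N → pw< λ n n<N → φ-local n (λ i i≤n → at< (approx p N) i (ℕP.≤-<-trans i≤n n<N))

  φ-κ : ∀ a → φ (κ a) ≋ κ a
  φ-κ a = pw λ n → K.trans (φ-local n λ i _ → K.trans (K.sym (K.*-identityʳ _)) (go i)) (K.trans (φ-κ✶ n a 1#) (K.trans (K.*-congˡ (at (RingHom.1-hom φHom) n)) (K.sym (K.trans (at (sym (*-identityʳ (κ a))) n) (κ-✶ a 1# n)))))
    where
    go : ∀ i → coe (κ a) i K.* K.1# K.≈ coe (κ a ✶ 1#) i
    go i = K.trans (K.*-identityʳ _) (at (sym (*-identityʳ (κ a))) i)

  φ-shift : ∀ f → φ (shift f) ≋ shift (shift (shift (shift (shift (φ f)))))
  φ-shift f = pw λ where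
    0 → K.refl
    1 → K.refl
    2 → K.refl
    3 → K.refl
    4 → K.refl
    (suc (suc (suc (suc (suc n))))) → K.refl

  φ-q : φ q ≋ q ^ 5
  φ-q = trans (φ-shift 1#) (sym (trans (q-✶ _) (sh (trans (q-✶ _) (sh (trans (q-✶ _) (sh (trans (q-✶ _) (sh
    (trans (q-✶ _) (sh (sym (RingHom.1-hom φHom)))))))))))))
    where
    sh : ∀ {f g} → f ≋ g → shift f ≋ shift g
    sh p = pw λ where
      zero    → K.refl
      (suc n) → at p n

  σ-φ : ∀ w → Exp._^_ K.semiring w 5 K.≈ K.1# → ∀ f → Twist.σ K w (φ f) ≋ φ f
  σ-φ w w⁵ f = pw λ n → go n (coe f)
    where
    open Exp K.semiring using () renaming (_^_ to _^ᴷ_)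
    go : ∀ n f → w ^ᴷ n K.* spread f n K.≈ spread f n
    go 0 f = K.*-identityˡ _
    go 1 f = K.zeroʳ _
    go 2 f = K.zeroʳ _
    go 3 f = K.zeroʳ _
    go 4 f = K.zeroʳ _
    go (suc (suc (suc (suc (suc n))))) f = K.trans (K.*-congʳ (K.trans (Exp.^-homo-* K.semiring w 5 n) (K.trans (K.*-congʳ w⁵) (K.*-identityˡ _))))
      (go n (λ i → f (suc i)))

  κHom : RingHom K seriesRing
  κHom = record { ⟦_⟧ = κ ; ⟦⟧-cong = κ-cong ; +-hom = κ-+ ; *-hom = κ-* ; neg-hom = κ-neg ; 1-hom = refl }
  part : ℕ → Series → Series
  coe (part r f) n = coe f (r ℕ.+ n ℕ.* 5)

  part-cong : ∀ r {f g} → f ≋ g → part r f ≋ part r g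
  part-cong r p = pw λ n → at p (r ℕ.+ n ℕ.* 5)

  private
    part-+ : ∀ r f g → part r (f + g) ≋ part r f + part r g
    part-+ r f g = pw λ n → K.refl

    part₀-φ : ∀ f → part 0 (φ f) ≋ f
    part₀-φ f = pw λ n → go n (coe f)
      where
      go : ∀ n f → spread f (n ℕ.* 5) K.≈ f n
      go zero    f = K.refl
      go (suc n) f = go n (λ i → f (suc i))

    vanish : ∀ r → (∀ f → spread f r K.≈ K.0#) → ∀ f → part r (φ f) ≋ 0#
    vanish r base f = pw λ n → go n (coe f)
      where
      go : ∀ n f → spread f (r ℕ.+ n ℕ.* 5) K.≈ K.0#
      go zero    f = K.trans (K.reflexive (≡.cong (spread f) (ℕP.+-identityʳ r))) (base f)
      go (suc n) f = K.trans (K.reflexive (≡.cong (spread f) (shuffle r (n ℕ.* 5)))) (go n (λ i → f (suc i)))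
        where
        shuffle : ∀ r m → r ℕ.+ (5 ℕ.+ m) ≡ 5 ℕ.+ (r ℕ.+ m)
        shuffle r m = ≡.trans (≡.sym (ℕP.+-assoc r 5 m)) (≡.trans (≡.cong (ℕ._+ m) (ℕP.+-comm r 5)) (ℕP.+-assoc 5 r m))

    part₀-q : ∀ f → part 0 (q * f) ≋ q * part 4 f
    part₀-q f = trans {j = part 0 (shift f)} (pw λ n → at (q-✶ f) (n ℕ.* 5)) (trans (pw go) (sym (q-✶ (part 4 f))))
      where
      go : ∀ n → coe (shift f) (n ℕ.* 5) K.≈ coe (shift (part 4 f)) n
      go zero    = K.refl
      go (suc n) = K.refl

    part-q : ∀ r f → part (suc r) (q * f) ≋ part r f
    part-q r f = pw λ n → at (q-✶ f) (suc r ℕ.+ n ℕ.* 5)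

  recombine : (g₀ g₁ g₂ g₃ g₄ : Series) → Series
  recombine g₀ g₁ g₂ g₃ g₄ = φ g₀ + q * (φ g₁ + q * (φ g₂ + q * (φ g₃ + q * φ g₄)))

  private
    split : ∀ r {f g h} → part (suc r) (φ f) ≋ 0# → part r g ≋ h → part (suc r) (φ f + q * g) ≋ h
    split r {f} {g} {h} pf pg = begin
      part (suc r) (φ f + q * g)                ≈⟨ part-+ (suc r) (φ f) (q * g) ⟩
      part (suc r) (φ f) + part (suc r) (q * g) ≈⟨ +-cong pf (trans (part-q r g) pg) ⟩
      0# + h                                    ≈⟨ +-identityˡ h ⟩
      h                                         ∎

    split₀ : ∀ f g → part 4 g ≋ 0# → part 0 (φ f + q * g) ≋ f
    split₀ f g pg = begin
      part 0 (φ f + q * g)          ≈⟨ part-+ 0 (φ f) (q * g) ⟩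
      part 0 (φ f) + part 0 (q * g) ≈⟨ +-cong (part₀-φ f) (trans (part₀-q g) (trans (*-congˡ pg) (zeroʳ q))) ⟩
      f + 0#                        ≈⟨ +-identityʳ f ⟩
      f                             ∎

    v₁ : ∀ f → part 1 (φ f) ≋ 0#
    v₁ = vanish 1 (λ f → K.refl)
    v₂ : ∀ f → part 2 (φ f) ≋ 0#
    v₂ = vanish 2 (λ f → K.refl)
    v₃ : ∀ f → part 3 (φ f) ≋ 0#
    v₃ = vanish 3 (λ f → K.refl)
    v₄ : ∀ f → part 4 (φ f) ≋ 0#
    v₄ = vanish 4 (λ f → K.refl)

  part₀-recombine : ∀ a b c d e → part 0 (recombine a b c d e) ≋ a
  part₀-recombine a b c d e = split₀ a _ (split 3 (v₄ b) (split 2 (v₃ c) (split 1 (v₂ d) (v₁ e))))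

  part₁-recombine : ∀ a b c d e → part 1 (recombine a b c d e) ≋ b
  part₁-recombine a b c d e = split 0 (v₁ a) (split₀ b _ (split 3 (v₄ c) (split 2 (v₃ d) (v₂ e))))

  part₃-recombine : ∀ a b c d e → part 3 (recombine a b c d e) ≋ d
  part₃-recombine a b c d e = split 2 (v₃ a) (split 1 (v₂ b) (split 0 (v₁ c) (split₀ d (φ e) (v₄ e))))

  part₄-recombine : ∀ a b c d e → part 4 (recombine a b c d e) ≋ e
  part₄-recombine a b c d e = split 3 (v₄ a) (split 2 (v₃ b) (split 1 (v₂ c) (split 0 (v₁ d) (part₀-φ e))))

module Exponents where
  t u u′ v v′ : ℕ → ℕ
  t zero     = 0
  t (suc k)  = t k ℕ.+ suc k
  u zero     = 0
  u (suc k)  = u k ℕ.+ (3 ℕ.+ k ℕ.* 5)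
  u′ zero    = 2
  u′ (suc k) = u′ k ℕ.+ (2 ℕ.+ suc k ℕ.* 5)
  v zero     = 0
  v (suc k)  = v k ℕ.+ (4 ℕ.+ k ℕ.* 5)
  v′ zero    = 1
  v′ (suc k) = v′ k ℕ.+ (1 ℕ.+ suc k ℕ.* 5)

  private
    five : ∀ k n {m} → t (k ℕ.+ n ℕ.* 5) ≡ m → t (5 ℕ.+ (k ℕ.+ n ℕ.* 5)) ≡ m ℕ.+ (15 ℕ.+ k ℕ.* 5 ℕ.+ n ℕ.* 25)
    five k n ≡.refl = go k n (t (k ℕ.+ n ℕ.* 5))
      where
      go : ∀ k n T → T ℕ.+ suc (k ℕ.+ n ℕ.* 5) ℕ.+ suc (suc (k ℕ.+ n ℕ.* 5)) ℕ.+ suc (suc (suc (k ℕ.+ n ℕ.* 5)))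
                       ℕ.+ suc (suc (suc (suc (k ℕ.+ n ℕ.* 5)))) ℕ.+ suc (suc (suc (suc (suc (k ℕ.+ n ℕ.* 5)))))
                   ≡ T ℕ.+ (15 ℕ.+ k ℕ.* 5 ℕ.+ n ℕ.* 25)
      go = solve-∀

  t₀ : ∀ i → t (i ℕ.* 5) ≡ u i ℕ.* 5
  t₀ zero    = ≡.refl
  t₀ (suc i) = ≡.trans (five 0 i (t₀ i)) (go i (u i))
    where
    go : ∀ i U → U ℕ.* 5 ℕ.+ (15 ℕ.+ 0 ℕ.+ i ℕ.* 25) ≡ (U ℕ.+ (3 ℕ.+ i ℕ.* 5)) ℕ.* 5
    go = solve-∀

  t₁ : ∀ i → t (1 ℕ.+ i ℕ.* 5) ≡ suc (v i ℕ.* 5)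
  t₁ zero    = ≡.refl
  t₁ (suc i) = ≡.trans (five 1 i (t₁ i)) (go i (v i))
    where
    go : ∀ i U → suc (U ℕ.* 5) ℕ.+ (15 ℕ.+ 5 ℕ.+ i ℕ.* 25) ≡ suc ((U ℕ.+ (4 ℕ.+ i ℕ.* 5)) ℕ.* 5)
    go = solve-∀

  t₂ : ∀ i → t (2 ℕ.+ i ℕ.* 5) ≡ 3 ℕ.+ t i ℕ.* 5 ℕ.* 5
  t₂ zero    = ≡.refl
  t₂ (suc i) = ≡.trans (five 2 i (t₂ i)) (go i (t i))
    where
    go : ∀ i U → (3 ℕ.+ U ℕ.* 5 ℕ.* 5) ℕ.+ (15 ℕ.+ 10 ℕ.+ i ℕ.* 25) ≡ 3 ℕ.+ (U ℕ.+ suc i) ℕ.* 5 ℕ.* 5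
    go = solve-∀

  t₃ : ∀ i → t (3 ℕ.+ i ℕ.* 5) ≡ suc (v′ i ℕ.* 5)
  t₃ zero    = ≡.refl
  t₃ (suc i) = ≡.trans (five 3 i (t₃ i)) (go i (v′ i))
    where
    go : ∀ i U → suc (U ℕ.* 5) ℕ.+ (15 ℕ.+ 15 ℕ.+ i ℕ.* 25) ≡ suc ((U ℕ.+ (1 ℕ.+ suc i ℕ.* 5)) ℕ.* 5)
    go = solve-∀

  t₄ : ∀ i → t (4 ℕ.+ i ℕ.* 5) ≡ u′ i ℕ.* 5
  t₄ zero    = ≡.refl
  t₄ (suc i) = ≡.trans (five 4 i (t₄ i)) (go i (u′ i))
    where
    go : ∀ i U → U ℕ.* 5 ℕ.+ (15 ℕ.+ 20 ℕ.+ i ℕ.* 25) ≡ (U ℕ.+ (2 ℕ.+ suc i ℕ.* 5)) ℕ.* 5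
    go = solve-∀

  k≤t : ∀ k → k ≤ t k
  k≤t zero    = z≤n
  k≤t (suc k) = ℕP.m≤n+m (suc k) (t k)

  private
    grow : ∀ {k n} m → k ≤ n → suc k ≤ n ℕ.+ suc m
    grow {k} {n} m k≤n = ℕP.≤-trans (s≤s (ℕP.≤-trans k≤n (ℕP.m≤m+n n m))) (ℕP.≤-reflexive (≡.sym (ℕP.+-suc n m)))

  k≤u : ∀ k → k ≤ u k
  k≤u zero    = z≤n
  k≤u (suc k) = grow _ (k≤u k)
  k≤u′ : ∀ k → k ≤ u′ k
  k≤u′ zero    = z≤n
  k≤u′ (suc k) = grow _ (k≤u′ k)
  k≤v : ∀ k → k ≤ v k
  k≤v zero    = z≤n
  k≤v (suc k) = grow _ (k≤v k)
  k≤v′ : ∀ k → k ≤ v′ k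
  k≤v′ zero    = z≤n
  k≤v′ (suc k) = grow _ (k≤v′ k)

module ThetaExpansion {c ℓ} (R : CommutativeRing c ℓ) where
  open CommutativeRing R
  open Exp semiring using (_^_)
  open IntegerSolver R
  open SetoidReasoning setoid

  summand : (ε σ τ α m β : Carrier) → Carrier
  summand ε σ τ α m β = σ * (τ * (α * (1# + m * ε) - β * (1# - (1# + m) * ε)))

  expansion : (w ε q u v s s′ j : Carrier) → Carrier
  expansion w ε q u v s s′ j = (1# - w ^ 4) * u - q * ((w - w ^ 3) * v)
    + ε * (fromℤ (ℤ.+ 5) * (1# + w ^ 4) * s + w ^ 4 * u
           - q * (fromℤ (ℤ.+ 5) * (w + w ^ 3) * s′ + (w + fromℤ (ℤ.+ 2) * w ^ 3) * v)
           + fromℤ (ℤ.+ 5) * w ^ 2 * q ^ 3 * j)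

  expansion-cong : ∀ w ε q {u v s s′ j u₁ v₁ s₁ s′₁ j₁} → u ≈ u₁ → v ≈ v₁ → s ≈ s₁ → s′ ≈ s′₁ → j ≈ j₁ →
    expansion w ε q u v s s′ j ≈ expansion w ε q u₁ v₁ s₁ s′₁ j₁
  expansion-cong w ε q pu pv ps ps′ pj = +-cong (+-cong (*-congˡ pu) (-‿cong (*-congˡ (*-congˡ pv))))
    (*-congˡ (+-cong (+-cong (+-cong (*-congˡ ps) (*-congˡ pu)) (-‿cong (*-congˡ (+-cong (*-congˡ ps′) (*-congˡ pv))))) (*-congˡ pj)))

  expand-block : ∀ w ε q σ n a a′ b b′ c {e₀ e₁ e₂ e₃ e₄ u v s s′ j} →
    e₀ ≈ summand ε σ a (w ^ 0) (fromℤ (ℤ.+ 5) * n) (w ^ 4) →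
    e₁ ≈ summand ε (- σ) (q * b) (w ^ 1) (1# + fromℤ (ℤ.+ 5) * n) (w ^ 3) →
    e₂ ≈ summand ε (- - σ) (q ^ 3 * c) (w ^ 2) (1# + (1# + fromℤ (ℤ.+ 5) * n)) (w ^ 2) →
    e₃ ≈ summand ε (- - - σ) (q * b′) (w ^ 3) (1# + (1# + (1# + fromℤ (ℤ.+ 5) * n))) (w ^ 1) →
    e₄ ≈ summand ε (- - - - σ) a′ (w ^ 4) (1# + (1# + (1# + (1# + fromℤ (ℤ.+ 5) * n)))) (w ^ 0) →
    u ≈ σ * (a - a′) → v ≈ σ * (b - b′) → s ≈ σ * (n * a + (1# + n) * a′) → s′ ≈ σ * (n * b + (1# + n) * b′) → j ≈ σ * ((n + (1# + n)) * c) →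
    e₀ + e₁ + e₂ + e₃ + e₄ ≈ expansion w ε q u v s s′ j
  expand-block w ε q σ n a a′ b b′ c {e₀} {e₁} {e₂} {e₃} {e₄} {u} {v} {s} {s′} {j} p₀ p₁ p₂ p₃ p₄ pu pv ps ps′ pj = begin
    e₀ + e₁ + e₂ + e₃ + e₄ ≈⟨ +-cong (+-cong (+-cong (+-cong p₀ p₁) p₂) p₃) p₄ ⟩
    summand ε σ a (w ^ 0) m (w ^ 4) + summand ε (- σ) (q * b) (w ^ 1) (1# + m) (w ^ 3) + summand ε (- - σ) (q ^ 3 * c) (w ^ 2) (1# + (1# + m)) (w ^ 2)
      + summand ε (- - - σ) (q * b′) (w ^ 3) (1# + (1# + (1# + m))) (w ^ 1) + summand ε (- - - - σ) a′ (w ^ 4) (1# + (1# + (1# + (1# + m)))) (w ^ 0)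
      ≈⟨ solve 10 (λ w e q s n a a′ b b′ c →
           let m = # 5 :* n; o = # 1 in
           s :* (a :* (o :* (o :+ m :* e) :- w :^ 4 :* (o :- (o :+ m) :* e)))
           :+ :- s :* ((q :* b) :* (w :^ 1 :* (o :+ (o :+ m) :* e) :- w :^ 3 :* (o :- (o :+ (o :+ m)) :* e)))
           :+ :- :- s :* ((q :^ 3 :* c) :* (w :^ 2 :* (o :+ (o :+ (o :+ m)) :* e) :- w :^ 2 :* (o :- (o :+ (o :+ (o :+ m))) :* e)))
           :+ :- :- :- s :* ((q :* b′) :* (w :^ 3 :* (o :+ (o :+ (o :+ (o :+ m))) :* e) :- w :^ 1 :* (o :- (o :+ (o :+ (o :+ (o :+ m)))) :* e)))
           :+ :- :- :- :- s :* (a′ :* (w :^ 4 :* (o :+ (o :+ (o :+ (o :+ (o :+ m)))) :* e) :- o :* (o :- (o :+ (o :+ (o :+ (o :+ (o :+ m))))) :* e)))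
           := (o :- w :^ 4) :* (s :* (a :- a′)) :- q :* ((w :- w :^ 3) :* (s :* (b :- b′)))
              :+ e :* (# 5 :* (o :+ w :^ 4) :* (s :* (n :* a :+ (o :+ n) :* a′)) :+ w :^ 4 :* (s :* (a :- a′))
                 :- q :* (# 5 :* (w :+ w :^ 3) :* (s :* (n :* b :+ (o :+ n) :* b′)) :+ (w :+ # 2 :* w :^ 3) :* (s :* (b :- b′)))
                 :+ # 5 :* w :^ 2 :* q :^ 3 :* (s :* ((n :+ (o :+ n)) :* c))))
         w ε q σ n a a′ b b′ c ⟩
    expansion w ε q (σ * (a - a′)) (σ * (b - b′)) (σ * (n * a + (1# + n) * a′)) (σ * (n * b + (1# + n) * b′)) (σ * ((n + (1# + n)) * c))
      ≈⟨ sym (expansion-cong w ε q pu pv ps ps′ pj) ⟩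
    expansion w ε q u v s s′ j ∎
    where
    m : Carrier
    m = fromℤ (ℤ.+ 5) * n

module ThetaSeries {c ℓ} (K : CommutativeRing c ℓ) where
  open SeriesLimits K public
  open Dissection K public
  open IntegerSolver seriesRing using (fromℤ) public
  open IntegerSolver seriesRing hiding (fromℤ)
  open ThetaExpansion seriesRing using (expansion; expand-block; summand)
  open SetoidReasoning setoid
  open Exp semiring using (^-homo-*; ^-assocʳ; ^-congˡ; ^-congʳ) public
  open Exponents
  open FirstOrderPowers seriesRing using (ν; first-order) public
  module φ = RingHom φHom

  IsInverse : Series → Series → Set ℓ
  IsInverse f g = f * g ≋ 1#

  q^-order : ∀ {k n} → k ≤ n → q ^ n ≈[ k ] 0#
  q^-order {n = n} k≤n = ≈-weaken k≤n (order-^ order-q n)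

  q^-≡ : ∀ {m n} → m ≡ n → q ^ m ≋ q ^ n
  q^-≡ e = reflexive (≡.cong (q ^_) e)

  φ-q^ : ∀ n → φ (q ^ n) ≋ q ^ (n ℕ.* 5)
  φ-q^ n = trans (φ.^-hom q n) (trans (^-congˡ n φ-q) (trans (^-assocʳ q 5 n) (q^-≡ (ℕP.*-comm 5 n))))

  euler : ℕ → Series
  euler r = lim (∏ (λ k → 1# - q ^ (r ℕ.+ k ℕ.* 5)))

  euler-⟶ : ∀ r → ∏ (λ k → 1# - q ^ (r ℕ.+ k ℕ.* 5)) ⟶ euler r
  euler-⟶ r = ∏-⟶ _ (λ k → q^-order (ℕP.≤-trans (ℕP.m≤m*n k 5) (ℕP.m≤n+m _ r)))

  E₁ : Series
  E₁ = lim (∏ (λ k → 1# - q ^ suc k))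

  E₁-⟶ : ∏ (λ k → 1# - q ^ suc k) ⟶ E₁
  E₁-⟶ = ∏-⟶ _ (λ k → q^-order (ℕP.n≤1+n k))

  A B E₅ : Series
  A = euler 1 * euler 4
  B = euler 2 * euler 3
  E₅ = euler 5

  5-fold : ∀ N → N ≤ N ℕ.* 5
  5-fold N = ℕP.m≤m*n N 5

  E₁≋ABE₅ : E₁ ≋ A * B * E₅
  E₁≋ABE₅ = ⟶-unique (⟶-sub (ℕ._* 5) 5-fold E₁-⟶) (⟶-cong regroup
      (⟶-* (⟶-* (⟶-* (euler-⟶ 1) (euler-⟶ 4)) (⟶-* (euler-⟶ 2) (euler-⟶ 3))) (euler-⟶ 5)))
    where
    f : ℕ → ℕ → Series
    f r k = 1# - q ^ (r ℕ.+ k ℕ.* 5)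
    regroup : ∀ N → ((∏ (f 1) N * ∏ (f 4) N) * (∏ (f 2) N * ∏ (f 3) N)) * ∏ (f 5) N ≋ ∏ (λ k → 1# - q ^ suc k) (N ℕ.* 5)
    regroup N = sym (begin
      ∏ (λ k → 1# - q ^ suc k) (N ℕ.* 5)                                                      ≈⟨ ∏-blocks _ N ⟩
      ∏ (λ k → (((f 1 k * f 2 k) * f 3 k) * f 4 k) * f 5 k) N                                ≈⟨ ∏-* _ (f 5) N ⟩
      ∏ (λ k → ((f 1 k * f 2 k) * f 3 k) * f 4 k) N * ∏ (f 5) N                              ≈⟨ *-congʳ (∏-* _ (f 4) N) ⟩
      ∏ (λ k → (f 1 k * f 2 k) * f 3 k) N * ∏ (f 4) N * ∏ (f 5) N                            ≈⟨ *-congʳ (*-congʳ (∏-* _ (f 3) N)) ⟩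
      ∏ (λ k → f 1 k * f 2 k) N * ∏ (f 3) N * ∏ (f 4) N * ∏ (f 5) N                          ≈⟨ *-congʳ (*-congʳ (*-congʳ (∏-* _ (f 2) N))) ⟩
      ∏ (f 1) N * ∏ (f 2) N * ∏ (f 3) N * ∏ (f 4) N * ∏ (f 5) N
        ≈⟨ solve 5 (λ a b c d e → a :* b :* c :* d :* e := ((a :* d) :* (b :* c)) :* e) _ _ _ _ _ ⟩
      ((∏ (f 1) N * ∏ (f 4) N) * (∏ (f 2) N * ∏ (f 3) N)) * ∏ (f 5) N                        ∎)

  φ-factor : ∀ n → φ (1# - q ^ n) ≋ 1# - q ^ (n ℕ.* 5)
  φ-factor n = trans (φ.sub-hom _ _) (+-cong φ.1-hom (-‿cong (φ-q^ n)))

  φE₁≋E₅ : φ E₁ ≋ E₅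
  φE₁≋E₅ = ⟶-unique (φ-⟶ E₁-⟶) (⟶-cong (λ N → sym (trans (φ.∏-hom _ N) (∏-cong N (λ k → φ-factor (suc k))))) (euler-⟶ 5))

  sgn : ℕ → Series
  sgn zero    = 1#
  sgn (suc k) = - sgn k

  sgn-5 : ∀ i → sgn (i ℕ.* 5) ≋ sgn i
  sgn-5 zero    = refl
  sgn-5 (suc i) = trans (solve 1 (λ s → :- :- :- :- :- s := :- s) _) (-‿cong (sgn-5 i))

  ν-5 : ∀ i → ν (i ℕ.* 5) ≋ fromℤ (ℤ.+ 5) * ν i
  ν-5 zero    = solve 0 (# 0 := # 5 :* # 0)
  ν-5 (suc i) = trans (+-congˡ (+-congˡ (+-congˡ (+-congˡ (+-congˡ (ν-5 i))))))
    (solve 1 (λ n → # 1 :+ (# 1 :+ (# 1 :+ (# 1 :+ (# 1 :+ # 5 :* n)))) := # 5 :* (# 1 :+ n)) _)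

  unit-power : ∀ {w} → w ^ 5 ≋ 1# → ∀ r i → w ^ (r ℕ.+ i ℕ.* 5) ≋ w ^ r
  unit-power {w} w⁵ r i = trans (^-homo-* w r (i ℕ.* 5)) (trans (*-congˡ (go i)) (*-identityʳ _))
    where
    go : ∀ i → w ^ (i ℕ.* 5) ≋ 1#
    go zero    = refl
    go (suc i) = trans (^-homo-* w 5 (i ℕ.* 5)) (trans (*-cong w⁵ (go i)) (*-identityˡ _))

  Uᵢ Vᵢ Sᵢ S′ᵢ Jᵢ : ℕ → Series
  Uᵢ i  = sgn i * (q ^ u i - q ^ u′ i)
  Vᵢ i  = sgn i * (q ^ v i - q ^ v′ i)
  Sᵢ i  = sgn i * (ν i * q ^ u i + ν (suc i) * q ^ u′ i)
  S′ᵢ i = sgn i * (ν i * q ^ v i + ν (suc i) * q ^ v′ i)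
  Jᵢ i  = sgn i * ((ν i + ν (suc i)) * q ^ t i)

  S S′ J : Series
  S  = lim (∑ Sᵢ)
  S′ = lim (∑ S′ᵢ)
  J  = lim (∑ Jᵢ)

  private
    ord₂ : ∀ s a b {k m n} → k ≤ m → k ≤ n → s * (a * q ^ m + b * q ^ n) ≈[ k ] 0#
    ord₂ s a b k≤m k≤n = order-*ˡ s (≈-trans (≈-+ (order-*ˡ a (q^-order k≤m)) (order-*ˡ b (q^-order k≤n))) (≋⇒≈ (+-identityˡ 0#)))

  S-⟶ : ∑ Sᵢ ⟶ S
  S-⟶ = ∑-⟶ Sᵢ λ k → ord₂ _ _ _ (k≤u k) (k≤u′ k)
  S′-⟶ : ∑ S′ᵢ ⟶ S′
  S′-⟶ = ∑-⟶ S′ᵢ λ k → ord₂ _ _ _ (k≤v k) (k≤v′ k)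
  J-⟶ : ∑ Jᵢ ⟶ J
  J-⟶ = ∑-⟶ Jᵢ λ k → order-*ˡ _ (order-*ˡ _ (q^-order (k≤t k)))

  private
    module Quintic (a b : ℕ) (ab : a ℕ.+ b ≡ 5) (a₁ : 1 ≤ a) where
      x y p : Series
      x = q ^ a
      y = q ^ b
      p = q ^ 5
      xy≈p : x * y ≋ p
      xy≈p = trans (sym (^-homo-* q a b)) (q^-≡ ab)
      open JacobiTripleProduct p x y xy≈p (q^-order a₁) hiding (sgn) public

      p^ : ∀ k → p ^ k ≋ q ^ (k ℕ.* 5)
      p^ k = trans (^-assocʳ q 5 k) (q^-≡ (ℕP.*-comm 5 k))

      factor : ∀ c k → 1# - q ^ c * p ^ k ≋ 1# - q ^ (c ℕ.+ k ℕ.* 5)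
      factor c k = +-congˡ (-‿cong (trans (*-congˡ (p^ k)) (sym (^-homo-* q c (k ℕ.* 5)))))

      sum-⟶ : ∑ E ⟶ E₅ * (euler a * euler b)
      sum-⟶ = jacobi
        (⟶-cong (λ N → ∏-cong N (λ k → +-congˡ (-‿cong (sym (p^ (suc k)))))) (euler-⟶ 5))
        (⟶-cong (λ N → ∏-cong N (λ k → sym (factor a k))) (euler-⟶ a))
        (⟶-cong (λ N → ∏-cong (suc N) (λ k → sym (factor b k))) (⟶-sub suc ℕP.n≤1+n (euler-⟶ b)))

      X-q : (f : ℕ → ℕ) → f 0 ≡ 0 → (∀ k → f (suc k) ≡ f k ℕ.+ (a ℕ.+ k ℕ.* 5)) → ∀ k → X k ≋ q ^ f k
      X-q f f₀ f₁ zero    = q^-≡ (≡.sym f₀)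
      X-q f f₀ f₁ (suc k) = trans (*-cong (X-q f f₀ f₁ k) (trans (*-congˡ (p^ k)) (sym (^-homo-* q a (k ℕ.* 5)))))
        (trans (sym (^-homo-* q (f k) _)) (q^-≡ (≡.sym (f₁ k))))

      Y-q : (f : ℕ → ℕ) → f 0 ≡ b → (∀ k → f (suc k) ≡ f k ℕ.+ (b ℕ.+ suc k ℕ.* 5)) → ∀ k → Y (suc k) ≋ q ^ f k
      Y-q f f₀ f₁ zero    = trans (solve 1 (λ y → # 1 :* (y :* # 1) := y) _) (q^-≡ (≡.sym f₀))
      Y-q f f₀ f₁ (suc k) = trans (*-cong (Y-q f f₀ f₁ k) (trans (*-congˡ (p^ (suc k))) (sym (^-homo-* q b (suc k ℕ.* 5)))))
        (trans (sym (^-homo-* q (f k) _)) (q^-≡ (≡.sym (f₁ k))))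

    sgn≋ : ∀ {p x y} (xy : x * y ≋ p) k → FiniteJacobi.sgn seriesRing p x y xy k ≋ sgn k
    sgn≋ xy zero    = refl
    sgn≋ xy (suc k) = -‿cong (sgn≋ xy k)

  U-⟶ : ∑ Uᵢ ⟶ B * E₅
  U-⟶ = ⟶-cong (λ N → ∑-cong N λ k → *-cong (sgn≋ xy≈p k)
                  (+-cong (X-q u ≡.refl (λ _ → ≡.refl) k) (-‿cong (Y-q u′ ≡.refl (λ _ → ≡.refl) k))))
          (tends λ N → ≈-trans (approx sum-⟶ N) (≋⇒≈ (solve 3 (λ e a b → e :* (a :* b) := b :* a :* e) _ _ _)))
    where open Quintic 3 2 ≡.refl (s≤s z≤n)

  V-⟶ : ∑ Vᵢ ⟶ A * E₅
  V-⟶ = ⟶-cong (λ N → ∑-cong N λ k → *-cong (sgn≋ xy≈p k)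
                  (+-cong (X-q v ≡.refl (λ _ → ≡.refl) k) (-‿cong (Y-q v′ ≡.refl (λ _ → ≡.refl) k))))
          (tends λ N → ≈-trans (approx sum-⟶ N) (≋⇒≈ (solve 3 (λ e a b → e :* (a :* b) := b :* a :* e) _ _ _)))
    where open Quintic 4 1 ≡.refl (s≤s z≤n)

  φ-sgn : ∀ i → φ (sgn i) ≋ sgn i
  φ-sgn zero    = φ.1-hom
  φ-sgn (suc i) = trans (φ.neg-hom _) (-‿cong (φ-sgn i))

  φ-ν : ∀ i → φ (ν i) ≋ ν i
  φ-ν zero    = φ.0-hom
  φ-ν (suc i) = trans (φ.+-hom _ _) (+-cong φ.1-hom (φ-ν i))

  private
    φ-diff : ∀ i m n → φ (sgn i * (q ^ m - q ^ n)) ≋ sgn i * (φ (q ^ m) - φ (q ^ n))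
    φ-diff i m n = trans (φ.*-hom _ _) (*-cong (φ-sgn i) (φ.sub-hom _ _))

    φ-weighted : ∀ i m n → φ (sgn i * (ν i * q ^ m + ν (suc i) * q ^ n)) ≋ sgn i * (ν i * φ (q ^ m) + ν (suc i) * φ (q ^ n))
    φ-weighted i m n = trans (φ.*-hom _ _) (*-cong (φ-sgn i) (trans (φ.+-hom _ _)
      (+-cong (trans (φ.*-hom _ _) (*-congʳ (φ-ν i))) (trans (φ.*-hom _ _) (*-congʳ (φ-ν (suc i)))))))

    φ-J : ∀ i f → φ (sgn i * ((ν i + ν (suc i)) * f)) ≋ sgn i * ((ν i + ν (suc i)) * φ f)
    φ-J i f = trans (φ.*-hom _ _) (*-cong (φ-sgn i) (trans (φ.*-hom _ _) (*-congʳ (trans (φ.+-hom _ _) (+-cong (φ-ν i) (φ-ν (suc i)))))))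

    φφ-J : ∀ i → φ (φ (Jᵢ i)) ≋ sgn i * ((ν i + ν (suc i)) * φ (φ (q ^ t i)))
    φφ-J i = trans (φ.⟦⟧-cong (φ-J i (q ^ t i))) (φ-J i (φ (q ^ t i)))

  Θ : Series → Series
  Θ x = lim (∏ (λ k → 1# - x * q ^ suc k))

  Θ-⟶ : ∀ x → ∏ (λ k → 1# - x * q ^ suc k) ⟶ Θ x
  Θ-⟶ x = ∏-⟶ _ (λ k → order-*ˡ x (q^-order (ℕP.n≤1+n k)))

  -- The theta function at Z = w(1+ε) for a fifth root of unity w, to first order in ε.
  module FirstOrder (w ε : Series) (w⁵ : w ^ 5 ≋ 1#) (ε² : ε * ε ≋ 0#) where
    Z Z′ : Series
    Z  = w * (1# + ε)
    Z′ = w ^ 4 * (1# - ε)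

    private
      ε-unit : (1# + ε) * (1# - ε) ≋ 1#
      ε-unit = trans (solve 1 (λ e → (# 1 :+ e) :* (# 1 :- e) := # 1 :- e :* e) ε)
        (trans (+-congˡ (-‿cong ε²)) (solve 0 (# 1 :- # 0 := # 1)))

      ZZ′ : Z * Z′ ≋ 1#
      ZZ′ = trans (solve 4 (λ w W e f → (w :* e) :* (W :* f) := (w :* W) :* (e :* f)) w (w ^ 4) _ _)
        (trans (*-cong w⁵ ε-unit) (*-identityˡ _))

      xy≈q : (Z * q) * Z′ ≋ q
      xy≈q = trans (solve 3 (λ a b q → (a :* q) :* b := (a :* b) :* q) Z Z′ q) (trans (*-congʳ ZZ′) (*-identityˡ _))

    open JacobiTripleProduct q (Z * q) Z′ xy≈q (order-*ˡ Z order-q) using (X; Y; E; jacobi) public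

    theta : Series
    theta = E₁ * (Θ Z * ((1# - Z′) * Θ Z′))

    E-⟶ : ∑ E ⟶ theta
    E-⟶ = jacobi E₁-⟶
      (⟶-cong (λ N → ∏-cong N λ k → +-congˡ (-‿cong (sym (*-assoc Z q (q ^ k))))) (Θ-⟶ Z))
      (⟶-cong (λ N → trans (*-congʳ (+-congˡ (-‿cong (sym (*-identityʳ Z′))))) (sym (∏-suc _ N)))
        (⟶-* (⟶-const (1# - Z′)) (Θ-⟶ Z′)))

    private
      X-form : ∀ k → X k ≋ q ^ t k * Z ^ k
      X-form zero    = sym (*-identityˡ _)
      X-form (suc k) = trans (*-congʳ (X-form k))
        (trans (solve 5 (λ T P z q Q → T :* P :* (z :* q :* Q) := T :* (q :* Q) :* (z :* P)) _ _ _ _ _)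
          (*-congʳ (sym (^-homo-* q (t k) (suc k)))))

      Y-form : ∀ k → Y (suc k) ≋ q ^ t k * Z′ ^ suc k
      Y-form zero    = solve 1 (λ z → # 1 :* (z :* # 1) := # 1 :* (z :* # 1)) _
      Y-form (suc k) = trans (*-congʳ (Y-form k))
        (trans (solve 4 (λ T P z Q → T :* P :* (z :* Q) := T :* Q :* (z :* P)) _ _ _ _)
          (*-congʳ (sym (^-homo-* q (t k) (suc k)))))

    E-form : ∀ k → E k ≋ sgn k * (q ^ t k * (w ^ k * (1# + ν k * ε) - (w ^ 4) ^ suc k * (1# - ν (suc k) * ε)))
    E-form k = *-cong (sgn≋ xy≈q k) (trans (+-cong (trans (X-form k) (*-congˡ (first-order w ε ε² k)))
            (-‿cong (trans (Y-form k) (*-congˡ (trans (first-order (w ^ 4) (- ε) (trans (solve 1 (λ e → :- e :* :- e := e :* e) ε) ε²) (suc k))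
              (*-congˡ (+-congˡ (solve 2 (λ n e → n :* :- e := :- (n :* e)) _ _))))))))
            (solve 3 (λ T a b → T :* a :- T :* b := T :* (a :- b)) _ _ _))

    private
      flips adds : ℕ → Series → Series
      flips zero    s = s
      flips (suc r) s = - flips r s
      adds zero    n = n
      adds (suc r) n = 1# + adds r n

      flips-sgn : ∀ r i → sgn (r ℕ.+ i ℕ.* 5) ≋ flips r (sgn i)
      flips-sgn zero    i = sgn-5 i
      flips-sgn (suc r) i = -‿cong (flips-sgn r i)

      adds-ν : ∀ r i → ν (r ℕ.+ i ℕ.* 5) ≋ adds r (fromℤ (ℤ.+ 5) * ν i)
      adds-ν zero    i = ν-5 i
      adds-ν (suc r) i = +-congˡ (adds-ν r i)

      w′⁵ : (w ^ 4) ^ 5 ≋ 1#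
      w′⁵ = trans (^-assocʳ w 4 5) (unit-power w⁵ 0 4)

      E-at : ∀ r i {τ w′} → q ^ t (r ℕ.+ i ℕ.* 5) ≋ τ → (w ^ 4) ^ suc r ≋ w′ →
        E (r ℕ.+ i ℕ.* 5) ≋ summand ε (flips r (sgn i)) τ (w ^ r) (adds r (fromℤ (ℤ.+ 5) * ν i)) w′
      E-at r i pτ pw′ = trans (E-form (r ℕ.+ i ℕ.* 5)) (*-cong (flips-sgn r i) (*-cong pτ
        (+-cong (*-cong (unit-power w⁵ r i) (+-congˡ (*-congʳ (adds-ν r i))))
          (-‿cong (*-cong (trans (unit-power w′⁵ (suc r) i) pw′) (+-congˡ (-‿cong (*-congʳ (adds-ν (suc r) i)))))))))

      w′^ : ∀ r {k} i → k ≡ r ℕ.+ i ℕ.* 5 → w ^ k ≋ w ^ r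
      w′^ r i ≡.refl = unit-power w⁵ r i

    E-block : ∀ i → ∑-block E i ≋ expansion w ε q (φ (Uᵢ i)) (φ (Vᵢ i)) (φ (Sᵢ i)) (φ (S′ᵢ i)) (φ (φ (Jᵢ i)))
    E-block i = expand-block w ε q (sgn i) (ν i) (φ (q ^ u i)) (φ (q ^ u′ i)) (φ (q ^ v i)) (φ (q ^ v′ i)) (φ (φ (q ^ t i)))
      (E-at 0 i (trans (q^-≡ (t₀ i)) (sym (φ-q^ (u i)))) (trans (^-assocʳ w 4 1) (w′^ 4 0 ≡.refl)))
      (E-at 1 i (trans (q^-≡ (t₁ i)) (*-congˡ (sym (φ-q^ (v i))))) (trans (^-assocʳ w 4 2) (w′^ 3 1 ≡.refl)))
      (E-at 2 i (trans (q^-≡ (t₂ i)) (trans (^-homo-* q 3 (t i ℕ.* 5 ℕ.* 5)) (*-congˡ (sym (trans (φ.⟦⟧-cong (φ-q^ (t i))) (φ-q^ (t i ℕ.* 5)))))))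
        (trans (^-assocʳ w 4 3) (w′^ 2 2 ≡.refl)))
      (E-at 3 i (trans (q^-≡ (t₃ i)) (*-congˡ (sym (φ-q^ (v′ i))))) (trans (^-assocʳ w 4 4) (w′^ 1 3 ≡.refl)))
      (E-at 4 i (trans (q^-≡ (t₄ i)) (sym (φ-q^ (u′ i)))) (trans (^-assocʳ w 4 5) (w′^ 0 4 ≡.refl)))
      (φ-diff i (u i) (u′ i)) (φ-diff i (v i) (v′ i)) (φ-weighted i (u i) (u′ i)) (φ-weighted i (v i) (v′ i)) (φφ-J i)

    theta-dissection : theta ≋ expansion w ε q (φ (B * E₅)) (φ (A * E₅)) (φ S) (φ S′) (φ (φ J))
    theta-dissection = ⟶-unique (⟶-sub (ℕ._* 5) 5-fold E-⟶) (⟶-cong (λ N → sym (blocks N))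
      (⟶-+ (⟶-+ (c* U⟶) (⟶-neg (c* (c* V⟶))))
        (c* (⟶-+ (⟶-+ (⟶-+ (c* (φ-⟶ S-⟶)) (c* U⟶)) (⟶-neg (c* (⟶-+ (c* (φ-⟶ S′-⟶)) (c* V⟶)))))
                 (c* (φ-⟶ (φ-⟶ J-⟶)))))))
      where
      U⟶ : (λ N → φ (∑ Uᵢ N)) ⟶ φ (B * E₅)
      U⟶ = φ-⟶ U-⟶
      V⟶ : (λ N → φ (∑ Vᵢ N)) ⟶ φ (A * E₅)
      V⟶ = φ-⟶ V-⟶
      c* : ∀ {a s f} → s ⟶ f → (λ N → a * s N) ⟶ (a * f)
      c* = ⟶-* (⟶-const _)

      pull : ∀ a f N → ∑ (λ i → a * φ (f i)) N ≋ a * φ (∑ f N)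
      pull a f N = trans (sym (*-∑ a _ N)) (*-congˡ (sym (φ.∑-hom f N)))

      pull₂ : ∀ a b f g N → ∑ (λ i → a * φ (f i) + b * φ (g i)) N ≋ a * φ (∑ f N) + b * φ (∑ g N)
      pull₂ a b f g N = trans (∑-+ _ _ N) (+-cong (pull a f N) (pull b g N))

      minus : ∀ f g N → ∑ (λ i → f i - g i) N ≋ ∑ f N - ∑ g N
      minus f g N = trans (∑-+ f _ N) (+-congˡ (neg-∑ g N))
        where
        neg-∑ : ∀ g N → ∑ (λ i → - g i) N ≋ - ∑ g N
        neg-∑ g zero    = solve 0 (# 0 := :- # 0)
        neg-∑ g (suc N) = trans (+-congʳ (neg-∑ g N)) (solve 2 (λ a b → :- a :- b := :- (a :+ b)) _ _)

      blocks : ∀ N → ∑ E (N ℕ.* 5) ≋ expansion w ε q (φ (∑ Uᵢ N)) (φ (∑ Vᵢ N)) (φ (∑ Sᵢ N)) (φ (∑ S′ᵢ N)) (φ (φ (∑ Jᵢ N)))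
      blocks N = trans (∑-blocks E N) (trans (∑-cong N E-block) (trans (∑-+ _ _ N) (+-cong
        (trans (minus _ _ N) (+-cong (pull _ Uᵢ N) (-‿cong (trans (sym (*-∑ q _ N)) (*-congˡ (pull _ Vᵢ N))))))
        (trans (sym (*-∑ ε _ N)) (*-congˡ (trans (∑-+ _ _ N) (+-cong
          (trans (minus _ _ N) (+-cong (pull₂ _ _ Sᵢ Uᵢ N) (-‿cong (trans (sym (*-∑ q _ N)) (*-congˡ (pull₂ _ _ S′ᵢ Vᵢ N))))))
          (trans (pull _ (λ i → φ (Jᵢ i)) N) (*-congˡ (φ.⟦⟧-cong (sym (φ.∑-hom Jᵢ N))))))))))))

  module _ (ε : Series) (ε² : ε * ε ≋ 0#) where
    private
      open FirstOrder 1# ε (solve 0 (# 1 :^ 5 := # 1)) ε²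

      Z≋ : Z ≋ 1# + ε
      Z≋ = *-identityˡ _
      Z′≋ : Z′ ≋ 1# - ε
      Z′≋ = solve 1 (λ e → # 1 :^ 4 :* (# 1 :- e) := # 1 :- e) ε

      εΘ : ∀ x δ → x ≋ 1# + δ → ε * δ ≋ 0# → ε * Θ x ≋ ε * E₁
      εΘ x δ x≋ εδ = ⟶-unique (⟶-* (⟶-const ε) (Θ-⟶ x)) (⟶-cong (λ N → sym (go N)) (⟶-* (⟶-const ε) E₁-⟶))
        where
        go : ∀ N → ε * ∏ (λ k → 1# - x * q ^ suc k) N ≋ ε * ∏ (λ k → 1# - q ^ suc k) N
        go zero    = refl
        go (suc N) = begin
          ε * (∏ (λ k → 1# - x * q ^ suc k) N * (1# - x * q ^ suc N))
            ≈⟨ *-congˡ (*-congˡ (+-congˡ (-‿cong (*-congʳ x≋)))) ⟩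
          ε * (∏ (λ k → 1# - x * q ^ suc k) N * (1# - (1# + δ) * q ^ suc N))
            ≈⟨ solve 4 (λ e P d Q → e :* (P :* (# 1 :- (# 1 :+ d) :* Q)) := (e :* P) :* (# 1 :- Q) :- (e :* d) :* (P :* Q)) _ _ _ _ ⟩
          (ε * ∏ (λ k → 1# - x * q ^ suc k) N) * (1# - q ^ suc N) - (ε * δ) * (∏ (λ k → 1# - x * q ^ suc k) N * q ^ suc N)
            ≈⟨ +-cong (*-congʳ (go N)) (-‿cong (trans (*-congʳ εδ) (zeroˡ _))) ⟩
          (ε * ∏ (λ k → 1# - q ^ suc k) N) * (1# - q ^ suc N) - 0#
            ≈⟨ solve 3 (λ e P Q → (e :* P) :* Q :- # 0 := e :* (P :* Q)) _ _ _ ⟩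
          ε * (∏ (λ k → 1# - q ^ suc k) N * (1# - q ^ suc N)) ∎

      theta≋ : theta ≋ ε * E₁ ^ 3
      theta≋ = begin
        E₁ * (Θ Z * ((1# - Z′) * Θ Z′))
          ≈⟨ *-congˡ (*-congˡ (*-congʳ (trans (+-congˡ (-‿cong Z′≋)) (solve 1 (λ e → # 1 :- (# 1 :- e) := e) ε)))) ⟩
        E₁ * (Θ Z * (ε * Θ Z′))
          ≈⟨ *-congˡ (*-congˡ (εΘ Z′ (- ε) Z′≋ (trans (solve 1 (λ e → e :* :- e := :- (e :* e)) ε) (trans (-‿cong ε²) (solve 0 (:- # 0 := # 0)))))) ⟩
        E₁ * (Θ Z * (ε * E₁))
          ≈⟨ solve 3 (λ a b e → a :* (b :* (e :* a)) := a :* a :* (e :* b)) _ _ _ ⟩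
        E₁ * E₁ * (ε * Θ Z) ≈⟨ *-congˡ (εΘ Z ε Z≋ ε²) ⟩
        E₁ * E₁ * (ε * E₁)  ≈⟨ solve 2 (λ a e → a :* a :* (e :* a) := e :* a :^ 3) _ _ ⟩
        ε * E₁ ^ 3 ∎

      1^ : ∀ k → 1# ^ k ≋ 1#
      1^ zero    = refl
      1^ (suc k) = trans (*-identityˡ _) (1^ k)

      E≋ : ∀ k → E k ≋ ε * Jᵢ k
      E≋ k = trans (E-form k) (trans (*-congˡ (*-congˡ (+-cong (*-congʳ (1^ k)) (-‿cong (*-congʳ (one-power (suc k)))))))
        (solve 4 (λ s Q n e → s :* (Q :* (# 1 :* (# 1 :+ n :* e) :- # 1 :* (# 1 :- (# 1 :+ n) :* e)))
                  := e :* (s :* ((n :+ (# 1 :+ n)) :* Q))) _ _ _ _))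
        where
        one-power : ∀ k → (1# ^ 4) ^ k ≋ 1#
        one-power k = trans (^-congˡ k (1^ 4)) (1^ k)

    εJ : ε * J ≋ ε * E₁ ^ 3
    εJ = trans (⟶-unique (⟶-* (⟶-const ε) J-⟶) (⟶-cong (λ N → trans (∑-cong N E≋) (sym (*-∑ ε Jᵢ N))) E-⟶)) theta≋

    ε-jacobi : ε * E₁ ^ 3 ≋ expansion 1# ε q (φ (B * E₅)) (φ (A * E₅)) (φ S) (φ S′) (φ (φ J))
    ε-jacobi = trans (sym theta≋) theta-dissection

module Scalars {r ℓ} (R : CommutativeRing r ℓ) where
  open CommutativeRing R
  open Exp semiring using (_^_)
  open SetoidReasoning setoid

  IsFifthRoot IsHalf IsFifth : Carrier → Set ℓ
  IsFifthRoot z = 1# + z + z ^ 2 + z ^ 3 + z ^ 4 ≈ 0#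
  IsHalf a      = (1# + 1#) * a ≈ 1#
  IsFifth a     = (1# + 1# + 1# + 1# + 1#) * a ≈ 1#

  cancel : ∀ {a b} k k⁻¹ → k * k⁻¹ ≈ 1# → a * k ≈ b * k → a ≈ b
  cancel {a} {b} k k⁻¹ kk ab = begin
    a              ≈⟨ sym (*-identityʳ a) ⟩
    a * 1#         ≈⟨ *-congˡ (sym kk) ⟩
    a * (k * k⁻¹)  ≈⟨ sym (*-assoc a k k⁻¹) ⟩
    a * k * k⁻¹    ≈⟨ *-congʳ ab ⟩
    b * k * k⁻¹    ≈⟨ *-assoc b k k⁻¹ ⟩
    b * (k * k⁻¹)  ≈⟨ *-congˡ kk ⟩
    b * 1#         ≈⟨ *-identityʳ b ⟩
    b              ∎

-- Each consequence of 1 + z + z² + z³ + z⁴ = 0 is certified by its cofactor of that relation.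
module RootOfUnity {r ℓ} (R : CommutativeRing r ℓ) (z : CommutativeRing.Carrier R) (Φ₀ : Scalars.IsFifthRoot R z) where
  open CommutativeRing R
  open Exp semiring using (_^_)
  open IntegerSolver R

  ⌜_⌝ : ℕ → Carrier
  ⌜ n ⌝ = fromℤ (ℤ.+ n)

  private
    Φᵖ cᵖ c′ᵖ s₁ᵖ s₂ᵖ ℓ₃ᵖ ℓ₂ᵖ ℓ₁ᵖ ℓ₀ᵖ ℓ₋₁ᵖ ℓ₋₂ᵖ : ∀ {n} → Expr ℤ n → Expr ℤ n
    Φᵖ z   = # 1 :+ z :+ z :^ 2 :+ z :^ 3 :+ z :^ 4
    cᵖ z   = # 1 :+ z :+ z :^ 4
    c′ᵖ z  = # 1 :+ z :^ 2 :+ z :^ 3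
    s₁ᵖ z  = z :- z :^ 4
    s₂ᵖ z  = z :^ 2 :- z :^ 3
    ℓ₃ᵖ z  = :- (# 3 :* s₁ᵖ z :+ s₂ᵖ z)
    ℓ₂ᵖ z  = :- (# 10 :* s₁ᵖ z)
    ℓ₁ᵖ z  = :- (# 10 :* (s₁ᵖ z :+ s₂ᵖ z))
    ℓ₀ᵖ z  = # 10 :* (s₂ᵖ z :- s₁ᵖ z)
    ℓ₋₁ᵖ z = :- (# 10 :* s₂ᵖ z)
    ℓ₋₂ᵖ z = # 3 :* s₂ᵖ z :- s₁ᵖ z

  c c′ s₁ s₂ ℓ₃ ℓ₂ ℓ₁ ℓ₀ ℓ₋₁ ℓ₋₂ : Carrier
  c   = 1# + z + z ^ 4
  c′  = 1# + z ^ 2 + z ^ 3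
  s₁  = z - z ^ 4
  s₂  = z ^ 2 - z ^ 3
  ℓ₃  = - (⌜ 3 ⌝ * s₁ + s₂)
  ℓ₂  = - (⌜ 10 ⌝ * s₁)
  ℓ₁  = - (⌜ 10 ⌝ * (s₁ + s₂))
  ℓ₀  = ⌜ 10 ⌝ * (s₂ - s₁)
  ℓ₋₁ = - (⌜ 10 ⌝ * s₂)
  ℓ₋₂ = ⌜ 3 ⌝ * s₂ - s₁

  modΦ : ∀ {a b k} → a ≈ b + (1# + z + z ^ 2 + z ^ 3 + z ^ 4) * k → a ≈ b
  modΦ p = trans p (trans (+-congˡ (trans (*-congʳ Φ₀) (zeroˡ _))) (+-identityʳ _))

  z⁵ : z ^ 5 ≈ 1#
  z⁵ = modΦ (solve 1 (λ z → z :^ 5 := # 1 :+ Φᵖ z :* (z :- # 1)) z)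

  ∏roots : ∀ X Y → (X - Y) * (X - z * Y) * (X - z ^ 2 * Y) * (X - z ^ 3 * Y) * (X - z ^ 4 * Y) ≈ X ^ 5 - Y ^ 5
  ∏roots X Y = modΦ (solve 3 (λ z X Y →
    (X :- Y) :* (X :- z :* Y) :* (X :- z :^ 2 :* Y) :* (X :- z :^ 3 :* Y) :* (X :- z :^ 4 :* Y) :=
    X :^ 5 :- Y :^ 5 :+ Φᵖ z :* (:- (X :^ 4 :* Y) :+ z :* (# 1 :+ z :^ 2) :* X :^ 3 :* Y :^ 2
      :- z :^ 3 :* (# 1 :+ z :^ 2) :* X :^ 2 :* Y :^ 3 :+ z :^ 6 :* X :* Y :^ 4 :- (z :- # 1) :* (z :^ 5 :+ # 1) :* Y :^ 5)) z X Y)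

  Φ-square : 1# + z ^ 2 + (z ^ 2) ^ 2 + (z ^ 2) ^ 3 + (z ^ 2) ^ 4 ≈ 0#
  Φ-square = modΦ (solve 1 (λ z → # 1 :+ z :^ 2 :+ (z :^ 2) :^ 2 :+ (z :^ 2) :^ 3 :+ (z :^ 2) :^ 4
    := # 0 :+ Φᵖ z :* (# 1 :- z :+ z :^ 2 :- z :^ 3 :+ z :^ 4)) z)

  five : (1# - z ^ 4) * ((1# - z) * (1# - z ^ 2) * (1# - z ^ 3)) ≈ ⌜ 5 ⌝
  five = modΦ (solve 1 (λ z → (# 1 :- z :^ 4) :* ((# 1 :- z) :* (# 1 :- z :^ 2) :* (# 1 :- z :^ 3))
    := # 5 :+ Φᵖ z :* (:- # 4 :+ z :* (# 3 :+ z :* (# 0 :+ z :* (# 1 :+ z :* (# 0 :+ z :* (:- # 2 :+ z :* # 1))))))) z)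

  z-z³ : (1# - z ^ 4) * c ≈ z - z ^ 3
  z-z³ = modΦ (solve 1 (λ z → (# 1 :- z :^ 4) :* cᵖ z := z :- z :^ 3 :+ Φᵖ z :* ((# 1 :- z) :* (# 1 :+ z :^ 3))) z)

  c+c′ : c + c′ ≈ 1#
  c+c′ = modΦ (solve 1 (λ z → cᵖ z :+ c′ᵖ z := # 1 :+ Φᵖ z :* # 1) z)

  cc′ : c * c′ ≈ - 1#
  cc′ = modΦ (solve 1 (λ z → cᵖ z :* c′ᵖ z := :- # 1 :+ Φᵖ z :* (# 2 :- z :+ z :^ 3)) z)

  quotient0 : (1# - z ^ 4) * (ℓ₃) ≈ ⌜ 5 ⌝ * (1# + z ^ 4)
  quotient0 = modΦ (solve 1 (λ z → (# 1 :- z :^ 4) :* (ℓ₃ᵖ z) := # 5 :* (# 1 :+ z :^ 4) :+ Φᵖ z :* (:- # 5 :+ z :* (# 2 :+ z :* (# 2 :+ z :* (# 2 :+ z :* (:- # 3)))))) z)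
  quotient1 : (1# - z ^ 4) * (ℓ₂ - c * ℓ₃) ≈ - (⌜ 15 ⌝ * (z + z ^ 3))
  quotient1 = modΦ (solve 1 (λ z → (# 1 :- z :^ 4) :* (ℓ₂ᵖ z :- cᵖ z :* ℓ₃ᵖ z) := :- (# 15 :* (z :+ z :^ 3)) :+ Φᵖ z :* (# 0 :+ z :* (# 8 :+ z :* (:- # 4 :+ z :* (# 11 :+ z :* (:- # 9 :+ z :* (# 1 :+ z :* (:- # 2 :+ z :* (:- # 2 :+ z :* (# 3)))))))))) z)
  quotient2 : (1# - z ^ 4) * (ℓ₁ - c * ℓ₂) ≈ 0#
  quotient2 = modΦ (solve 1 (λ z → (# 1 :- z :^ 4) :* (ℓ₁ᵖ z :- cᵖ z :* ℓ₂ᵖ z) := # 0 :+ Φᵖ z :* (# 0 :+ z :* (# 0 :+ z :* (# 0 :+ z :* (# 10 :+ z :* (:- # 10 :+ z :* (# 0 :+ z :* (# 0 :+ z :* (:- # 10 :+ z :* (# 10)))))))))) z)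
  quotient3 : (1# - z ^ 4) * (ℓ₀ - c * ℓ₁) ≈ ⌜ 50 ⌝ * z ^ 2
  quotient3 = modΦ (solve 1 (λ z → (# 1 :- z :^ 4) :* (ℓ₀ᵖ z :- cᵖ z :* ℓ₁ᵖ z) := # 50 :* z :^ 2 :+ Φᵖ z :* (# 0 :+ z :* (# 0 :+ z :* (:- # 20 :+ z :* (# 10 :+ z :* (# 0 :+ z :* (# 10 :+ z :* (:- # 20 :+ z :* (# 0 :+ z :* (# 10)))))))))) z)
  quotient4 : (1# - z ^ 4) * (ℓ₋₁ - c * ℓ₀) ≈ 0#
  quotient4 = modΦ (solve 1 (λ z → (# 1 :- z :^ 4) :* (ℓ₋₁ᵖ z :- cᵖ z :* ℓ₀ᵖ z) := # 0 :+ Φᵖ z :* (# 0 :+ z :* (# 10 :+ z :* (:- # 20 :+ z :* (# 20 :+ z :* (:- # 10 :+ z :* (:- # 10 :+ z :* (# 20 :+ z :* (:- # 20 :+ z :* (# 10)))))))))) z)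
  quotient5 : (1# - z ^ 4) * (ℓ₋₂ - c * ℓ₋₁) ≈ - (⌜ 15 ⌝ * (1# + z ^ 4))
  quotient5 = modΦ (solve 1 (λ z → (# 1 :- z :^ 4) :* (ℓ₋₂ᵖ z :- cᵖ z :* ℓ₋₁ᵖ z) := :- (# 15 :* (# 1 :+ z :^ 4)) :+ Φᵖ z :* (# 15 :+ z :* (:- # 16 :+ z :* (# 14 :+ z :* (:- # 16 :+ z :* (# 9 :+ z :* (# 10 :+ z :* (:- # 20 :+ z :* (# 10))))))))) z)
  quotient6 : (1# - z ^ 4) * (- (c * ℓ₋₂)) ≈ - (⌜ 5 ⌝ * (z + z ^ 3))
  quotient6 = modΦ (solve 1 (λ z → (# 1 :- z :^ 4) :* (:- (cᵖ z :* ℓ₋₂ᵖ z)) := :- (# 5 :* (z :+ z :^ 3)) :+ Φᵖ z :* (# 0 :+ z :* (# 6 :+ z :* (:- # 8 :+ z :* (# 7 :+ z :* (:- # 3 :+ z :* (:- # 3 :+ z :* (# 6 :+ z :* (:- # 4 :+ z :* (# 1)))))))))) z)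

  product0 : ℓ₃ ≈ - (⌜ 3 ⌝ * s₁) - ⌜ 1 ⌝ * s₂
  product0 = modΦ (solve 1 (λ z → ℓ₃ᵖ z := :- (# 3 :* s₁ᵖ z) :- # 1 :* s₂ᵖ z :+ Φᵖ z :* (# 0)) z)
  product1 : ℓ₂ - c′ * ℓ₃ ≈ - (⌜ 11 ⌝ * s₁) - ⌜ 2 ⌝ * s₂
  product1 = modΦ (solve 1 (λ z → ℓ₂ᵖ z :- c′ᵖ z :* ℓ₃ᵖ z := :- (# 11 :* s₁ᵖ z) :- # 2 :* s₂ᵖ z :+ Φᵖ z :* (# 0 :+ z :* (# 4 :+ z :* (:- # 1 :+ z :* (:- # 3))))) z)
  product2 : ℓ₁ - c′ * ℓ₂ ≈ - (⌜ 10 ⌝ * s₁) - ⌜ 20 ⌝ * s₂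
  product2 = modΦ (solve 1 (λ z → ℓ₁ᵖ z :- c′ᵖ z :* ℓ₂ᵖ z := :- (# 10 :* s₁ᵖ z) :- # 20 :* s₂ᵖ z :+ Φᵖ z :* (# 0 :+ z :* (# 10 :+ z :* (# 0 :+ z :* (:- # 10))))) z)
  product3 : ℓ₀ - c′ * ℓ₁ ≈ - (⌜ 20 ⌝ * s₁) + ⌜ 10 ⌝ * s₂
  product3 = modΦ (solve 1 (λ z → ℓ₀ᵖ z :- c′ᵖ z :* ℓ₁ᵖ z := :- (# 20 :* s₁ᵖ z) :+ # 10 :* s₂ᵖ z :+ Φᵖ z :* (# 0 :+ z :* (# 20 :+ z :* (:- # 10 :+ z :* (:- # 10))))) z)
  product4 : ℓ₋₁ - c′ * ℓ₀ ≈ ⌜ 10 ⌝ * s₁ - ⌜ 30 ⌝ * s₂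
  product4 = modΦ (solve 1 (λ z → ℓ₋₁ᵖ z :- c′ᵖ z :* ℓ₀ᵖ z := # 10 :* s₁ᵖ z :- # 30 :* s₂ᵖ z :+ Φᵖ z :* (# 0 :+ z :* (# 0 :+ z :* (# 10 :+ z :* (:- # 10))))) z)
  product5 : ℓ₋₂ - c′ * ℓ₋₁ ≈ - (⌜ 11 ⌝ * s₁) + ⌜ 13 ⌝ * s₂
  product5 = modΦ (solve 1 (λ z → ℓ₋₂ᵖ z :- c′ᵖ z :* ℓ₋₁ᵖ z := :- (# 11 :* s₁ᵖ z) :+ # 13 :* s₂ᵖ z :+ Φᵖ z :* (# 0 :+ z :* (# 10 :+ z :* (:- # 10)))) z)
  product6 : - (c′ * ℓ₋₂) ≈ ⌜ 3 ⌝ * s₁ - ⌜ 4 ⌝ * s₂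
  product6 = modΦ (solve 1 (λ z → :- (c′ᵖ z :* ℓ₋₂ᵖ z) := # 3 :* s₁ᵖ z :- # 4 :* s₂ᵖ z :+ Φᵖ z :* (# 0 :+ z :* (:- # 2 :+ z :* (# 3 :+ z :* (:- # 1))))) z)

module FifthRoots {r ℓ} (K : CommutativeRing r ℓ) (z : CommutativeRing.Carrier K) (Φ₀ : Scalars.IsFifthRoot K z)
  (fifth : CommutativeRing.Carrier K) (fifth≈ : Scalars.IsFifth K fifth) where
  private
    module K = CommutativeRing K
    module KE = Exp K.semiring
  open ThetaSeries K public
  open CExp commutativeSemiring using (^-distrib-*) public
  private
    module I = IntegerSolver seriesRing
  open I using (solve)
  open SetoidReasoning setoid

  module κ = RingHom κHom

  ζ : Series
  ζ = κ z

  Φζ : 1# + ζ + ζ ^ 2 + ζ ^ 3 + ζ ^ 4 ≋ 0#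
  Φζ = trans (sym (trans (κ-+ _ _) (+-cong (trans (κ-+ _ _) (+-cong (trans (κ-+ _ _) (+-cong (κ-+ _ _) (κ.^-hom z 2))) (κ.^-hom z 3))) (κ.^-hom z 4))))
    (trans (κ-cong Φ₀) κ.0-hom)

  open RootOfUnity seriesRing ζ Φζ public
  open Scalars seriesRing using (cancel) public

  fifthₛ : ⌜ 5 ⌝ * κ fifth ≋ 1#
  fifthₛ = trans (*-congʳ (sym (trans (κ-+ _ _) (trans (+-congʳ (trans (κ-+ _ _) (+-congʳ (trans (κ-+ _ _) (+-congʳ (κ-+ _ _))))))
      (solve 0 (# 1 :+ # 1 :+ # 1 :+ # 1 :+ # 1 := # 5))))))
    (trans (sym (κ-* _ _)) (κ-cong fifth≈))

  Θ-cong : ∀ {x y} → x ≋ y → Θ x ≋ Θ y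
  Θ-cong {x} {y} p = ⟶-unique (Θ-⟶ x) (⟶-cong (λ N → ∏-cong N λ k → +-congˡ (-‿cong (*-congʳ (sym p)))) (Θ-⟶ y))

  private
    fifth-power : ∀ r k → 1# ^ 5 - (q ^ (r ℕ.+ k ℕ.* 5)) ^ 5 ≋ φ (1# - q ^ (r ℕ.+ k ℕ.* 5))
    fifth-power r k = trans (+-cong (solve 0 (# 1 :^ 5 := # 1)) (-‿cong (^-assocʳ q (r ℕ.+ k ℕ.* 5) 5))) (sym (φ-factor (r ℕ.+ k ℕ.* 5)))

    suc-blocks : ∀ k → 1# ^ 5 - (q ^ suc k) ^ 5 ≋ φ (1# - q ^ suc k)
    suc-blocks k = trans (+-cong (solve 0 (# 1 :^ 5 := # 1)) (-‿cong (^-assocʳ q (suc k) 5))) (sym (φ-factor (suc k)))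

  Θ-roots : E₁ * Θ ζ * Θ (ζ ^ 2) * Θ (ζ ^ 3) * Θ (ζ ^ 4) ≋ E₅
  Θ-roots = trans (⟶-unique
      (⟶-* (⟶-* (⟶-* (⟶-* E₁-⟶ (Θ-⟶ ζ)) (Θ-⟶ (ζ ^ 2))) (Θ-⟶ (ζ ^ 3))) (Θ-⟶ (ζ ^ 4)))
      (⟶-cong (λ N → sym (trans (sym (trans (∏-* _ _ N) (*-congʳ (trans (∏-* _ _ N) (*-congʳ (trans (∏-* _ _ N) (*-congʳ (∏-* _ _ N))))))))
        (trans (∏-cong N λ k → trans (∏roots 1# (q ^ suc k)) (suc-blocks k)) (sym (φ.∏-hom _ N))))) (φ-⟶ E₁-⟶)))
    φE₁≋E₅

  theta-root : ∀ w → 1# + w + w ^ 2 + w ^ 3 + w ^ 4 ≋ 0# →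
    E₁ * (Θ w * Θ (w ^ 4)) ≋ φ (B * E₅) - q * ((1# + w + w ^ 4) * φ (A * E₅))
  theta-root w Φw = cancel (1# - w ^ 4) (κ fifth * _)
      (trans (solve 3 (λ d f r → d :* (f :* r) := (d :* r) :* f) _ _ _) (trans (*-congʳ W.five) fifthₛ))
    (begin
      E₁ * (Θ w * Θ (w ^ 4)) * (1# - w ^ 4)
        ≈⟨ solve 4 (λ e a b d → e :* (a :* b) :* d := e :* (a :* (d :* b))) _ _ _ _ ⟩
      E₁ * (Θ w * ((1# - w ^ 4) * Θ (w ^ 4)))
        ≈⟨ *-congˡ (*-cong (Θ-cong (sym Z≋)) (*-cong (+-congˡ (-‿cong (sym Z′≋))) (Θ-cong (sym Z′≋)))) ⟩
      theta ≈⟨ theta-dissection ⟩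
      _ ≈⟨ +-congˡ (zeroˡ _) ⟩
      (1# - w ^ 4) * φ (B * E₅) - q * ((w - w ^ 3) * φ (A * E₅)) + 0#
        ≈⟨ trans (+-identityʳ _) (+-congˡ (-‿cong (*-congˡ (*-congʳ (sym W.z-z³))))) ⟩
      (1# - w ^ 4) * φ (B * E₅) - q * ((1# - w ^ 4) * W.c * φ (A * E₅))
        ≈⟨ solve 5 (λ d u q c v → d :* u :- q :* (d :* c :* v) := (u :- q :* (c :* v)) :* d) _ _ _ _ _ ⟩
      (φ (B * E₅) - q * ((1# + w + w ^ 4) * φ (A * E₅))) * (1# - w ^ 4) ∎)
    where
    module W = RootOfUnity seriesRing w Φw
    open FirstOrder w 0# W.z⁵ (zeroˡ 0#)
    Z≋ : Z ≋ w
    Z≋ = solve 1 (λ w → w :* (# 1 :+ # 0) := w) w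
    Z′≋ : Z′ ≋ w ^ 4
    Z′≋ = solve 1 (λ w → w :^ 4 :* (# 1 :- # 0) := w :^ 4) w

  ζ^ : ∀ r {k} i → k ≡ r ℕ.+ i ℕ.* 5 → ζ ^ k ≋ ζ ^ r
  ζ^ r i ≡.refl = unit-power z⁵ r i

  θ₁ θ₂ : Series
  θ₁ = φ (B * E₅) - q * (c * φ (A * E₅))
  θ₂ = φ (B * E₅) - q * (c′ * φ (A * E₅))

  theta₁ : E₁ * (Θ ζ * Θ (ζ ^ 4)) ≋ θ₁
  theta₁ = theta-root ζ Φζ

  theta₂ : E₁ * (Θ (ζ ^ 2) * Θ (ζ ^ 3)) ≋ θ₂
  theta₂ = trans (*-congˡ (*-congˡ (Θ-cong (sym ζ²⁴)))) (trans (theta-root (ζ ^ 2) Φ-square)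
      (+-congˡ (-‿cong (*-congˡ (*-congʳ (+-congˡ ζ²⁴))))))
    where
    ζ²⁴ : (ζ ^ 2) ^ 4 ≋ ζ ^ 3
    ζ²⁴ = trans (^-assocʳ ζ 2 4) (ζ^ 3 1 ≡.refl)

  θ₁θ₂ : θ₁ * θ₂ ≋ E₁ * E₅
  θ₁θ₂ = begin
    θ₁ * θ₂ ≈⟨ *-cong (sym theta₁) (sym theta₂) ⟩
    _ ≈⟨ solve 5 (λ e a b c d → (e :* (a :* d)) :* (e :* (b :* c)) := e :* (e :* a :* b :* c :* d)) E₁ (Θ ζ) (Θ (ζ ^ 2)) (Θ (ζ ^ 3)) (Θ (ζ ^ 4)) ⟩
    _ ≈⟨ *-congˡ Θ-roots ⟩
    E₁ * E₅ ∎

  private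
    module σ (i : ℕ) where
      open Twist K (z KE.^ i) public
      open RingHom σHom public

      σ-const : ∀ n → σ (q ^ n) ≋ (ζ ^ i) ^ n * q ^ n
      σ-const n = trans (^-hom q n) (trans (^-congˡ n (trans σ-q (*-congʳ (κ.^-hom z i)))) (^-distrib-* (ζ ^ i) q n))

      σ-factor : ∀ n → σ (1# - q ^ n) ≋ 1# - (ζ ^ i) ^ n * q ^ n
      σ-factor n = trans (sub-hom 1# (q ^ n)) (+-cong 1-hom (-‿cong (σ-const n)))

  norm : Series → Series
  norm f = σ.σ 0 f * σ.σ 1 f * σ.σ 2 f * σ.σ 3 f * σ.σ 4 f

  private
    5-cong : ∀ {a b c d e a′ b′ c′ d′ e′} → a ≋ a′ → b ≋ b′ → c ≋ c′ → d ≋ d′ → e ≋ e′ → a * b * c * d * e ≋ a′ * b′ * c′ * d′ * e′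
    5-cong p q r s t = *-cong (*-cong (*-cong (*-cong p q) r) s) t

  norm-cong : ∀ {f g} → f ≋ g → norm f ≋ norm g
  norm-cong p = 5-cong (σ.⟦⟧-cong 0 p) (σ.⟦⟧-cong 1 p) (σ.⟦⟧-cong 2 p) (σ.⟦⟧-cong 3 p) (σ.⟦⟧-cong 4 p)

  norm-* : ∀ f g → norm (f * g) ≋ norm f * norm g
  norm-* f g = trans (5-cong (σ.*-hom 0 f g) (σ.*-hom 1 f g) (σ.*-hom 2 f g) (σ.*-hom 3 f g) (σ.*-hom 4 f g))
    (solve 10 (λ a b c d e a′ b′ c′ d′ e′ → (a :* a′) :* (b :* b′) :* (c :* c′) :* (d :* d′) :* (e :* e′)
      := (a :* b :* c :* d :* e) :* (a′ :* b′ :* c′ :* d′ :* e′)) _ _ _ _ _ _ _ _ _ _)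

  norm-1 : norm 1# ≋ 1#
  norm-1 = trans (5-cong (σ.1-hom 0) (σ.1-hom 1) (σ.1-hom 2) (σ.1-hom 3) (σ.1-hom 4)) (solve 0 (# 1 :* # 1 :* # 1 :* # 1 :* # 1 := # 1))

  norm-⟶ : ∀ {s f} → s ⟶ f → (λ N → norm (s N)) ⟶ norm f
  norm-⟶ p = ⟶-* (⟶-* (⟶-* (⟶-* (σ.σ-⟶ 0 p) (σ.σ-⟶ 1 p)) (σ.σ-⟶ 2 p)) (σ.σ-⟶ 3 p)) (σ.σ-⟶ 4 p)

  norm-∏ : ∀ f N → norm (∏ f N) ≋ ∏ (λ k → norm (f k)) N
  norm-∏ f zero    = norm-1
  norm-∏ f (suc N) = trans (norm-* _ _) (*-congʳ (norm-∏ f N))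

  norm-euler : ∀ r → (∀ k → norm (1# - q ^ (r ℕ.+ k ℕ.* 5)) ≋ φ (1# - q ^ (r ℕ.+ k ℕ.* 5))) → norm (euler r) ≋ φ (euler r)
  norm-euler r p = ⟶-unique (norm-⟶ (euler-⟶ r))
    (⟶-cong (λ N → trans (φ.∏-hom _ N) (sym (trans (norm-∏ _ N) (∏-cong N p)))) (φ-⟶ (euler-⟶ r)))

  private
    σ-factor′ : ∀ r k i j {m} → i ℕ.* r ≡ j ℕ.+ m ℕ.* 5 → σ.σ i (1# - q ^ (r ℕ.+ k ℕ.* 5)) ≋ 1# - ζ ^ j * q ^ (r ℕ.+ k ℕ.* 5)
    σ-factor′ r k i j {m} e = trans (σ.σ-factor i (r ℕ.+ k ℕ.* 5)) (+-congˡ (-‿cong (*-congʳ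
      (trans (unit-power ζⁱ⁵ r k) (trans (^-assocʳ ζ i r) (ζ^ j m e))))))
      where
      ζⁱ⁵ : (ζ ^ i) ^ 5 ≋ 1#
      ζⁱ⁵ = trans (^-assocʳ ζ i 5) (ζ^ 0 i ≡.refl)

    roots-in-order : ∀ r k → (1# - ζ ^ 0 * q ^ (r ℕ.+ k ℕ.* 5)) * (1# - ζ ^ 1 * q ^ (r ℕ.+ k ℕ.* 5)) * (1# - ζ ^ 2 * q ^ (r ℕ.+ k ℕ.* 5))
                             * (1# - ζ ^ 3 * q ^ (r ℕ.+ k ℕ.* 5)) * (1# - ζ ^ 4 * q ^ (r ℕ.+ k ℕ.* 5))
                     ≋ φ (1# - q ^ (r ℕ.+ k ℕ.* 5))
    roots-in-order r k = trans (*-congʳ (*-congʳ (*-congʳ (*-cong (+-congˡ (-‿cong (*-identityˡ _))) (+-congˡ (-‿cong (*-congʳ (*-identityʳ ζ))))))))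
      (trans (∏roots 1# (q ^ (r ℕ.+ k ℕ.* 5))) (fifth-power r k))

  norm-euler₁ : norm (euler 1) ≋ φ (euler 1)
  norm-euler₁ = norm-euler 1 λ k → trans (5-cong (σ-factor′ 1 k 0 0 {0} ≡.refl) (σ-factor′ 1 k 1 1 {0} ≡.refl) (σ-factor′ 1 k 2 2 {0} ≡.refl) (σ-factor′ 1 k 3 3 {0} ≡.refl) (σ-factor′ 1 k 4 4 {0} ≡.refl))
    (roots-in-order 1 k)

  norm-euler₂ : norm (euler 2) ≋ φ (euler 2)
  norm-euler₂ = norm-euler 2 λ k → trans (5-cong (σ-factor′ 2 k 0 0 {0} ≡.refl) (σ-factor′ 2 k 1 2 {0} ≡.refl) (σ-factor′ 2 k 2 4 {0} ≡.refl) (σ-factor′ 2 k 3 1 {1} ≡.refl) (σ-factor′ 2 k 4 3 {1} ≡.refl))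
    (trans (solve 5 (λ a b c d e → a :* c :* e :* b :* d := a :* b :* c :* d :* e) _ _ _ _ _) (roots-in-order 2 k))

  norm-euler₃ : norm (euler 3) ≋ φ (euler 3)
  norm-euler₃ = norm-euler 3 λ k → trans (5-cong (σ-factor′ 3 k 0 0 {0} ≡.refl) (σ-factor′ 3 k 1 3 {0} ≡.refl) (σ-factor′ 3 k 2 1 {1} ≡.refl) (σ-factor′ 3 k 3 4 {1} ≡.refl) (σ-factor′ 3 k 4 2 {2} ≡.refl))
    (trans (solve 5 (λ a b c d e → a :* d :* b :* e :* c := a :* b :* c :* d :* e) _ _ _ _ _) (roots-in-order 3 k))

  norm-euler₄ : norm (euler 4) ≋ φ (euler 4)
  norm-euler₄ = norm-euler 4 λ k → trans (5-cong (σ-factor′ 4 k 0 0 {0} ≡.refl) (σ-factor′ 4 k 1 4 {0} ≡.refl) (σ-factor′ 4 k 2 3 {1} ≡.refl) (σ-factor′ 4 k 3 2 {2} ≡.refl) (σ-factor′ 4 k 4 1 {3} ≡.refl))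
    (trans (solve 5 (λ a b c d e → a :* e :* d :* c :* b := a :* b :* c :* d :* e) _ _ _ _ _) (roots-in-order 4 k))

  zⁱ⁵ : ∀ i → (z KE.^ i) KE.^ 5 K.≈ K.1#
  zⁱ⁵ i = K.trans (KE.^-assocʳ z i 5) (K.trans (at (κ.^-hom z (i ℕ.* 5)) 0) (at (ζ^ 0 i ≡.refl) 0))

  norm-φ : ∀ f → norm (φ f) ≋ φ f ^ 5
  norm-φ f = trans (5-cong (fixed 0) (fixed 1) (fixed 2) (fixed 3) (fixed 4)) (solve 1 (λ a → a :* a :* a :* a :* a := a :^ 5) (φ f))
    where
    fixed : ∀ i → σ.σ i (φ f) ≋ φ f
    fixed i = σ-φ (z KE.^ i) (zⁱ⁵ i) f

  norm-E₁ : norm E₁ ≋ φ (A * B) * E₅ ^ 5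
  norm-E₁ = begin
    norm E₁ ≈⟨ norm-cong E₁≋ABE₅ ⟩
    norm (A * B * E₅) ≈⟨ trans (norm-* _ _) (*-congʳ (trans (norm-* _ _) (*-cong (norm-* _ _) (norm-* _ _)))) ⟩
    (norm (euler 1) * norm (euler 4)) * (norm (euler 2) * norm (euler 3)) * norm E₅
      ≈⟨ *-cong (*-cong (*-cong norm-euler₁ norm-euler₄) (*-cong norm-euler₂ norm-euler₃))
           (trans (norm-cong (sym φE₁≋E₅)) (trans (norm-φ E₁) (^-congˡ 5 φE₁≋E₅))) ⟩
    (φ (euler 1) * φ (euler 4)) * (φ (euler 2) * φ (euler 3)) * E₅ ^ 5
      ≈⟨ *-congʳ (sym (trans (φ.*-hom _ _) (*-cong (φ.*-hom _ _) (φ.*-hom _ _)))) ⟩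
    φ (A * B) * E₅ ^ 5 ∎

  norm-q^ : ∀ i → σ.σ i q ≋ ζ ^ i * q
  norm-q^ i = trans (σ.σ-q i) (*-congʳ (κ.^-hom z i))

-- Positions of the residue classes modulo 5 in p²(x + q) and p²(x⁶ + 3x⁵q + 10x⁴q² + 10x²q⁴ - 3xq⁵ + q⁶),
-- with q⁵ written as q.
module PartPolynomials where
  pᵖ : ∀ {n} → Expr ℤ n → Expr ℤ n → Expr ℤ n
  pᵖ x q = x :^ 8 :+ x :^ 7 :* q :+ # 2 :* x :^ 6 :* q :^ 2 :+ # 3 :* x :^ 5 :* q :^ 3 :+ # 5 :* x :^ 4 :* q :^ 4
           :- # 3 :* x :^ 3 :* q :^ 5 :+ # 2 :* x :^ 2 :* q :^ 6 :- x :* q :^ 7 :+ q :^ 8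

  α₁ᵖ α₂ᵖ : ∀ {n} (x q : Expr ℤ n) → Expr ℤ n
  α₁ᵖ x q = :- (# 3 :* x :+ q)
  α₂ᵖ x q = :- (x :+ # 2 :* q)

  β₁ᵖ β₂ᵖ : ∀ {n} (y x q : Expr ℤ n) → Expr ℤ n
  β₁ᵖ y x q = y :^ 2 :* (:- (# 3 :* x :^ 6) :- # 11 :* x :^ 5 :* q :- # 10 :* x :^ 4 :* q :^ 2 :- # 20 :* x :^ 3 :* q :^ 3
                         :+ # 10 :* x :^ 2 :* q :^ 4 :- # 11 :* x :* q :^ 5 :+ # 3 :* q :^ 6)
  β₂ᵖ y x q = y :^ 2 :* (:- x :^ 6 :- # 2 :* x :^ 5 :* q :- # 20 :* x :^ 4 :* q :^ 2 :+ # 10 :* x :^ 3 :* q :^ 3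
                         :- # 30 :* x :^ 2 :* q :^ 4 :+ # 13 :* x :* q :^ 5 :- # 4 :* q :^ 6)

  Wᵖ H₁ᵖ H₂ᵖ : ∀ {n} (g v y e x q : Expr ℤ n) → Expr ℤ n
  Wᵖ g v y e x q  = g :* (y :^ 4 :* pᵖ x q) :^ 2 :* v
  H₁ᵖ g v y e x q = Wᵖ g v y e x q :* (α₁ᵖ x q :- e :^ 2 :* v :* β₁ᵖ y x q)
  H₂ᵖ g v y e x q = Wᵖ g v y e x q :* (α₂ᵖ x q :- e :^ 2 :* v :* β₂ᵖ y x q)

  fᵖ hᵖ : ℕ → ∀ {n} → Expr ℤ n → Expr ℤ n → Expr ℤ n
  fᵖ 0 x q = :- (x :^ 17) :- # 36 :* x :^ 12 :* q :- # 7 :* x :^ 7 :* q :^ 2 :- # 3 :* x :^ 2 :* q :^ 3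
  fᵖ 1 x q = :- (# 3 :* x :^ 16) :- # 43 :* x :^ 11 :* q :- # 11 :* x :^ 6 :* q :^ 2 :+ x :* q :^ 3
  fᵖ 2 x q = :- (# 7 :* x :^ 15) :- # 47 :* x :^ 10 :* q :- # 4 :* x :^ 5 :* q :^ 2 :- q :^ 3
  fᵖ 3 x q = :- (# 15 :* x :^ 14) :- # 35 :* x :^ 9 :* q :- # 10 :* x :^ 4 :* q :^ 2
  fᵖ _ x q = :- (# 30 :* x :^ 13) :+ # 5 :* x :^ 8 :* q :+ # 5 :* x :^ 3 :* q :^ 2
  hᵖ 0 x q = x :^ 22 :+ # 193 :* x :^ 17 :* q :+ # 359 :* x :^ 12 :* q :^ 2 :- # 348 :* x :^ 7 :* q :^ 3 :+ # 21 :* x :^ 2 :* q :^ 4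
  hᵖ 1 x q = # 5 :* x :^ 21 :+ # 320 :* x :^ 16 :* q :+ # 320 :* x :^ 6 :* q :^ 3 :- # 5 :* x :* q :^ 4
  hᵖ 2 x q = # 21 :* x :^ 20 :+ # 348 :* x :^ 15 :* q :+ # 359 :* x :^ 10 :* q :^ 2 :- # 193 :* x :^ 5 :* q :^ 3 :+ q :^ 4
  hᵖ 3 x q = # 45 :* x :^ 19 :+ # 520 :* x :^ 14 :* q :- # 335 :* x :^ 9 :* q :^ 2 :+ # 110 :* x :^ 4 :* q :^ 3
  hᵖ _ x q = # 110 :* x :^ 18 :+ # 335 :* x :^ 13 :* q :+ # 520 :* x :^ 8 :* q :^ 2 :- # 45 :* x :^ 3 :* q :^ 3

  partᵖ : ℕ → ∀ {n} → (g v y e x q : Expr ℤ n) → Expr ℤ n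
  partᵖ r g v y e x q = # 5 :* (g :* v :* (y :^ 8 :* fᵖ r x q :+ e :^ 2 :* v :* (y :^ 10 :* hᵖ r x q)))

  at-variables : (∀ {n} (g v y e x q : Expr ℤ n) → Expr ℤ n) → Expr ℤ 6
  at-variables f = f (var 0F) (var 1F) (var 2F) (var 3F) (var 4F) (var 5F)

module QuinticAlgebra {r ℓ} (R : CommutativeRing r ℓ) (z : CommutativeRing.Carrier R) (Φ₀ : Scalars.IsFifthRoot R z) where
  open CommutativeRing R
  open Exp semiring using (_^_; ^-congˡ)
  open Scalars R using (cancel)
  open RootOfUnity R z Φ₀ public
  open PartPolynomials
  private
    module I = IntegerSolver R
  open I using (solve; eval)
  open SetoidReasoning setoid

  private
    negligible : ∀ {a} x k → a ≈ 0# → x - a * k ≈ x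
    negligible x k p = trans (+-congˡ (trans (-‿cong (trans (*-congʳ p) (zeroˡ k))) (solve 0 (:- # 0 := # 0)))) (+-identityʳ x)

    negligible⁺ : ∀ {a b} x k t → a ≈ 0# → b ≈ 0# → x + (a * k + b * t) ≈ x
    negligible⁺ x k t p r = trans (+-congˡ (trans (+-cong (trans (*-congʳ p) (zeroˡ k)) (trans (*-congʳ r) (zeroˡ t))) (+-identityˡ 0#))) (+-identityʳ x)

    ρ : c * c - c - 1# ≈ 0#
    ρ = trans (solve 2 (λ c d → c :* c :- c :- # 1 := :- (c :* d) :- # 1 :- c :* (# 1 :- (c :+ d))) c c′)
      (trans (+-cong (+-congʳ (-‿cong cc′)) (-‿cong (*-congˡ (+-congˡ (-‿cong c+c′))))) (solve 1 (λ c → :- :- # 1 :- # 1 :- c :* (# 1 :- # 1) := # 0) c))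

    c′≈ : c′ ≈ 1# - c
    c′≈ = trans (solve 2 (λ c d → d := (c :+ d) :- c) c c′) (+-congʳ c+c′)

    cofactor : ∀ {n} (b q c a : Expr ℤ n) → Expr ℤ n
    cofactor b q c a = let ρ = c :* c :- c :- # 1 in
      (# 5 :* c :* c :- # 5 :* c :+ # 10) :* (q :^ 5 :* a :^ 5 :* b :^ 5)
      :+ (# 5 :+ # 10 :* ρ :+ # 10 :* ρ :^ 2 :+ # 5 :* ρ :^ 3 :+ ρ :^ 4) :* (q :^ 10 :* a :^ 10)

    fibonacci : ∀ q a b → (b ^ 5 - (q * (c * a)) ^ 5) * (b ^ 5 - (q * (c′ * a)) ^ 5) ≈ b ^ 10 - ⌜ 11 ⌝ * q ^ 5 * a ^ 5 * b ^ 5 - q ^ 10 * a ^ 10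
    fibonacci q a b = begin
      (b ^ 5 - (q * (c * a)) ^ 5) * (b ^ 5 - (q * (c′ * a)) ^ 5) ≈⟨ *-congˡ (+-congˡ (-‿cong (^-congˡ 5 (*-congˡ (*-congʳ c′≈))))) ⟩
      (b ^ 5 - (q * (c * a)) ^ 5) * (b ^ 5 - (q * ((1# - c) * a)) ^ 5)
        ≈⟨ solve 4 (λ b q c a → let ρ = c :* c :- c :- # 1 in
             (b :^ 5 :- (q :* (c :* a)) :^ 5) :* (b :^ 5 :- (q :* ((# 1 :- c) :* a)) :^ 5) :=
             b :^ 10 :- # 11 :* q :^ 5 :* a :^ 5 :* b :^ 5 :- q :^ 10 :* a :^ 10
             :- ρ :* cofactor b q c a) b q c a ⟩
      b ^ 10 - ⌜ 11 ⌝ * q ^ 5 * a ^ 5 * b ^ 5 - q ^ 10 * a ^ 10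
        - (c * c - c - 1#) * eval (cofactor (var 0F) (var 1F) (var 2F) (var 3F)) (b ∷ q ∷ c ∷ a ∷ []) ≈⟨ negligible _ _ ρ ⟩
      b ^ 10 - ⌜ 11 ⌝ * q ^ 5 * a ^ 5 * b ^ 5 - q ^ 10 * a ^ 10 ∎

  E₁-form : ∀ {q a b e x y u E₁} → (a * b) * u ≈ 1# → x * a ≈ b → y * b ≈ a →
    E₁ * (a * b) ≈ e * ((b - q * (c * a)) * (b - q * (c′ * a))) → E₁ ≈ e * y * (x ^ 2 - q * x - q ^ 2)
  E₁-form {q} {a} {b} {e} {x} {y} {u} {E₁} ab xa yb E₁ab = cancel (a * b) u ab (begin
    E₁ * (a * b) ≈⟨ E₁ab ⟩
    e * ((b - q * (c * a)) * (b - q * (c′ * a)))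
      ≈⟨ solve 6 (λ e b q c c′ a → e :* ((b :- q :* (c :* a)) :* (b :- q :* (c′ :* a))) := e :* (b :* b :- (c :+ c′) :* (q :* a :* b) :+ c :* c′ :* (q :* a :* (q :* a)))) e b q c c′ a ⟩
    e * (b * b - (c + c′) * (q * a * b) + c * c′ * (q * a * (q * a)))
      ≈⟨ *-congˡ (+-cong (+-cong (*-cong (sym xa) (sym xa)) (-‿cong (*-cong c+c′ (*-congˡ (sym xa))))) (*-congʳ cc′)) ⟩
    e * (x * a * (x * a) - 1# * (q * a * (x * a)) + - 1# * (q * a * (q * a)))
      ≈⟨ solve 4 (λ e x a q → e :* (x :* a :* (x :* a) :- # 1 :* (q :* a :* (x :* a)) :+ :- # 1 :* (q :* a :* (q :* a)))
           := e :* (x :^ 2 :- q :* x :- q :^ 2) :* (a :* a)) e x a q ⟩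
    e * (x ^ 2 - q * x - q ^ 2) * (a * a) ≈⟨ *-congˡ (*-congˡ (sym yb)) ⟩
    e * (x ^ 2 - q * x - q ^ 2) * (a * (y * b)) ≈⟨ solve 5 (λ e s a y b → e :* s :* (a :* (y :* b)) := e :* y :* s :* (a :* b)) e (x ^ 2 - q * x - q ^ 2) a y b ⟩
    e * y * (x ^ 2 - q * x - q ^ 2) * (a * b) ∎)

  E₅-form : ∀ {q a b e x y} → x * a ≈ b → y * b ≈ a →
    e * (e ^ 5 * ((b ^ 5 - (q * (c * a)) ^ 5) * (b ^ 5 - (q * (c′ * a)) ^ 5))) ≈ e ^ 6 * y ^ 5 * (x ^ 10 - ⌜ 11 ⌝ * q ^ 5 * x ^ 5 - q ^ 10) * (a * b) ^ 5
  E₅-form {q} {a} {b} {e} {x} {y} xa yb = begin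
    e * (e ^ 5 * ((b ^ 5 - (q * (c * a)) ^ 5) * (b ^ 5 - (q * (c′ * a)) ^ 5))) ≈⟨ *-congˡ (*-congˡ (fibonacci q a b)) ⟩
    e * (e ^ 5 * (b ^ 10 - ⌜ 11 ⌝ * q ^ 5 * a ^ 5 * b ^ 5 - q ^ 10 * a ^ 10))
      ≈⟨ *-congˡ (*-congˡ (+-congʳ (+-cong (^-congˡ 10 (sym xa)) (-‿cong (*-congˡ (^-congˡ 5 (sym xa))))))) ⟩
    e * (e ^ 5 * ((x * a) ^ 10 - ⌜ 11 ⌝ * q ^ 5 * a ^ 5 * (x * a) ^ 5 - q ^ 10 * a ^ 10))
      ≈⟨ solve 4 (λ e x a q → e :* (e :^ 5 :* ((x :* a) :^ 10 :- # 11 :* q :^ 5 :* a :^ 5 :* (x :* a) :^ 5 :- q :^ 10 :* a :^ 10))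
           := e :^ 6 :* (x :^ 10 :- # 11 :* q :^ 5 :* x :^ 5 :- q :^ 10) :* (a :^ 5 :* a :^ 5)) e x a q ⟩
    e ^ 6 * (x ^ 10 - ⌜ 11 ⌝ * q ^ 5 * x ^ 5 - q ^ 10) * (a ^ 5 * a ^ 5) ≈⟨ *-congˡ (*-congˡ (^-congˡ 5 (sym yb))) ⟩
    e ^ 6 * (x ^ 10 - ⌜ 11 ⌝ * q ^ 5 * x ^ 5 - q ^ 10) * (a ^ 5 * (y * b) ^ 5)
      ≈⟨ solve 5 (λ e s a y b → e :* s :* (a :^ 5 :* (y :* b) :^ 5) := e :* y :^ 5 :* s :* (a :* b) :^ 5) (e ^ 6) (x ^ 10 - ⌜ 11 ⌝ * q ^ 5 * x ^ 5 - q ^ 10) a y b ⟩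
    e ^ 6 * y ^ 5 * (x ^ 10 - ⌜ 11 ⌝ * q ^ 5 * x ^ 5 - q ^ 10) * (a * b) ^ 5 ∎

  p : Carrier → Carrier → Carrier
  p x q = eval (pᵖ (var 0F) (var 1F)) (x ∷ q ∷ [])

  inverse-form : ∀ {q e x y E₁ E₅} → E₁ ≈ e * y * (x ^ 2 - q * x - q ^ 2) →
    E₅ ^ 6 ≈ e ^ 6 * y ^ 5 * (x ^ 10 - ⌜ 11 ⌝ * q ^ 5 * x ^ 5 - q ^ 10) → E₁ * (e ^ 5 * (y ^ 4 * p x q)) ≈ E₅ ^ 6
  inverse-form {q} {e} {x} {y} E₁≈ E₅⁶ = trans (*-congʳ E₁≈) (trans
    (solve 4 (λ e y x q → (e :* y :* (x :^ 2 :- q :* x :- q :^ 2)) :* (e :^ 5 :* (y :^ 4 :* pᵖ x q))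
       := e :^ 6 :* y :^ 5 :* (x :^ 10 :- # 11 :* q :^ 5 :* x :^ 5 :- q :^ 10)) e y x q)
    (sym E₅⁶))

  cube : ∀ {q ε e x y E₁} → x * y ≈ 1# → E₁ ≈ e * y * (x ^ 2 - q * x - q ^ 2) →
    ε * E₁ ^ 3 ≈ ε * (e ^ 3 * y ^ 3 * (x ^ 6 - ⌜ 3 ⌝ * q ^ 5 * x)) + q * (ε * - (e ^ 3 * y ^ 3 * (⌜ 3 ⌝ * x ^ 5 + q ^ 5))) + ⌜ 5 ⌝ * q ^ 3 * (ε * e ^ 3)
  cube {q} {ε} {e} {x} {y} xy E₁≈ = trans (*-congˡ (^-congˡ 3 E₁≈)) (trans
    (solve 5 (λ ε e y x q → ε :* (e :* y :* (x :^ 2 :- q :* x :- q :^ 2)) :^ 3 :=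
       ε :* (e :^ 3 :* y :^ 3 :* (x :^ 6 :- # 3 :* q :^ 5 :* x)) :+ q :* (ε :* :- (e :^ 3 :* y :^ 3 :* (# 3 :* x :^ 5 :+ q :^ 5)))
       :+ # 5 :* q :^ 3 :* (ε :* e :^ 3) :* (x :* y) :^ 3) ε e y x q)
    (+-congˡ (trans (*-congˡ (trans (^-congˡ 3 xy) (solve 0 (# 1 :^ 3 := # 1)))) (*-identityʳ _))))

  -- The first-order part of θ(ζ(1 + ε)) and of θ(1 + ε), the latter being Jacobi's series for E₁³.
  D₁ : (w q s u s′ v j : Carrier) → Carrier
  D₁ w q s u s′ v j = ⌜ 5 ⌝ * (1# + w ^ 4) * s + w ^ 4 * u - q * (⌜ 5 ⌝ * (w + w ^ 3) * s′ + (w + ⌜ 2 ⌝ * w ^ 3) * v) + ⌜ 5 ⌝ * w ^ 2 * q ^ 3 * j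

  jacobi-parts : ∀ {q ε e x y a b E₁ s s′ u v j} → x * y ≈ 1# → E₁ ≈ e * y * (x ^ 2 - q * x - q ^ 2) → u ≈ b * e → v ≈ a * e → ε * j ≈ ε * e ^ 3 →
    ε * E₁ ^ 3 ≈ (1# - 1# ^ 4) * u - q * ((1# - 1# ^ 3) * v) + ε * D₁ 1# q s u s′ v j →
    ε * (⌜ 10 ⌝ * s + b * e) + q * (ε * - (⌜ 10 ⌝ * s′ + ⌜ 3 ⌝ * (a * e))) ≈
    ε * (e ^ 3 * y ^ 3 * (x ^ 6 - ⌜ 3 ⌝ * q ^ 5 * x)) + q * (ε * - (e ^ 3 * y ^ 3 * (⌜ 3 ⌝ * x ^ 5 + q ^ 5)))
  jacobi-parts {q} {ε} {e} {x} {y} {a} {b} {E₁} {s} {s′} {u} {v} {j} xy E₁≈ ub va εj jac = begin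
    _ ≈⟨ solve 2 (λ f t → f := (f :+ t) :- t) _ (⌜ 5 ⌝ * q ^ 3 * (ε * e ^ 3)) ⟩
    _ ≈⟨ +-congʳ (trans (sym (trans jac expand)) (cube xy E₁≈)) ⟩
    _ ≈⟨ solve 2 (λ f t → (f :+ t) :- t := f) _ (⌜ 5 ⌝ * q ^ 3 * (ε * e ^ 3)) ⟩
    _ ∎
    where
    expand : (1# - 1# ^ 4) * u - q * ((1# - 1# ^ 3) * v) + ε * D₁ 1# q s u s′ v j ≈
      ε * (⌜ 10 ⌝ * s + b * e) + q * (ε * - (⌜ 10 ⌝ * s′ + ⌜ 3 ⌝ * (a * e))) + ⌜ 5 ⌝ * q ^ 3 * (ε * e ^ 3)
    expand = trans (solve 7 (λ ε s be q s′ ae j →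
                 (# 1 :- # 1 :^ 4) :* be :- q :* ((# 1 :- # 1 :^ 3) :* ae) :+ ε :* (# 5 :* (# 1 :+ # 1 :^ 4) :* s :+ # 1 :^ 4 :* be
                   :- q :* (# 5 :* (# 1 :+ # 1 :^ 3) :* s′ :+ (# 1 :+ # 2 :* # 1 :^ 3) :* ae) :+ # 5 :* # 1 :^ 2 :* q :^ 3 :* j)
                 := ε :* (# 10 :* s :+ be) :+ q :* (ε :* :- (# 10 :* s′ :+ # 3 :* ae)) :+ # 5 :* q :^ 3 :* (ε :* j))
               ε s u q s′ v j)
      (+-cong (+-cong (*-congˡ (+-congˡ ub)) (*-congˡ (*-congˡ (-‿cong (+-congˡ (*-congˡ va)))))) (*-congˡ εj))

  L : (x y q : Carrier) → Carrier
  L x y q = y ^ 2 * (ℓ₃ * x ^ 5 + ℓ₂ * x ^ 4 * q + ℓ₁ * x ^ 3 * q ^ 2 + ℓ₀ * x ^ 2 * q ^ 3 + ℓ₋₁ * x * q ^ 4 + ℓ₋₂ * q ^ 5)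

  d : Carrier
  d = 1# - z ^ 4

  private
    sextic : (c₆ c₅ c₃ c₁ c₀ y x q : Carrier) → Carrier
    sextic c₆ c₅ c₃ c₁ c₀ y x q = y ^ 3 * (c₆ * x ^ 6 + c₅ * x ^ 5 * q + c₃ * x ^ 3 * q ^ 3 + c₁ * x * q ^ 5 + c₀ * q ^ 6)

    sextic-cong : ∀ {c₆ c₅ c₃ c₁ c₀ d₆ d₅ d₃ d₁ d₀} y x q → c₆ ≈ d₆ → c₅ ≈ d₅ → c₃ ≈ d₃ → c₁ ≈ d₁ → c₀ ≈ d₀ →
      sextic c₆ c₅ c₃ c₁ c₀ y x q ≈ sextic d₆ d₅ d₃ d₁ d₀ y x q
    sextic-cong y x q p₆ p₅ p₃ p₁ p₀ = *-congˡ (+-cong (+-cong (+-cong (+-cong (*-congʳ p₆) (*-congʳ (*-congʳ p₅))) (*-congʳ (*-congʳ p₃))) (*-congʳ (*-congʳ p₁))) (*-congʳ p₀))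

    Γ : ∀ x y q → sextic (⌜ 5 ⌝ * (1# + z ^ 4)) (- (⌜ 15 ⌝ * (z + z ^ 3))) (⌜ 50 ⌝ * z ^ 2) (- (⌜ 15 ⌝ * (1# + z ^ 4))) (- (⌜ 5 ⌝ * (z + z ^ 3))) y x q
      ≈ d * (y * (x - q * c)) * L x y q
    Γ x y q = sym (begin
      d * (y * (x - q * c)) * L x y q
        ≈⟨ solve 11 (λ d c l₃ l₂ l₁ l₀ l₋ l₌ x y q →
             d :* (y :* (x :- q :* c)) :* (y :^ 2 :* (l₃ :* x :^ 5 :+ l₂ :* x :^ 4 :* q :+ l₁ :* x :^ 3 :* q :^ 2 :+ l₀ :* x :^ 2 :* q :^ 3 :+ l₋ :* x :* q :^ 4 :+ l₌ :* q :^ 5))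
             := y :^ 3 :* (d :* l₃ :* x :^ 6 :+ d :* (l₂ :- c :* l₃) :* x :^ 5 :* q :+ d :* (l₀ :- c :* l₁) :* x :^ 3 :* q :^ 3
                  :+ d :* (l₌ :- c :* l₋) :* x :* q :^ 5 :+ d :* (:- (c :* l₌)) :* q :^ 6)
                :+ (d :* (l₁ :- c :* l₂) :* (y :^ 3 :* x :^ 4 :* q :^ 2) :+ d :* (l₋ :- c :* l₀) :* (y :^ 3 :* x :^ 2 :* q :^ 4)))
             d c ℓ₃ ℓ₂ ℓ₁ ℓ₀ ℓ₋₁ ℓ₋₂ x y q ⟩
      sextic (d * ℓ₃) (d * (ℓ₂ - c * ℓ₃)) (d * (ℓ₀ - c * ℓ₁)) (d * (ℓ₋₂ - c * ℓ₋₁)) (d * (- (c * ℓ₋₂))) y x q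
        + (d * (ℓ₁ - c * ℓ₂) * (y ^ 3 * x ^ 4 * q ^ 2) + d * (ℓ₋₁ - c * ℓ₀) * (y ^ 3 * x ^ 2 * q ^ 4))
        ≈⟨ negligible⁺ _ _ _ quotient2 quotient4 ⟩
      sextic (d * ℓ₃) (d * (ℓ₂ - c * ℓ₃)) (d * (ℓ₀ - c * ℓ₁)) (d * (ℓ₋₂ - c * ℓ₋₁)) (d * (- (c * ℓ₋₂))) y x q
        ≈⟨ sextic-cong y x q quotient0 quotient1 quotient3 quotient5 quotient6 ⟩
      _ ∎)

  θ₁ev : ∀ {q a b e v x y} → b * v ≈ 1# → y ≈ a * v → x * y ≈ 1# → e * (b - q * (c * a)) * (e ^ 2 * v) ≈ e ^ 3 * (y * (x - q * c))
  θ₁ev {q} {a} {b} {e} {v} {x} {y} bv y≈ xy = begin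
    e * (b - q * (c * a)) * (e ^ 2 * v)
      ≈⟨ solve 6 (λ e b q c a v → e :* (b :- q :* (c :* a)) :* (e :^ 2 :* v) := e :^ 3 :* (b :* v :- q :* c :* (a :* v))) e b q c a v ⟩
    e ^ 3 * (b * v - q * c * (a * v)) ≈⟨ *-congˡ (+-cong (trans bv (trans (sym xy) (*-comm x y))) (-‿cong (*-congˡ (sym y≈)))) ⟩
    e ^ 3 * (y * x - q * c * y) ≈⟨ solve 5 (λ e y x q c → e :* (y :* x :- q :* c :* y) := e :* (y :* (x :- q :* c))) (e ^ 3) y x q c ⟩
    e ^ 3 * (y * (x - q * c)) ∎

  10εD₁ : ∀ {q ε a b e v x y s s′ u t j} → b * v ≈ 1# → y ≈ a * v → x * y ≈ 1# → u ≈ b * e → t ≈ a * e →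
    ε * (⌜ 10 ⌝ * s + b * e) ≈ ε * (e ^ 3 * y ^ 3 * (x ^ 6 - ⌜ 3 ⌝ * q ^ 5 * x)) →
    ε * - (⌜ 10 ⌝ * s′ + ⌜ 3 ⌝ * (a * e)) ≈ ε * - (e ^ 3 * y ^ 3 * (⌜ 3 ⌝ * x ^ 5 + q ^ 5)) → ε * j ≈ ε * e ^ 3 →
    ⌜ 10 ⌝ * (ε * D₁ z q s u s′ t j) ≈ ε * (d * (e * (b - q * (c * a))) * (e ^ 2 * v * L x y q - ⌜ 5 ⌝))
  10εD₁ {q} {ε} {a} {b} {e} {v} {x} {y} {s} {s′} {u} {t} {j} bv y≈ xy ub ta εs εs′ εj = begin
    ⌜ 10 ⌝ * (ε * D₁ z q s u s′ t j)
      ≈⟨ *-congˡ (*-congˡ (+-congʳ (+-cong (+-congˡ (*-congˡ ub)) (-‿cong (*-congˡ (+-congˡ (*-congˡ ta))))))) ⟩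
    ⌜ 10 ⌝ * (ε * D₁ z q s (b * e) s′ (a * e) j)
      ≈⟨ solve 8 (λ ε z s be q s′ ae j → # 10 :* (ε :* (# 5 :* (# 1 :+ z :^ 4) :* s :+ z :^ 4 :* be
             :- q :* (# 5 :* (z :+ z :^ 3) :* s′ :+ (z :+ # 2 :* z :^ 3) :* ae) :+ # 5 :* z :^ 2 :* q :^ 3 :* j))
           := # 5 :* (# 1 :+ z :^ 4) :* (ε :* (# 10 :* s :+ be)) :+ # 5 :* q :* (z :+ z :^ 3) :* (ε :* :- (# 10 :* s′ :+ # 3 :* ae))
              :+ # 50 :* z :^ 2 :* q :^ 3 :* (ε :* j) :- # 5 :* ε :* ((# 1 :- z :^ 4) :* be :- q :* ((z :- z :^ 3) :* ae)))
         ε z s (b * e) q s′ (a * e) j ⟩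
    combination (ε * (⌜ 10 ⌝ * s + b * e)) (ε * - (⌜ 10 ⌝ * s′ + ⌜ 3 ⌝ * (a * e))) (ε * j) (z - z ^ 3)
      ≈⟨ +-cong (+-cong (+-cong (*-congˡ εs) (*-congˡ εs′)) (*-congˡ (trans εj (sym (trans (*-congˡ (trans (^-congˡ 3 xy) (solve 0 (# 1 :^ 3 := # 1)))) (*-identityʳ _))))))
           (-‿cong (*-congˡ (+-congˡ (-‿cong (*-congˡ (*-congʳ (sym z-z³))))))) ⟩
    combination (ε * (e ^ 3 * y ^ 3 * (x ^ 6 - ⌜ 3 ⌝ * q ^ 5 * x))) (ε * - (e ^ 3 * y ^ 3 * (⌜ 3 ⌝ * x ^ 5 + q ^ 5))) (ε * e ^ 3 * (x * y) ^ 3) ((1# - z ^ 4) * c)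
      ≈⟨ solve 9 (λ ε z e y x q b a c →
           # 5 :* (# 1 :+ z :^ 4) :* (ε :* (e :^ 3 :* y :^ 3 :* (x :^ 6 :- # 3 :* q :^ 5 :* x)))
           :+ # 5 :* q :* (z :+ z :^ 3) :* (ε :* :- (e :^ 3 :* y :^ 3 :* (# 3 :* x :^ 5 :+ q :^ 5)))
           :+ # 50 :* z :^ 2 :* q :^ 3 :* (ε :* e :^ 3 :* (x :* y) :^ 3)
           :- # 5 :* ε :* ((# 1 :- z :^ 4) :* (b :* e) :- q :* ((# 1 :- z :^ 4) :* c :* (a :* e)))
           := ε :* (e :^ 3 :* (y :^ 3 :* (# 5 :* (# 1 :+ z :^ 4) :* x :^ 6 :+ :- (# 15 :* (z :+ z :^ 3)) :* x :^ 5 :* q :+ # 50 :* z :^ 2 :* x :^ 3 :* q :^ 3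
               :+ :- (# 15 :* (# 1 :+ z :^ 4)) :* x :* q :^ 5 :+ :- (# 5 :* (z :+ z :^ 3)) :* q :^ 6))
              :- (# 1 :- z :^ 4) :* (e :* (b :- q :* (c :* a))) :* # 5)) ε z e y x q b a c ⟩
    ε * (e ^ 3 * sextic (⌜ 5 ⌝ * (1# + z ^ 4)) (- (⌜ 15 ⌝ * (z + z ^ 3))) (⌜ 50 ⌝ * z ^ 2) (- (⌜ 15 ⌝ * (1# + z ^ 4))) (- (⌜ 5 ⌝ * (z + z ^ 3))) y x q - d * θ * ⌜ 5 ⌝)
      ≈⟨ *-congˡ (+-congʳ (*-congˡ (Γ x y q))) ⟩
    ε * (e ^ 3 * (d * (y * (x - q * c)) * L x y q) - d * θ * ⌜ 5 ⌝)
      ≈⟨ *-congˡ (+-congʳ (trans (solve 4 (λ e d t l → e :* (d :* t :* l) := d :* (e :* t) :* l) (e ^ 3) d (y * (x - q * c)) (L x y q))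
           (*-congʳ (*-congˡ (sym (θ₁ev bv y≈ xy)))))) ⟩
    ε * (d * (θ * (e ^ 2 * v)) * L x y q - d * θ * ⌜ 5 ⌝)
      ≈⟨ solve 5 (λ ε d t k l → ε :* (d :* (t :* k) :* l :- d :* t :* # 5) := ε :* (d :* t :* (k :* l :- # 5))) ε d θ (e ^ 2 * v) (L x y q) ⟩
    ε * (d * θ * (e ^ 2 * v * L x y q - ⌜ 5 ⌝)) ∎
    where
    θ : Carrier
    θ = e * (b - q * (c * a))
    combination : (f g h k : Carrier) → Carrier
    combination f g h k = ⌜ 5 ⌝ * (1# + z ^ 4) * f + ⌜ 5 ⌝ * q * (z + z ^ 3) * g + ⌜ 50 ⌝ * z ^ 2 * q ^ 3 * h
      - ⌜ 5 ⌝ * ε * ((1# - z ^ 4) * (b * e) - q * (k * (a * e)))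

  -- Since ε² = 0, the factor 10 + εη of 10θ(ζ(1 + ε)) is inverted by (10 - εη)/100.
  first-order-inverse : ∀ {ε E₁ θ t M k f} → ε * ε ≈ 0# → ⌜ 5 ⌝ * f ≈ 1# → ∀ h → (1# + 1#) * h ≈ 1# →
    ⌜ 10 ⌝ * t ≈ d * θ * (⌜ 10 ⌝ + ε * (k - ⌜ 5 ⌝)) → M * E₁ * t ≈ 1# - z ^ 4 * (1# - ε) →
    ⌜ 10 ⌝ * M * E₁ * θ ≈ ⌜ 10 ⌝ + ε * (ℓ₃ - k)
  first-order-inverse {ε} {E₁} {θ} {t} {M} {k} {f} ε² 5f h 2h 10t Mt = cancel (⌜ 10 ⌝ * d) _ 10d-unit (begin
    ⌜ 10 ⌝ * M * E₁ * θ * (⌜ 10 ⌝ * d)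
      ≈⟨ solve 4 (λ M E t d → # 10 :* M :* E :* t :* (# 10 :* d) := M :* E :* (d :* t :* # 100)) M E₁ θ d ⟩
    M * E₁ * (d * θ * ⌜ 100 ⌝)
      ≈⟨ *-congˡ (*-congˡ (sym (trans (solve 2 (λ ε η → (# 10 :+ ε :* η) :* (# 10 :- ε :* η) := # 100 :- ε :* ε :* (η :* η)) ε (k - ⌜ 5 ⌝))
           (trans (+-congˡ (-‿cong (trans (*-congʳ ε²) (zeroˡ _)))) (solve 0 (# 100 :- # 0 := # 100)))))) ⟩
    M * E₁ * (d * θ * ((⌜ 10 ⌝ + ε * (k - ⌜ 5 ⌝)) * (⌜ 10 ⌝ - ε * (k - ⌜ 5 ⌝))))
      ≈⟨ *-congˡ (trans (sym (*-assoc _ _ _)) (*-congʳ (sym 10t))) ⟩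
    M * E₁ * (⌜ 10 ⌝ * t * (⌜ 10 ⌝ - ε * (k - ⌜ 5 ⌝)))
      ≈⟨ solve 4 (λ M E t r → M :* E :* (# 10 :* t :* r) := # 10 :* (M :* E :* t) :* r) M E₁ t _ ⟩
    ⌜ 10 ⌝ * (M * E₁ * t) * (⌜ 10 ⌝ - ε * (k - ⌜ 5 ⌝)) ≈⟨ *-congʳ (*-congˡ Mt) ⟩
    ⌜ 10 ⌝ * (1# - z ^ 4 * (1# - ε)) * (⌜ 10 ⌝ - ε * (k - ⌜ 5 ⌝))
      ≈⟨ solve 3 (λ z ε k → # 10 :* (# 1 :- z :^ 4 :* (# 1 :- ε)) :* (# 10 :- ε :* (k :- # 5))
           := # 10 :* (# 10 :* (# 1 :- z :^ 4) :+ ε :* (# 5 :* (# 1 :+ z :^ 4) :- (# 1 :- z :^ 4) :* k)) :- ε :* ε :* (# 10 :* z :^ 4 :* (k :- # 5))) z ε k ⟩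
    _ ≈⟨ trans (+-congˡ (trans (-‿cong (trans (*-congʳ ε²) (zeroˡ _))) (solve 0 (:- # 0 := # 0)))) (+-identityʳ _) ⟩
    ⌜ 10 ⌝ * (⌜ 10 ⌝ * d + ε * (⌜ 5 ⌝ * (1# + z ^ 4) - d * k))
      ≈⟨ *-congˡ (+-congˡ (*-congˡ (+-congʳ (sym quotient0)))) ⟩
    _ ≈⟨ solve 4 (λ d ε l k → # 10 :* (# 10 :* d :+ ε :* (d :* l :- d :* k)) := (# 10 :+ ε :* (l :- k)) :* (# 10 :* d)) d ε ℓ₃ k ⟩
    (⌜ 10 ⌝ + ε * (ℓ₃ - k)) * (⌜ 10 ⌝ * d) ∎)
    where
    10d-unit : (⌜ 10 ⌝ * d) * (f * h * (f * ((1# - z) * (1# - z ^ 2) * (1# - z ^ 3)))) ≈ 1#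
    10d-unit = trans (solve 4 (λ d f h t → # 10 :* d :* (f :* h :* (f :* t)) := (# 5 :* f) :* ((# 1 :+ # 1) :* h) :* (f :* (d :* t))) d f h _)
      (trans (*-cong (trans (*-cong 5f 2h) (*-identityˡ 1#)) (trans (*-congˡ five) (trans (*-comm _ _) 5f))) (*-identityˡ 1#))

  θ₂-reduced : ∀ {q a b e v a⁻ e⁻ x} → a * a⁻ ≈ 1# → e * e⁻ ≈ 1# → x ≈ b * a⁻ → e * (b - q * (c′ * a)) * (a⁻ * v * e⁻) ≈ v * (x - q * c′)
  θ₂-reduced {q} {a} {b} {e} {v} {a⁻} {e⁻} {x} aa⁻ ee⁻ x≈ = begin
    e * (b - q * (c′ * a)) * (a⁻ * v * e⁻)
      ≈⟨ solve 8 (λ e b q c a i v j → e :* (b :- q :* (c :* a)) :* (i :* v :* j) := (e :* j) :* (v :* (b :* i :- q :* (c :* (a :* i))))) e b q c′ a a⁻ v e⁻ ⟩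
    (e * e⁻) * (v * (b * a⁻ - q * (c′ * (a * a⁻)))) ≈⟨ *-cong ee⁻ (*-congˡ (+-cong (sym x≈) (-‿cong (*-congˡ (trans (*-congˡ aa⁻) (*-identityʳ c′)))))) ⟩
    1# * (v * (x - q * c′)) ≈⟨ *-identityˡ _ ⟩
    v * (x - q * c′) ∎

  clear-denominators : ∀ {M E₁ E₅ θ₁ θ₂ u i e w r t} → E₅ ^ 12 * i ≈ 1# → E₅ * u ≈ 1# → E₁ * (e ^ 5 * w) ≈ E₅ ^ 6 → θ₁ * θ₂ ≈ E₁ * E₅ →
    θ₂ * u ≈ t → ⌜ 10 ⌝ * M * E₁ * θ₁ ≈ r → ⌜ 10 ⌝ * M ≈ e ^ 10 * i * w ^ 2 * t * r
  clear-denominators {M} {E₁} {E₅} {θ₁} {θ₂} {u} {i} {e} {w} {r} {t} E₅i E₅u E₁w θθ θ₂u Mθ₁ = begin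
    ⌜ 10 ⌝ * M ≈⟨ sym (*-identityʳ _) ⟩
    ⌜ 10 ⌝ * M * 1# ≈⟨ *-congˡ (sym (trans (*-cong E₅i E₅u) (*-identityˡ 1#))) ⟩
    ⌜ 10 ⌝ * M * ((E₅ ^ 12 * i) * (E₅ * u))
      ≈⟨ solve 4 (λ M E i u → # 10 :* M :* ((E :^ 12 :* i) :* (E :* u)) := # 10 :* M :* (((E :^ 6) :* (E :^ 6) :* i) :* (E :* u))) M E₅ i u ⟩
    ⌜ 10 ⌝ * M * ((E₅ ^ 6 * E₅ ^ 6 * i) * (E₅ * u)) ≈⟨ *-congˡ (*-congʳ (*-congʳ (*-cong (sym E₁w) (sym E₁w)))) ⟩
    ⌜ 10 ⌝ * M * ((E₁ * (e ^ 5 * w) * (E₁ * (e ^ 5 * w)) * i) * (E₅ * u))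
      ≈⟨ solve 7 (λ M E e w i E₅ u → # 10 :* M :* ((E :* (e :^ 5 :* w) :* (E :* (e :^ 5 :* w)) :* i) :* (E₅ :* u))
           := # 10 :* M :* E :* (E :* E₅) :* u :* (e :^ 10 :* i :* w :^ 2)) M E₁ e w i E₅ u ⟩
    ⌜ 10 ⌝ * M * E₁ * (E₁ * E₅) * u * (e ^ 10 * i * w ^ 2) ≈⟨ *-congʳ (*-congʳ (*-congˡ (sym θθ))) ⟩
    ⌜ 10 ⌝ * M * E₁ * (θ₁ * θ₂) * u * (e ^ 10 * i * w ^ 2)
      ≈⟨ solve 5 (λ M t s u g → M :* (t :* s) :* u :* g := g :* (s :* u) :* (M :* t)) (⌜ 10 ⌝ * M * E₁) θ₁ θ₂ u _ ⟩
    e ^ 10 * i * w ^ 2 * (θ₂ * u) * (⌜ 10 ⌝ * M * E₁ * θ₁) ≈⟨ *-cong (*-congˡ θ₂u) Mθ₁ ⟩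
    e ^ 10 * i * w ^ 2 * t * r ∎

  α₁ α₂ : (x q : Carrier) → Carrier
  α₁ x q = eval (α₁ᵖ (var 0F) (var 1F)) (x ∷ q ∷ [])
  α₂ x q = eval (α₂ᵖ (var 0F) (var 1F)) (x ∷ q ∷ [])

  β₁ β₂ : (y x q : Carrier) → Carrier
  β₁ y x q = eval (β₁ᵖ (var 0F) (var 1F) (var 2F)) (y ∷ x ∷ q ∷ [])
  β₂ y x q = eval (β₂ᵖ (var 0F) (var 1F) (var 2F)) (y ∷ x ∷ q ∷ [])

  private
    lin-ℓ₃ : ∀ x q → (x - q * c′) * ℓ₃ ≈ s₁ * α₁ x q + s₂ * α₂ x q
    lin-ℓ₃ x q = begin
      (x - q * c′) * ℓ₃ ≈⟨ solve 5 (λ x q c l₃ l₂ → (x :- q :* c) :* l₃ := x :* l₃ :+ q :* ((l₂ :- c :* l₃) :- l₂)) x q c′ ℓ₃ ℓ₂ ⟩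
      x * ℓ₃ + q * ((ℓ₂ - c′ * ℓ₃) - ℓ₂) ≈⟨ +-congˡ (*-congˡ (+-congʳ product1)) ⟩
      _ ≈⟨ solve 4 (λ x q s t → x :* (:- (# 3 :* s :+ t)) :+ q :* ((:- (# 11 :* s) :- # 2 :* t) :- :- (# 10 :* s)) :=
             s :* α₁ᵖ x q :+ t :* α₂ᵖ x q) x q s₁ s₂ ⟩
      s₁ * α₁ x q + s₂ * α₂ x q ∎

    lin-L : ∀ y x q → (x - q * c′) * L x y q ≈ s₁ * β₁ y x q + s₂ * β₂ y x q
    lin-L y x q = begin
      (x - q * c′) * L x y q
        ≈⟨ solve 10 (λ c l₃ l₂ l₁ l₀ l₋ l₌ x y q →
           (x :- q :* c) :* (y :^ 2 :* (l₃ :* x :^ 5 :+ l₂ :* x :^ 4 :* q :+ l₁ :* x :^ 3 :* q :^ 2 :+ l₀ :* x :^ 2 :* q :^ 3 :+ l₋ :* x :* q :^ 4 :+ l₌ :* q :^ 5))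
           := y :^ 2 :* (l₃ :* x :^ 6 :+ (l₂ :- c :* l₃) :* x :^ 5 :* q :+ (l₁ :- c :* l₂) :* x :^ 4 :* q :^ 2 :+ (l₀ :- c :* l₁) :* x :^ 3 :* q :^ 3
                :+ (l₋ :- c :* l₀) :* x :^ 2 :* q :^ 4 :+ (l₌ :- c :* l₋) :* x :* q :^ 5 :+ (:- (c :* l₌)) :* q :^ 6))
           c′ ℓ₃ ℓ₂ ℓ₁ ℓ₀ ℓ₋₁ ℓ₋₂ x y q ⟩
      septic ℓ₃ (ℓ₂ - c′ * ℓ₃) (ℓ₁ - c′ * ℓ₂) (ℓ₀ - c′ * ℓ₁) (ℓ₋₁ - c′ * ℓ₀) (ℓ₋₂ - c′ * ℓ₋₁) (- (c′ * ℓ₋₂))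
        ≈⟨ *-congˡ (+-cong (+-cong (+-cong (+-cong (+-cong (+-cong (*-congʳ product0) (*-congʳ (*-congʳ product1))) (*-congʳ (*-congʳ product2))) (*-congʳ (*-congʳ product3)))
             (*-congʳ (*-congʳ product4))) (*-congʳ (*-congʳ product5))) (*-congʳ product6)) ⟩
      septic (- (⌜ 3 ⌝ * s₁) - 1# * s₂) (- (⌜ 11 ⌝ * s₁) - ⌜ 2 ⌝ * s₂) (- (⌜ 10 ⌝ * s₁) - ⌜ 20 ⌝ * s₂) (- (⌜ 20 ⌝ * s₁) + ⌜ 10 ⌝ * s₂)
          (⌜ 10 ⌝ * s₁ - ⌜ 30 ⌝ * s₂) (- (⌜ 11 ⌝ * s₁) + ⌜ 13 ⌝ * s₂) (⌜ 3 ⌝ * s₁ - ⌜ 4 ⌝ * s₂)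
        ≈⟨ solve 5 (λ s t x y q →
             y :^ 2 :* ((:- (# 3 :* s) :- # 1 :* t) :* x :^ 6 :+ (:- (# 11 :* s) :- # 2 :* t) :* x :^ 5 :* q :+ (:- (# 10 :* s) :- # 20 :* t) :* x :^ 4 :* q :^ 2
               :+ (:- (# 20 :* s) :+ # 10 :* t) :* x :^ 3 :* q :^ 3 :+ (# 10 :* s :- # 30 :* t) :* x :^ 2 :* q :^ 4 :+ (:- (# 11 :* s) :+ # 13 :* t) :* x :* q :^ 5
               :+ (# 3 :* s :- # 4 :* t) :* q :^ 6)
             := s :* β₁ᵖ y x q :+ t :* β₂ᵖ y x q) s₁ s₂ x y q ⟩
      s₁ * β₁ y x q + s₂ * β₂ y x q ∎
      where
      septic : (c₆ c₅ c₄ c₃ c₂ c₁ c₀ : Carrier) → Carrier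
      septic c₆ c₅ c₄ c₃ c₂ c₁ c₀ = y ^ 2 * (c₆ * x ^ 6 + c₅ * x ^ 5 * q + c₄ * x ^ 4 * q ^ 2 + c₃ * x ^ 3 * q ^ 3 + c₂ * x ^ 2 * q ^ 4 + c₁ * x * q ^ 5 + c₀ * q ^ 6)

  evaluate : (∀ {n} (g v y e x q : Expr ℤ n) → Expr ℤ n) → (g v y e x q : Carrier) → Carrier
  evaluate f g v y e x q = eval (at-variables f) (g ∷ v ∷ y ∷ e ∷ x ∷ q ∷ [])

  split : ∀ {M W ε k x y q} → ⌜ 10 ⌝ * M ≈ W * (x - q * c′) * (⌜ 10 ⌝ + ε * (ℓ₃ - k * L x y q)) →
    ⌜ 10 ⌝ * M ≈ ⌜ 10 ⌝ * W * x - c′ * (⌜ 10 ⌝ * W * q) + (ε * s₁ * (W * (α₁ x q - k * β₁ y x q)) + ε * s₂ * (W * (α₂ x q - k * β₂ y x q)))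
  split {M} {W} {ε} {k} {x} {y} {q} 10M = begin
    ⌜ 10 ⌝ * M ≈⟨ 10M ⟩
    W * (x - q * c′) * (⌜ 10 ⌝ + ε * (ℓ₃ - k * L x y q))
      ≈⟨ solve 8 (λ W x q c ε l k L → W :* (x :- q :* c) :* (# 10 :+ ε :* (l :- k :* L)) :=
           # 10 :* W :* x :- c :* (# 10 :* W :* q) :+ W :* ε :* ((x :- q :* c) :* l :- k :* ((x :- q :* c) :* L))) W x q c′ ε ℓ₃ k (L x y q) ⟩
    _ ≈⟨ +-congˡ (*-congˡ (+-cong (lin-ℓ₃ x q) (-‿cong (*-congˡ (lin-L y x q))))) ⟩
    _ ≈⟨ +-congˡ (solve 9 (λ W ε s t a a′ k b b′ → W :* ε :* (s :* a :+ t :* a′ :- k :* (s :* b :+ t :* b′)) :=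
           ε :* s :* (W :* (a :- k :* b)) :+ ε :* t :* (W :* (a′ :- k :* b′))) W ε s₁ s₂ (α₁ x q) (α₂ x q) k (β₁ y x q) (β₂ y x q)) ⟩
    _ ∎

  dissected : ∀ g v y e x q → evaluate H₁ᵖ g v y e x q + ⌜ 2 ⌝ * evaluate H₂ᵖ g v y e x q ≈
    evaluate (partᵖ 0) g v y e x (q ^ 5) + q * (evaluate (partᵖ 1) g v y e x (q ^ 5) + q * (evaluate (partᵖ 2) g v y e x (q ^ 5)
      + q * (evaluate (partᵖ 3) g v y e x (q ^ 5) + q * evaluate (partᵖ 4) g v y e x (q ^ 5))))
  dissected = solve 6 (λ g v y e x q → let part = λ r → partᵖ r g v y e x (q :^ 5) in
    H₁ᵖ g v y e x q :+ # 2 :* H₂ᵖ g v y e x q := part 0 :+ q :* (part 1 :+ q :* (part 2 :+ q :* (part 3 :+ q :* part 4))))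

module QuinticIdentities {r ℓ} (K : CommutativeRing r ℓ) (z : CommutativeRing.Carrier K) (Φ₀ : Scalars.IsFifthRoot K z)
  (fifth : CommutativeRing.Carrier K) (fifth≈ : Scalars.IsFifth K fifth) (A⁻¹ B⁻¹ E₁⁻¹ : ThetaSeries.Series K)
  (AA⁻¹ : ThetaSeries.IsInverse K (ThetaSeries.A K) A⁻¹) (BB⁻¹ : ThetaSeries.IsInverse K (ThetaSeries.B K) B⁻¹)
  (E₁E₁⁻¹ : ThetaSeries.IsInverse K (ThetaSeries.E₁ K) E₁⁻¹) where
  open FifthRoots K z Φ₀ fifth fifth≈
  private
    module K = CommutativeRing K
    module KE = Exp K.semiring
    module I = IntegerSolver seriesRing
  open I using (solve)
  open QuinticAlgebra seriesRing ζ Φζ using (E₁-form; E₅-form; p; inverse-form; jacobi-parts; L; d; 10εD₁; first-order-inverse; θ₂-reduced; clear-denominators; split; dissected; evaluate)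
  open PartPolynomials
  open SetoidReasoning setoid

  X Y a b e a⁻ v e⁻ x y : Series
  X = B * A⁻¹
  Y = A * B⁻¹
  a = φ A
  b = φ B
  e = φ E₅
  a⁻ = φ A⁻¹
  v = φ B⁻¹
  e⁻ = φ (A * B * E₁⁻¹)
  x = φ X
  y = φ Y

  φ-unit : ∀ {f g} → f * g ≋ 1# → φ f * φ g ≋ 1#
  φ-unit p = trans (sym (φ.*-hom _ _)) (trans (φ.⟦⟧-cong p) φ.1-hom)

  aa⁻ : a * a⁻ ≋ 1#
  aa⁻ = φ-unit AA⁻¹
  bv : b * v ≋ 1#
  bv = φ-unit BB⁻¹
  ee⁻ : e * e⁻ ≋ 1#
  ee⁻ = φ-unit (trans (solve 4 (λ E a b i → E :* (a :* b :* i) := (a :* b :* E) :* i) _ _ _ _)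
    (trans (*-congʳ (sym E₁≋ABE₅)) E₁E₁⁻¹))

  x≋ : x ≋ b * a⁻
  x≋ = φ.*-hom _ _
  y≋ : y ≋ a * v
  y≋ = φ.*-hom _ _

  XY : X * Y ≋ 1#
  XY = trans (solve 4 (λ b i a j → (b :* i) :* (a :* j) := (a :* i) :* (b :* j)) _ _ _ _) (trans (*-cong AA⁻¹ BB⁻¹) (*-identityˡ _))

  xy : x * y ≋ 1#
  xy = φ-unit XY

  xa : x * a ≋ b
  xa = trans (*-congʳ x≋) (trans (solve 3 (λ b i a → b :* i :* a := b :* (a :* i)) _ _ _) (trans (*-congˡ aa⁻) (*-identityʳ _)))

  yb : y * b ≋ a
  yb = trans (*-congʳ y≋) (trans (solve 3 (λ b i a → b :* i :* a := b :* (a :* i)) _ _ _) (trans (*-congˡ bv) (*-identityʳ _)))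

  E₅≋ : E₅ ≋ a * b * e
  E₅≋ = trans (sym φE₁≋E₅) (trans (φ.⟦⟧-cong E₁≋ABE₅) (trans (φ.*-hom _ _) (*-congʳ (φ.*-hom _ _))))

  be : φ (B * E₅) ≋ b * e
  be = φ.*-hom _ _
  ae : φ (A * E₅) ≋ a * e
  ae = φ.*-hom _ _

  θ₁≋ : θ₁ ≋ e * (b - q * (c * a))
  θ₁≋ = trans (+-cong be (-‿cong (*-congˡ (*-congˡ ae)))) (solve 5 (λ b e q c a → b :* e :- q :* (c :* (a :* e)) := e :* (b :- q :* (c :* a))) _ _ _ _ _)
  θ₂≋ : θ₂ ≋ e * (b - q * (c′ * a))
  θ₂≋ = trans (+-cong be (-‿cong (*-congˡ (*-congˡ ae)))) (solve 5 (λ b e q c a → b :* e :- q :* (c :* (a :* e)) := e :* (b :- q :* (c :* a))) _ _ _ _ _)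

  E₁ab : E₁ * (a * b) ≋ e * ((b - q * (c * a)) * (b - q * (c′ * a)))
  E₁ab = cancel e e⁻ ee⁻ (begin
    E₁ * (a * b) * e  ≈⟨ *-assoc _ _ _ ⟩
    E₁ * (a * b * e)  ≈⟨ *-congˡ (sym E₅≋) ⟩
    E₁ * E₅           ≈⟨ sym θ₁θ₂ ⟩
    θ₁ * θ₂           ≈⟨ *-cong θ₁≋ θ₂≋ ⟩
    _                 ≈⟨ solve 3 (λ e f g → (e :* f) :* (e :* g) := (e :* (f :* g)) :* e) _ _ _ ⟩
    e * ((b - q * (c * a)) * (b - q * (c′ * a))) * e ∎)

  ab-unit : (a * b) * (a⁻ * v) ≋ 1#
  ab-unit = trans (solve 4 (λ a b c d → (a :* b) :* (c :* d) := (a :* c) :* (b :* d)) _ _ _ _) (trans (*-cong aa⁻ bv) (*-identityˡ _))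

  E₁≋ : E₁ ≋ e * y * (x ^ 2 - q * x - q ^ 2)
  E₁≋ = E₁-form ab-unit xa yb E₁ab

  φ-ζ : φ ζ ≋ ζ
  φ-ζ = φ-κ z
  φ-c : φ c ≋ c
  φ-c = trans (φ.+-hom _ _) (+-cong (trans (φ.+-hom _ _) (+-cong φ.1-hom φ-ζ)) (trans (φ.^-hom ζ 4) (^-congˡ 4 φ-ζ)))
  φ-c′ : φ c′ ≋ c′
  φ-c′ = trans (φ.+-hom _ _) (+-cong (trans (φ.+-hom _ _) (+-cong φ.1-hom (trans (φ.^-hom ζ 2) (^-congˡ 2 φ-ζ)))) (trans (φ.^-hom ζ 3) (^-congˡ 3 φ-ζ)))

  norm-linear : ∀ f g → norm (φ f - q * φ g) ≋ φ f ^ 5 - (q * φ g) ^ 5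
  norm-linear f g = trans (*-cong (*-cong (*-cong (*-cong (at-root 0 (*-identityˡ _)) (at-root 1 (*-congʳ (*-identityʳ ζ)))) (at-root 2 refl)) (at-root 3 refl)) (at-root 4 refl))
    (∏roots (φ f) (q * φ g))
    where
    at-root : ∀ i {t} → ζ ^ i * (q * φ g) ≋ t → Twist.σ K (z KE.^ i) (φ f - q * φ g) ≋ φ f - t
    at-root i p = trans (T.sub-hom _ _) (+-cong (σ-φ (z KE.^ i) (zⁱ⁵ i) f) (-‿cong
      (trans (T.*-hom q (φ g)) (trans (*-cong (norm-q^ i) (σ-φ (z KE.^ i) (zⁱ⁵ i) g)) (trans (*-assoc _ _ _) p)))))
      where module T = RingHom (Twist.σHom K (z KE.^ i))

  norm-factor : ∀ γ → φ γ ≋ γ → norm (b - q * (γ * a)) ≋ b ^ 5 - (q * (γ * a)) ^ 5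
  norm-factor γ p = trans (norm-cong (+-congˡ (-‿cong (*-congˡ γa)))) (trans (norm-linear B (γ * A)) (+-congˡ (-‿cong (^-congˡ 5 (*-congˡ (sym γa))))))
    where
    γa : γ * a ≋ φ (γ * A)
    γa = sym (trans (φ.*-hom _ _) (*-congʳ p))

  E₅⁶ : E₅ ^ 6 ≋ e ^ 6 * y ^ 5 * (x ^ 10 - ⌜ 11 ⌝ * q ^ 5 * x ^ 5 - q ^ 10)
  E₅⁶ = cancel ((a * b) ^ 5) ((a⁻ * v) ^ 5) (trans (sym (^-distrib-* (a * b) (a⁻ * v) 5)) (trans (^-congˡ 5 ab-unit) (solve 0 (# 1 :^ 5 := # 1)))) (begin
    E₅ ^ 6 * (a * b) ^ 5
      ≈⟨ solve 2 (λ E f → E :^ 6 :* f :^ 5 := (E :* E :^ 5) :* f :^ 5) _ _ ⟩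
    E₅ * E₅ ^ 5 * (a * b) ^ 5
      ≈⟨ *-congʳ (*-congʳ E₅≋) ⟩
    a * b * e * E₅ ^ 5 * (a * b) ^ 5
      ≈⟨ solve 4 (λ f e E g → f :* e :* E :* g := e :* (f :* E :* g)) (a * b) e (E₅ ^ 5) ((a * b) ^ 5) ⟩
    e * (a * b * E₅ ^ 5 * (a * b) ^ 5)
      ≈⟨ *-congˡ (*-cong (trans (*-congʳ (sym (φ.*-hom A B))) (sym norm-E₁)) (^-congˡ 5 (sym (φ.*-hom A B)))) ⟩
    e * (norm E₁ * φ (A * B) ^ 5)
      ≈⟨ *-congˡ (trans (*-congˡ (sym (norm-φ (A * B)))) (sym (norm-* E₁ (φ (A * B))))) ⟩
    e * norm (E₁ * φ (A * B))
      ≈⟨ *-congˡ (norm-cong (trans (*-congˡ (φ.*-hom A B)) E₁ab)) ⟩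
    e * norm (e * ((b - q * (c * a)) * (b - q * (c′ * a))))
      ≈⟨ *-congˡ (trans (norm-* _ _) (*-cong (norm-φ E₅) (trans (norm-* _ _) (*-cong (norm-factor c φ-c) (norm-factor c′ φ-c′))))) ⟩
    e * (e ^ 5 * ((b ^ 5 - (q * (c * a)) ^ 5) * (b ^ 5 - (q * (c′ * a)) ^ 5)))
      ≈⟨ E₅-form xa yb ⟩
    e ^ 6 * y ^ 5 * (x ^ 10 - ⌜ 11 ⌝ * q ^ 5 * x ^ 5 - q ^ 10) * (a * b) ^ 5 ∎)

  E₁-inverse : E₁ * (e ^ 5 * (y ^ 4 * p x q)) ≋ E₅ ^ 6
  E₁-inverse = inverse-form E₁≋ E₅⁶

  G₀ G : Series
  G₀ = E₅ ^ 10 * E₁⁻¹ ^ 12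
  G  = e ^ 10 * φ E₁⁻¹ ^ 12

  part-series : ℕ → Series
  part-series r = evaluate (partᵖ r) G₀ B⁻¹ Y E₅ X q

  evalᶠ : ∀ r → φ (part-series r) ≋ evaluate (partᵖ r) G v y e x (q ^ 5)
  evalᶠ r = trans (φ.eval-hom (at-variables (partᵖ r)) _) (I.eval-cong (at-variables (partᵖ r)) λ where
    0F → trans (φ.*-hom _ _) (*-cong (φ.^-hom E₅ 10) (φ.^-hom E₁⁻¹ 12))
    1F → refl
    2F → refl
    3F → refl
    4F → refl
    5F → φ-q)

  W H₁ H₂ H : Series
  W  = evaluate Wᵖ G v y e x q
  H₁ = evaluate H₁ᵖ G v y e x q
  H₂ = evaluate H₂ᵖ G v y e x q
  H  = H₁ + ⌜ 2 ⌝ * H₂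

  H-recombine : H ≋ recombine (part-series 0) (part-series 1) (part-series 2) (part-series 3) (part-series 4)
  H-recombine = trans (dissected G v y e x q)
    (sym (+-cong (evalᶠ 0) (*-congˡ (+-cong (evalᶠ 1) (*-congˡ (+-cong (evalᶠ 2) (*-congˡ (+-cong (evalᶠ 3) (*-congˡ (evalᶠ 4))))))))))

  -- ε is an infinitesimal, and M stands for 1/((Zq, Z⁻¹q; q)_∞ (q; q)²_∞) with Z = ζ(1 + ε).
  module CrankSeries (ε₀ half : K.Carrier) (ε₀² : ε₀ K.* ε₀ K.≈ K.0#) (half≈ : Scalars.IsHalf K half) where
    ε : Series
    ε = κ ε₀

    ε² : ε * ε ≋ 0#
    ε² = trans (sym (κ-* _ _)) (trans (κ-cong ε₀²) κ.0-hom)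

    φ-ε : φ ε ≋ ε
    φ-ε = φ-κ ε₀

    private
      εj : ε * φ (φ J) ≋ ε * e ^ 3
      εj = trans (sym (φφε J)) (trans (φ.⟦⟧-cong (φ.⟦⟧-cong (εJ ε ε²))) (trans (φφε (E₁ ^ 3))
          (*-congˡ (trans (φ.⟦⟧-cong (φ.^-hom E₁ 3)) (trans (φ.^-hom (φ E₁) 3) (^-congˡ 3 (φ.⟦⟧-cong φE₁≋E₅)))))))
        where
        φφε : ∀ f → φ (φ (ε * f)) ≋ ε * φ (φ f)
        φφε f = trans (φ.⟦⟧-cong (trans (φ.*-hom ε f) (*-congʳ φ-ε))) (trans (φ.*-hom ε (φ f)) (*-congʳ φ-ε))

      f₀ f₁ g₀ g₁ : Series
      f₀ = ε * (⌜ 10 ⌝ * S + B * E₅)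
      f₁ = ε * - (⌜ 10 ⌝ * S′ + ⌜ 3 ⌝ * (A * E₅))
      g₀ = ε * (E₅ ^ 3 * Y ^ 3 * (X ^ 6 - ⌜ 3 ⌝ * q * X))
      g₁ = ε * - (E₅ ^ 3 * Y ^ 3 * (⌜ 3 ⌝ * X ^ 5 + q))

      φ-⌜⌝ : ∀ n → φ ⌜ n ⌝ ≋ ⌜ n ⌝
      φ-⌜⌝ zero          = φ.0-hom
      φ-⌜⌝ (suc zero)    = φ.1-hom
      φ-⌜⌝ (suc (suc n)) = trans (φ.⟦⟧-cong (I.fromℤ-+ (ℤ.+ 1) (ℤ.+ suc n))) (trans (φ.+-hom _ _) (trans (+-cong φ.1-hom (φ-⌜⌝ (suc n))) (sym (I.fromℤ-+ (ℤ.+ 1) (ℤ.+ suc n)))))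

      φf₀ : φ f₀ ≋ ε * (⌜ 10 ⌝ * φ S + b * e)
      φf₀ = trans (φ.*-hom _ _) (*-cong φ-ε (trans (φ.+-hom _ _) (+-cong (trans (φ.*-hom _ _) (*-congʳ (φ-⌜⌝ 10))) be)))

      φf₁ : φ f₁ ≋ ε * - (⌜ 10 ⌝ * φ S′ + ⌜ 3 ⌝ * (a * e))
      φf₁ = trans (φ.*-hom _ _) (*-cong φ-ε (trans (φ.neg-hom _) (-‿cong (trans (φ.+-hom _ _)
        (+-cong (trans (φ.*-hom _ _) (*-congʳ (φ-⌜⌝ 10))) (trans (φ.*-hom _ _) (*-cong (φ-⌜⌝ 3) ae)))))))

      φg₀ : φ g₀ ≋ ε * (e ^ 3 * y ^ 3 * (x ^ 6 - ⌜ 3 ⌝ * q ^ 5 * x))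
      φg₀ = trans (φ.*-hom _ _) (*-cong φ-ε (trans (φ.*-hom _ _) (*-cong (trans (φ.*-hom _ _) (*-cong (φ.^-hom E₅ 3) (φ.^-hom Y 3)))
        (trans (φ.sub-hom _ _) (+-cong (φ.^-hom X 6) (-‿cong (trans (φ.*-hom _ _) (*-congʳ (trans (φ.*-hom _ _) (*-cong (φ-⌜⌝ 3) φ-q))))))))))

      φg₁ : φ g₁ ≋ ε * - (e ^ 3 * y ^ 3 * (⌜ 3 ⌝ * x ^ 5 + q ^ 5))
      φg₁ = trans (φ.*-hom _ _) (*-cong φ-ε (trans (φ.neg-hom _) (-‿cong (trans (φ.*-hom _ _) (*-cong (trans (φ.*-hom _ _) (*-cong (φ.^-hom E₅ 3) (φ.^-hom Y 3)))
        (trans (φ.+-hom _ _) (+-cong (trans (φ.*-hom _ _) (*-cong (φ-⌜⌝ 3) (φ.^-hom X 5))) φ-q)))))))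

      recombined : recombine f₀ f₁ 0# 0# 0# ≋ recombine g₀ g₁ 0# 0# 0#
      recombined = trans (two f₀ f₁) (trans (+-cong φf₀ (*-congˡ φf₁)) (trans (jacobi-parts xy E₁≋ be ae εj (ε-jacobi ε ε²)) (trans (sym (+-cong φg₀ (*-congˡ φg₁))) (sym (two g₀ g₁)))))
        where
        two : ∀ f g → recombine f g 0# 0# 0# ≋ φ f + q * φ g
        two f g = +-congˡ (*-congˡ (trans (+-congˡ (trans (*-congˡ (trans (+-cong φ.0-hom (*-congˡ (trans (+-cong φ.0-hom (*-congˡ φ.0-hom)) (solve 1 (λ q → # 0 :+ q :* # 0 := # 0) q))))
          (solve 1 (λ q → # 0 :+ q :* # 0 := # 0) q))) (zeroʳ q))) (+-identityʳ _)))

    εS : ε * (⌜ 10 ⌝ * S + B * E₅) ≋ ε * (E₅ ^ 3 * Y ^ 3 * (X ^ 6 - ⌜ 3 ⌝ * q * X))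
    εS = trans (sym (part₀-recombine f₀ f₁ 0# 0# 0#)) (trans (part-cong 0 recombined) (part₀-recombine g₀ g₁ 0# 0# 0#))

    private
      f₁≋g₁ : f₁ ≋ g₁
      f₁≋g₁ = trans (sym (part₁-recombine f₀ f₁ 0# 0# 0#)) (trans (part-cong 1 recombined) (part₁-recombine g₀ g₁ 0# 0# 0#))

      εs : ε * (⌜ 10 ⌝ * φ S + b * e) ≋ ε * (e ^ 3 * y ^ 3 * (x ^ 6 - ⌜ 3 ⌝ * q ^ 5 * x))
      εs = trans (sym φf₀) (trans (φ.⟦⟧-cong εS) φg₀)

      εs′ : ε * - (⌜ 10 ⌝ * φ S′ + ⌜ 3 ⌝ * (a * e)) ≋ ε * - (e ^ 3 * y ^ 3 * (⌜ 3 ⌝ * x ^ 5 + q ^ 5))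
      εs′ = trans (sym φf₁) (trans (φ.⟦⟧-cong f₁≋g₁) φg₁)

    open FirstOrder ζ ε z⁵ ε² using (Z; Z′; theta; theta-dissection) public

    private
      k η : Series
      k = e ^ 2 * v * L x y q
      η = k - ⌜ 5 ⌝

      10theta : ⌜ 10 ⌝ * theta ≋ d * (e * (b - q * (c * a))) * (⌜ 10 ⌝ + ε * η)
      10theta = begin
        ⌜ 10 ⌝ * theta ≈⟨ *-congˡ theta-dissection ⟩
        _ ≈⟨ solve 6 (λ d be q zc ae t → # 10 :* (d :* be :- q :* (zc :* ae) :+ t) := # 10 :* (d :* be :- q :* (zc :* ae)) :+ # 10 :* t)
               d (φ (B * E₅)) q (ζ - ζ ^ 3) (φ (A * E₅)) _ ⟩
        _ ≈⟨ +-cong (*-congˡ (+-cong (*-congˡ be) (-‿cong (*-congˡ (*-cong (sym z-z³) ae))))) (10εD₁ bv y≋ xy be ae εs εs′ εj) ⟩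
        _ ≈⟨ solve 8 (λ d b e q c a ε η → # 10 :* (d :* (b :* e) :- q :* (d :* c :* (a :* e))) :+ ε :* (d :* (e :* (b :- q :* (c :* a))) :* η) :=
               d :* (e :* (b :- q :* (c :* a))) :* (# 10 :+ ε :* η)) d b e q c a ε η ⟩
        d * (e * (b - q * (c * a))) * (⌜ 10 ⌝ + ε * η) ∎

      half′ : (1# + 1#) * κ half ≋ 1#
      half′ = trans (*-congʳ (sym (κ-+ _ _))) (trans (sym (κ-* _ _)) (κ-cong half≈))

      E₅-unit : E₅ ^ 12 * φ E₁⁻¹ ^ 12 ≋ 1#
      E₅-unit = trans (sym (^-distrib-* E₅ (φ E₁⁻¹) 12)) (trans (^-congˡ 12 (trans (*-congʳ (sym φE₁≋E₅)) (φ-unit E₁E₁⁻¹))) (solve 0 (# 1 :^ 12 := # 1)))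

      abe-unit : E₅ * (a⁻ * v * e⁻) ≋ 1#
      abe-unit = trans (*-congʳ E₅≋) (trans (solve 6 (λ a b c d f g → (a :* b :* c) :* (d :* f :* g) := ((a :* b) :* (d :* f)) :* (c :* g)) a b e a⁻ v e⁻)
        (trans (*-cong ab-unit ee⁻) (*-identityˡ 1#)))

    module _ (M : Series) (M-inverse : M * (Θ Z * Θ Z′ * E₁ * E₁) ≋ 1#) where
      private
        MθE₁ : M * E₁ * theta ≋ 1# - Z′
        MθE₁ = trans (solve 5 (λ M E a b d → M :* E :* (E :* (a :* (d :* b))) := M :* (a :* b :* E :* E) :* d) M E₁ (Θ Z) (Θ Z′) (1# - Z′))
          (trans (*-congʳ M-inverse) (*-identityˡ _))

        10M : ⌜ 10 ⌝ * M ≋ G * (y ^ 4 * p x q) ^ 2 * (v * (x - q * c′)) * (⌜ 10 ⌝ + ε * (ℓ₃ - k))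
        10M = clear-denominators E₅-unit abe-unit E₁-inverse (trans (sym (*-cong θ₁≋ θ₂≋)) θ₁θ₂) (θ₂-reduced aa⁻ ee⁻ x≋)
          (first-order-inverse ε² fifthₛ (κ half) half′ 10theta MθE₁)

      10M-split : ⌜ 10 ⌝ * M ≋ ⌜ 10 ⌝ * W * x - c′ * (⌜ 10 ⌝ * W * q) + (ε * s₁ * H₁ + ε * s₂ * H₂)
      10M-split = split (trans 10M (*-congʳ (sym (*-assoc (G * (y ^ 4 * p x q) ^ 2) v (x - q * c′)))))

-- R[τ] with τ² = tτ + s.
module Quadratic {c ℓ} (R : CommutativeRing c ℓ) (t s : CommutativeRing.Carrier R) where
  private module R = CommutativeRing R
  open R using (Carrier; _≈_; refl; sym; trans; _+_; _*_; -_; 0#; 1#)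

  infix 4 _≈ʳ_
  infix 5 _+τ_

  record Ext : Set c where
    no-eta-equality
    constructor _+τ_
    field re im : Carrier
  open Ext public

  record _≈ʳ_ (a b : Ext) : Set ℓ where
    constructor parts
    field
      re≈ : re a ≈ re b
      im≈ : im a ≈ im b
  open _≈ʳ_ public

  private
    _⊞_ _⊠_ : Ext → Ext → Ext
    re (a ⊞ b) = re a + re b
    im (a ⊞ b) = im a + im b
    re (a ⊠ b) = re a * re b + s * (im a * im b)
    im (a ⊠ b) = re a * im b + im a * re b + t * (im a * im b)

    ⊟_ : Ext → Ext
    re (⊟ a) = - re a
    im (⊟ a) = - im a

  embed : Carrier → Ext
  re (embed a) = a
  im (embed a) = 0#

  τ : Ext
  re τ = 0#
  im τ = 1#

  open IntegerSolver R

  extension : CommutativeRing c ℓ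
  extension = record
    { Carrier = Ext ; _≈_ = _≈ʳ_ ; _+_ = _⊞_ ; _*_ = _⊠_ ; -_ = ⊟_ ; 0# = embed 0# ; 1# = embed 1#
    ; isCommutativeRing = record
      { isRing = record
        { +-isAbelianGroup = record
          { isGroup = record
            { isMonoid = record
              { isSemigroup = record
                { isMagma = record
                  { isEquivalence = record
                    { refl = parts refl refl
                    ; sym = λ p → parts (sym (re≈ p)) (sym (im≈ p))
                    ; trans = λ p q → parts (trans (re≈ p) (re≈ q)) (trans (im≈ p) (im≈ q)) }
                  ; ∙-cong = λ p q → parts (R.+-cong (re≈ p) (re≈ q)) (R.+-cong (im≈ p) (im≈ q)) }
                ; assoc = λ a b c → parts (R.+-assoc _ _ _) (R.+-assoc _ _ _) }
              ; identity = (λ a → parts (R.+-identityˡ _) (R.+-identityˡ _)) , (λ a → parts (R.+-identityʳ _) (R.+-identityʳ _)) }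
            ; inverse = (λ a → parts (R.-‿inverseˡ _) (R.-‿inverseˡ _)) , (λ a → parts (R.-‿inverseʳ _) (R.-‿inverseʳ _))
            ; ⁻¹-cong = λ p → parts (R.-‿cong (re≈ p)) (R.-‿cong (im≈ p)) }
          ; comm = λ a b → parts (R.+-comm _ _) (R.+-comm _ _) }
        ; *-cong = λ p q → parts (R.+-cong (R.*-cong (re≈ p) (re≈ q)) (R.*-congˡ (R.*-cong (im≈ p) (im≈ q))))
            (R.+-cong (R.+-cong (R.*-cong (re≈ p) (im≈ q)) (R.*-cong (im≈ p) (re≈ q))) (R.*-congˡ (R.*-cong (im≈ p) (im≈ q))))
        ; *-assoc = λ a b c → parts
            (solve 8 (λ t s a a′ b b′ c c′ → (a :* b :+ s :* (a′ :* b′)) :* c :+ s :* ((a :* b′ :+ a′ :* b :+ t :* (a′ :* b′)) :* c′)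
              := a :* (b :* c :+ s :* (b′ :* c′)) :+ s :* (a′ :* (b :* c′ :+ b′ :* c :+ t :* (b′ :* c′)))) t s (re a) (im a) (re b) (im b) (re c) (im c))
            (solve 8 (λ t s a a′ b b′ c c′ → (a :* b :+ s :* (a′ :* b′)) :* c′ :+ (a :* b′ :+ a′ :* b :+ t :* (a′ :* b′)) :* c :+ t :* ((a :* b′ :+ a′ :* b :+ t :* (a′ :* b′)) :* c′)
              := a :* (b :* c′ :+ b′ :* c :+ t :* (b′ :* c′)) :+ a′ :* (b :* c :+ s :* (b′ :* c′)) :+ t :* (a′ :* (b :* c′ :+ b′ :* c :+ t :* (b′ :* c′)))) t s (re a) (im a) (re b) (im b) (re c) (im c))
        ; *-identity = (λ a → parts (solve 3 (λ s a a′ → # 1 :* a :+ s :* (# 0 :* a′) := a) _ _ _)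
                                    (solve 3 (λ t a a′ → # 1 :* a′ :+ # 0 :* a :+ t :* (# 0 :* a′) := a′) _ _ _))
                     , (λ a → parts (solve 3 (λ s a a′ → a :* # 1 :+ s :* (a′ :* # 0) := a) _ _ _)
                                    (solve 3 (λ t a a′ → a :* # 0 :+ a′ :* # 1 :+ t :* (a′ :* # 0) := a′) _ _ _))
        ; distrib = (λ a b c → parts
                      (solve 7 (λ s a a′ b b′ c c′ → a :* (b :+ c) :+ s :* (a′ :* (b′ :+ c′)) := (a :* b :+ s :* (a′ :* b′)) :+ (a :* c :+ s :* (a′ :* c′))) _ _ _ _ _ _ _)
                      (solve 7 (λ t a a′ b b′ c c′ → a :* (b′ :+ c′) :+ a′ :* (b :+ c) :+ t :* (a′ :* (b′ :+ c′))
                        := (a :* b′ :+ a′ :* b :+ t :* (a′ :* b′)) :+ (a :* c′ :+ a′ :* c :+ t :* (a′ :* c′))) _ _ _ _ _ _ _))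
                  , (λ a b c → parts
                      (solve 7 (λ s a a′ b b′ c c′ → (b :+ c) :* a :+ s :* ((b′ :+ c′) :* a′) := (b :* a :+ s :* (b′ :* a′)) :+ (c :* a :+ s :* (c′ :* a′))) _ _ _ _ _ _ _)
                      (solve 7 (λ t a a′ b b′ c c′ → (b :+ c) :* a′ :+ (b′ :+ c′) :* a :+ t :* ((b′ :+ c′) :* a′)
                        := (b :* a′ :+ b′ :* a :+ t :* (b′ :* a′)) :+ (c :* a′ :+ c′ :* a :+ t :* (c′ :* a′))) _ _ _ _ _ _ _)) }
      ; *-comm = λ a b → parts (solve 5 (λ s a a′ b b′ → a :* b :+ s :* (a′ :* b′) := b :* a :+ s :* (b′ :* a′)) _ _ _ _ _)
                               (solve 5 (λ t a a′ b b′ → a :* b′ :+ a′ :* b :+ t :* (a′ :* b′) := b :* a′ :+ b′ :* a :+ t :* (b′ :* a′)) _ _ _ _ _) } }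

  embedHom : RingHom R extension
  embedHom = record
    { ⟦_⟧ = embed
    ; ⟦⟧-cong = λ p → parts p refl
    ; +-hom = λ a b → parts refl (sym (R.+-identityˡ _))
    ; *-hom = λ a b → parts (solve 3 (λ s a b → a :* b := a :* b :+ s :* (# 0 :* # 0)) _ _ _)
                            (solve 3 (λ t a b → # 0 := a :* # 0 :+ # 0 :* b :+ t :* (# 0 :* # 0)) _ _ _)
    ; neg-hom = λ a → parts refl (solve 0 (# 0 := :- # 0))
    ; 1-hom = parts refl refl }

  embed-* : ∀ a b → embed a ⊠ b ≈ʳ (a * re b) +τ (a * im b)
  embed-* a b = parts (solve 4 (λ s a b b′ → a :* b :+ s :* (# 0 :* b′) := a :* b) _ _ _ _)
                      (solve 4 (λ t a b b′ → a :* b′ :+ # 0 :* b :+ t :* (# 0 :* b′) := a :* b′) _ _ _ _)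

  τ² : τ ⊠ τ ≈ʳ (embed t ⊠ τ) ⊞ embed s
  τ² = parts (solve 2 (λ t s → # 0 :* # 0 :+ s :* (# 1 :* # 1) := t :* # 0 :+ s :* (# 0 :* # 1) :+ s) t s)
             (solve 1 (λ t → # 0 :* # 1 :+ # 1 :* # 0 :+ t :* (# 1 :* # 1) := t :* # 1 :+ # 0 :* # 0 :+ t :* (# 0 :* # 1) :+ # 0) t)

  conj : Ext → Ext
  re (conj a) = re a + im a * t
  im (conj a) = - im a

  conjHom : RingHom extension extension
  conjHom = record
    { ⟦_⟧ = conj
    ; ⟦⟧-cong = λ p → parts (R.+-cong (re≈ p) (R.*-congʳ (im≈ p))) (R.-‿cong (im≈ p))
    ; +-hom = λ a b → parts (solve 5 (λ t a a′ b b′ → a :+ b :+ (a′ :+ b′) :* t := (a :+ a′ :* t) :+ (b :+ b′ :* t)) _ _ _ _ _)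
                            (solve 2 (λ a b → :- (a :+ b) := :- a :+ :- b) _ _)
    ; *-hom = λ a b → parts
        (solve 6 (λ t s a a′ b b′ → (a :* b :+ s :* (a′ :* b′)) :+ (a :* b′ :+ a′ :* b :+ t :* (a′ :* b′)) :* t
          := (a :+ a′ :* t) :* (b :+ b′ :* t) :+ s :* (:- a′ :* :- b′)) _ _ _ _ _ _)
        (solve 5 (λ t a a′ b b′ → :- (a :* b′ :+ a′ :* b :+ t :* (a′ :* b′))
          := (a :+ a′ :* t) :* :- b′ :+ :- a′ :* (b :+ b′ :* t) :+ t :* (:- a′ :* :- b′)) _ _ _ _ _)
    ; neg-hom = λ a → parts (solve 3 (λ t a a′ → :- a :+ :- a′ :* t := :- (a :+ a′ :* t)) _ _ _) refl
    ; 1-hom = parts (solve 1 (λ t → # 1 :+ # 0 :* t := # 1) _) (solve 0 (:- # 0 := # 0)) }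

  extend : (h : RingHom R R) → RingHom.⟦_⟧ h t ≈ t → RingHom.⟦_⟧ h s ≈ s → RingHom extension extension
  extend h ht hs = record
    { ⟦_⟧ = ⟪_⟫
    ; ⟦⟧-cong = λ p → parts (h.⟦⟧-cong (re≈ p)) (h.⟦⟧-cong (im≈ p))
    ; +-hom = λ a b → parts (h.+-hom _ _) (h.+-hom _ _)
    ; *-hom = λ a b → parts
        (trans (h.+-hom _ _) (R.+-cong (h.*-hom _ _) (trans (h.*-hom _ _) (R.*-cong hs (h.*-hom _ _)))))
        (trans (h.+-hom _ _) (R.+-cong (trans (h.+-hom _ _) (R.+-cong (h.*-hom _ _) (h.*-hom _ _))) (trans (h.*-hom _ _) (R.*-cong ht (h.*-hom _ _)))))
    ; neg-hom = λ a → parts (h.neg-hom _) (h.neg-hom _)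
    ; 1-hom = parts h.1-hom h.0-hom }
    where
    module h = RingHom h
    ⟪_⟫ : Ext → Ext
    re ⟪ a ⟫ = h.⟦ re a ⟧
    im ⟪ a ⟫ = h.⟦ im a ⟧

module ListSums {c ℓ} (R : CommutativeRing c ℓ) where
  open CommutativeRing R hiding (zero)
  open RingFolds R

  sumL : ∀ {a} {A : Set a} → (A → Carrier) → List A → Carrier
  sumL f List.[]       = 0#
  sumL f (x List.∷ xs) = f x + sumL f xs

  sumL-cong : ∀ {a} {A : Set a} {f g : A → Carrier} → (∀ x → f x ≈ g x) → ∀ xs → sumL f xs ≈ sumL g xs
  sumL-cong p List.[]       = refl
  sumL-cong p (x List.∷ xs) = +-cong (p x) (sumL-cong p xs)

  sumL-++ : ∀ {a} {A : Set a} (f : A → Carrier) xs ys → sumL f (xs List.++ ys) ≈ sumL f xs + sumL f ys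
  sumL-++ f List.[]       ys = sym (+-identityˡ _)
  sumL-++ f (x List.∷ xs) ys = trans (+-congˡ (sumL-++ f xs ys)) (sym (+-assoc _ _ _))

  sumL-map : ∀ {a b} {A : Set a} {B : Set b} (f : B → Carrier) (g : A → B) xs → sumL f (List.map g xs) ≈ sumL (λ x → f (g x)) xs
  sumL-map f g List.[]       = refl
  sumL-map f g (x List.∷ xs) = +-congˡ (sumL-map f g xs)

  sumL-concatMap : ∀ {a b} {A : Set a} {B : Set b} (f : B → Carrier) (g : A → List B) xs → sumL f (concatMap g xs) ≈ sumL (λ x → sumL f (g x)) xs
  sumL-concatMap f g List.[]       = refl
  sumL-concatMap f g (x List.∷ xs) = trans (sumL-++ f (g x) _) (+-congˡ (sumL-concatMap f g xs))

  sumL-* : ∀ {a} {A : Set a} (f : A → Carrier) k xs → sumL (λ x → k * f x) xs ≈ k * sumL f xs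
  sumL-* f k List.[]       = sym (zeroʳ k)
  sumL-* f k (x List.∷ xs) = trans (+-congˡ (sumL-* f k xs)) (sym (distribˡ _ _ _))

  sumL-*ʳ : ∀ {a} {A : Set a} (f : A → Carrier) k xs → sumL (λ x → f x * k) xs ≈ sumL f xs * k
  sumL-*ʳ f k List.[]       = sym (zeroˡ k)
  sumL-*ʳ f k (x List.∷ xs) = trans (+-congˡ (sumL-*ʳ f k xs)) (sym (distribʳ _ _ _))

  sumL-applyUpTo : ∀ {a} {A : Set a} (f : A → Carrier) (g : ℕ → A) n → sumL f (applyUpTo g n) ≈ ∑ (λ k → f (g k)) n
  sumL-applyUpTo f g zero    = refl
  sumL-applyUpTo f g (suc n) = trans (+-congˡ (sumL-applyUpTo f (λ k → g (suc k)) n)) (sym (∑-suc _ n))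

  ∑-cong< : ∀ {f g} n → (∀ k → k < n → f k ≈ g k) → ∑ f n ≈ ∑ g n
  ∑-cong< zero    p = refl
  ∑-cong< (suc n) p = +-cong (∑-cong< n λ k k<n → p k (ℕP.m<n⇒m<1+n k<n)) (p n ℕP.≤-refl)

module PartitionSeries {c ℓ} (K : CommutativeRing c ℓ) where
  private module K = CommutativeRing K
  open ThetaSeries K
  open ListSums K
  open Exp K.semiring using () renaming (_^_ to _^ᴷ_)
  open RingFolds K using () renaming (∑ to ∑ᴷ; ∑-suc to ∑ᴷ-suc)
  private module IS = IntegerSolver seriesRing
  open IS using (solve)

  conv-∑ : ∀ f g n → coe (f * g) n K.≈ ∑ᴷ (λ i → coe f i K.* coe g (n ℕ.∸ i)) (suc n)
  conv-∑ f g zero    = K.sym (K.+-identityˡ _)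
  conv-∑ f g (suc n) = K.trans (K.+-congˡ (conv-∑ (tail f) g n)) (K.sym (∑ᴷ-suc _ (suc n)))

  module Parts (x : K.Carrier) where
    private
      count : ℕ → ℕ → ℕ → K.Carrier
      count fuel n m = sumL (λ p → x ^ᴷ length p) (partsF fuel n m)

      count-suc : ∀ fuel n m → count (suc fuel) (suc n) m K.≈ ∑ᴷ (λ j → x K.* count fuel (n ℕ.∸ j) (suc j)) (suc n ℕ.⊓ m)
      count-suc fuel n m = K.trans (sumL-concatMap _ _ (List.map suc (upTo (suc n ℕ.⊓ m))))
        (K.trans (sumL-map _ suc (upTo (suc n ℕ.⊓ m)))
        (K.trans (sumL-applyUpTo _ (λ j → j) (suc n ℕ.⊓ m))
        (RingFolds.∑-cong K (suc n ℕ.⊓ m) λ j → K.trans (sumL-map _ (suc j List.∷_) (partsF fuel (n ℕ.∸ j) (suc j)))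
          (sumL-* _ x (partsF fuel (n ℕ.∸ j) (suc j))))))

      enough-fuel : ∀ fuel fuel′ n m → n ≤ fuel → n ≤ fuel′ → count fuel n m K.≈ count fuel′ n m
      enough-fuel zero       zero        zero    m _ _ = K.refl
      enough-fuel zero       (suc fuel′) zero    m _ _ = K.refl
      enough-fuel (suc fuel) zero        zero    m _ _ = K.refl
      enough-fuel (suc fuel) (suc fuel′) zero    m _ _ = K.refl
      enough-fuel (suc fuel) (suc fuel′) (suc n) m (s≤s p) (s≤s p′) = K.trans (count-suc fuel n m)
        (K.trans (RingFolds.∑-cong K (suc n ℕ.⊓ m) λ j → K.*-congˡ (enough-fuel fuel fuel′ (n ℕ.∸ j) (suc j)
            (ℕP.≤-trans (ℕP.m∸n≤m n j) p) (ℕP.≤-trans (ℕP.m∸n≤m n j) p′)))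
          (K.sym (count-suc fuel′ n m)))

      summand : ℕ → ℕ → K.Carrier
      summand n j = x K.* count (n ℕ.∸ j) (n ℕ.∸ j) (suc j)

      bounded-suc : ∀ n m → count (suc n) (suc n) m K.≈ ∑ᴷ (summand n) (suc n ℕ.⊓ m)
      bounded-suc n m = K.trans (count-suc n n m) (RingFolds.∑-cong K (suc n ℕ.⊓ m) λ j →
        K.*-congˡ (enough-fuel n (n ℕ.∸ j) (n ℕ.∸ j) (suc j) (ℕP.m∸n≤m n j) ℕP.≤-refl))

    bounded : ℕ → Series
    coe (bounded m) n = count n n m

    unbounded : Series
    coe unbounded n = sumL (λ p → x ^ᴷ length p) (partitions n)

    private
      saturated : ∀ n m → n ≤ m → count n n m K.≈ count n n n
      saturated zero    m _   = K.refl
      saturated (suc n) m n≤m = K.trans (bounded-suc n m) (K.trans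
        (K.reflexive (≡.cong (∑ᴷ (summand n)) (≡.trans (ℕP.m≤n⇒m⊓n≡m n≤m) (≡.sym (ℕP.⊓-idem (suc n))))))
        (K.sym (bounded-suc n (suc n))))

      q^*-low : ∀ k f n → n < k → coe (q ^ k * f) n K.≈ K.0#
      q^*-low k f n n<k = at< (≈-trans (≈-* (q^-order {k} ℕP.≤-refl) (≈-refl {k} {f})) (≋⇒≈ (zeroˡ f))) n n<k

      q^*-high : ∀ k f n → coe (q ^ k * f) (k ℕ.+ n) K.≈ coe f n
      q^*-high zero    f n = at (*-identityˡ f) n
      q^*-high (suc k) f n = K.trans (at (trans (*-assoc q (q ^ k) f) (q-✶ (q ^ k * f))) (suc (k ℕ.+ n))) (q^*-high k f n)

      step : ∀ m → bounded (suc m) ≋ bounded m + κ x * (q ^ suc m * bounded (suc m))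
      step m = pw λ n → K.sym (K.trans (K.+-congˡ (κ-✶ x (q ^ suc m * bounded (suc m)) n)) (go n (ℕP.<-≤-connex n (suc m))))
        where
        low : ∀ n → n < suc m → count n n m K.≈ count n n (suc m)
        low n (s≤s n≤m) = K.trans (saturated n m n≤m) (K.sym (saturated n (suc m) (ℕP.m≤n⇒m≤1+n n≤m)))
        high : ∀ j → count (suc m ℕ.+ j) (suc m ℕ.+ j) m K.+ x K.* count j j (suc m) K.≈ count (suc m ℕ.+ j) (suc m ℕ.+ j) (suc m)
        high j = K.trans (K.+-cong (K.trans (bounded-suc (m ℕ.+ j) m) (K.reflexive (≡.cong (∑ᴷ (summand (m ℕ.+ j))) (ℕP.m≥n⇒m⊓n≡n (ℕP.m≤n⇒m≤1+n (ℕP.m≤m+n m j))))))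
            (K.*-congˡ (K.reflexive (≡.cong (λ i → count i i (suc m)) (≡.sym (ℕP.m+n∸m≡n m j))))))
          (K.sym (K.trans (bounded-suc (m ℕ.+ j) (suc m)) (K.reflexive (≡.cong (∑ᴷ (summand (m ℕ.+ j))) (ℕP.m≥n⇒m⊓n≡n (s≤s (ℕP.m≤m+n m j)))))))
        go : ∀ n → n < suc m ⊎ suc m ≤ n → count n n m K.+ x K.* coe (q ^ suc m * bounded (suc m)) n K.≈ count n n (suc m)
        go n (inj₁ n<m) = K.trans (K.+-cong (low n n<m) (K.trans (K.*-congˡ (q^*-low (suc m) (bounded (suc m)) n n<m)) (K.zeroʳ x))) (K.+-identityʳ _)
        go n (inj₂ m≤n) with ℕP.m≤n⇒∃[o]m+o≡n m≤n
        ... | j , ≡.refl = K.trans (K.+-congˡ (K.*-congˡ (q^*-high (suc m) (bounded (suc m)) j))) (high j)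

      product : ∀ N → ∏ (λ k → 1# - κ x * q ^ suc k) N * bounded N ≋ 1#
      product zero    = trans (*-identityˡ _) (pw λ where
        zero    → K.+-identityʳ _
        (suc n) → K.trans (bounded-suc n 0) K.refl)
      product (suc N) = trans (*-assoc _ _ _) (trans (*-congˡ (trans
        (solve 3 (λ x Q b → (# 1 :- x :* Q) :* b := b :- x :* (Q :* b)) (κ x) (q ^ suc N) (bounded (suc N)))
        (trans (+-congʳ (step N)) (solve 2 (λ a b → a :+ b :- b := a) _ _)))) (product N))

      bounded-⟶ : bounded ⟶ unbounded
      bounded-⟶ = tends λ N → pw< λ n n<N → saturated n N (ℕP.<⇒≤ n<N)

    Θ-unbounded : Θ (κ x) * unbounded ≋ 1#
    Θ-unbounded = ⟶-unique (⟶-* (Θ-⟶ (κ x)) bounded-⟶) (⟶-cong (λ N → sym (product N)) (⟶-const 1#))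

  open Parts using (unbounded; Θ-unbounded) public

  weight : ∀ {k} → Vec K.Carrier k → Vec (List ℕ) k → K.Carrier
  weight []       []      = K.1#
  weight (x ∷ xs) (p ∷ π) = x ^ᴷ length p K.* weight xs π

  coloredSeries : ∀ {k} → Vec K.Carrier k → Series
  coe (coloredSeries {k} xs) n = sumL (weight xs) (colored k n)

  coloredSeries-[] : coloredSeries [] ≋ 1#
  coloredSeries-[] = pw λ where
    zero    → K.+-identityʳ _
    (suc n) → K.refl

  coloredSeries-∷ : ∀ {k} x (xs : Vec K.Carrier k) → coloredSeries (x ∷ xs) ≋ unbounded x * coloredSeries xs
  coloredSeries-∷ {k} x xs = pw λ n →
    let prepend = λ a p → List.map (p ∷_) (colored k (n ℕ.∸ a)) in
    K.trans (sumL-concatMap (weight (x ∷ xs)) (λ a → concatMap (prepend a) (partitions a)) (upTo (suc n)))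
    (K.trans (sumL-applyUpTo _ (λ a → a) (suc n))
    (K.trans (RingFolds.∑-cong K (suc n) λ a → K.trans (sumL-concatMap (weight (x ∷ xs)) (prepend a) (partitions a))
        (K.trans (sumL-cong (λ p → K.trans (sumL-map (weight (x ∷ xs)) (p ∷_) (colored k (n ℕ.∸ a))) (sumL-* (weight xs) (x ^ᴷ length p) (colored k (n ℕ.∸ a)))) (partitions a))
          (sumL-*ʳ (λ p → x ^ᴷ length p) _ (partitions a))))
      (K.sym (conv-∑ (unbounded x) (coloredSeries xs) n))))

ℚR : CommutativeRing 0ℓ 0ℓ
ℚR = ℚP.+-*-commutativeRing

module ℚSeries where
  open ThetaSeries ℚR public
  open PartitionSeries ℚR using (conv-∑) public
  open RingFolds ℚR using () renaming (∑ to ∑ℚ; ∑-cong to ∑ℚ-cong; ∑-+ to ∑ℚ-+; ∑-suc to ∑ℚ-suc) public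

module FrozenSeries where
  open ℚSeries

  sumTo≡∑ : ∀ f n → sumTo f n ≡ ∑ℚ f n
  sumTo≡∑ f zero    = ≡.refl
  sumTo≡∑ f (suc n) = ≡.cong (ℚ._+ f n) (sumTo≡∑ f n)

  series-⊗ : ∀ f g → series (f Defs.⊗ g) ≋ series f * series g
  series-⊗ f g = pw λ n → ≡.trans (sumTo≡∑ _ (suc n)) (≡.sym (conv-∑ (series f) (series g) n))

  series-one : series Defs.one ≋ 1#
  series-one = pw λ where
    zero    → ≡.refl
    (suc n) → ≡.refl

  series-· : ∀ c f → series (c Defs.· f) ≋ κ c * series f
  series-· c f = pw λ n → ≡.sym (κ-✶ c (series f) n)

  series-pow : ∀ f k → series (Defs.pow f k) ≋ series f ^ k
  series-pow f zero    = series-one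
  series-pow f (suc k) = trans (series-⊗ f _) (*-congˡ (series-pow f k))

  private
    shift-q : ∀ k f n → coe (q ^ suc k * f) n ≡ coe (shift (q ^ k * f)) n
    shift-q k f n = at (trans (*-assoc q (q ^ k) f) (q-✶ (q ^ k * f))) n

  series-qpow : ∀ k f → series (Defs.qpow k f) ≋ q ^ k * series f
  series-qpow k f = pw λ n → go k n
    where
    go : ∀ k n → Defs.qpow k f n ≡ coe (q ^ k * series f) n
    go zero          n       = ≡.sym (at (*-identityˡ (series f)) n)
    go (suc k)       zero    = ≡.sym (shift-q k (series f) 0)
    go (suc zero)    (suc n) = ≡.trans (go zero n) (≡.sym (shift-q 0 (series f) (suc n)))
    go (suc (suc k)) (suc n) = ≡.trans (go (suc k) n) (≡.sym (shift-q (suc k) (series f) (suc n)))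

  coe-q^ : ∀ k n → coe (q ^ k) n ≡ (if k ℕ.≡ᵇ n then 1ℚ else 0ℚ)
  coe-q^ zero    zero    = ≡.refl
  coe-q^ zero    (suc n) = ≡.refl
  coe-q^ (suc k) zero    = at (q-✶ (q ^ k)) 0
  coe-q^ (suc k) (suc n) = ≡.trans (at (q-✶ (q ^ k)) (suc n)) (coe-q^ k n)

  series-oneMinusQ : ∀ m → series (oneMinusQ (suc m)) ≋ 1# - q ^ suc m
  series-oneMinusQ m = pw λ where
      zero    → ≡.cong (λ c → 1ℚ ℚ.+ ℚ.- c) (≡.sym (coe-q^ (suc m) 0))
      (suc n) → ≡.trans (negated (m ℕ.≡ᵇ n)) (≡.cong (λ c → 0ℚ ℚ.+ ℚ.- c) (≡.sym (coe-q^ (suc m) (suc n))))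
    where
    negated : ∀ (b : Bool) → (if b then ℚ.- 1ℚ else 0ℚ) ≡ 0ℚ ℚ.+ ℚ.- (if b then 1ℚ else 0ℚ)
    negated true  = ≡.refl
    negated false = ≡.refl

  series-pochTrunc : ∀ a c N → series (pochTrunc (suc a) c N) ≋ ∏ (λ k → 1# - q ^ (suc a ℕ.+ c ℕ.* k)) N
  series-pochTrunc a c zero    = series-one
  series-pochTrunc a c (suc N) = trans (series-⊗ _ _) (*-cong (series-pochTrunc a c N) (series-oneMinusQ (a ℕ.+ c ℕ.* N)))

  series-poch₅ : ∀ a → series (Defs.poch (suc a) 5) ≋ euler (suc a)
  series-poch₅ a = pw λ n → at (trans (series-pochTrunc a 5 (suc n))
    (∏-cong (suc n) λ k → +-congˡ (-‿cong (q^-≡ (≡.cong (suc a ℕ.+_) (ℕP.*-comm 5 k)))))) n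

  series-E₁ : series Defs.E₁ ≋ E₁
  series-E₁ = pw λ n → at (trans (series-pochTrunc 0 1 (suc n))
    (∏-cong (suc n) λ k → +-congˡ (-‿cong (q^-≡ (≡.cong suc (ℕP.*-identityˡ k)))))) n

  series-A : series Defs.Aₚ ≋ A
  series-A = trans (series-⊗ _ _) (*-cong (series-poch₅ 0) (series-poch₅ 3))

  series-B : series Defs.Bₚ ≋ B
  series-B = trans (series-⊗ _ _) (*-cong (series-poch₅ 1) (series-poch₅ 2))

  series-E₅ : series Defs.E₅ ≋ E₅
  series-E₅ = series-poch₅ 4

  private
    true-≤ : ∀ {i n} → i ≤ n → (i ℕ.≤ᵇ n) ≡ true
    true-≤ {i} {n} i≤n with i ℕ.≤ᵇ n | ℕP.≤⇒≤ᵇ i≤n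
    ... | true | _ = ≡.refl

    false-> : ∀ n → (suc n ℕ.≤ᵇ n) ≡ false
    false-> zero    = ≡.refl
    false-> (suc n) = false-> n

    invUpTo-stable : ∀ f n i → i ≤ n → invUpTo f n i ≡ Defs.inv f i
    invUpTo-stable f zero    zero z≤n = ≡.refl
    invUpTo-stable f (suc n) i    i≤n with ℕP.m≤n⇒m<n∨m≡n i≤n
    ... | inj₂ ≡.refl    = ≡.refl
    ... | inj₁ (s≤s i≤n) rewrite true-≤ i≤n = invUpTo-stable f n i i≤n

    inv-suc : ∀ f n → Defs.inv f (suc n) ≡ ℚ.- coe (tail (series f) * series (Defs.inv f)) n
    inv-suc f n rewrite false-> n = ≡.cong ℚ.-_ (≡.trans (sumTo≡∑ _ (suc n))
      (≡.trans (∑ℚ-cong (suc n) λ j → ≡.cong (f (suc j) ℚ.*_) (invUpTo-stable f n (n ℕ.∸ j) (ℕP.m∸n≤m n j)))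
        (≡.sym (conv-∑ (tail (series f)) (series (Defs.inv f)) n))))

  inv-* : ∀ f → f 0 ≡ 1ℚ → series f * series (Defs.inv f) ≋ 1#
  inv-* f f₀ = pw go
    where
    rest : ℕ → ℚ
    rest = coe (tail (series f) * series (Defs.inv f))
    go : ∀ n → coe (series f * series (Defs.inv f)) n ≡ coe 1# n
    go zero    = ≡.cong (ℚ._* 1ℚ) f₀
    go (suc n) = ≡.trans (≡.cong₂ (λ a b → a ℚ.* b ℚ.+ rest n) f₀ (inv-suc f n))
      (≡.trans (≡.cong (ℚ._+ rest n) (ℚP.*-identityˡ (ℚ.- rest n))) (ℚP.+-inverseˡ (rest n)))

  fromInt-+ : ∀ i j → (i ℤ.+ j) / 1 ≡ i / 1 ℚ.+ j / 1
  fromInt-+ i j = ℚP.toℚᵘ-injective (begin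
    ℚ.toℚᵘ ((i ℤ.+ j) / 1)                   ≈⟨ ℚP.toℚᵘ-fromℚᵘ (ℚᵘ.mkℚᵘ (i ℤ.+ j) 0) ⟩
    ℚᵘ.mkℚᵘ (i ℤ.+ j) 0                      ≈⟨ ℚᵘ.*≡* (≡.cong (ℤ._* ℤ.+ 1) (≡.sym (≡.cong₂ ℤ._+_ (ℤP.*-identityʳ i) (ℤP.*-identityʳ j)))) ⟩
    ℚᵘ.mkℚᵘ i 0 ℚᵘ.+ ℚᵘ.mkℚᵘ j 0             ≈⟨ ℚᵘP.≃-sym (ℚᵘP.+-cong (ℚP.toℚᵘ-fromℚᵘ (ℚᵘ.mkℚᵘ i 0)) (ℚP.toℚᵘ-fromℚᵘ (ℚᵘ.mkℚᵘ j 0))) ⟩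
    ℚ.toℚᵘ (i / 1) ℚᵘ.+ ℚ.toℚᵘ (j / 1)       ≈⟨ ℚᵘP.≃-sym (ℚP.toℚᵘ-homo-+ (i / 1) (j / 1)) ⟩
    ℚ.toℚᵘ (i / 1 ℚ.+ j / 1)                 ∎)
    where open ℚᵘP.≃-Reasoning

  fromInt-* : ∀ i j → (i ℤ.* j) / 1 ≡ (i / 1) ℚ.* (j / 1)
  fromInt-* i j = ℚP.toℚᵘ-injective (begin
    ℚ.toℚᵘ ((i ℤ.* j) / 1)                   ≈⟨ ℚP.toℚᵘ-fromℚᵘ (ℚᵘ.mkℚᵘ (i ℤ.* j) 0) ⟩
    ℚᵘ.mkℚᵘ i 0 ℚᵘ.* ℚᵘ.mkℚᵘ j 0             ≈⟨ ℚᵘP.≃-sym (ℚᵘP.*-cong (ℚP.toℚᵘ-fromℚᵘ (ℚᵘ.mkℚᵘ i 0)) (ℚP.toℚᵘ-fromℚᵘ (ℚᵘ.mkℚᵘ j 0))) ⟩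
    ℚ.toℚᵘ (i / 1) ℚᵘ.* ℚ.toℚᵘ (j / 1)       ≈⟨ ℚᵘP.≃-sym (ℚP.toℚᵘ-homo-* (i / 1) (j / 1)) ⟩
    ℚ.toℚᵘ ((i / 1) ℚ.* (j / 1))             ∎)
    where open ℚᵘP.≃-Reasoning

  fromInt-neg : ∀ i → (ℤ.- i) / 1 ≡ ℚ.- (i / 1)
  fromInt-neg i = GroupP.inverseʳ-unique ℚP.+-0-group (i / 1) ((ℤ.- i) / 1)
      (≡.trans (≡.sym (fromInt-+ i (ℤ.- i))) (≡.cong (_/ 1) (ℤP.+-inverseʳ i)))

  -- The bilateral sum over n ∈ ℤ is paired as n = k with n = -(k+1).
  module _ where
    open Exponents
    private
      ∑ℚ-append : ∀ f a b → ∑ℚ f (b ℕ.+ a) ≡ ∑ℚ f a ℚ.+ ∑ℚ (λ k → f (k ℕ.+ a)) b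
      ∑ℚ-append f a zero    = ≡.sym (ℚP.+-identityʳ (∑ℚ f a))
      ∑ℚ-append f a (suc b) = ≡.trans (≡.cong (ℚ._+ f (b ℕ.+ a)) (∑ℚ-append f a b)) (ℚP.+-assoc (∑ℚ f a) (∑ℚ (λ k → f (k ℕ.+ a)) b) (f (b ℕ.+ a)))

      ∑ℚ-reverse : ∀ f n → ∑ℚ f (suc n) ≡ ∑ℚ (λ k → f (n ℕ.∸ k)) (suc n)
      ∑ℚ-reverse f zero    = ≡.refl
      ∑ℚ-reverse f (suc n) = ≡.trans (ℚP.+-comm (∑ℚ f (suc n)) (f (suc n))) (≡.trans (≡.cong (f (suc n) ℚ.+_) (∑ℚ-reverse f n))
        (≡.sym (∑ℚ-suc (λ k → f (suc n ℕ.∸ k)) (suc n))))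

      u-double : ∀ k → 2 ℕ.* u k ≡ k ℕ.* (5 ℕ.* k ℕ.+ 1)
      u-double zero    = ≡.refl
      u-double (suc k) = ≡.trans (ℕP.*-distribˡ-+ 2 (u k) _) (≡.trans (≡.cong (ℕ._+ 2 ℕ.* (3 ℕ.+ k ℕ.* 5)) (u-double k)) (go k))
        where
        go : ∀ k → k ℕ.* (5 ℕ.* k ℕ.+ 1) ℕ.+ 2 ℕ.* (3 ℕ.+ k ℕ.* 5) ≡ suc k ℕ.* (5 ℕ.* suc k ℕ.+ 1)
        go = solve-∀

      u′-double : ∀ k → 2 ℕ.* u′ k ≡ suc k ℕ.* (5 ℕ.* k ℕ.+ 4)
      u′-double zero    = ≡.refl
      u′-double (suc k) = ≡.trans (ℕP.*-distribˡ-+ 2 (u′ k) _) (≡.trans (≡.cong (ℕ._+ 2 ℕ.* (2 ℕ.+ suc k ℕ.* 5)) (u′-double k)) (go k))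
        where
        go : ∀ k → suc k ℕ.* (5 ℕ.* k ℕ.+ 4) ℕ.+ 2 ℕ.* (2 ℕ.+ suc k ℕ.* 5) ≡ suc (suc k) ℕ.* (5 ℕ.* suc k ℕ.+ 4)
        go = solve-∀

      exponent : ℤ → ℤ
      exponent z = z ℤ.* ((ℤ.+ 5) ℤ.* z ℤ.+ ℤ.+ 1)

      exponent⁺ : ∀ k → exponent (ℤ.+ k) ≡ ℤ.+ 2 ℤ.* ℤ.+ u k
      exponent⁺ k = ≡.trans (≡.cong (ℤ.+ k ℤ.*_) (≡.trans (≡.cong (ℤ._+ ℤ.+ 1) (≡.sym (ℤP.pos-* 5 k))) (≡.sym (ℤP.pos-+ (5 ℕ.* k) 1))))
        (≡.trans (≡.sym (ℤP.pos-* k _)) (≡.trans (≡.cong ℤ.+_ (≡.sym (u-double k))) (ℤP.pos-* 2 (u k))))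

      exponent⁻ : ∀ k → exponent -[1+ k ] ≡ ℤ.+ 2 ℤ.* ℤ.+ u′ k
      exponent⁻ k = ≡.trans (go (ℤ.+ k)) (≡.trans (≡.cong₂ ℤ._*_ (≡.refl {x = ℤ.+ suc k}) (≡.trans (≡.cong (ℤ._+ ℤ.+ 4) (≡.sym (ℤP.pos-* 5 k))) (≡.sym (ℤP.pos-+ (5 ℕ.* k) 4))))
        (≡.trans (≡.sym (ℤP.pos-* (suc k) _)) (≡.trans (≡.cong ℤ.+_ (≡.sym (u′-double k))) (ℤP.pos-* 2 (u′ k)))))
        where
        go : ∀ k → (ℤ.- (ℤ.+ 1 ℤ.+ k)) ℤ.* ((ℤ.+ 5) ℤ.* (ℤ.- (ℤ.+ 1 ℤ.+ k)) ℤ.+ ℤ.+ 1) ≡ (ℤ.+ 1 ℤ.+ k) ℤ.* ((ℤ.+ 5) ℤ.* k ℤ.+ ℤ.+ 4)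
        go = ℤSolver.solve-∀

      select : ∀ z m N (c : ℚ) → exponent z ≡ ℤ.+ 2 ℤ.* ℤ.+ m →
        (if ⌊ exponent z ℤ.≟ (ℤ.+ 2) ℤ.* (ℤ.+ N) ⌋ then c else 0ℚ) ≡ c ℚ.* coe (q ^ m) N
      select z m N c e rewrite coe-q^ m N with exponent z ℤ.≟ (ℤ.+ 2) ℤ.* (ℤ.+ N) | m ℕ.≡ᵇ N in eq
      ... | yes p | true  = ≡.sym (ℚP.*-identityʳ c)
      ... | no  p | false = ≡.sym (ℚP.*-zeroʳ c)
      ... | no  p | true  = contradiction (≡.trans e (≡.cong (λ j → ℤ.+ 2 ℤ.* ℤ.+ j) (ℕP.≡ᵇ⇒≡ m N (≡.subst Bool.T (≡.sym eq) _)))) p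
      ... | yes p | false = contradiction (≡.subst Bool.T eq (ℕP.≡⇒≡ᵇ m N (ℤP.+-injective (ℤP.*-cancelˡ-≡ (ℤ.+ 2) (ℤ.+ m) (ℤ.+ N) (≡.trans (≡.sym e) p))))) λ ()

      signℕ : ℕ → ℤ
      signℕ k = if k ℕ.% 2 ℕ.≡ᵇ 0 then ℤ.+ 1 else ℤ.- (ℤ.+ 1)

      signℕ-suc : ∀ k → signℕ (suc k) ≡ ℤ.- signℕ k
      signℕ-suc zero          = ≡.refl
      signℕ-suc (suc zero)    = ≡.refl
      signℕ-suc (suc (suc k)) = signℕ-suc k

      sgn-κ : ∀ k → sgn k ≋ κ (signℕ k / 1)
      sgn-κ zero    = refl
      sgn-κ (suc k) = trans (-‿cong (sgn-κ k)) (trans (sym (κ-neg (signℕ k / 1))) (κ-cong (≡.trans (≡.sym (fromInt-neg (signℕ k))) (≡.cong (_/ 1) (≡.sym (signℕ-suc k))))))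

      ν-κ : ∀ k → ν k ≋ κ (ℤ.+ k / 1)
      ν-κ zero    = pw λ where
        zero    → ≡.refl
        (suc n) → ≡.refl
      ν-κ (suc k) = trans (+-congˡ (ν-κ k)) (trans (sym (κ-+ 1ℚ (ℤ.+ k / 1))) (κ-cong (≡.sym (fromInt-+ (ℤ.+ 1) (ℤ.+ k)))))

      coe-Sᵢ : ∀ k N → coe (Sᵢ k) N ≡ ((signℕ k ℤ.* ℤ.+ k) / 1) ℚ.* coe (q ^ u k) N ℚ.+ ((signℕ (suc k) ℤ.* -[1+ k ]) / 1) ℚ.* coe (q ^ u′ k) N
      coe-Sᵢ k N = ≡.trans (at (trans (*-cong (sgn-κ k) (+-cong (*-congʳ (ν-κ k)) (*-congʳ (ν-κ (suc k)))))
                              (distribˡ (κ (signℕ k / 1)) (κ (ℤ.+ k / 1) * q ^ u k) (κ (ℤ.+ suc k / 1) * q ^ u′ k))) N)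
        (≡.cong₂ ℚ._+_ (scaled (ℤ.+ k) (u k))
          (≡.trans (scaled (ℤ.+ suc k) (u′ k)) (≡.cong (λ i → i / 1 ℚ.* coe (q ^ u′ k) N)
            (≡.trans (flip (signℕ k) (ℤ.+ suc k)) (≡.cong (ℤ._* -[1+ k ]) (≡.sym (signℕ-suc k)))))))
        where
        scaled : ∀ m e → coe (κ (signℕ k / 1) * (κ (m / 1) * q ^ e)) N ≡ ((signℕ k ℤ.* m) / 1) ℚ.* coe (q ^ e) N
        scaled m e = ≡.trans (κ-✶ (signℕ k / 1) (κ (m / 1) * q ^ e) N) (≡.trans (≡.cong (signℕ k / 1 ℚ.*_) (κ-✶ (m / 1) (q ^ e) N))
          (≡.trans (≡.sym (ℚP.*-assoc (signℕ k / 1) (m / 1) (coe (q ^ e) N))) (≡.cong (ℚ._* coe (q ^ e) N) (≡.sym (fromInt-* (signℕ k) m)))))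
        flip : ∀ s m → s ℤ.* m ≡ (ℤ.- s) ℤ.* (ℤ.- m)
        flip = ℤSolver.solve-∀

      term : ℕ → ℕ → ℚ
      term N i = let z = (ℤ.+ i) ℤ.- (ℤ.+ suc N) in
        if ⌊ exponent z ℤ.≟ (ℤ.+ 2) ℤ.* (ℤ.+ N) ⌋ then (signℤ z ℤ.* z) / 1 else 0ℚ

      term-at : ∀ N i z m → (ℤ.+ i) ℤ.- (ℤ.+ suc N) ≡ z → exponent z ≡ ℤ.+ 2 ℤ.* ℤ.+ m → term N i ≡ ((signℤ z ℤ.* z) / 1) ℚ.* coe (q ^ m) N
      term-at N i z m ≡.refl e = select z m N _ e

      coe-∑ : ∀ f n N → coe (∑ f n) N ≡ ∑ℚ (λ k → coe (f k) N) n
      coe-∑ f zero    N = ≡.refl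
      coe-∑ f (suc n) N = ≡.cong (ℚ._+ coe (f n) N) (coe-∑ f n N)

    series-S : series Defs.Sₚ ≋ S
    series-S = pw λ N → ≡.trans (sumTo≡∑ (term N) (suc (2 ℕ.* suc N)))
      (≡.trans (≡.cong (∑ℚ (term N)) (size N))
      (≡.trans (∑ℚ-append (term N) (suc N) (suc (suc N)))
      (≡.trans (≡.cong₂ ℚ._+_ (≡.trans (∑ℚ-reverse (term N) N) (lower N)) (upper N))
      (≡.trans (ℚP.+-comm (∑ℚ (lowerTerm N) (suc N)) (∑ℚ (upperTerm N) (suc N))) (≡.trans (≡.sym (∑ℚ-+ (upperTerm N) (lowerTerm N) (suc N)))
        (≡.trans (∑ℚ-cong (suc N) λ k → ≡.sym (coe-Sᵢ k N)) (≡.sym (coe-∑ Sᵢ (suc N) N))))))))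
      where
      lowerTerm upperTerm : ℕ → ℕ → ℚ
      lowerTerm N k = ((signℕ (suc k) ℤ.* -[1+ k ]) / 1) ℚ.* coe (q ^ u′ k) N
      upperTerm N k = ((signℕ k ℤ.* ℤ.+ k) / 1) ℚ.* coe (q ^ u k) N
      size : ∀ N → suc (2 ℕ.* suc N) ≡ suc (suc N) ℕ.+ suc N
      size = solve-∀
      lower : ∀ N → ∑ℚ (λ k → term N (N ℕ.∸ k)) (suc N) ≡ ∑ℚ (lowerTerm N) (suc N)
      lower N = ListSums.∑-cong< ℚR (suc N) λ k k≤N → term-at N (N ℕ.∸ k) -[1+ k ] (u′ k) (index k (ℕP.≤-pred k≤N)) (exponent⁻ k)
        where
        index : ∀ k → k ≤ N → (ℤ.+ (N ℕ.∸ k)) ℤ.- (ℤ.+ suc N) ≡ -[1+ k ]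
        index k k≤N = ≡.trans (≡.cong (ℤ._- ℤ.+ suc N) (≡.sym (ℤP.⊖-≥ k≤N))) (≡.trans (≡.cong (ℤ._- ℤ.+ suc N) (≡.sym (ℤP.m-n≡m⊖n N k))) (go (ℤ.+ N) (ℤ.+ k)))
          where
          go : ∀ n k → n ℤ.- k ℤ.- (ℤ.+ 1 ℤ.+ n) ≡ ℤ.- (ℤ.+ 1 ℤ.+ k)
          go = ℤSolver.solve-∀
      upper : ∀ N → ∑ℚ (λ k → term N (k ℕ.+ suc N)) (suc (suc N)) ≡ ∑ℚ (upperTerm N) (suc N)
      upper N = ≡.trans (∑ℚ-cong (suc (suc N)) λ k → term-at N (k ℕ.+ suc N) (ℤ.+ k) (u k) (index (ℤ.+ k) (ℤ.+ suc N)) (exponent⁺ k))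
        (≡.trans (≡.cong (∑ℚ (upperTerm N) (suc N) ℚ.+_)
           (≡.trans (≡.cong (((signℕ (suc N) ℤ.* ℤ.+ suc N) / 1) ℚ.*_) (at< (q^-order (k≤u (suc N))) N ℕP.≤-refl)) (ℚP.*-zeroʳ ((signℕ (suc N) ℤ.* ℤ.+ suc N) / 1))))
          (ℚP.+-identityʳ (∑ℚ (upperTerm N) (suc N))))
        where
        index : ∀ k n → k ℤ.+ n ℤ.- n ≡ k
        index = ℤSolver.solve-∀

open FrozenSeries

centred : ℕ → ℤ
centred 1 = ℤ.+ 1
centred 2 = ℤ.+ 2
centred 3 = ℤ.- (ℤ.+ 2)
centred 4 = ℤ.- (ℤ.+ 1)
centred _ = ℤ.+ 0

-- A ℚ-algebra with a fifth root of unity z, an infinitesimal ε, complex conjugation, and a linear functional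
-- reading off the centred residue of r from zʳε.
record CrankRing : Set₁ where
  field
    K : CommutativeRing 0ℓ 0ℓ
  open CommutativeRing K
  open Exp semiring using (_^_)
  field
    ι         : RingHom ℚR K
    z ε       : Carrier
    Φ₀        : 1# + z + z ^ 2 + z ^ 3 + z ^ 4 ≈ 0#
    ε²        : ε * ε ≈ 0#
    conj      : RingHom K K
    μ         : Carrier → ℚ
  open RingHom ι using () renaming (⟦_⟧ to ι⟨_⟩)
  open RingHom conj using () renaming (⟦_⟧ to conj⟨_⟩)
  field
    ι-injective : ∀ {r s} → ι⟨ r ⟩ ≈ ι⟨ s ⟩ → r ≡ s
    conj-z    : conj⟨ z ⟩ ≈ z ^ 4
    conj-ε    : conj⟨ ε ⟩ ≈ ε
    μ-cong    : ∀ {a b} → a ≈ b → μ a ≡ μ b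
    μ-+       : ∀ a b → μ (a + b) ≡ μ a ℚ.+ μ b
    μ-ι       : ∀ r a → μ (ι⟨ r ⟩ * a) ≡ r ℚ.* μ a
    μ-conj    : ∀ a → μ conj⟨ a ⟩ ≡ ℚ.- μ a
    μ-z       : ∀ r → r < 5 → μ (z ^ r) ≡ 0ℚ
    μ-zε      : ∀ r → r < 5 → μ (z ^ r * ε) ≡ centred r / 1

module CrankMoment (𝒦 : CrankRing) where
  open CrankRing 𝒦
  open CommutativeRing K hiding (zero)
  open Exp semiring using (_^_; ^-homo-*; ^-assocʳ; ^-congˡ)
  open FirstOrderPowers K using (ν; first-order)
  open ListSums K using (sumL; sumL-cong)
  open ListSums ℚR using () renaming (sumL to sumℚ; sumL-cong to sumℚ-cong)
  open PartitionSeries K using (weight; coloredSeries; coloredSeries-∷; coloredSeries-[]; unbounded; Θ-unbounded)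
  open SeriesLimits K using (coe; _≋_; at)
  private
    module ι = RingHom ι
    module conj = RingHom conj
    module S = CommutativeRing (SeriesLimits.seriesRing K)
    module I = IntegerSolver K
  open I using (solve)

  z⁵ : z ^ 5 ≈ 1#
  z⁵ = RootOfUnity.z⁵ K z Φ₀

  μ-0 : μ 0# ≡ 0ℚ
  μ-0 = ≡.trans (μ-cong (sym (zeroʳ (ι.⟦ 0ℚ ⟧)))) (≡.trans (μ-ι 0ℚ 0#) (ℚP.*-zeroˡ (μ 0#)))

  μ-sumL : ∀ {a} {A : Set a} (f : A → Carrier) xs → μ (sumL f xs) ≡ sumℚ (λ x → μ (f x)) xs
  μ-sumL f List.[]       = μ-0
  μ-sumL f (x List.∷ xs) = ≡.trans (μ-+ _ _) (≡.cong (μ (f x) ℚ.+_) (μ-sumL f xs))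

  z^-period : ∀ r k → z ^ (r ℕ.+ k ℕ.* 5) ≈ z ^ r
  z^-period r zero    = reflexive (≡.cong (z ^_) (ℕP.+-identityʳ r))
  z^-period r (suc k) = trans (reflexive (≡.cong (z ^_) (shuffle r (k ℕ.* 5)))) (trans (^-homo-* z 5 (r ℕ.+ k ℕ.* 5))
      (trans (*-congʳ z⁵) (trans (*-identityˡ _) (z^-period r k))))
    where
    shuffle : ∀ r m → r ℕ.+ (5 ℕ.+ m) ≡ 5 ℕ.+ (r ℕ.+ m)
    shuffle = solve-∀

  z^-difference : ∀ a b → z ^ a * (z ^ 4) ^ b ≈ z ^ ((ℤ.+ a ℤ.- ℤ.+ b) ℤ.%ℕ 5)
  z^-difference a b = trans (trans (*-congˡ (^-assocʳ z 4 b)) (sym (^-homo-* z a (4 ℕ.* b)))) (go ((ℤ.+ a ℤ.- ℤ.+ b) ℤ.%ℕ 5) ((ℤ.+ a ℤ.- ℤ.+ b) ℤ./ℕ 5) (ℤD.a≡a%ℕn+[a/ℕn]*n (ℤ.+ a ℤ.- ℤ.+ b) 5))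
    where
    move : ∀ a b c → a ℤ.- b ≡ c → a ≡ c ℤ.+ b
    move a b c p = ≡.trans (lemma a b) (≡.cong (ℤ._+ b) p)
      where
      lemma : ∀ a b → a ≡ a ℤ.- b ℤ.+ b
      lemma = ℤSolver.solve-∀
    go : ∀ r t → ℤ.+ a ℤ.- ℤ.+ b ≡ ℤ.+ r ℤ.+ t ℤ.* ℤ.+ 5 → z ^ (a ℕ.+ 4 ℕ.* b) ≈ z ^ r
    go r (ℤ.+ t) p = trans (reflexive (≡.cong (z ^_) (≡.trans (≡.cong (ℕ._+ 4 ℕ.* b) a≡) (shuffle r t b)))) (z^-period r (t ℕ.+ b))
      where
      a≡ : a ≡ r ℕ.+ t ℕ.* 5 ℕ.+ b
      a≡ = ℤP.+-injective (≡.trans (move (ℤ.+ a) (ℤ.+ b) _ p) (≡.cong (ℤ._+ ℤ.+ b) (≡.cong (ℤ._+_ (ℤ.+ r)) (≡.sym (ℤP.pos-* t 5)))))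
      shuffle : ∀ r t b → r ℕ.+ t ℕ.* 5 ℕ.+ b ℕ.+ 4 ℕ.* b ≡ r ℕ.+ (t ℕ.+ b) ℕ.* 5
      shuffle = solve-∀
    go r ℤ.-[1+ t ] p = trans (sym (z^-period (a ℕ.+ 4 ℕ.* b) (suc t)))
      (trans (reflexive (≡.cong (z ^_) (≡.trans (swap a b t) (≡.trans (≡.cong (ℕ._+ 4 ℕ.* b) a≡) (shuffle r b))))) (z^-period r b))
      where
      a≡ : a ℕ.+ suc t ℕ.* 5 ≡ r ℕ.+ b
      a≡ = ℤP.+-injective (≡.trans (ℤP.pos-+ a (suc t ℕ.* 5)) (≡.trans (≡.cong₂ ℤ._+_ (move (ℤ.+ a) (ℤ.+ b) _ p) (ℤP.pos-* (suc t) 5)) (lemma (ℤ.+ r) (ℤ.+ b) (ℤ.+ suc t))))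
        where
        lemma : ∀ r b t → r ℤ.+ (ℤ.- t) ℤ.* ℤ.+ 5 ℤ.+ b ℤ.+ t ℤ.* ℤ.+ 5 ≡ r ℤ.+ b
        lemma = ℤSolver.solve-∀
      swap : ∀ a b t → a ℕ.+ 4 ℕ.* b ℕ.+ suc t ℕ.* 5 ≡ a ℕ.+ suc t ℕ.* 5 ℕ.+ 4 ℕ.* b
      swap = solve-∀
      shuffle : ∀ r b → r ℕ.+ b ℕ.+ 4 ℕ.* b ≡ r ℕ.+ b ℕ.* 5
      shuffle = solve-∀

  ν-ι : ∀ k → ν k ≈ ι.⟦ ℤ.+ k / 1 ⟧
  ν-ι zero    = sym ι.0-hom
  ν-ι (suc k) = trans (+-cong (sym ι.1-hom) (ν-ι k)) (trans (sym (ι.+-hom 1ℚ (ℤ.+ k / 1))) (ι.⟦⟧-cong (≡.sym (fromInt-+ (ℤ.+ 1) (ℤ.+ k)))))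

  colours : Carrier → Carrier → Vec Carrier 4
  colours x y = x ∷ y ∷ 1# ∷ 1# ∷ []

  1^ : ∀ k → 1# ^ k ≈ 1#
  1^ zero    = refl
  1^ (suc k) = trans (*-identityˡ _) (1^ k)

  weight-colours : ∀ x y (π : Vec (List ℕ) 4) → weight (colours x y) π ≈ x ^ parts₁ π * y ^ parts₁ (Vec.tail π)
  weight-colours x y (p ∷ p′ ∷ p″ ∷ p‴ ∷ []) = *-congˡ (trans (*-congˡ (trans (*-cong (1^ (length p″)) (trans (*-congʳ (1^ (length p‴))) (*-identityˡ 1#))) (*-identityˡ 1#))) (*-identityʳ _))

  z₁ z′ : Carrier
  z₁ = z * (1# + ε)
  z′ = z ^ 4

  μ-weight : ∀ π → μ (weight (colours z₁ z′) π) ≡ (ℤ.+ parts₁ π ℤ.* centred (crank π ℤ.%ℕ 5)) / 1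
  μ-weight π@(p ∷ p′ ∷ _) = ≡.trans (μ-cong (trans (weight-colours z₁ z′ π) rearrange)) (≡.trans (μ-+ _ _)
      (≡.trans (≡.cong₂ ℚ._+_ (μ-z r r<5) (≡.trans (μ-ι (ℤ.+ a / 1) (z ^ r * ε)) (≡.cong (ℤ.+ a / 1 ℚ.*_) (μ-zε r r<5))))
        (≡.trans (ℚP.+-identityˡ _) (≡.sym (fromInt-* (ℤ.+ a) (centred r))))))
    where
    a b r : ℕ
    a = length p
    b = length p′
    r = (ℤ.+ a ℤ.- ℤ.+ b) ℤ.%ℕ 5
    r<5 : r < 5
    r<5 = ℤD.n%ℕd<d (ℤ.+ a ℤ.- ℤ.+ b) 5
    rearrange : z₁ ^ a * z′ ^ b ≈ z ^ r + ι.⟦ ℤ.+ a / 1 ⟧ * (z ^ r * ε)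
    rearrange = trans (*-congʳ (first-order z ε ε² a)) (trans
      (solve 4 (λ u v n e → (u :* (# 1 :+ n :* e)) :* v := u :* v :+ n :* (u :* v :* e)) (z ^ a) (z′ ^ b) (ν a) ε)
      (+-cong (z^-difference a b) (*-cong (ν-ι a) (*-congʳ (z^-difference a b)))))

  private
    selected : ℕ → ℕ → ℕ → ℕ
    selected m r l = if r ℕ.≡ᵇ m then l else 0

    combine : ℕ → ℕ → ℕ → ℕ → ℤ
    combine s₁ s₄ s₂ s₃ = ((ℤ.+ s₁) ℤ.- (ℤ.+ s₄) ℤ.+ (ℤ.+ 2) ℤ.* (ℤ.+ s₂)) ℤ.- (ℤ.+ 2) ℤ.* (ℤ.+ s₃)

    combine-selected : ∀ r l → combine (selected 1 r l) (selected 4 r l) (selected 2 r l) (selected 3 r l) ≡ ℤ.+ l ℤ.* centred r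
    combine-selected 0 l = ≡.sym (ℤP.*-zeroʳ (ℤ.+ l))
    combine-selected 1 l = go (ℤ.+ l)
      where
      go : ∀ l → (l ℤ.- ℤ.+ 0 ℤ.+ (ℤ.+ 2) ℤ.* ℤ.+ 0) ℤ.- (ℤ.+ 2) ℤ.* ℤ.+ 0 ≡ l ℤ.* ℤ.+ 1
      go = ℤSolver.solve-∀
    combine-selected 2 l = go (ℤ.+ l)
      where
      go : ∀ l → (ℤ.+ 0 ℤ.- ℤ.+ 0 ℤ.+ (ℤ.+ 2) ℤ.* l) ℤ.- (ℤ.+ 2) ℤ.* ℤ.+ 0 ≡ l ℤ.* ℤ.+ 2
      go = ℤSolver.solve-∀
    combine-selected 3 l = go (ℤ.+ l)
      where
      go : ∀ l → (ℤ.+ 0 ℤ.- ℤ.+ 0 ℤ.+ (ℤ.+ 2) ℤ.* ℤ.+ 0) ℤ.- (ℤ.+ 2) ℤ.* l ≡ l ℤ.* ℤ.- (ℤ.+ 2)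
      go = ℤSolver.solve-∀
    combine-selected 4 l = go (ℤ.+ l)
      where
      go : ∀ l → (ℤ.+ 0 ℤ.- l ℤ.+ (ℤ.+ 2) ℤ.* ℤ.+ 0) ℤ.- (ℤ.+ 2) ℤ.* ℤ.+ 0 ≡ l ℤ.* ℤ.- (ℤ.+ 1)
      go = ℤSolver.solve-∀
    combine-selected (suc (suc (suc (suc (suc r))))) l = ≡.sym (ℤP.*-zeroʳ (ℤ.+ l))

    combine-+ : ∀ a b c d a′ b′ c′ d′ → combine (a ℕ.+ a′) (b ℕ.+ b′) (c ℕ.+ c′) (d ℕ.+ d′) ≡ combine a b c d ℤ.+ combine a′ b′ c′ d′
    combine-+ a b c d a′ b′ c′ d′ = go (ℤ.+ a) (ℤ.+ b) (ℤ.+ c) (ℤ.+ d) (ℤ.+ a′) (ℤ.+ b′) (ℤ.+ c′) (ℤ.+ d′)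
      where
      go : ∀ a b c d a′ b′ c′ d′ → (a ℤ.+ a′ ℤ.- (b ℤ.+ b′) ℤ.+ (ℤ.+ 2) ℤ.* (c ℤ.+ c′)) ℤ.- (ℤ.+ 2) ℤ.* (d ℤ.+ d′)
             ≡ (a ℤ.- b ℤ.+ (ℤ.+ 2) ℤ.* c) ℤ.- (ℤ.+ 2) ℤ.* d ℤ.+ ((a′ ℤ.- b′ ℤ.+ (ℤ.+ 2) ℤ.* c′) ℤ.- (ℤ.+ 2) ℤ.* d′)
      go = ℤSolver.solve-∀

    total : ℕ → List (Vec (List ℕ) 4) → ℕ
    total m πs = ListAction.sum (List.map (λ π → selected m (crank π ℤ.%ℕ 5) (parts₁ π)) πs)

    moment : ∀ πs → combine (total 1 πs) (total 4 πs) (total 2 πs) (total 3 πs) / 1 ≡ sumℚ (λ π → μ (weight (colours z₁ z′) π)) πs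
    moment List.[]       = ≡.refl
    moment (π List.∷ πs) = ≡.trans (≡.cong (_/ 1) (combine-+ (sel 1) (sel 4) (sel 2) (sel 3) (total 1 πs) (total 4 πs) (total 2 πs) (total 3 πs)))
      (≡.trans (fromInt-+ (combine (sel 1) (sel 4) (sel 2) (sel 3)) (combine (total 1 πs) (total 4 πs) (total 2 πs) (total 3 πs)))
      (≡.cong₂ ℚ._+_ (≡.trans (≡.cong (_/ 1) (combine-selected (crank π ℤ.%ℕ 5) (parts₁ π))) (≡.sym (μ-weight π))) (moment πs)))
      where
      sel : ℕ → ℕ
      sel m = selected m (crank π ℤ.%ℕ 5) (parts₁ π)

  F≡μ : ∀ r n → Defs.F r n ≡ μ (coe (coloredSeries (colours z₁ z′)) (5 ℕ.* n ℕ.+ r))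
  F≡μ r n = ≡.trans (moment (colored 4 (5 ℕ.* n ℕ.+ r))) (≡.sym (μ-sumL (weight (colours z₁ z′)) (colored 4 (5 ℕ.* n ℕ.+ r))))

  factorised : ∀ x y → coloredSeries (colours x y) ≋ unbounded x S.* (unbounded y S.* (unbounded 1# S.* (unbounded 1# S.* S.1#)))
  factorised x y = S.trans (coloredSeries-∷ x _) (S.*-congˡ (S.trans (coloredSeries-∷ y _) (S.*-congˡ (S.trans (coloredSeries-∷ 1# _)
    (S.*-congˡ (S.trans (coloredSeries-∷ 1# []) (S.*-congˡ coloredSeries-[])))))))

  colour-swap : ∀ x y → coloredSeries (colours x y) ≋ coloredSeries (colours y x)
  colour-swap x y = S.trans (factorised x y) (S.trans (S.trans (S.sym (S.*-assoc _ _ _)) (S.trans (S.*-congʳ (S.*-comm _ _)) (S.*-assoc _ _ _))) (S.sym (factorised y x)))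

  weight-cong : ∀ {x x′ y y′} → x ≈ x′ → y ≈ y′ → ∀ π → weight (colours x y) π ≈ weight (colours x′ y′) π
  weight-cong {x} {x′} {y} {y′} p r π = trans (weight-colours x y π) (trans (*-cong (^-congˡ (parts₁ π) p) (^-congˡ (parts₁ (Vec.tail π)) r)) (sym (weight-colours x′ y′ π)))

  conj-weight : ∀ x y π → conj.⟦ weight (colours x y) π ⟧ ≈ weight (colours conj.⟦ x ⟧ conj.⟦ y ⟧) π
  conj-weight x y π = trans (conj.⟦⟧-cong (weight-colours x y π)) (trans (conj.*-hom _ _)
    (trans (*-cong (conj.^-hom x (parts₁ π)) (conj.^-hom y (parts₁ (Vec.tail π)))) (sym (weight-colours _ _ π))))

  conj-sumL : ∀ {a} {A : Set a} (f : A → Carrier) xs → conj.⟦ sumL f xs ⟧ ≈ sumL (λ x → conj.⟦ f x ⟧) xs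
  conj-sumL f List.[]       = conj.0-hom
  conj-sumL f (x List.∷ xs) = trans (conj.+-hom _ _) (+-congˡ (conj-sumL f xs))

  z₁′ Z′ : Carrier
  z₁′ = z′ * (1# + ε)
  Z′  = z′ * (1# - ε)

  conj-z₁ : conj.⟦ z₁ ⟧ ≈ z₁′
  conj-z₁ = trans (conj.*-hom _ _) (*-cong conj-z (trans (conj.+-hom _ _) (+-cong conj.1-hom conj-ε)))

  conj-z′ : conj.⟦ z′ ⟧ ≈ z
  conj-z′ = trans (conj.^-hom z 4) (trans (^-congˡ 4 conj-z) (trans (^-assocʳ z 4 4) (trans (z^-period 1 3) (*-identityʳ z))))

  -- Exchanging the first two colours and conjugating turns the count of parts of π⁽¹⁾ into that of π⁽²⁾.
  μ-second : ∀ N → μ (coe (coloredSeries (colours z z₁′)) N) ≡ ℚ.- μ (coe (coloredSeries (colours z₁ z′)) N)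
  μ-second N = ≡.trans (μ-cong (trans (at (colour-swap z z₁′) N)
      (sym (trans (conj-sumL _ (colored 4 N)) (sumL-cong (λ π → trans (conj-weight z₁ z′ π) (weight-cong conj-z₁ conj-z′ π)) (colored 4 N))))))
    (μ-conj _)

  μ-both : ∀ N → μ (coe (coloredSeries (colours z₁ Z′)) N) ≡ μ (coe (coloredSeries (colours z₁ z′)) N) ℚ.+ μ (coe (coloredSeries (colours z₁ z′)) N)
  μ-both N = ≡.trans (move _ _ _ sum-rule) (≡.cong (λ t → m₁ ℚ.+ ℚ.- t) (μ-second N) ⟨≡⟩ ≡.cong (m₁ ℚ.+_) (GroupP.⁻¹-involutive ℚP.+-0-group m₁))
    where
    m₁ : ℚ
    m₁ = μ (coe (coloredSeries (colours z₁ z′)) N)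
    infixr 4 _⟨≡⟩_
    _⟨≡⟩_ : ∀ {a b c : ℚ} → a ≡ b → b ≡ c → a ≡ c
    _⟨≡⟩_ = ≡.trans
    move : ∀ a b c → a ℚ.+ b ≡ c → a ≡ c ℚ.+ ℚ.- b
    move a b c p = ≡.sym (≡.trans (≡.cong (ℚ._+ ℚ.- b) (≡.sym p)) (≡.trans (ℚP.+-assoc a b (ℚ.- b)) (≡.trans (≡.cong (a ℚ.+_) (ℚP.+-inverseʳ b)) (ℚP.+-identityʳ a))))
    termwise : ∀ π → weight (colours z₁ Z′) π + weight (colours z z₁′) π ≈ weight (colours z₁ z′) π + weight (colours z z′) π
    termwise π = trans (+-cong (weight-colours z₁ Z′ π) (weight-colours z z₁′ π)) (trans
      (trans (+-cong (*-cong (first-order z ε ε² a) (first-order z′ (- ε) (trans (solve 1 (λ e → :- e :* :- e := e :* e) ε) ε²) b)) (*-congˡ (first-order z′ ε ε² b)))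
        (trans (solve 5 (λ u w m n e → (u :* (# 1 :+ m :* e)) :* (w :* (# 1 :+ n :* :- e)) :+ u :* (w :* (# 1 :+ n :* e))
               := (u :* (# 1 :+ m :* e)) :* w :+ u :* w :- u :* w :* m :* n :* (e :* e)) (z ^ a) (z′ ^ b) (ν a) (ν b) ε)
          (trans (+-congˡ (trans (-‿cong (trans (*-congˡ ε²) (zeroʳ _))) (solve 0 (:- # 0 := # 0)))) (+-identityʳ _))))
      (sym (+-cong (trans (weight-colours z₁ z′ π) (*-congʳ (first-order z ε ε² a))) (weight-colours z z′ π))))
      where
      a b : ℕ
      a = parts₁ π
      b = parts₁ (Vec.tail π)
    μ-unperturbed : ∀ π → μ (weight (colours z z′) π) ≡ 0ℚ
    μ-unperturbed π = ≡.trans (μ-cong (trans (weight-colours z z′ π) (z^-difference (parts₁ π) (parts₁ (Vec.tail π)))))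
      (μ-z _ (ℤD.n%ℕd<d (ℤ.+ parts₁ π ℤ.- ℤ.+ parts₁ (Vec.tail π)) 5))
    sum-rule : μ (coe (coloredSeries (colours z₁ Z′)) N) ℚ.+ μ (coe (coloredSeries (colours z z₁′)) N) ≡ m₁
    sum-rule = ≡.trans (≡.cong₂ ℚ._+_ (μ-sumL _ (colored 4 N)) (μ-sumL _ (colored 4 N))) (≡.trans (go (colored 4 N)) (≡.sym (μ-sumL _ (colored 4 N))))
      where
      go : ∀ πs → sumℚ (λ π → μ (weight (colours z₁ Z′) π)) πs ℚ.+ sumℚ (λ π → μ (weight (colours z z₁′) π)) πs ≡ sumℚ (λ π → μ (weight (colours z₁ z′) π)) πs
      go List.[]       = ≡.refl
      go (π List.∷ πs) = ≡.trans (interchange (μ (weight (colours z₁ Z′) π)) _ (μ (weight (colours z z₁′) π)) _) (≡.cong₂ ℚ._+_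
        (≡.trans (≡.sym (μ-+ _ _)) (≡.trans (μ-cong (termwise π)) (≡.trans (μ-+ _ _) (≡.trans (≡.cong (μ (weight (colours z₁ z′) π) ℚ.+_) (μ-unperturbed π)) (ℚP.+-identityʳ (μ (weight (colours z₁ z′) π)))))))
        (go πs))
        where open CommutativeSemigroupP (CommutativeRing.+-commutativeSemigroup ℚR) using (interchange)

  F-double : ∀ r n → Defs.F r n ℚ.+ Defs.F r n ≡ μ (coe (coloredSeries (colours z₁ Z′)) (5 ℕ.* n ℕ.+ r))
  F-double r n = ≡.trans (≡.cong₂ ℚ._+_ (F≡μ r n) (F≡μ r n)) (≡.sym (μ-both (5 ℕ.* n ℕ.+ r)))

module ℚInverses where
  open ℚSeries
  A⁻¹ B⁻¹ E₁⁻¹ X Y G₀ : Series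
  A⁻¹  = series (Defs.inv Defs.Aₚ)
  B⁻¹  = series (Defs.inv Defs.Bₚ)
  E₁⁻¹ = series (Defs.inv Defs.E₁)
  X    = B * A⁻¹
  Y    = A * B⁻¹
  G₀   = E₅ ^ 10 * E₁⁻¹ ^ 12

  AA⁻¹ : A * A⁻¹ ≋ 1#
  AA⁻¹ = trans (*-congʳ (sym series-A)) (inv-* Defs.Aₚ ≡.refl)
  BB⁻¹ : B * B⁻¹ ≋ 1#
  BB⁻¹ = trans (*-congʳ (sym series-B)) (inv-* Defs.Bₚ ≡.refl)
  E₁E₁⁻¹ : E₁ * E₁⁻¹ ≋ 1#
  E₁E₁⁻¹ = trans (*-congʳ (sym series-E₁)) (inv-* Defs.E₁ ≡.refl)

module Extraction (𝒦 : CrankRing) where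
  open CrankRing 𝒦
  private
    module K = CommutativeRing K
    module KE = Exp K.semiring
    module ι = RingHom ι
    module Q = ℚSeries
    module Qi = ℚInverses
    module IQ = IntegerSolver Q.seriesRing
    module ιS = MapSeries ι
    module m = RingHom ιS.mapHom
    module CM = CrankMoment 𝒦
  open ThetaSeries K
  open ιS using (map)

  map-q^ : ∀ n → map (Q.q Q.^ n) ≋ q ^ n
  map-q^ n = trans (m.^-hom Q.q n) (^-congˡ n ιS.map-q)

  map-factor : ∀ n → map (Q.1# Q.- Q.q Q.^ n) ≋ 1# - q ^ n
  map-factor n = trans (m.sub-hom Q.1# (Q.q Q.^ n)) (+-cong m.1-hom (-‿cong (map-q^ n)))

  map-euler : ∀ r → map (Q.euler r) ≋ euler r
  map-euler r = ⟶-unique (ιS.map-⟶ (Q.euler-⟶ r)) (⟶-cong (λ N → sym (trans (m.∏-hom _ N) (∏-cong N λ k → map-factor (r ℕ.+ k ℕ.* 5)))) (euler-⟶ r))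

  map-E₁ : map Q.E₁ ≋ E₁
  map-E₁ = ⟶-unique (ιS.map-⟶ Q.E₁-⟶) (⟶-cong (λ N → sym (trans (m.∏-hom _ N) (∏-cong N λ k → map-factor (suc k)))) E₁-⟶)

  map-A : map Q.A ≋ A
  map-A = trans (m.*-hom _ _) (*-cong (map-euler 1) (map-euler 4))
  map-B : map Q.B ≋ B
  map-B = trans (m.*-hom _ _) (*-cong (map-euler 2) (map-euler 3))
  map-E₅ : map Q.E₅ ≋ E₅
  map-E₅ = map-euler 5

  map-φ : ∀ f → map (Q.φ f) ≋ φ (map f)
  map-φ f = pw λ n → go n f
    where
    go : ∀ n f → coe (map (Q.φ f)) n K.≈ coe (φ (map f)) n
    go 0 f = K.refl
    go 1 f = ι.0-hom
    go 2 f = ι.0-hom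
    go 3 f = ι.0-hom
    go 4 f = ι.0-hom
    go (suc (suc (suc (suc (suc n))))) f = go n (Q.tail f)

  private
    unit : ∀ {f f⁻¹ g} → map f ≋ g → f Q.* f⁻¹ Q.≋ Q.1# → g * map f⁻¹ ≋ 1#
    unit p u = trans (*-congʳ (sym p)) (trans (sym (m.*-hom _ _)) (trans (m.⟦⟧-cong u) m.1-hom))

    fifth≈ : (K.1# K.+ K.1# K.+ K.1# K.+ K.1# K.+ K.1#) K.* ι.⟦ ℤ.+ 1 / 5 ⟧ K.≈ K.1#
    fifth≈ = K.trans (K.*-congʳ (K.sym (K.trans (ι.+-hom _ _) (K.+-cong (K.trans (ι.+-hom _ _) (K.+-cong (K.trans (ι.+-hom _ _) (K.+-cong
      (K.trans (ι.+-hom 1ℚ 1ℚ) (K.+-cong ι.1-hom ι.1-hom)) ι.1-hom)) ι.1-hom)) ι.1-hom))))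
      (K.trans (K.sym (ι.*-hom (1ℚ ℚ.+ 1ℚ ℚ.+ 1ℚ ℚ.+ 1ℚ ℚ.+ 1ℚ) (ℤ.+ 1 / 5))) (K.trans (ι.⟦⟧-cong ≡.refl) ι.1-hom))

    half≈ : (K.1# K.+ K.1#) K.* ι.⟦ ℤ.+ 1 / 2 ⟧ K.≈ K.1#
    half≈ = K.trans (K.*-congʳ (K.sym (K.trans (ι.+-hom 1ℚ 1ℚ) (K.+-cong ι.1-hom ι.1-hom))))
      (K.trans (K.sym (ι.*-hom (1ℚ ℚ.+ 1ℚ) (ℤ.+ 1 / 2))) (K.trans (ι.⟦⟧-cong ≡.refl) ι.1-hom))

  module QI = QuinticIdentities K z Φ₀ ι.⟦ ℤ.+ 1 / 5 ⟧ fifth≈ (map Qi.A⁻¹) (map Qi.B⁻¹) (map Qi.E₁⁻¹)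
    (unit map-A Qi.AA⁻¹) (unit map-B Qi.BB⁻¹) (unit map-E₁ Qi.E₁E₁⁻¹)
  module CS = QI.CrankSeries ε ι.⟦ ℤ.+ 1 / 2 ⟧ ε² half≈
  open FifthRoots K z Φ₀ ι.⟦ ℤ.+ 1 / 5 ⟧ fifth≈ using (ζ; ⌜_⌝; c′; s₁; s₂; Θ-cong)
  open PartPolynomials
  open PartitionSeries K using (coloredSeries; unbounded; Θ-unbounded)
  private
    module κ = RingHom κHom

  M : Series
  M = coloredSeries (CM.colours CM.z₁ CM.Z′)

  private
    κ-Z : κ CM.z₁ ≋ CS.Z
    κ-Z = trans (κ-* _ _) (*-congˡ (κ-+ _ _))
    κ-Z′ : κ CM.Z′ ≋ CS.Z′
    κ-Z′ = trans (κ-* _ _) (*-cong (κ.^-hom z 4) (κ.sub-hom _ _))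
    Θ-1 : Θ (κ K.1#) ≋ E₁
    Θ-1 = ⟶-unique (Θ-⟶ 1#) (⟶-cong (λ N → ∏-cong N λ k → +-congˡ (-‿cong (sym (*-identityˡ _)))) E₁-⟶)

    inverse-pair : ∀ {x t} → Θ (κ x) ≋ t → unbounded x * t ≋ 1#
    inverse-pair {x} p = trans (*-congˡ (sym p)) (trans (*-comm _ _) (Θ-unbounded x))

  M-inverse : M * (Θ CS.Z * Θ CS.Z′ * E₁ * E₁) ≋ 1#
  M-inverse = trans (*-congʳ (CM.factorised CM.z₁ CM.Z′)) (trans
    (IntegerSolver.solve seriesRing 7 (λ a b c d p r e → (a :* (b :* (c :* (d :* # 1)))) :* (p :* r :* e :* e) := (a :* p) :* (b :* r) :* (c :* e) :* (d :* e)) _ _ _ _ _ _ _)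
    (trans (*-cong (*-cong (*-cong (inverse-pair (Θ-cong κ-Z)) (inverse-pair (Θ-cong κ-Z′))) (inverse-pair Θ-1)) (inverse-pair Θ-1))
      (IntegerSolver.solve seriesRing 0 (# 1 :* # 1 :* # 1 :* # 1 := # 1))))

  private
    μ-κ : ∀ k {f} fℚ n → map fℚ ≋ f → μ (coe (κ k * f) n) ≡ Q.coe fℚ n ℚ.* μ k
    μ-κ k {f} fℚ n p = ≡.trans (μ-cong (K.trans (κ-✶ k f n) (K.trans (K.*-congˡ (K.sym (at p n))) (K.*-comm _ _)))) (μ-ι _ k)

    μ-κ′ : ∀ k {k′ f} fℚ n → κ k ≋ k′ → map fℚ ≋ f → μ (coe (k′ * f) n) ≡ Q.coe fℚ n ℚ.* μ k
    μ-κ′ k {f = f} fℚ n pk p = ≡.trans (μ-cong (at (*-congʳ {f} (sym pk)) n)) (μ-κ k fℚ n p)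

    module Variables where
      variablesℚ : Vec Q.Series 6
      variablesℚ = Q.φ Qi.G₀ ∷ Q.φ Qi.B⁻¹ ∷ Q.φ Qi.Y ∷ Q.φ Q.E₅ ∷ Q.φ Qi.X ∷ Q.q ∷ []

      map-Y : map Qi.Y ≋ QI.Y
      map-Y = trans (m.*-hom _ _) (*-congʳ map-A)
      map-X : map Qi.X ≋ QI.X
      map-X = trans (m.*-hom _ _) (*-congʳ map-B)
      map-G₀ : map Qi.G₀ ≋ QI.G₀
      map-G₀ = trans (m.*-hom _ _) (*-cong (trans (m.^-hom Q.E₅ 10) (^-congˡ 10 map-E₅)) (m.^-hom Qi.E₁⁻¹ 12))

      φ-G₀ : φ QI.G₀ ≋ QI.G
      φ-G₀ = trans (φ.*-hom _ _) (*-cong (φ.^-hom E₅ 10) (φ.^-hom _ 12))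

      map-φ′ : ∀ {f g} → map f ≋ g → map (Q.φ f) ≋ φ g
      map-φ′ {f} p = trans (map-φ f) (φ.⟦⟧-cong p)

      map-eval : ∀ (e : Expr ℤ 6) → map (IQ.eval e variablesℚ)
        ≋ IntegerSolver.eval seriesRing e (QI.G ∷ QI.v ∷ QI.y ∷ QI.e ∷ QI.x ∷ q ∷ [])
      map-eval e = trans (m.eval-hom e variablesℚ) (IntegerSolver.eval-cong seriesRing e λ where
        0F → trans (map-φ′ map-G₀) φ-G₀
        1F → map-φ′ refl
        2F → map-φ′ map-Y
        3F → map-φ′ map-E₅
        4F → map-φ′ map-X
        5F → ιS.map-q)

      map-part : ∀ r → map (IQ.eval (at-variables (partᵖ r)) (Qi.G₀ ∷ Qi.B⁻¹ ∷ Qi.Y ∷ Q.E₅ ∷ Qi.X ∷ Q.q ∷ [])) ≋ QI.part-series r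
      map-part r = trans (m.eval-hom (at-variables (partᵖ r)) (Qi.G₀ ∷ Qi.B⁻¹ ∷ Qi.Y ∷ Q.E₅ ∷ Qi.X ∷ Q.q ∷ [])) (IntegerSolver.eval-cong seriesRing (at-variables (partᵖ r)) λ where
        0F → map-G₀
        1F → refl
        2F → map-Y
        3F → map-E₅
        4F → map-X
        5F → ιS.map-q)

    open Variables

    h₁ᵉ h₂ᵉ wxᵉ wqᵉ : Expr ℤ 6
    h₁ᵉ = at-variables H₁ᵖ
    h₂ᵉ = at-variables H₂ᵖ
    wxᵉ = at-variables (λ g v y e x q → # 10 :* Wᵖ g v y e x q :* x)
    wqᵉ = at-variables (λ g v y e x q → # 10 :* Wᵖ g v y e x q :* q)

    h₁ h₂ : Q.Series
    h₁ = IQ.eval h₁ᵉ variablesℚ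
    h₂ = IQ.eval h₂ᵉ variablesℚ

    μ-1 : μ K.1# ≡ 0ℚ
    μ-1 = μ-z 0 (s≤s z≤n)

    μ-c′ : μ (K.1# K.+ z KE.^ 2 K.+ z KE.^ 3) ≡ 0ℚ
    μ-c′ = ≡.trans (μ-+ _ _) (≡.cong₂ ℚ._+_ (≡.trans (μ-+ _ _) (≡.cong₂ ℚ._+_ μ-1 (μ-z 2 (s≤s (s≤s (s≤s z≤n)))))) (μ-z 3 (s≤s (s≤s (s≤s (s≤s z≤n))))))

    μ-neg : ∀ a → μ (K.- a) ≡ ℚ.- μ a
    μ-neg a = GroupP.inverseʳ-unique ℚP.+-0-group (μ a) (μ (K.- a))
      (≡.trans (≡.sym (μ-+ a (K.- a))) (≡.trans (μ-cong (K.-‿inverseʳ a)) CM.μ-0))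

    μ-difference : ∀ i j → i < 5 → j < 5 → μ (ε K.* (z KE.^ i K.- z KE.^ j)) ≡ centred i / 1 ℚ.+ ℚ.- (centred j / 1)
    μ-difference i j i<5 j<5 = ≡.trans (μ-cong (K.trans (K.*-comm _ _) (K.trans (K.distribʳ ε (z KE.^ i) (K.- z KE.^ j)) (K.+-congˡ (neg-*ˡ (z KE.^ j) ε)))))
      (≡.trans (μ-+ _ _) (≡.cong₂ ℚ._+_ (μ-zε i i<5) (≡.trans (μ-neg _) (≡.cong ℚ.-_ (μ-zε j j<5)))))
      where
      neg-*ˡ : ∀ a b → (K.- a) K.* b K.≈ K.- (a K.* b)
      neg-*ˡ a b = K.sym (RingP.-‿distribˡ-* K.ring a b)

    μ-10M : ∀ n → (ℤ.+ 10 / 1) ℚ.* μ (coe M n) ≡ Q.coe h₁ n ℚ.* (ℤ.+ 2 / 1) ℚ.+ Q.coe h₂ n ℚ.* (ℤ.+ 4 / 1)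
    μ-10M n = ≡.trans (≡.sym ten) (≡.trans (μ-cong (at (CS.10M-split M M-inverse) n)) (≡.trans (μ-+ _ _)
      (≡.trans (≡.cong₂ ℚ._+_ vanishing (≡.trans (μ-+ _ _) (≡.cong₂ ℚ._+_
          (≡.trans (μ-κ′ (ε K.* (z KE.^ 1 K.- z KE.^ 4)) h₁ n (trans (κ-* _ _) (*-congˡ (trans (κ.sub-hom _ _) (+-cong (trans (κ.^-hom z 1) (*-identityʳ _)) (-‿cong (κ.^-hom z 4)))))) (map-eval h₁ᵉ))
                   (≡.cong (Q.coe h₁ n ℚ.*_) (μ-difference 1 4 (s≤s (s≤s z≤n)) (s≤s (s≤s (s≤s (s≤s (s≤s z≤n))))))))
          (≡.trans (μ-κ′ (ε K.* (z KE.^ 2 K.- z KE.^ 3)) h₂ n (trans (κ-* _ _) (*-congˡ (trans (κ.sub-hom _ _) (+-cong (κ.^-hom z 2) (-‿cong (κ.^-hom z 3)))))) (map-eval h₂ᵉ))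
                   (≡.cong (Q.coe h₂ n ℚ.*_) (μ-difference 2 3 (s≤s (s≤s (s≤s z≤n))) (s≤s (s≤s (s≤s (s≤s z≤n))))))))))
        (ℚP.+-identityˡ _))))
      where
      ten : μ (coe (⌜ 10 ⌝ * M) n) ≡ (ℤ.+ 10 / 1) ℚ.* μ (coe M n)
      ten = ≡.trans (μ-cong (K.trans (at (*-congʳ {M} (sym (trans (κ.⟦⟧-cong (ι.fromℤ-hom (ℤ.+ 10))) (κ.fromℤ-hom (ℤ.+ 10))))) n) (κ-✶ _ M n))) (μ-ι _ _)
      vanishing : μ (coe (⌜ 10 ⌝ * QI.W * QI.x - c′ * (⌜ 10 ⌝ * QI.W * q)) n) ≡ 0ℚ
      vanishing = ≡.trans (μ-+ _ _) (≡.cong₂ ℚ._+_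
        (≡.trans (μ-cong (K.sym (at (*-identityˡ (⌜ 10 ⌝ * QI.W * QI.x)) n))) (≡.trans (μ-κ K.1# (IQ.eval wxᵉ variablesℚ) n (map-eval wxᵉ)) (≡.trans (≡.cong (Q.coe (IQ.eval wxᵉ variablesℚ) n ℚ.*_) μ-1) (ℚP.*-zeroʳ (Q.coe (IQ.eval wxᵉ variablesℚ) n)))))
        (≡.trans (μ-neg _) (≡.cong ℚ.-_ (≡.trans (μ-κ′ _ (IQ.eval wqᵉ variablesℚ) n (trans (κ-+ _ _) (+-cong (trans (κ-+ _ _) (+-congˡ (κ.^-hom z 2))) (κ.^-hom z 3))) (map-eval wqᵉ))
          (≡.trans (≡.cong (Q.coe (IQ.eval wqᵉ variablesℚ) n ℚ.*_) μ-c′) (ℚP.*-zeroʳ (Q.coe (IQ.eval wqᵉ variablesℚ) n)))))))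

    h : Q.Series
    h = h₁ Q.+ IQ.fromℤ (ℤ.+ 2) Q.* h₂

    map-h : map h ≋ QI.H
    map-h = trans (m.+-hom _ _) (+-cong (map-eval h₁ᵉ) (trans (m.*-hom _ _) (*-cong (m.fromℤ-hom (ℤ.+ 2)) (map-eval h₂ᵉ))))

    10F : ∀ r n → (ℤ.+ 10 / 1) ℚ.* Defs.F r n ≡ Q.coe h (5 ℕ.* n ℕ.+ r)
    10F r n = ≡.trans (halve (Defs.F r n) (Q.coe h₁ N) (Q.coe h₂ N) (≡.trans (≡.cong ((ℤ.+ 10 / 1) ℚ.*_) (CM.F-double r n)) (μ-10M N)))
      (≡.cong (Q.coe h₁ N ℚ.+_) (≡.sym (≡.trans (Q.at (Q.*-congʳ {h₂} two) N) (Q.κ-✶ (ℤ.+ 2 / 1) h₂ N))))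
      where
      N : ℕ
      N = 5 ℕ.* n ℕ.+ r
      two : IQ.fromℤ (ℤ.+ 2) Q.≋ Q.κ (ℤ.+ 2 / 1)
      two = Q.sym (Q.κ-+ 1ℚ 1ℚ)
      halve : ∀ f a b → (ℤ.+ 10 / 1) ℚ.* (f ℚ.+ f) ≡ a ℚ.* (ℤ.+ 2 / 1) ℚ.+ b ℚ.* (ℤ.+ 4 / 1) → (ℤ.+ 10 / 1) ℚ.* f ≡ a ℚ.+ (ℤ.+ 2 / 1) ℚ.* b
      halve f a b p = ≡.trans (lhs f) (≡.trans (≡.cong ((ℤ.+ 1 / 2) ℚ.*_) p) (rhs a b))
        where
        t : ℚ
        t = ℤ.+ 1 / 2
        lhs : ∀ f → (ℤ.+ 10 / 1) ℚ.* f ≡ t ℚ.* ((ℤ.+ 10 / 1) ℚ.* (f ℚ.+ f))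
        lhs f = ≡.sym (≡.trans (≡.cong (λ g → t ℚ.* ((ℤ.+ 10 / 1) ℚ.* g)) (≡.trans (≡.cong₂ ℚ._+_ (≡.sym (ℚP.*-identityˡ f)) (≡.sym (ℚP.*-identityˡ f))) (≡.sym (ℚP.*-distribʳ-+ f 1ℚ 1ℚ))))
          (≡.trans (≡.cong (t ℚ.*_) (≡.sym (ℚP.*-assoc (ℤ.+ 10 / 1) (1ℚ ℚ.+ 1ℚ) f))) (≡.sym (ℚP.*-assoc t ((ℤ.+ 10 / 1) ℚ.* (1ℚ ℚ.+ 1ℚ)) f))))
        scale : ∀ c a → t ℚ.* (a ℚ.* c) ≡ (t ℚ.* c) ℚ.* a
        scale c a = ≡.trans (≡.cong (t ℚ.*_) (ℚP.*-comm a c)) (≡.sym (ℚP.*-assoc t c a))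
        rhs : ∀ a b → t ℚ.* (a ℚ.* (ℤ.+ 2 / 1) ℚ.+ b ℚ.* (ℤ.+ 4 / 1)) ≡ a ℚ.+ (ℤ.+ 2 / 1) ℚ.* b
        rhs a b = ≡.trans (ℚP.*-distribˡ-+ t (a ℚ.* (ℤ.+ 2 / 1)) (b ℚ.* (ℤ.+ 4 / 1))) (≡.cong₂ ℚ._+_ (≡.trans (scale (ℤ.+ 2 / 1) a) (ℚP.*-identityˡ a)) (scale (ℤ.+ 4 / 1) b))

  partℚ : ℕ → Q.Series
  partℚ r = IQ.eval (at-variables (partᵖ r)) (Qi.G₀ ∷ Qi.B⁻¹ ∷ Qi.Y ∷ Q.E₅ ∷ Qi.X ∷ Q.q ∷ [])

  private
    10F-part : ∀ r → part r (QI.H) ≋ QI.part-series r → Q.κ (ℤ.+ 10 / 1) Q.* Q.series (Defs.F r) Q.≋ partℚ r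
    10F-part r p = Q.pw λ n → ≡.trans (Q.κ-✶ (ℤ.+ 10 / 1) (Q.series (Defs.F r)) n) (≡.trans (10F r n) (≡.trans (≡.cong (Q.coe h) (index r n))
      (ι-injective (at (trans (part-cong r map-h) (trans p (sym (map-part r)))) n))))
      where
      index : ∀ r n → 5 ℕ.* n ℕ.+ r ≡ r ℕ.+ n ℕ.* 5
      index = solve-∀

  10F₀ : Q.κ (ℤ.+ 10 / 1) Q.* Q.series (Defs.F 0) Q.≋ partℚ 0
  10F₀ = 10F-part 0 (trans (part-cong 0 (QI.H-recombine)) (part₀-recombine _ _ _ _ _))

  10F₃ : Q.κ (ℤ.+ 10 / 1) Q.* Q.series (Defs.F 3) Q.≋ partℚ 3
  10F₃ = 10F-part 3 (trans (part-cong 3 (QI.H-recombine)) (part₃-recombine _ _ _ _ _))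

  10F₄ : Q.κ (ℤ.+ 10 / 1) Q.* Q.series (Defs.F 4) Q.≋ partℚ 4
  10F₄ = 10F-part 4 (trans (part-cong 4 (QI.H-recombine)) (part₄-recombine _ _ _ _ _))

  private
    map-sgn : ∀ k → map (Q.sgn k) ≋ sgn k
    map-sgn zero    = m.1-hom
    map-sgn (suc k) = trans (m.neg-hom _) (-‿cong (map-sgn k))

    map-ν : ∀ k → map (Q.ν k) ≋ ν k
    map-ν zero    = m.0-hom
    map-ν (suc k) = trans (m.+-hom _ _) (+-cong m.1-hom (map-ν k))

    map-S : map Q.S ≋ S
    map-S = ⟶-unique (ιS.map-⟶ Q.S-⟶) (⟶-cong (λ N → sym (trans (m.∑-hom _ N) (∑-cong N λ k →
      trans (m.*-hom _ _) (*-cong (map-sgn k) (trans (m.+-hom _ _) (+-cong (term k (Exponents.u k)) (term (suc k) (Exponents.u′ k)))))))) S-⟶)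
      where
      term : ∀ k n → map (Q.ν k Q.* Q.q Q.^ n) ≋ ν k * q ^ n
      term k n = trans (m.*-hom _ _) (*-cong (map-ν k) (map-q^ n))

    unperturb : ∀ f {f′} → map f ≋ f′ → ∀ n → μ (coe (ζ * (κ ε * f′)) n) ≡ Q.coe f n
    unperturb f {f′} p n = ≡.trans (μ-cong (at (trans (sym (*-assoc ζ (κ ε) f′)) (*-congʳ {f′} (sym (κ-* z ε)))) n))
      (≡.trans (μ-κ (z K.* ε) f n p) (≡.trans (≡.cong (Q.coe f n ℚ.*_)
        (≡.trans (μ-cong (K.*-congʳ (K.sym (K.*-identityʳ z)))) (μ-zε 1 (s≤s (s≤s z≤n))))) (ℚP.*-identityʳ (Q.coe f n))))

  10S : IQ.fromℤ (ℤ.+ 10) Q.* Q.S Q.+ Q.B Q.* Q.E₅ Q.≋ Q.E₅ Q.^ 3 Q.* Qi.Y Q.^ 3 Q.* (Qi.X Q.^ 6 Q.- IQ.fromℤ (ℤ.+ 3) Q.* Q.q Q.* Qi.X)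
  10S = Q.pw λ n → ≡.trans (≡.sym (unperturb _ lhs n)) (≡.trans (μ-cong (at (*-congˡ {ζ} CS.εS) n)) (unperturb _ rhs n))
    where
    lhs : map (IQ.fromℤ (ℤ.+ 10) Q.* Q.S Q.+ Q.B Q.* Q.E₅) ≋ ⌜ 10 ⌝ * S + B * E₅
    lhs = trans (m.+-hom _ _) (+-cong (trans (m.*-hom _ _) (*-cong (m.fromℤ-hom (ℤ.+ 10)) map-S)) (trans (m.*-hom _ _) (*-cong map-B map-E₅)))
    rhs : map (Q.E₅ Q.^ 3 Q.* Qi.Y Q.^ 3 Q.* (Qi.X Q.^ 6 Q.- IQ.fromℤ (ℤ.+ 3) Q.* Q.q Q.* Qi.X)) ≋ E₅ ^ 3 * QI.Y ^ 3 * (QI.X ^ 6 - ⌜ 3 ⌝ * q * QI.X)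
    rhs = trans (m.*-hom _ _) (*-cong (trans (m.*-hom _ _) (*-cong (trans (m.^-hom Q.E₅ 3) (^-congˡ 3 map-E₅)) (trans (m.^-hom Qi.Y 3) (^-congˡ 3 map-Y))))
      (trans (m.sub-hom _ _) (+-cong (trans (m.^-hom Qi.X 6) (^-congˡ 6 map-X)) (-‿cong (trans (m.*-hom _ _) (*-cong (trans (m.*-hom _ _) (*-cong (m.fromℤ-hom (ℤ.+ 3)) ιS.map-q)) map-X))))))

module FifthRootExtension {c ℓ} (R : CommutativeRing c ℓ) (γ : CommutativeRing.Carrier R)
  (γ² : CommutativeRing._≈_ R (CommutativeRing._*_ R γ γ) (CommutativeRing._+_ R γ (CommutativeRing.1# R))) where
  open CommutativeRing R
  open Quadratic R (γ - 1#) (- 1#) using (extension; _+τ_; parts; re; im; τ; conj)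
  private module K = CommutativeRing extension
  open Exp K.semiring using (_^_)
  open IntegerSolver R

  lo hi : ℕ → Carrier
  lo 0 = 1#
  lo 2 = - 1#
  lo 3 = 1# - γ
  lo 4 = γ - 1#
  lo _ = 0#
  hi 1 = 1#
  hi 2 = γ - 1#
  hi 3 = 1# - γ
  hi 4 = - 1#
  hi _ = 0#

  private
    golden : ∀ {a b} k → a ≈ b + (γ * γ - (γ + 1#)) * k → a ≈ b
    golden k p = trans p (trans (+-congˡ (trans (*-congʳ (trans (+-congʳ γ²) (-‿inverseʳ _))) (zeroˡ k))) (+-identityʳ _))

    τ-* : ∀ u → τ K.* u K.≈ (- im u) +τ (re u + (γ - 1#) * im u)
    τ-* u = parts (solve 2 (λ a b → # 0 :* a :+ :- # 1 :* (# 1 :* b) := :- b) (re u) (im u))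
      (solve 3 (λ γ a b → # 0 :* b :+ # 1 :* a :+ (γ :- # 1) :* (# 1 :* b) := a :+ (γ :- # 1) :* b) γ (re u) (im u))

  τ^2 : τ ^ 2 K.≈ lo 2 +τ hi 2
  τ^2 = K.trans (K.*-congˡ {τ} (K.*-identityʳ τ)) (K.trans (τ-* τ) (parts refl (solve 1 (λ γ → # 0 :+ (γ :- # 1) :* # 1 := γ :- # 1) γ)))

  τ^3 : τ ^ 3 K.≈ lo 3 +τ hi 3
  τ^3 = K.trans (K.*-congˡ {τ} τ^2) (K.trans (τ-* (lo 2 +τ hi 2)) (parts (solve 1 (λ γ → :- (γ :- # 1) := # 1 :- γ) γ)
    (golden 1# (solve 1 (λ γ → :- # 1 :+ (γ :- # 1) :* (γ :- # 1) := # 1 :- γ :+ (γ :* γ :- (γ :+ # 1)) :* # 1) γ))))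

  τ^4 : τ ^ 4 K.≈ lo 4 +τ hi 4
  τ^4 = K.trans (K.*-congˡ {τ} τ^3) (K.trans (τ-* (lo 3 +τ hi 3)) (parts (solve 1 (λ γ → :- (# 1 :- γ) := γ :- # 1) γ)
    (golden (- 1#) (solve 1 (λ γ → # 1 :- γ :+ (γ :- # 1) :* (# 1 :- γ) := :- # 1 :+ (γ :* γ :- (γ :+ # 1)) :* :- # 1) γ))))

  im-τ^ : ∀ r → r < 5 → im (τ ^ r) ≈ hi r
  im-τ^ 0 _ = refl
  im-τ^ 1 _ = Quadratic.im≈ (K.*-identityʳ τ)
  im-τ^ 2 _ = Quadratic.im≈ τ^2
  im-τ^ 3 _ = Quadratic.im≈ τ^3
  im-τ^ 4 _ = Quadratic.im≈ τ^4
  im-τ^ (suc (suc (suc (suc (suc r))))) (s≤s (s≤s (s≤s (s≤s (s≤s ())))))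

  Φ-τ : K.1# K.+ τ K.+ τ ^ 2 K.+ τ ^ 3 K.+ τ ^ 4 K.≈ K.0#
  Φ-τ = K.trans (K.+-cong (K.+-cong (K.+-congˡ {K.1# K.+ τ} τ^2) τ^3) τ^4)
    (parts (solve 1 (λ γ → # 1 :+ # 0 :+ :- # 1 :+ (# 1 :- γ) :+ (γ :- # 1) := # 0) γ)
           (solve 1 (λ γ → # 0 :+ # 1 :+ (γ :- # 1) :+ (# 1 :- γ) :+ :- # 1 := # 0) γ))

  conj-τ : conj τ K.≈ τ ^ 4
  conj-τ = K.trans (parts (solve 1 (λ γ → # 0 :+ # 1 :* (γ :- # 1) := γ :- # 1) γ) refl) (K.sym τ^4)

module DualNumbers {c ℓ} (R : CommutativeRing c ℓ) where
  open CommutativeRing R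
  open Quadratic R 0# 0# public
  private
    module K = CommutativeRing extension
    module e = RingHom embedHom
    module E = Exp semiring
  open Exp K.semiring using (_^_)

  embed-^ : ∀ a r → embed a ^ r K.≈ embed (a E.^ r)
  embed-^ a r = K.sym (e.^-hom a r)

  embed-Φ : ∀ {a} → 1# + a + a E.^ 2 + a E.^ 3 + a E.^ 4 ≈ 0# → K.1# K.+ embed a K.+ embed a ^ 2 K.+ embed a ^ 3 K.+ embed a ^ 4 K.≈ K.0#
  embed-Φ {a} p = K.trans (K.sym (K.trans (e.+-hom _ _) (K.+-cong (K.trans (e.+-hom _ _) (K.+-cong (K.trans (e.+-hom _ _)
      (K.+-cong (e.+-hom 1# a) (e.^-hom a 2))) (e.^-hom a 3))) (e.^-hom a 4)))) (e.⟦⟧-cong p)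

  im-embed-τ : ∀ a → im (embed a K.* τ) ≈ a
  im-embed-τ a = trans (im≈ (embed-* a τ)) (*-identityʳ a)

  ε² : τ K.* τ K.≈ K.0#
  ε² = K.trans τ² (K.trans (K.+-congʳ (K.zeroˡ τ)) (K.+-identityˡ K.0#))

_∘ʰ_ : ∀ {a b c a′ b′ c′} {A : CommutativeRing a a′} {B : CommutativeRing b b′} {C : CommutativeRing c c′} → RingHom B C → RingHom A B → RingHom A C
_∘ʰ_ {C = C} g f = record
  { ⟦_⟧ = λ a → g.⟦ f.⟦ a ⟧ ⟧
  ; ⟦⟧-cong = λ p → g.⟦⟧-cong (f.⟦⟧-cong p)
  ; +-hom = λ a b → C.trans (g.⟦⟧-cong (f.+-hom a b)) (g.+-hom _ _)
  ; *-hom = λ a b → C.trans (g.⟦⟧-cong (f.*-hom a b)) (g.*-hom _ _)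
  ; neg-hom = λ a → C.trans (g.⟦⟧-cong (f.neg-hom a)) (g.neg-hom _)
  ; 1-hom = C.trans (g.⟦⟧-cong f.1-hom) g.1-hom }
  where
  module C = CommutativeRing C
  module f = RingHom f
  module g = RingHom g

-- γ stands for (1 + √5)/2 and ℓ for the functional a + b γ ↦ a + 3b, which sends the γ-coordinates 0, 1, γ - 1, 1 - γ, -1
-- of the powers of z, where z² = (γ - 1)z - 1, to the residues 0, 1, 2, -2, -1.
record GoldenRing : Set₁ where
  field
    R  : CommutativeRing 0ℓ 0ℓ
  open CommutativeRing R
  field
    γ  : Carrier
    γ² : γ * γ ≈ γ + 1#
    ι  : RingHom ℚR R
    ℓ  : Carrier → ℚ
  open RingHom ι using () renaming (⟦_⟧ to ι⟨_⟩)
  field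
    ι-injective : ∀ {r s} → ι⟨ r ⟩ ≈ ι⟨ s ⟩ → r ≡ s
    ℓ-cong : ∀ {a b} → a ≈ b → ℓ a ≡ ℓ b
    ℓ-+    : ∀ a b → ℓ (a + b) ≡ ℓ a ℚ.+ ℓ b
    ℓ-ι    : ∀ r a → ℓ (ι⟨ r ⟩ * a) ≡ r ℚ.* ℓ a
    ℓ-neg  : ∀ a → ℓ (- a) ≡ ℚ.- ℓ a
    ℓ-hi   : ∀ r → ℓ (FifthRootExtension.hi R γ γ² r) ≡ centred r / 1

goldenRing : GoldenRing
goldenRing = record
  { R = Q.extension
  ; γ = Q.τ
  ; γ² = Q.parts ≡.refl ≡.refl
  ; ι = Q.embedHom
  ; ℓ = ℓ
  ; ι-injective = Q.re≈
  ; ℓ-cong = λ p → ≡.cong₂ (λ r i → r ℚ.+ t ℚ.* i) (Q.re≈ p) (Q.im≈ p)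
  ; ℓ-+ = λ a b → IQ.solve 5 (λ a b c d t → a :+ c :+ t :* (b :+ d) := a :+ t :* b :+ (c :+ t :* d)) (Q.re a) (Q.im a) (Q.re b) (Q.im b) t
  ; ℓ-ι = λ r a → ≡.trans (≡.cong₂ (λ r i → r ℚ.+ t ℚ.* i) (Q.re≈ (Q.embed-* r a)) (Q.im≈ (Q.embed-* r a)))
      (IQ.solve 4 (λ r a b t → r :* a :+ t :* (r :* b) := r :* (a :+ t :* b)) r (Q.re a) (Q.im a) t)
  ; ℓ-neg = λ a → IQ.solve 3 (λ a b t → :- a :+ t :* :- b := :- (a :+ t :* b)) (Q.re a) (Q.im a) t
  ; ℓ-hi = ℓ-hi }
  where
  module Q = Quadratic ℚR 1ℚ 1ℚ
  module IQ = IntegerSolver ℚR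
  t : ℚ
  t = ℤ.+ 3 / 1
  ℓ : Q.Ext → ℚ
  ℓ a = Q.re a ℚ.+ t ℚ.* Q.im a
  ℓ-hi : ∀ r → ℓ (FifthRootExtension.hi Q.extension Q.τ (Q.parts ≡.refl ≡.refl) r) ≡ centred r / 1
  ℓ-hi 0 = ≡.refl
  ℓ-hi 1 = ≡.refl
  ℓ-hi 2 = ≡.refl
  ℓ-hi 3 = ≡.refl
  ℓ-hi 4 = ≡.refl
  ℓ-hi (suc (suc (suc (suc (suc r))))) = ≡.refl

module Cyclotomic (𝒢 : GoldenRing) where
  open GoldenRing 𝒢
  private
    module R = CommutativeRing R
    module F = FifthRootExtension R γ γ²
    module Q = Quadratic R (γ R.- R.1#) (R.- R.1#)
    module D = DualNumbers Q.extension
    module K = CommutativeRing D.extension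
    module E = Exp (CommutativeRing.semiring Q.extension)
    module ι = RingHom ι
    module c = RingHom Q.conjHom
  open Exp K.semiring using (_^_)

  private
    z : K.Carrier
    z = D.embed Q.τ

    μ : K.Carrier → ℚ
    μ a = ℓ (Q.im (D.im a))

    μ-cong : ∀ {a b} → a K.≈ b → μ a ≡ μ b
    μ-cong p = ℓ-cong (Q.im≈ (D.im≈ p))

    embeddings : RingHom ℚR D.extension
    embeddings = D.embedHom ∘ʰ (Q.embedHom ∘ʰ ι)

    conj : RingHom D.extension D.extension
    conj = D.extend Q.conjHom c.0-hom c.0-hom

    ℓ-0 : ℓ R.0# ≡ 0ℚ
    ℓ-0 = ℓ-hi 0

    μ-ι : ∀ r a → μ (RingHom.⟦_⟧ embeddings r K.* a) ≡ r ℚ.* μ a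
    μ-ι r a = ≡.trans (ℓ-cong (R.trans (Q.im≈ (D.im≈ (D.embed-* (Q.embed ι.⟦ r ⟧) a))) (Q.im≈ (Q.embed-* ι.⟦ r ⟧ (D.im a))))) (ℓ-ι r _)

    μ-zε : ∀ r → r < 5 → μ (z ^ r K.* D.τ) ≡ centred r / 1
    μ-zε r r<5 = ≡.trans (μ-cong (K.*-congʳ {D.τ} (D.embed-^ Q.τ r)))
      (≡.trans (ℓ-cong (R.trans (Q.im≈ (D.im-embed-τ (Q.τ E.^ r))) (F.im-τ^ r r<5))) (ℓ-hi r))

  crankRing : CrankRing
  crankRing = record
    { K = D.extension
    ; ι = embeddings
    ; z = z
    ; ε = D.τ
    ; Φ₀ = D.embed-Φ F.Φ-τ
    ; ε² = D.ε²
    ; conj = conj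
    ; μ = μ
    ; ι-injective = λ p → ι-injective (Q.re≈ (D.re≈ p))
    ; conj-z = K.trans (D.parts F.conj-τ c.0-hom) (K.sym (D.embed-^ Q.τ 4))
    ; conj-ε = D.parts c.0-hom c.1-hom
    ; μ-cong = μ-cong
    ; μ-+ = λ a b → ℓ-+ _ _
    ; μ-ι = μ-ι
    ; μ-conj = λ a → ℓ-neg _
    ; μ-z = λ r _ → ≡.trans (μ-cong (D.embed-^ Q.τ r)) ℓ-0
    ; μ-zε = μ-zε }

module Final where
  open ℚSeries
  open ℚInverses
  private
    module Ex = Extraction (Cyclotomic.crankRing goldenRing)
    module I = IntegerSolver seriesRing
    module κ = RingHom κHom
    module Exp′ = CExp commutativeSemiring
  open I using (solve)
  open Exp′ using (^-distrib-*)
  open SetoidReasoning setoid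

  V I₁₂ : Series
  V = B⁻¹
  I₁₂ = E₁⁻¹ ^ 12

  XY : X * Y ≋ 1#
  XY = trans (solve 4 (λ b i a j → (b :* i) :* (a :* j) := (a :* i) :* (b :* j)) _ _ _ _) (trans (*-cong AA⁻¹ BB⁻¹) (*-identityˡ _))

  A⁻¹≋XV : A⁻¹ ≋ X * V
  A⁻¹≋XV = sym (trans (solve 3 (λ b i v → (b :* i) :* v := i :* (b :* v)) _ _ _) (trans (*-congˡ BB⁻¹) (*-identityʳ _)))

  1^ : ∀ n → 1# ^ n ≋ 1#
  1^ zero    = refl
  1^ (suc n) = trans (*-identityˡ _) (1^ n)

  cancelled : ∀ {f g} → f * g ≋ 1# → ∀ s n → f ^ n ≋ g ^ s * f ^ (s ℕ.+ n)
  cancelled {f} {g} fg s n = sym (begin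
    g ^ s * f ^ (s ℕ.+ n)     ≈⟨ *-congˡ (^-homo-* f s n) ⟩
    g ^ s * (f ^ s * f ^ n)   ≈⟨ sym (*-assoc _ _ _) ⟩
    g ^ s * f ^ s * f ^ n     ≈⟨ *-congʳ (trans (*-comm _ _) (trans (sym (^-distrib-* f g s)) (trans (^-congˡ s fg) (1^ s)))) ⟩
    1# * f ^ n                ≈⟨ *-identityˡ _ ⟩
    f ^ n                     ∎)

  mono⁻ : ∀ m d s → A⁻¹ ^ (m ℕ.+ d) * B ^ m ≋ Y ^ s * X ^ (s ℕ.+ (m ℕ.+ d)) * V ^ d
  mono⁻ m d s = begin
    A⁻¹ ^ (m ℕ.+ d) * B ^ m             ≈⟨ *-congʳ (^-homo-* A⁻¹ m d) ⟩
    A⁻¹ ^ m * A⁻¹ ^ d * B ^ m           ≈⟨ solve 3 (λ a b c → a :* b :* c := (c :* a) :* b) _ _ _ ⟩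
    (B ^ m * A⁻¹ ^ m) * A⁻¹ ^ d         ≈⟨ *-cong (sym (^-distrib-* B A⁻¹ m)) (trans (^-congˡ d A⁻¹≋XV) (^-distrib-* X V d)) ⟩
    X ^ m * (X ^ d * V ^ d)             ≈⟨ sym (*-assoc _ _ _) ⟩
    X ^ m * X ^ d * V ^ d               ≈⟨ *-congʳ (trans (sym (^-homo-* X m d)) (cancelled XY s (m ℕ.+ d))) ⟩
    Y ^ s * X ^ (s ℕ.+ (m ℕ.+ d)) * V ^ d ∎

  mono⁺ : ∀ m d s → A ^ m * V ^ (m ℕ.+ d) ≋ Y ^ (s ℕ.+ m) * X ^ s * V ^ d
  mono⁺ m d s = begin
    A ^ m * V ^ (m ℕ.+ d)         ≈⟨ *-congˡ (^-homo-* V m d) ⟩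
    A ^ m * (V ^ m * V ^ d)       ≈⟨ sym (*-assoc _ _ _) ⟩
    A ^ m * V ^ m * V ^ d         ≈⟨ *-congʳ (trans (sym (^-distrib-* A V m)) (trans (cancelled (trans (*-comm Y X) XY) s m) (*-comm _ _))) ⟩
    Y ^ (s ℕ.+ m) * X ^ s * V ^ d ∎

  private
    series-T : ∀ c k a b e {α β} → series (Defs.powℤ Defs.Aₚ a) ≋ α → series (Defs.powℤ Defs.Bₚ b) ≋ β →
      series (Defs.T c k a b e) ≋ κ c * (q ^ k * (α * β * E₅ ^ e * I₁₂))
    series-T c k a b e pα pβ = trans (series-· c _) (*-congˡ (trans (series-qpow k _) (*-congˡ
      (trans (series-⊗ _ _) (*-cong (trans (series-⊗ _ _) (*-cong (trans (series-⊗ _ _) (*-cong pα pβ))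
        (trans (series-pow Defs.E₅ e) (^-congˡ e series-E₅)))) (series-pow (Defs.inv Defs.E₁) 12))))))

  T⁻ : ∀ c k {n} m d s e → suc n ≡ m ℕ.+ d →
    series (Defs.T c k ℤ.-[1+ n ] (ℤ.+ m) e) ≋ κ c * (q ^ k * (Y ^ s * X ^ (s ℕ.+ (m ℕ.+ d)) * V ^ d * E₅ ^ e * I₁₂))
  T⁻ c k {n} m d s e p = trans (series-T c k ℤ.-[1+ n ] (ℤ.+ m) e (trans (series-pow (Defs.inv Defs.Aₚ) (suc n)) (reflexive (≡.cong (A⁻¹ ^_) p)))
      (trans (series-pow Defs.Bₚ m) (^-congˡ m series-B)))
    (*-congˡ (*-congˡ (*-congʳ (*-congʳ (mono⁻ m d s)))))

  T⁺ : ∀ c k {n} m d s e → suc n ≡ m ℕ.+ d →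
    series (Defs.T c k (ℤ.+ m) ℤ.-[1+ n ] e) ≋ κ c * (q ^ k * (Y ^ (s ℕ.+ m) * X ^ s * V ^ d * E₅ ^ e * I₁₂))
  T⁺ c k {n} m d s e p = trans (series-T c k (ℤ.+ m) ℤ.-[1+ n ] e (trans (series-pow Defs.Aₚ m) (^-congˡ m series-A))
      (trans (series-pow (Defs.inv Defs.Bₚ) (suc n)) (reflexive (≡.cong (V ^_) p))))
    (*-congˡ (*-congˡ (*-congʳ (*-congʳ (mono⁺ m d s)))))

  κ-fromInt : ∀ i → κ (i / 1) ≋ fromℤ i
  κ-fromInt i = trans (κ-cong (≡.sym (fromInt i))) (κ.fromℤ-hom i)
    where
    module IQ = IntegerSolver ℚR
    pos : ∀ n → IQ.fromℤ (ℤ.+ n) ≡ ℤ.+ n / 1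
    pos zero          = ≡.refl
    pos (suc zero)    = ≡.refl
    pos (suc (suc n)) = ≡.trans (IQ.fromℤ-+ (ℤ.+ 1) (ℤ.+ suc n)) (≡.trans (≡.cong (1ℚ ℚ.+_) (pos (suc n))) (≡.sym (fromInt-+ (ℤ.+ 1) (ℤ.+ suc n))))
    fromInt : ∀ i → IQ.fromℤ i ≡ i / 1
    fromInt (ℤ.+ n)    = pos n
    fromInt ℤ.-[1+ n ] = ≡.trans (≡.cong ℚ.-_ (pos (suc n))) (≡.sym (fromInt-neg (ℤ.+ suc n)))

  doubled : ∀ c i → c ℚ.+ c ≡ i / 1 → fromℤ (ℤ.+ 2) * κ c ≋ fromℤ i
  doubled c i p = trans (solve 1 (λ c → # 2 :* c := c :+ c) (κ c)) (trans (sym (κ-+ c c)) (trans (κ-cong p) (κ-fromInt i)))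

  twice : ∀ {t} c i f → t ≋ κ c * f → c ℚ.+ c ≡ i / 1 → fromℤ (ℤ.+ 2) * t ≋ fromℤ i * f
  twice c i f p e = trans (*-congˡ p) (trans (sym (*-assoc _ _ _)) (*-congʳ (doubled c i e)))

  once : ∀ {t} c i f → t ≋ κ c * f → c ≡ i / 1 → t ≋ fromℤ i * f
  once c i f p e = trans p (*-congʳ (trans (κ-cong e) (κ-fromInt i)))

  tenth : ∀ {f g : PS} → κ (ℤ.+ 10 / 1) * series f ≋ κ (ℤ.+ 10 / 1) * series g → ∀ n → f n ≡ g n
  tenth {f} {g} p n = ≡.trans (≡.sym (scale (f n))) (≡.trans (≡.cong ((ℤ.+ 1 / 10) ℚ.*_)
      (≡.trans (≡.sym (κ-✶ (ℤ.+ 10 / 1) (series f) n)) (≡.trans (at p n) (κ-✶ (ℤ.+ 10 / 1) (series g) n)))) (scale (g n)))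
    where
    scale : ∀ a → (ℤ.+ 1 / 10) ℚ.* ((ℤ.+ 10 / 1) ℚ.* a) ≡ a
    scale a = ≡.trans (≡.sym (ℚP.*-assoc (ℤ.+ 1 / 10) (ℤ.+ 10 / 1) a)) (ℚP.*-identityˡ a)

  from-double : ∀ {f g : PS} {P Q} → κ (ℤ.+ 10 / 1) * series f ≋ P → fromℤ (ℤ.+ 2) * series g ≋ Q → P ≋ fromℤ (ℤ.+ 5) * Q → ∀ n → f n ≡ g n
  from-double {g = g} p r s = tenth (trans p (trans s (trans (*-congˡ (sym r))
    (trans (solve 1 (λ g → # 5 :* (# 2 :* g) := # 10 :* g) (series g)) (*-congʳ (sym (κ-fromInt (ℤ.+ 10))))))))

  infixl 6 _⟨+⟩_ _⟨⊕⟩_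

  _⟨⊕⟩_ : ∀ {f g : PS} {P Q} → series f ≋ P → series g ≋ Q → series (f Defs.⊕ g) ≋ P + Q
  p ⟨⊕⟩ r = pw λ n → ≡.cong₂ ℚ._+_ (at p n) (at r n)

  _⟨+⟩_ : ∀ {f g : PS} {P Q} → fromℤ (ℤ.+ 2) * series f ≋ P → fromℤ (ℤ.+ 2) * series g ≋ Q → fromℤ (ℤ.+ 2) * series (f Defs.⊕ g) ≋ P + Q
  p ⟨+⟩ r = trans (*-congˡ (refl ⟨⊕⟩ refl)) (trans (distribˡ _ _ _) (+-cong p r))

  private
    mono : ℕ → ℕ → ℕ → ℕ → ℕ → Series
    mono k s j d e = q ^ k * (Y ^ s * X ^ j * V ^ d * E₅ ^ e * I₁₂)

    monoᵖ : ℕ → ℕ → ℕ → ℕ → ℕ → ∀ {n} (q y x v e i : Expr ℤ n) → Expr ℤ n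
    monoᵖ k s j d m q y x v e i = q :^ k :* (y :^ s :* x :^ j :* v :^ d :* e :^ m :* i)

  F₃≡ : Defs.F 3 Defs.≐ (Defs.T ℚ[ ℤ.+ 55 ] 3 (ℤ.+ 6) (ℤ.- ℤ.+ 8) 12
      Defs.⊕ Defs.T (ℚ.- (ℤ.+ 335 / 2)) 2 (ℤ.+ 1) (ℤ.- ℤ.+ 3) 12
      Defs.⊕ Defs.T ℚ[ ℤ.+ 260 ] 1 (ℤ.- ℤ.+ 4) (ℤ.+ 2) 12
      Defs.⊕ Defs.T (ℤ.+ 45 / 2) 0 (ℤ.- ℤ.+ 9) (ℤ.+ 7) 12
      Defs.⊕ Defs.T (ℚ.- ℚ[ ℤ.+ 5 ]) 2 (ℤ.+ 4) (ℤ.- ℤ.+ 5) 10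
      Defs.⊕ Defs.T (ℚ.- (ℤ.+ 35 / 2)) 1 (ℤ.- ℤ.+ 1) (ℤ.+ 0) 10
      Defs.⊕ Defs.T (ℚ.- (ℤ.+ 15 / 2)) 0 (ℤ.- ℤ.+ 6) (ℤ.+ 5) 10)
  F₃≡ = from-double Ex.10F₃ ((twice ℚ[ ℤ.+ 55 ] (ℤ.+ 110) (mono 3 10 4 2 12) (T⁺ ℚ[ ℤ.+ 55 ] 3 6 2 4 12 ≡.refl) ≡.refl)
      ⟨+⟩ (twice (ℚ.- (ℤ.+ 335 / 2)) (ℤ.- ℤ.+ 335) (mono 2 10 9 2 12) (T⁺ (ℚ.- (ℤ.+ 335 / 2)) 2 1 2 9 12 ≡.refl) ≡.refl)
      ⟨+⟩ (twice ℚ[ ℤ.+ 260 ] (ℤ.+ 520) (mono 1 10 14 2 12) (T⁻ ℚ[ ℤ.+ 260 ] 1 2 2 10 12 ≡.refl) ≡.refl)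
      ⟨+⟩ (twice (ℤ.+ 45 / 2) (ℤ.+ 45) (mono 0 10 19 2 12) (T⁻ (ℤ.+ 45 / 2) 0 7 2 10 12 ≡.refl) ≡.refl)
      ⟨+⟩ (twice (ℚ.- ℚ[ ℤ.+ 5 ]) (ℤ.- ℤ.+ 10) (mono 2 8 4 1 10) (T⁺ (ℚ.- ℚ[ ℤ.+ 5 ]) 2 4 1 4 10 ≡.refl) ≡.refl)
      ⟨+⟩ (twice (ℚ.- (ℤ.+ 35 / 2)) (ℤ.- ℤ.+ 35) (mono 1 8 9 1 10) (T⁻ (ℚ.- (ℤ.+ 35 / 2)) 1 0 1 8 10 ≡.refl) ≡.refl)
      ⟨+⟩ (twice (ℚ.- (ℤ.+ 15 / 2)) (ℤ.- ℤ.+ 15) (mono 0 8 14 1 10) (T⁻ (ℚ.- (ℤ.+ 15 / 2)) 0 5 1 8 10 ≡.refl) ≡.refl))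
    (solve 6 (λ q y x v e i → PartPolynomials.partᵖ 3 (e :^ 10 :* i) v y e x q := # 5 :* (
        # 110 :* monoᵖ 3 10 4 2 12 q y x v e i
        :+ :- # 335 :* monoᵖ 2 10 9 2 12 q y x v e i
        :+ # 520 :* monoᵖ 1 10 14 2 12 q y x v e i
        :+ # 45 :* monoᵖ 0 10 19 2 12 q y x v e i
        :+ :- # 10 :* monoᵖ 2 8 4 1 10 q y x v e i
        :+ :- # 35 :* monoᵖ 1 8 9 1 10 q y x v e i
        :+ :- # 15 :* monoᵖ 0 8 14 1 10 q y x v e i)) q Y X V E₅ I₁₂)

  F₄≡ : Defs.F 4 Defs.≐ (Defs.T (ℚ.- (ℤ.+ 45 / 2)) 3 (ℤ.+ 7) (ℤ.- ℤ.+ 9) 12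
      Defs.⊕ Defs.T ℚ[ ℤ.+ 260 ] 2 (ℤ.+ 2) (ℤ.- ℤ.+ 4) 12
      Defs.⊕ Defs.T (ℤ.+ 335 / 2) 1 (ℤ.- ℤ.+ 3) (ℤ.+ 1) 12
      Defs.⊕ Defs.T ℚ[ ℤ.+ 55 ] 0 (ℤ.- ℤ.+ 8) (ℤ.+ 6) 12
      Defs.⊕ Defs.T (ℤ.+ 5 / 2) 2 (ℤ.+ 5) (ℤ.- ℤ.+ 6) 10
      Defs.⊕ Defs.T (ℤ.+ 5 / 2) 1 (ℤ.+ 0) (ℤ.- ℤ.+ 1) 10
      Defs.⊕ Defs.T (ℚ.- ℚ[ ℤ.+ 15 ]) 0 (ℤ.- ℤ.+ 5) (ℤ.+ 4) 10)
  F₄≡ = from-double Ex.10F₄ ((twice (ℚ.- (ℤ.+ 45 / 2)) (ℤ.- ℤ.+ 45) (mono 3 10 3 2 12) (T⁺ (ℚ.- (ℤ.+ 45 / 2)) 3 7 2 3 12 ≡.refl) ≡.refl)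
      ⟨+⟩ (twice ℚ[ ℤ.+ 260 ] (ℤ.+ 520) (mono 2 10 8 2 12) (T⁺ ℚ[ ℤ.+ 260 ] 2 2 2 8 12 ≡.refl) ≡.refl)
      ⟨+⟩ (twice (ℤ.+ 335 / 2) (ℤ.+ 335) (mono 1 10 13 2 12) (T⁻ (ℤ.+ 335 / 2) 1 1 2 10 12 ≡.refl) ≡.refl)
      ⟨+⟩ (twice ℚ[ ℤ.+ 55 ] (ℤ.+ 110) (mono 0 10 18 2 12) (T⁻ ℚ[ ℤ.+ 55 ] 0 6 2 10 12 ≡.refl) ≡.refl)
      ⟨+⟩ (twice (ℤ.+ 5 / 2) (ℤ.+ 5) (mono 2 8 3 1 10) (T⁺ (ℤ.+ 5 / 2) 2 5 1 3 10 ≡.refl) ≡.refl)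
      ⟨+⟩ (twice (ℤ.+ 5 / 2) (ℤ.+ 5) (mono 1 8 8 1 10) (T⁺ (ℤ.+ 5 / 2) 1 0 1 8 10 ≡.refl) ≡.refl)
      ⟨+⟩ (twice (ℚ.- ℚ[ ℤ.+ 15 ]) (ℤ.- ℤ.+ 30) (mono 0 8 13 1 10) (T⁻ (ℚ.- ℚ[ ℤ.+ 15 ]) 0 4 1 8 10 ≡.refl) ≡.refl))
    (solve 6 (λ q y x v e i → PartPolynomials.partᵖ 4 (e :^ 10 :* i) v y e x q := # 5 :* (
        :- # 45 :* monoᵖ 3 10 3 2 12 q y x v e i
        :+ # 520 :* monoᵖ 2 10 8 2 12 q y x v e i
        :+ # 335 :* monoᵖ 1 10 13 2 12 q y x v e i
        :+ # 110 :* monoᵖ 0 10 18 2 12 q y x v e i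
        :+ # 5 :* monoᵖ 2 8 3 1 10 q y x v e i
        :+ # 5 :* monoᵖ 1 8 8 1 10 q y x v e i
        :+ :- # 30 :* monoᵖ 0 8 13 1 10 q y x v e i)) q Y X V E₅ I₁₂)

  private
    module S where
      sumᵖ restᵖ : ∀ {n} (q y x v e i : Expr ℤ n) → Expr ℤ n
      sumᵖ q y x v e i = :- # 7 :* monoᵖ 3 7 1 2 9 q y x v e i
        :+ # 12 :* monoᵖ 2 7 6 2 9 q y x v e i
        :+ :- # 4 :* monoᵖ 1 7 11 2 9 q y x v e i
        :+ :- # 9 :* monoᵖ 0 7 16 2 9 q y x v e i
        :+ # 20 :* monoᵖ 2 5 1 1 7 q y x v e i
        :+ :- # 5 :* monoᵖ 1 5 6 1 7 q y x v e i
        :+ # 5 :* monoᵖ 0 5 11 1 7 q y x v e i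
      restᵖ q y x v e i = # 20 :* monoᵖ 2 5 1 0 8 q y x v e i
        :+ :- # 5 :* monoᵖ 1 5 6 0 8 q y x v e i
        :+ # 5 :* monoᵖ 0 5 11 0 8 q y x v e i
        :+ :- # 305 :* monoᵖ 3 10 7 2 12 q y x v e i
        :+ # 335 :* monoᵖ 2 10 12 2 12 q y x v e i
        :+ # 170 :* monoᵖ 1 10 17 2 12 q y x v e i
        :+ # 10 :* monoᵖ 0 10 22 2 12 q y x v e i
        :+ # 50 :* monoᵖ 3 8 2 1 10 q y x v e i
        :+ :- # 30 :* monoᵖ 2 8 7 1 10 q y x v e i
        :+ :- # 20 :* monoᵖ 1 8 12 1 10 q y x v e i
        :+ :- # 15 :* monoᵖ 0 8 17 1 10 q y x v e i
      weight₂ᵖ weight₁ᵖ weight₀ᵖ : ∀ {n} (q y x v e i : Expr ℤ n) → Expr ℤ n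
      weight₂ᵖ q y x v e i = (e :^ 3 :* y :^ 3 :* (x :^ 6 :- # 3 :* q :* x)) :* sumᵖ q y x v e i :+ restᵖ q y x v e i
      weight₁ᵖ q y x v e i = v :* e :^ 10 :* y :^ 7 :* i :* (:- # 7 :* q :^ 3 :* x :+ # 12 :* q :^ 2 :* x :^ 6 :- # 4 :* q :* x :^ 11 :- # 9 :* x :^ 16)
      weight₀ᵖ q y x v e i = e :^ 8 :* y :^ 5 :* i :* (# 20 :* q :^ 2 :* x :- # 5 :* q :* x :^ 6 :+ # 5 :* x :^ 11)

    SumS : PS
    SumS = Defs.T (ℚ.- ℚ[ ℤ.+ 7 ]) 3 (ℤ.+ 6) (ℤ.- ℤ.+ 8) 9
      Defs.⊕ Defs.T ℚ[ ℤ.+ 12 ] 2 (ℤ.+ 1) (ℤ.- ℤ.+ 3) 9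
      Defs.⊕ Defs.T (ℚ.- ℚ[ ℤ.+ 4 ]) 1 (ℤ.- ℤ.+ 4) (ℤ.+ 2) 9
      Defs.⊕ Defs.T (ℚ.- ℚ[ ℤ.+ 9 ]) 0 (ℤ.- ℤ.+ 9) (ℤ.+ 7) 9
      Defs.⊕ Defs.T ℚ[ ℤ.+ 20 ] 2 (ℤ.+ 4) (ℤ.- ℤ.+ 5) 7
      Defs.⊕ Defs.T (ℚ.- ℚ[ ℤ.+ 5 ]) 1 (ℤ.- ℤ.+ 1) (ℤ.+ 0) 7
      Defs.⊕ Defs.T ℚ[ ℤ.+ 5 ] 0 (ℤ.- ℤ.+ 6) (ℤ.+ 5) 7

    series-SumS : series SumS ≋ _
    series-SumS =
        (once (ℚ.- ℚ[ ℤ.+ 7 ]) (ℤ.- ℤ.+ 7) (mono 3 7 1 2 9) (T⁺ (ℚ.- ℚ[ ℤ.+ 7 ]) 3 6 2 1 9 ≡.refl) ≡.refl)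
        ⟨⊕⟩ (once ℚ[ ℤ.+ 12 ] (ℤ.+ 12) (mono 2 7 6 2 9) (T⁺ ℚ[ ℤ.+ 12 ] 2 1 2 6 9 ≡.refl) ≡.refl)
        ⟨⊕⟩ (once (ℚ.- ℚ[ ℤ.+ 4 ]) (ℤ.- ℤ.+ 4) (mono 1 7 11 2 9) (T⁻ (ℚ.- ℚ[ ℤ.+ 4 ]) 1 2 2 7 9 ≡.refl) ≡.refl)
        ⟨⊕⟩ (once (ℚ.- ℚ[ ℤ.+ 9 ]) (ℤ.- ℤ.+ 9) (mono 0 7 16 2 9) (T⁻ (ℚ.- ℚ[ ℤ.+ 9 ]) 0 7 2 7 9 ≡.refl) ≡.refl)
        ⟨⊕⟩ (once ℚ[ ℤ.+ 20 ] (ℤ.+ 20) (mono 2 5 1 1 7) (T⁺ ℚ[ ℤ.+ 20 ] 2 4 1 1 7 ≡.refl) ≡.refl)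
        ⟨⊕⟩ (once (ℚ.- ℚ[ ℤ.+ 5 ]) (ℤ.- ℤ.+ 5) (mono 1 5 6 1 7) (T⁻ (ℚ.- ℚ[ ℤ.+ 5 ]) 1 0 1 5 7 ≡.refl) ≡.refl)
        ⟨⊕⟩ (once ℚ[ ℤ.+ 5 ] (ℤ.+ 5) (mono 0 5 11 1 7) (T⁻ ℚ[ ℤ.+ 5 ] 0 5 1 5 7 ≡.refl) ≡.refl)

    S-term : fromℤ (ℤ.+ 2) * series (ℚ[ ℤ.+ 5 ] Defs.· (Defs.Sₚ Defs.⊗ SumS)) ≋ (E₅ ^ 3 * Y ^ 3 * (X ^ 6 - fromℤ (ℤ.+ 3) * q * X) - B * E₅) * _
    S-term = begin
      fromℤ (ℤ.+ 2) * series (ℚ[ ℤ.+ 5 ] Defs.· (Defs.Sₚ Defs.⊗ SumS))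
        ≈⟨ twice ℚ[ ℤ.+ 5 ] (ℤ.+ 10) _ (trans (series-· ℚ[ ℤ.+ 5 ] _) (*-congˡ (trans (series-⊗ Defs.Sₚ SumS) (*-cong series-S series-SumS)))) ≡.refl ⟩
      _ ≈⟨ sym (*-assoc _ S _) ⟩
      _ ≈⟨ *-congʳ (trans (solve 2 (λ s b → # 10 :* s := (# 10 :* s :+ b) :- b) S (B * E₅)) (+-congʳ Ex.10S)) ⟩
      _ ∎

  F₀≡ : Defs.F 0 Defs.≐ (ℚ[ ℤ.+ 5 ] Defs.· (Defs.Sₚ Defs.⊗ (
      Defs.T (ℚ.- ℚ[ ℤ.+ 7 ]) 3 (ℤ.+ 6) (ℤ.- ℤ.+ 8) 9
      Defs.⊕ Defs.T ℚ[ ℤ.+ 12 ] 2 (ℤ.+ 1) (ℤ.- ℤ.+ 3) 9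
      Defs.⊕ Defs.T (ℚ.- ℚ[ ℤ.+ 4 ]) 1 (ℤ.- ℤ.+ 4) (ℤ.+ 2) 9
      Defs.⊕ Defs.T (ℚ.- ℚ[ ℤ.+ 9 ]) 0 (ℤ.- ℤ.+ 9) (ℤ.+ 7) 9
      Defs.⊕ Defs.T ℚ[ ℤ.+ 20 ] 2 (ℤ.+ 4) (ℤ.- ℤ.+ 5) 7
      Defs.⊕ Defs.T (ℚ.- ℚ[ ℤ.+ 5 ]) 1 (ℤ.- ℤ.+ 1) (ℤ.+ 0) 7
      Defs.⊕ Defs.T ℚ[ ℤ.+ 5 ] 0 (ℤ.- ℤ.+ 6) (ℤ.+ 5) 7))
      Defs.⊕ Defs.T ℚ[ ℤ.+ 10 ] 2 (ℤ.+ 4) (ℤ.- ℤ.+ 4) 8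
      Defs.⊕ Defs.T (ℚ.- (ℤ.+ 5 / 2)) 1 (ℤ.- ℤ.+ 1) (ℤ.+ 1) 8
      Defs.⊕ Defs.T (ℤ.+ 5 / 2) 0 (ℤ.- ℤ.+ 6) (ℤ.+ 6) 8
      Defs.⊕ Defs.T (ℚ.- (ℤ.+ 305 / 2)) 3 (ℤ.+ 3) (ℤ.- ℤ.+ 5) 12
      Defs.⊕ Defs.T (ℤ.+ 335 / 2) 2 (ℤ.- ℤ.+ 2) (ℤ.+ 0) 12
      Defs.⊕ Defs.T ℚ[ ℤ.+ 85 ] 1 (ℤ.- ℤ.+ 7) (ℤ.+ 5) 12
      Defs.⊕ Defs.T ℚ[ ℤ.+ 5 ] 0 (ℤ.- ℤ.+ 12) (ℤ.+ 10) 12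
      Defs.⊕ Defs.T ℚ[ ℤ.+ 25 ] 3 (ℤ.+ 6) (ℤ.- ℤ.+ 7) 10
      Defs.⊕ Defs.T (ℚ.- ℚ[ ℤ.+ 15 ]) 2 (ℤ.+ 1) (ℤ.- ℤ.+ 2) 10
      Defs.⊕ Defs.T (ℚ.- ℚ[ ℤ.+ 10 ]) 1 (ℤ.- ℤ.+ 4) (ℤ.+ 3) 10
      Defs.⊕ Defs.T (ℚ.- (ℤ.+ 15 / 2)) 0 (ℤ.- ℤ.+ 9) (ℤ.+ 8) 10)
  F₀≡ = from-double Ex.10F₀ (S-term
      ⟨+⟩ (twice ℚ[ ℤ.+ 10 ] (ℤ.+ 20) (mono 2 5 1 0 8) (T⁺ ℚ[ ℤ.+ 10 ] 2 4 0 1 8 ≡.refl) ≡.refl)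
      ⟨+⟩ (twice (ℚ.- (ℤ.+ 5 / 2)) (ℤ.- ℤ.+ 5) (mono 1 5 6 0 8) (T⁻ (ℚ.- (ℤ.+ 5 / 2)) 1 1 0 5 8 ≡.refl) ≡.refl)
      ⟨+⟩ (twice (ℤ.+ 5 / 2) (ℤ.+ 5) (mono 0 5 11 0 8) (T⁻ (ℤ.+ 5 / 2) 0 6 0 5 8 ≡.refl) ≡.refl)
      ⟨+⟩ (twice (ℚ.- (ℤ.+ 305 / 2)) (ℤ.- ℤ.+ 305) (mono 3 10 7 2 12) (T⁺ (ℚ.- (ℤ.+ 305 / 2)) 3 3 2 7 12 ≡.refl) ≡.refl)
      ⟨+⟩ (twice (ℤ.+ 335 / 2) (ℤ.+ 335) (mono 2 10 12 2 12) (T⁻ (ℤ.+ 335 / 2) 2 0 2 10 12 ≡.refl) ≡.refl)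
      ⟨+⟩ (twice ℚ[ ℤ.+ 85 ] (ℤ.+ 170) (mono 1 10 17 2 12) (T⁻ ℚ[ ℤ.+ 85 ] 1 5 2 10 12 ≡.refl) ≡.refl)
      ⟨+⟩ (twice ℚ[ ℤ.+ 5 ] (ℤ.+ 10) (mono 0 10 22 2 12) (T⁻ ℚ[ ℤ.+ 5 ] 0 10 2 10 12 ≡.refl) ≡.refl)
      ⟨+⟩ (twice ℚ[ ℤ.+ 25 ] (ℤ.+ 50) (mono 3 8 2 1 10) (T⁺ ℚ[ ℤ.+ 25 ] 3 6 1 2 10 ≡.refl) ≡.refl)
      ⟨+⟩ (twice (ℚ.- ℚ[ ℤ.+ 15 ]) (ℤ.- ℤ.+ 30) (mono 2 8 7 1 10) (T⁺ (ℚ.- ℚ[ ℤ.+ 15 ]) 2 1 1 7 10 ≡.refl) ≡.refl)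
      ⟨+⟩ (twice (ℚ.- ℚ[ ℤ.+ 10 ]) (ℤ.- ℤ.+ 20) (mono 1 8 12 1 10) (T⁻ (ℚ.- ℚ[ ℤ.+ 10 ]) 1 3 1 8 10 ≡.refl) ≡.refl)
      ⟨+⟩ (twice (ℚ.- (ℤ.+ 15 / 2)) (ℤ.- ℤ.+ 15) (mono 0 8 17 1 10) (T⁻ (ℚ.- (ℤ.+ 15 / 2)) 0 8 1 8 10 ≡.refl) ≡.refl))
    (sym (begin
      _ ≈⟨ solve 7 (λ q y x v e i b → # 5 :* (((e :^ 3 :* y :^ 3 :* (x :^ 6 :- # 3 :* q :* x)) :- b :* e) :* S.sumᵖ q y x v e i
             :+ # 20 :* monoᵖ 2 5 1 0 8 q y x v e i
        :+ :- # 5 :* monoᵖ 1 5 6 0 8 q y x v e i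
        :+ # 5 :* monoᵖ 0 5 11 0 8 q y x v e i
        :+ :- # 305 :* monoᵖ 3 10 7 2 12 q y x v e i
        :+ # 335 :* monoᵖ 2 10 12 2 12 q y x v e i
        :+ # 170 :* monoᵖ 1 10 17 2 12 q y x v e i
        :+ # 10 :* monoᵖ 0 10 22 2 12 q y x v e i
        :+ # 50 :* monoᵖ 3 8 2 1 10 q y x v e i
        :+ :- # 30 :* monoᵖ 2 8 7 1 10 q y x v e i
        :+ :- # 20 :* monoᵖ 1 8 12 1 10 q y x v e i
        :+ :- # 15 :* monoᵖ 0 8 17 1 10 q y x v e i)
             := # 5 :* (S.weight₂ᵖ q y x v e i :- (b :* v) :* S.weight₀ᵖ q y x v e i :- (b :* v) :* S.weight₁ᵖ q y x v e i)) q Y X V E₅ I₁₂ B ⟩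
      _ ≈⟨ *-congˡ (+-cong (+-congˡ (-‿cong (*-congʳ BB⁻¹))) (-‿cong (*-congʳ (trans BB⁻¹ (sym XY))))) ⟩
      _ ≈⟨ solve 6 (λ q y x v e i → # 5 :* (S.weight₂ᵖ q y x v e i :- # 1 :* S.weight₀ᵖ q y x v e i :- (x :* y) :* S.weight₁ᵖ q y x v e i)
             := PartPolynomials.partᵖ 0 (e :^ 10 :* i) v y e x q) q Y X V E₅ I₁₂ ⟩
      _ ∎))

open import Defs
open import Data.Integer as ℤ using (+_)
open import Data.Rational as ℚ using (_/_)

theorem1p3 :
  (F 0 ≐ (ℚ[ + 5 ] · (Sₚ ⊗
            (T (ℚ.- ℚ[ + 7 ]) 3 (+ 6) (ℤ.- + 8) 9
           ⊕ T ℚ[ + 12 ] 2 (+ 1) (ℤ.- + 3) 9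
           ⊕ T (ℚ.- ℚ[ + 4 ]) 1 (ℤ.- + 4) (+ 2) 9
           ⊕ T (ℚ.- ℚ[ + 9 ]) 0 (ℤ.- + 9) (+ 7) 9
           ⊕ T ℚ[ + 20 ] 2 (+ 4) (ℤ.- + 5) 7
           ⊕ T (ℚ.- ℚ[ + 5 ]) 1 (ℤ.- + 1) (+ 0) 7
           ⊕ T ℚ[ + 5 ] 0 (ℤ.- + 6) (+ 5) 7))
          ⊕ T ℚ[ + 10 ] 2 (+ 4) (ℤ.- + 4) 8
          ⊕ T (ℚ.- (+ 5 / 2)) 1 (ℤ.- + 1) (+ 1) 8
          ⊕ T (+ 5 / 2) 0 (ℤ.- + 6) (+ 6) 8
          ⊕ T (ℚ.- (+ 305 / 2)) 3 (+ 3) (ℤ.- + 5) 12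
          ⊕ T (+ 335 / 2) 2 (ℤ.- + 2) (+ 0) 12
          ⊕ T ℚ[ + 85 ] 1 (ℤ.- + 7) (+ 5) 12
          ⊕ T ℚ[ + 5 ] 0 (ℤ.- + 12) (+ 10) 12
          ⊕ T ℚ[ + 25 ] 3 (+ 6) (ℤ.- + 7) 10
          ⊕ T (ℚ.- ℚ[ + 15 ]) 2 (+ 1) (ℤ.- + 2) 10
          ⊕ T (ℚ.- ℚ[ + 10 ]) 1 (ℤ.- + 4) (+ 3) 10
          ⊕ T (ℚ.- (+ 15 / 2)) 0 (ℤ.- + 9) (+ 8) 10))
  × (F 3 ≐ (T ℚ[ + 55 ] 3 (+ 6) (ℤ.- + 8) 12
          ⊕ T (ℚ.- (+ 335 / 2)) 2 (+ 1) (ℤ.- + 3) 12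
          ⊕ T ℚ[ + 260 ] 1 (ℤ.- + 4) (+ 2) 12
          ⊕ T (+ 45 / 2) 0 (ℤ.- + 9) (+ 7) 12
          ⊕ T (ℚ.- ℚ[ + 5 ]) 2 (+ 4) (ℤ.- + 5) 10
          ⊕ T (ℚ.- (+ 35 / 2)) 1 (ℤ.- + 1) (+ 0) 10
          ⊕ T (ℚ.- (+ 15 / 2)) 0 (ℤ.- + 6) (+ 5) 10))
  × (F 4 ≐ (T (ℚ.- (+ 45 / 2)) 3 (+ 7) (ℤ.- + 9) 12
          ⊕ T ℚ[ + 260 ] 2 (+ 2) (ℤ.- + 4) 12
          ⊕ T (+ 335 / 2) 1 (ℤ.- + 3) (+ 1) 12
          ⊕ T ℚ[ + 55 ] 0 (ℤ.- + 8) (+ 6) 12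
          ⊕ T (+ 5 / 2) 2 (+ 5) (ℤ.- + 6) 10
          ⊕ T (+ 5 / 2) 1 (+ 0) (ℤ.- + 1) 10
          ⊕ T (ℚ.- ℚ[ + 15 ]) 0 (ℤ.- + 5) (+ 4) 10))
theorem1p3 = Final.F₀≡ , Final.F₃≡ , Final.F₄≡
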